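{- Let $p\ge5$ be prime, $k\ge1$ an integer, and $t\in\{1,\dots,p-1\}$. Let $S=\{(A,B)\in\mathbb{F}_{p^k}^2: 4A^3+27B^2\ne0\}$, and let $S_t\subset S$ be the set of pairs for which the trace $T$ of the $p^k$-th power Frobenius of the elliptic curve $y^2=x^3+Ax+B$ over $\mathbb{F}_{p^k}$ satisfies $T\equiv t\bmod p$. Then $\#S=p^{2k}-p^k$ and \[\left|\#S_t-\frac{\#S}{p-1}\right|\le 3p^{\frac{3k}{2}+1}.\]
   Context: The trace of Frobenius $T$ is the integer with $\#E(\mathbb{F}_{p^k})=p^k+1-T$. -}

module Defs where

open import Level using (0ℓ)
open import Data.Bool using (Bool; true; false; if_then_else_)
open import Data.Nat as ℕ using (ℕ; zero; suc)
open import Data.Fin using (Fin)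
import Data.Nat.Divisibility as ℕD
open import Data.Fin.Properties using () renaming (_≟_ to _≟Fin_)
open import Data.List using (List; map; allFin)
open import Data.Nat.ListAction using (sum)
open import Data.Product using (Σ)
open import Data.Integer as ℤ using (ℤ; +_)
open import Relation.Nullary using (¬_; Dec; yes; no; does)
open import Relation.Binary.PropositionalEquality using (_≡_; refl; sym; trans; cong)
open import Algebra.Structures using (IsCommutativeRing)
open import Function.Bundles using (_↔_; Inverse)

-- A finite field with exactly q elements (equality is propositional equality).
-- Any two such fields are isomorphic, so "F_q" is any inhabitant of this record.
record FiniteField (q : ℕ) : Set₁ where
  infixl 6 _+_
  infixl 7 _*_
  field
    Carrier : Set
    _+_ _*_ : Carrier → Carrier → Carrier
    -_      : Carrier → Carrier
    0# 1#   : Carrier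
    isCommutativeRing : IsCommutativeRing _≡_ _+_ _*_ -_ 0# 1#
    0≢1     : ¬ (0# ≡ 1#)
    inverse : ∀ x → ¬ (x ≡ 0#) → Σ Carrier (λ y → x * y ≡ 1#)
    enum    : Carrier ↔ Fin q

  _≟_ : (x y : Carrier) → Dec (x ≡ y)
  x ≟ y with Inverse.to enum x ≟Fin Inverse.to enum y
  ... | yes e = yes (trans (sym (Inverse.strictlyInverseʳ enum x))
                      (trans (cong (Inverse.from enum) e) (Inverse.strictlyInverseʳ enum y)))
  ... | no ne = no (λ e → ne (cong (Inverse.to enum) e))

  elements : List Carrier
  elements = map (Inverse.from enum) (allFin q)

  #_ : (Carrier → Bool) → ℕ
  # P = sum (map (λ x → if P x then 1 else 0) elements)

  #² : (Carrier → Carrier → Bool) → ℕ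
  #² P = sum (map (λ x → # (P x)) elements)

  ofℕ : ℕ → Carrier
  ofℕ zero    = 0#
  ofℕ (suc n) = 1# + ofℕ n

  nonsingular : Carrier → Carrier → Bool
  nonsingular A B = Data.Bool.not (does ((ofℕ 4 * (A * A * A) + ofℕ 27 * (B * B)) ≟ 0#))

  -- #E(F) for E : y² = x³ + Ax + B : affine solutions plus the point at infinity
  #E : Carrier → Carrier → ℕ
  #E A B = suc (#² (λ x y → does ((y * y) ≟ (x * x * x + A * x + B))))

  trace : Carrier → Carrier → ℤ
  trace A B = (+ q ℤ.+ + 1) ℤ.- + (#E A B)

  #S : ℕ
  #S = #² nonsingular

  #S[_,_] : (p t : ℕ) → ℕ
  #S[ p , t ] = #² (λ A B → Data.Bool._∧_ (nonsingular A B)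
                     (does (p ℕD.∣? ℤ.∣ trace A B ℤ.- + t ∣)))

{-# OPTIONS --safe #-}
module Submission where

open import Level using (0ℓ)
open import Algebra.Bundles using (CommutativeRing; CommutativeSemiring; Semiring; RawRing)
open import Algebra.Structures using (IsCommutativeRing)
import Algebra.Solver.Ring as RingSolver
open import Algebra.Solver.Ring.AlmostCommutativeRing using (fromCommutativeRing; _-Raw-AlmostCommutative⟶_)
open import Data.Bool using (Bool; true; false; if_then_else_; not; _∧_)
open import Data.Empty using (⊥; ⊥-elim)
open import Data.Fin as Fin using (Fin; toℕ)
import Data.Fin.Properties as FinP
open import Data.Integer as ℤ using (ℤ; +_; -[1+_]; _⊖_)
import Data.Integer.Properties as ℤP
open import Data.List using (List; []; _∷_; _++_; map; concatMap; length; allFin; upTo; foldr; lookup; filter; replicate; concat)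
import Data.List.Properties as ListP
open import Data.List.Membership.Propositional using (_∈_)
open import Data.List.Relation.Unary.Any using (here; there)
open import Data.List.Relation.Unary.All as All using (All; []; _∷_)
open import Data.List.Relation.Unary.Unique.Propositional using (Unique)
open import Data.List.Relation.Unary.AllPairs using ([]; _∷_)
open import Data.Maybe using (Maybe; nothing; just)
open import Data.Nat as ℕ using (ℕ; zero; suc; z≤n; s≤s; _≤_; _<_; _∸_)
import Data.Nat.Properties as ℕP
open ℕP using (*-cancelʳ-≤; *-cancelˡ-<; *-cancelˡ-≤; *-mono-<; *-mono-≤; *-monoʳ-≤; *-monoˡ-<; *-monoˡ-≤; +-cancelʳ-<; +-cancelʳ-≤; +-mono-<; +-mono-≤; +-monoʳ-<; +-monoʳ-≤; +-monoˡ-<; +-monoˡ-≤; +-∸-assoc; <-irrefl; <-trans; <-≤-trans; <⇒≤; <⇒≱; ^-monoʳ-<; ^-monoʳ-≤; ^-monoˡ-≤; m+[n∸m]≡n; m+n∸m≡n; m+n∸n≡m; m<m+n; m<n+m; m<n⇒0<n∸m; m<n⇒m<1+n; m<n⇒n≢0; m∸n+n≡m; m∸n≡0⇒m≤n; m∸n≢0⇒n<m; m∸n≤m; m≤m*n; m≤m+n; m≤n+m; m≤n+m∸n; m≤n+o⇒m∸n≤o; m≤n⇒m<n∨m≡n; m≤n⇒m∸n≡0; m≤n⇒m≤1+n; n<1+n; n<1⇒n≡0; n∸n≡0; n≤1+n; ∸-+-assoc; ∸-monoʳ-<; ∸-monoˡ-≤; ≤-<-trans; ≤-antisym; ≤-pred;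 ≤-refl; ≤-reflexive; ≤-total; ≤-trans; ≮⇒≥; ≰⇒>; ⌈n/2⌉-mono; ⌊n/2⌋+⌈n/2⌉≡n; ⌊n/2⌋≤⌈n/2⌉)
open import Data.Nat.Primality using (Prime)
open import Data.Product using (Σ; ∃; _×_; _,_; proj₁; proj₂)
open import Data.Sum using (_⊎_; inj₁; inj₂)
open import Function using (_∘_; id; case_of_)
open import Function.Bundles using (Inverse)
open import Relation.Nullary using (¬_; Dec; yes; no; does)
open import Relation.Binary.PropositionalEquality as ≡ using (_≡_; _≢_; cong; cong₂; subst; subst₂)
open import Defs using (FiniteField)
import Data.Nat.Primality as Primality
import Data.Nat.Divisibility as ℕD
import Data.Nat.DivMod as ℕDM
import Data.Nat.Combinatorics as Comb
import Data.Nat.Coprimality as Coprime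
import Data.Nat.GCD as GCD
open import Algebra.Bundles using (CommutativeMonoid)
open import Data.List.Base using (cartesianProductWith)
open import Data.List.Membership.Propositional.Properties using (∈-map⁺; ∈-map⁻; ∈-cartesianProductWith⁺; ∈-cartesianProductWith⁻; ∈-filter⁺; ∈-filter⁻; ∈-allFin; ∈-lookup; ∈-upTo⁺; ∈-upTo⁻)
open import Data.List.Membership.Propositional.Properties.WithK using (unique∧set⇒bag)
open import Data.List.Relation.Binary.BagAndSetEquality using (∼bag⇒↭)
open import Data.List.Relation.Binary.Permutation.Propositional using (_↭_; prep; swap)
open import Data.List.Relation.Binary.Permutation.Propositional.Properties using (↭-length)
import Data.List.Relation.Unary.Unique.Propositional.Properties as Uniq
import Data.List.Relation.Unary.Any as Any
open import Data.List.Relation.Unary.Any.Properties using (lookup-index)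
open import Data.List.Relation.Unary.AllPairs using (AllPairs)
open import Function.Bundles using (mk⇔)
open import Relation.Nullary.Decidable using (¬?)
import Data.List.Relation.Unary.All.Properties as AllP
open import Data.List.Membership.Propositional using (find; lose)
open import Data.List.Relation.Unary.All.Properties using (all-filter)
open import Data.List.Membership.Propositional.Properties using (∈-concatMap⁺; ∈-concatMap⁻)
open import Relation.Nullary.Decidable using (_×-dec_; decidable-stable)
import Data.List.Relation.Unary.AllPairs.Properties as AllPairsP
import Data.Fin.Subset.Properties
import Data.List.Relation.Unary.AllPairs as AP
import Data.Integer.Divisibility.Signed as Signed
import Data.Nat.ListAction as ListAction

-- Write `q = p^k`, `n = p - 1`, and let `H(A,B)` be the Hasse invariant, the coefficient of
-- `x^(p-1)` in `(x³ + Ax + B)^((p-1)/2)`. Counting points by Euler's criterion and evaluating power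
-- sums over the field shows that, modulo `p`, the trace is `H(A,B)^((q-1)/(p-1))` (`square-count`,
-- `∑-eval`, `hasse-power`, `nat-affine`). Up to the `q` singular pairs, `S_t` therefore consists of
-- the pairs at which a power residue character of order `n` takes the value `t` on `H(A,B)`.
--
-- The pairs are cut into lines. For `p ≥ 7` fix `A ≠ 0`. Then `H` is a polynomial in `B` of degree
-- at most `(p-1)/2`, and it satisfies the Picard-Fuchs equation `4ΔH″ + 216BH′ + 15H = 0`. By this
-- equation a double root would be a root of every derivative, but one of the derivatives is a
-- nonzero constant; hence all roots are simple (`Vertical.simple`). For `p = 5` one has `H = 2A`,
-- and the lines are those with `B` fixed. On each line Weil's bound for character sums gives `n`
-- times the number of hits as `q`, up to `n · (p-1)/2 · √q` and the zeros of `H`. Adding up the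
-- lines, with trivial bounds for the excluded line and the singular pairs, yields the theorem with
-- room in the constant.
--
-- Weil's bound (`Weil.weil`) is proved for a monic `f` of degree `d` having an irreducible factor
-- of multiplicity one. Complex characters are replaced by one universal character `χ` with values
-- in an integral convolution algebra on `F`, and `κ = n - ∑ χ(t)` over `t ∈ μ_n` removes the
-- trivial character. The value `λ` of a monic `g` is a power of the resultant of `f` and `g`.
--
-- The resultant, read over the roots of `f`, depends only on `g` modulo `f`, up to a sign governed
-- by the degree; read over the roots of a prime polynomial `P` it is the norm of `f` modulo `P`
-- (`α-ρB`). The first reading makes `κ` times the L-series a polynomial of degree at most `d - 1`
-- (`χ-coef`). By the second, its logarithmic derivative counts the points of the field with `q^m`
-- elements according to the value of `f^((q^m-1)/n)` (`mangoldt-value`).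
--
-- Stepanov's method bounds each of these counts from above by `q^m/n` plus a multiple of `q^(m/2)`,
-- rounded up in the exponent (`stepanov`). Since all counts together give `q^m` (`total`), upper
-- bounds alone suffice to control the deviations.
--
-- So the power sums of the L-polynomial are `O(q^(m/2))`. Its reciprocal roots are never
-- constructed. A determinant identity of Pieri type converts the estimate into
-- `c₁^N = O(N^β D^N q^(N/2))` for the linear coefficient, with `D = d - 1` (`pieri`,
-- `power-bound`). Finally the positivity of `a a*` bounds the square of a value of `a = κ c₁` by
-- the growth rate of `a^N`, which removes the polynomial factor and leaves exactly `(n D)² q`
-- (`squares`, `growth`).

-- Commutative rings and a ring solver with integer coefficients

-- The canonical map from ℤ lets the ring solver work with integer coefficients.
module IntegerSolver (R : CommutativeRing 0ℓ 0ℓ) where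
  open CommutativeRing R
  open import Algebra.Properties.Ring ring
  open import Algebra.Properties.Semiring.Mult.TCOptimised semiring renaming (_×_ to _·_)
  open import Relation.Binary.Reasoning.Setoid setoid

  ⟦_⟧ℤ : ℤ → Carrier
  ⟦ + n ⟧ℤ = n · 1#
  ⟦ -[1+ n ] ⟧ℤ = - (suc n · 1#)

  private
    suc· : ∀ n → suc n · 1# ≈ 1# + n · 1#
    suc· n = 1+× n 1#

    cancel : ∀ a b c → (a + b) - (a + c) ≈ b - c
    cancel a b c = begin
      (a + b) - (a + c)       ≈⟨ +-congˡ (sym (-‿+-comm a c)) ⟩
      (a + b) + (- a + - c)   ≈⟨ sym (+-assoc _ _ _) ⟩
      ((a + b) + - a) + - c   ≈⟨ +-congʳ (xyx⁻¹≈y a b) ⟩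
      b - c ∎

    ⊖-homo : ∀ m n → ⟦ m ⊖ n ⟧ℤ ≈ m · 1# - n · 1#
    ⊖-homo m zero = sym (trans (+-congˡ -0#≈0#) (+-identityʳ _))
    ⊖-homo zero (suc n) = sym (+-identityˡ _)
    ⊖-homo (suc m) (suc n) = begin
      ⟦ suc m ⊖ suc n ⟧ℤ            ≡⟨ cong ⟦_⟧ℤ (ℤP.[1+m]⊖[1+n]≡m⊖n m n) ⟩
      ⟦ m ⊖ n ⟧ℤ                    ≈⟨ ⊖-homo m n ⟩
      m · 1# - n · 1#               ≈⟨ sym (cancel 1# _ _) ⟩
      (1# + m · 1#) - (1# + n · 1#) ≈⟨ sym (+-cong (suc· m) (-‿cong (suc· n))) ⟩
      suc m · 1# - suc n · 1# ∎

    +-homo : ∀ i j → ⟦ i ℤ.+ j ⟧ℤ ≈ ⟦ i ⟧ℤ + ⟦ j ⟧ℤ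
    +-homo (+ m) (+ n) = ×-homo-+ 1# m n
    +-homo (+ m) -[1+ n ] = ⊖-homo m (suc n)
    +-homo -[1+ m ] (+ n) = trans (⊖-homo n (suc m)) (+-comm _ _)
    +-homo -[1+ m ] -[1+ n ] = begin
      - (suc (suc (m ℕ.+ n)) · 1#)      ≡⟨ cong (λ z → - (z · 1#)) (≡.sym (ℕP.+-suc (suc m) n)) ⟩
      - ((suc m ℕ.+ suc n) · 1#)        ≈⟨ -‿cong (×-homo-+ 1# (suc m) (suc n)) ⟩
      - (suc m · 1# + suc n · 1#)       ≈⟨ sym (-‿+-comm _ _) ⟩
      - (suc m · 1#) + - (suc n · 1#) ∎

    -‿homo : ∀ i → ⟦ ℤ.- i ⟧ℤ ≈ - ⟦ i ⟧ℤ
    -‿homo (+ zero) = sym -0#≈0#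
    -‿homo (+ suc n) = refl
    -‿homo -[1+ n ] = sym (-‿involutive _)

    *-homo⁺ : ∀ m j → ⟦ + m ℤ.* j ⟧ℤ ≈ m · 1# * ⟦ j ⟧ℤ
    *-homo⁺ m (+ n) = trans (reflexive (cong ⟦_⟧ℤ (≡.sym (ℤP.pos-* m n)))) (×1-homo-* m n)
    *-homo⁺ m -[1+ n ] = begin
      ⟦ + m ℤ.* (ℤ.- (+ suc n)) ⟧ℤ ≡⟨ cong ⟦_⟧ℤ (≡.sym (ℤP.neg-distribʳ-* (+ m) (+ suc n))) ⟩
      ⟦ ℤ.- (+ m ℤ.* + suc n) ⟧ℤ   ≈⟨ -‿homo (+ m ℤ.* + suc n) ⟩
      - ⟦ + m ℤ.* + suc n ⟧ℤ       ≈⟨ -‿cong (*-homo⁺ m (+ suc n)) ⟩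
      - (m · 1# * suc n · 1#)      ≈⟨ -‿distribʳ-* _ _ ⟩
      m · 1# * - (suc n · 1#) ∎

    *-homo : ∀ i j → ⟦ i ℤ.* j ⟧ℤ ≈ ⟦ i ⟧ℤ * ⟦ j ⟧ℤ
    *-homo (+ m) j = *-homo⁺ m j
    *-homo -[1+ m ] j = begin
      ⟦ (ℤ.- (+ suc m)) ℤ.* j ⟧ℤ ≡⟨ cong ⟦_⟧ℤ (≡.sym (ℤP.neg-distribˡ-* (+ suc m) j)) ⟩
      ⟦ ℤ.- (+ suc m ℤ.* j) ⟧ℤ   ≈⟨ -‿homo (+ suc m ℤ.* j) ⟩
      - ⟦ + suc m ℤ.* j ⟧ℤ       ≈⟨ -‿cong (*-homo⁺ (suc m) j) ⟩
      - (suc m · 1# * ⟦ j ⟧ℤ)    ≈⟨ -‿distribˡ-* _ _ ⟩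
      - (suc m · 1#) * ⟦ j ⟧ℤ ∎

    morphism : ℤ.+-*-rawRing -Raw-AlmostCommutative⟶ fromCommutativeRing R
    morphism = record { ⟦_⟧ = ⟦_⟧ℤ ; +-homo = +-homo ; *-homo = *-homo ; -‿homo = -‿homo ; 0-homo = refl ; 1-homo = refl }

    coefficients-equal : ∀ i j → Maybe (⟦ i ⟧ℤ ≈ ⟦ j ⟧ℤ)
    coefficients-equal i j = case i ℤ.≟ j of λ { (yes ≡.refl) → just refl ; (no _) → nothing }

  open RingSolver ℤ.+-*-rawRing (fromCommutativeRing R) morphism coefficients-equal
    public using (solve; _:=_; _:+_; _:*_; _:-_; :-_; con; _:^_)

module RingKit (R : CommutativeRing 0ℓ 0ℓ) where
  open CommutativeRing R public using (Carrier; _≈_; _+_; _*_; -_; _-_; 0#; 1#; refl; sym; trans; reflexive; setoid; ring; semiring; commutativeSemiring; +-cong; +-congˡ; +-congʳ; *-cong; *-congˡ; *-congʳ; -‿cong; +-assoc; +-comm; +-identityˡ; +-identityʳ; *-assoc; *-comm; *-identityˡ; *-identityʳ; distribˡ; distribʳ; zeroˡ; zeroʳ; -‿inverseˡ; -‿inverseʳ)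
  open import Algebra.Properties.Ring ring public
    using (-‿+-comm; -0#≈0#; -‿involutive; -‿distribˡ-*; -‿distribʳ-*; +-cancelˡ; +-cancelʳ; x≈y⇒x∙y⁻¹≈ε; x∙y⁻¹≈ε⇒x≈y)
    renaming (-1*x≈-x to -1*x≈-x)
  open import Algebra.Properties.CommutativeSemiring.Exp commutativeSemiring public
    using (_^_; ^-congˡ; ^-congʳ; ^-cong; ^-homo-*; ^-assocʳ; ^-distrib-*)
  open import Algebra.Properties.Semiring.Mult semiring public
    using (×-homo-+; ×1-homo-*; ×-congʳ; ×-assoc-*; ×-comm-*) renaming (_×_ to _·_)
  open IntegerSolver R public using (solve; _:=_; _:+_; _:*_; _:-_; :-_; con; _:^_)

  nat : ℕ → Carrier
  nat n = n · 1#

  nat-+ : ∀ m n → nat (m ℕ.+ n) ≈ nat m + nat n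
  nat-+ = ×-homo-+ 1#

  nat-* : ∀ m n → nat (m ℕ.* n) ≈ nat m * nat n
  nat-* = ×1-homo-*

  ·-nat : ∀ n x → n · x ≈ nat n * x
  ·-nat zero x = sym (zeroˡ x)
  ·-nat (suc n) x = trans (+-cong (sym (*-identityˡ x)) (·-nat n x)) (sym (distribʳ x 1# (nat n)))

  infix 4 _∣_ _by_
  record _∣_ (a b : Carrier) : Set where
    constructor _by_
    field
      quotient : Carrier
      equation : b ≈ a * quotient

  ∣-resp : ∀ {a b c} → b ≈ c → a ∣ b → a ∣ c
  ∣-resp e (w by p) = w by trans (sym e) p

  ∣-respˡ : ∀ {a b c} → a ≈ b → a ∣ c → b ∣ c
  ∣-respˡ e (w by p) = w by trans p (*-congʳ e)

  ∣-refl : ∀ {a} → a ∣ a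
  ∣-refl = 1# by sym (*-identityʳ _)

  ∣-trans : ∀ {a b c} → a ∣ b → b ∣ c → a ∣ c
  ∣-trans (w by p) (v by q) = w * v by trans q (trans (*-congʳ p) (*-assoc _ _ _))

  ∣-* : ∀ {a b} c → a ∣ b → a ∣ b * c
  ∣-* c (w by p) = w * c by trans (*-congʳ p) (*-assoc _ _ _)

  ∣-*ˡ : ∀ {a b} c → a ∣ b → a ∣ c * b
  ∣-*ˡ c d = ∣-resp (*-comm _ _) (∣-* c d)

  ∣-+ : ∀ {a b c} → a ∣ b → a ∣ c → a ∣ b + c
  ∣-+ (w by p) (v by q) = w + v by trans (+-cong p q) (sym (distribˡ _ _ _))

  ∣-neg : ∀ {a b} → a ∣ b → a ∣ - b
  ∣-neg (w by p) = - w by trans (-‿cong p) (-‿distribʳ-* _ _)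

  ∣-sub : ∀ {a b c} → a ∣ b → a ∣ c → a ∣ b - c
  ∣-sub p q = ∣-+ p (∣-neg q)

  ∣0 : ∀ {a} → a ∣ 0#
  ∣0 = 0# by sym (zeroʳ _)

  1∣ : ∀ {a} → 1# ∣ a
  1∣ = _ by sym (*-identityˡ _)

  *-mono-∣ : ∀ {a b c d} → a ∣ b → c ∣ d → a * c ∣ b * d
  *-mono-∣ (w by p) (v by q) = w * v by trans (*-cong p q) (solve 4 (λ a w c v → (a :* w) :* (c :* v) := (a :* c) :* (w :* v)) refl _ _ _ _)

  ^-1 : ∀ x → x ^ 1 ≈ x
  ^-1 = *-identityʳ

  1^ : ∀ n → 1# ^ n ≈ 1#
  1^ zero = refl
  1^ (suc n) = trans (*-identityˡ _) (1^ n)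

  0^ : ∀ n → 0# ^ suc n ≈ 0#
  0^ n = zeroˡ _

  ^-∣ : ∀ {a b} n → a ∣ b → a ^ n ∣ b ^ n
  ^-∣ zero d = ∣-refl
  ^-∣ (suc n) d = *-mono-∣ d (^-∣ n d)

  ^-mono-∣ : ∀ a {m n} → m ≤ n → a ^ m ∣ a ^ n
  ^-mono-∣ a {m} {n} le = a ^ (n ∸ m) by trans (reflexive (cong (a ^_) (≡.sym (m+[n∸m]≡n le)))) (^-homo-* a m (n ∸ m))

-- Binomial coefficients modulo p and the Frobenius map

prime∤! : ∀ {p} → Prime p → ∀ k → k < p → ¬ (p ℕD.∣ k ℕ.!)
prime∤! pr zero k<p d = <-irrefl ≡.refl (<-≤-trans (ℕ.nonTrivial⇒n>1 _ {{Primality.prime⇒nonTrivial pr}}) (ℕD.∣⇒≤ d))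
prime∤! pr (suc k) k<p d with Primality.euclidsLemma (suc k) (k ℕ.!) pr d
... | inj₁ d′ = <⇒≱ k<p (ℕD.∣⇒≤ d′)
... | inj₂ d′ = prime∤! pr k (<-trans ≤-refl k<p) d′

-- In `C(p,k) k! (p-k)! = p!` the prime divides the right side but neither factorial.
prime∣C : ∀ {p k} → Prime p → 0 < k → k < p → p ℕD.∣ (p Comb.C k)
prime∣C {p} {k} pr 0<k k<p = case Primality.euclidsLemma (p Comb.C k) (k ℕ.! ℕ.* (p ∸ k) ℕ.!) pr p∣prod of λ
  { (inj₁ d) → d
  ; (inj₂ d) → ⊥-elim (case Primality.euclidsLemma (k ℕ.!) _ pr d of λ
      { (inj₁ d′) → prime∤! pr k k<p d′
      ; (inj₂ d′) → prime∤! pr (p ∸ k) (∸-monoʳ-< 0<k (<⇒≤ k<p)) d′ }) }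
  where
  instance _ = ℕP._!*_!≢0 k (p ∸ k)
  p∣! : ∀ {p} → 0 < p → p ℕD.∣ p ℕ.!
  p∣! {suc p} _ = ℕD.m∣m*n (p ℕ.!)
  eq : (p Comb.C k) ℕ.* (k ℕ.! ℕ.* (p ∸ k) ℕ.!) ≡ p ℕ.!
  eq = ≡.trans (cong (ℕ._* (k ℕ.! ℕ.* (p ∸ k) ℕ.!)) (Comb.nCk≡n!/k![n-k]! (<⇒≤ k<p)))
         (ℕDM.m/n*n≡m (Comb.k![n∸k]!∣n! (<⇒≤ k<p)))
  p∣prod : p ℕD.∣ (p Comb.C k) ℕ.* (k ℕ.! ℕ.* (p ∸ k) ℕ.!)
  p∣prod = subst (p ℕD.∣_) (≡.sym eq) (p∣! (<-trans 0<k k<p))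

module Frobenius (R : CommutativeRing 0ℓ 0ℓ) (p : ℕ) (pr : Prime p)
                 (charp : CommutativeRing._≈_ R (RingKit.nat R p) (CommutativeRing.0# R)) where
  open RingKit R
  open import Relation.Binary.Reasoning.Setoid setoid
  import Algebra.Properties.CommutativeSemiring.Binomial commutativeSemiring as Bin
  open import Algebra.Properties.Semiring.Sum semiring using (sum; sum-cong-≋; sum-init-last; sum-replicate-zero)

  p·≈0 : ∀ m x → p ℕD.∣ m → m · x ≈ 0#
  p·≈0 m x (ℕD.divides q ≡.refl) = begin
    (q ℕ.* p) · x        ≈⟨ ·-nat (q ℕ.* p) x ⟩
    nat (q ℕ.* p) * x    ≈⟨ *-congʳ (nat-* q p) ⟩
    (nat q * nat p) * x  ≈⟨ *-congʳ (*-congˡ charp) ⟩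
    (nat q * 0#) * x     ≈⟨ *-congʳ (zeroʳ _) ⟩
    0# * x               ≈⟨ zeroˡ x ⟩
    0# ∎

  -- In the binomial theorem all interior coefficients are multiples of `p`.
  frob-+ : ∀ x y → (x + y) ^ p ≈ x ^ p + y ^ p
  frob-+ x y = go p ≡.refl
    where
    go : ∀ n → n ≡ p → (x + y) ^ n ≈ x ^ n + y ^ n
    go zero ≡.refl = ⊥-elim (Primality.¬prime[0] pr)
    go (suc n) ≡.refl = begin
      (x + y) ^ suc n                       ≈⟨ Bin.theorem (suc n) x y ⟩
      T Fin.zero + sum (λ i → T (Fin.suc i)) ≈⟨ +-cong first (trans (sum-init-last (λ i → T (Fin.suc i))) (+-cong middle last)) ⟩
      y ^ suc n + (0# + x ^ suc n)          ≈⟨ +-congˡ (+-identityˡ _) ⟩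
      y ^ suc n + x ^ suc n                 ≈⟨ +-comm _ _ ⟩
      x ^ suc n + y ^ suc n ∎
      where
      T : Fin (suc (suc n)) → Carrier
      T = Bin.binomialTerm x y (suc n)
      first : T Fin.zero ≈ y ^ suc n
      first = trans (reflexive (cong (_· (1# * (y ^ suc n))) (≡.trans (Comb.nCk≡nC[n∸k] {0} {suc n} z≤n) (Comb.nCn≡1 (suc n)))))
                (trans (+-identityʳ _) (*-identityˡ _))
      term : ∀ i → toℕ i < n → T (Fin.suc i) ≈ 0#
      term i i<n = p·≈0 _ _ (prime∣C pr (s≤s z≤n) (s≤s i<n))
      middle : sum (λ i → T (Fin.suc (Fin.inject₁ i))) ≈ 0#
      middle = trans (sum-cong-≋ (λ i → term (Fin.inject₁ i) (subst (_< n) (≡.sym (FinP.toℕ-inject₁ i)) (FinP.toℕ<n i))))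
                 (sum-replicate-zero n)
      last : T (Fin.suc (Fin.fromℕ n)) ≈ x ^ suc n
      last = begin
        T (Fin.suc (Fin.fromℕ n))
          ≡⟨ cong (λ z → (suc n Comb.C suc z) · ((x ^ suc z) * (y ^ (n ∸ z)))) (FinP.toℕ-fromℕ n) ⟩
        (suc n Comb.C suc n) · ((x ^ suc n) * (y ^ (n ∸ n)))
          ≡⟨ cong₂ (λ u v → u · ((x ^ suc n) * (y ^ v))) (Comb.nCn≡1 (suc n)) (n∸n≡0 n) ⟩
        1 · ((x ^ suc n) * 1#) ≈⟨ +-identityʳ _ ⟩
        (x ^ suc n) * 1# ≈⟨ *-identityʳ _ ⟩
        x ^ suc n ∎

  frob-+^ : ∀ j x y → (x + y) ^ (p ℕ.^ j) ≈ x ^ (p ℕ.^ j) + y ^ (p ℕ.^ j)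
  frob-+^ zero x y = trans (^-1 _) (sym (+-cong (^-1 _) (^-1 _)))
  frob-+^ (suc j) x y = begin
    (x + y) ^ (p ℕ.* p ℕ.^ j)                    ≈⟨ sym (^-assocʳ (x + y) p (p ℕ.^ j)) ⟩
    ((x + y) ^ p) ^ (p ℕ.^ j)                    ≈⟨ ^-congˡ (p ℕ.^ j) (frob-+ x y) ⟩
    (x ^ p + y ^ p) ^ (p ℕ.^ j)                  ≈⟨ frob-+^ j _ _ ⟩
    (x ^ p) ^ (p ℕ.^ j) + (y ^ p) ^ (p ℕ.^ j)    ≈⟨ +-cong (^-assocʳ x p _) (^-assocʳ y p _) ⟩
    x ^ (p ℕ.* p ℕ.^ j) + y ^ (p ℕ.* p ℕ.^ j) ∎

  0^p^ : ∀ j → 0# ^ (p ℕ.^ j) ≈ 0#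
  0^p^ j with p ℕ.^ j in eq
  ... | zero = ⊥-elim (p^≢0 j eq)
    where
    p^≢0 : ∀ j → p ℕ.^ j ≢ 0
    p^≢0 j e = Primality.¬prime[0] (subst Prime (ℕP.m^n≡0⇒m≡0 p j e) pr)
  ... | suc m = 0^ m

  frob-neg : ∀ j x → (- x) ^ (p ℕ.^ j) ≈ - (x ^ (p ℕ.^ j))
  frob-neg j x = begin
    (- x) ^ P ≈⟨ solve 2 (λ a b → a := (b :+ a) :- b) refl ((- x) ^ P) (x ^ P) ⟩
    (x ^ P + (- x) ^ P) - x ^ P ≈⟨ +-congʳ (sym (frob-+^ j x (- x))) ⟩
    (x - x) ^ P - x ^ P ≈⟨ +-congʳ (^-congˡ P (-‿inverseʳ x)) ⟩
    0# ^ P - x ^ P ≈⟨ +-congʳ (0^p^ j) ⟩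
    0# - x ^ P ≈⟨ +-identityˡ _ ⟩
    - (x ^ P) ∎
    where P = p ℕ.^ j

  frob-sub : ∀ j x y → (x - y) ^ (p ℕ.^ j) ≈ x ^ (p ℕ.^ j) - y ^ (p ℕ.^ j)
  frob-sub j x y = trans (frob-+^ j x (- y)) (+-congˡ (frob-neg j y))

-- Homomorphisms and quotient rings

record Hom (R S : CommutativeRing 0ℓ 0ℓ) : Set where
  private
    module R = CommutativeRing R
    module S = CommutativeRing S
  field
    fn : R.Carrier → S.Carrier
    resp : ∀ {x y} → x R.≈ y → fn x S.≈ fn y
    +-homo : ∀ x y → fn (x R.+ y) S.≈ fn x S.+ fn y
    *-homo : ∀ x y → fn (x R.* y) S.≈ fn x S.* fn y
    0-homo : fn R.0# S.≈ S.0#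
    1-homo : fn R.1# S.≈ S.1#

module HomP {R S : CommutativeRing 0ℓ 0ℓ} (φ : Hom R S) where
  open Hom φ public
  private
    module R = RingKit R
    module S = RingKit S

  neg-homo : ∀ x → fn (R.- x) S.≈ S.- fn x
  neg-homo x = S.trans (S.solve 2 (λ a b → a S.:= (b S.:+ a) S.:- b) S.refl (fn (R.- x)) (fn x))
    (S.trans (S.+-congʳ (S.trans (S.sym (+-homo x (R.- x))) (S.trans (Hom.resp φ (R.-‿inverseʳ x)) 0-homo))) (S.+-identityˡ _))

  sub-homo : ∀ x y → fn (x R.- y) S.≈ fn x S.- fn y
  sub-homo x y = S.trans (+-homo x (R.- y)) (S.+-congˡ (neg-homo y))

  ^-homo : ∀ x n → fn (x R.^ n) S.≈ fn x S.^ n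
  ^-homo x zero = 1-homo
  ^-homo x (suc n) = S.trans (*-homo x (x R.^ n)) (S.*-congˡ (^-homo x n))

  nat-homo : ∀ n → fn (R.nat n) S.≈ S.nat n
  nat-homo zero = 0-homo
  nat-homo (suc n) = S.trans (+-homo R.1# (R.nat n)) (S.+-cong 1-homo (nat-homo n))

  ∣-homo : ∀ {a b} → a R.∣ b → fn a S.∣ fn b
  ∣-homo (w R.by e) = fn w S.by S.trans (Hom.resp φ e) (*-homo _ w)

idHom : ∀ {R} → Hom R R
idHom {R} = record { fn = λ x → x ; resp = λ e → e ; +-homo = λ _ _ → refl ; *-homo = λ _ _ → refl ; 0-homo = refl ; 1-homo = refl }
  where open CommutativeRing R

infixr 9 _∘ₕ_
_∘ₕ_ : ∀ {R S T} → Hom S T → Hom R S → Hom R T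
_∘ₕ_ {R} {S} {T} ψ φ = record
  { fn = λ x → Ψ.fn (Φ.fn x)
  ; resp = λ e → Ψ.resp (Φ.resp e)
  ; +-homo = λ x y → T.trans (Ψ.resp (Φ.+-homo x y)) (Ψ.+-homo _ _)
  ; *-homo = λ x y → T.trans (Ψ.resp (Φ.*-homo x y)) (Ψ.*-homo _ _)
  ; 0-homo = T.trans (Ψ.resp Φ.0-homo) Ψ.0-homo
  ; 1-homo = T.trans (Ψ.resp Φ.1-homo) Ψ.1-homo }
  where
  module T = CommutativeRing T
  module Φ = Hom φ
  module Ψ = Hom ψ

-- The quotient R/(m), realised by coarsening the setoid equality of R.
module Quotient (R : CommutativeRing 0ℓ 0ℓ) (m : CommutativeRing.Carrier R) where
  open RingKit R

  infix 4 _~_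
  record _~_ (a b : Carrier) : Set where
    constructor ~by
    field
      divides : m ∣ (a - b)
  open _~_ public

  ≈⇒~ : ∀ {a b} → a ≈ b → a ~ b
  ≈⇒~ e = ~by (∣-resp (sym (x≈y⇒x∙y⁻¹≈ε e)) ∣0)

  ∣⇒~0 : ∀ {a} → m ∣ a → a ~ 0#
  ∣⇒~0 d = ~by (∣-resp (solve 1 (λ a → a := a :- con (+ 0)) refl _) d)

  ~0⇒∣ : ∀ {a} → a ~ 0# → m ∣ a
  ~0⇒∣ (~by d) = ∣-resp (solve 1 (λ a → a :- con (+ 0) := a) refl _) d

  /ring : CommutativeRing 0ℓ 0ℓ
  /ring = record
    { Carrier = Carrier ; _≈_ = _~_ ; _+_ = _+_ ; _*_ = _*_ ; -_ = -_ ; 0# = 0# ; 1# = 1#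
    ; isCommutativeRing = record
      { isRing = record
        { +-isAbelianGroup = record
          { isGroup = record
            { isMonoid = record
              { isSemigroup = record
                { isMagma = record
                  { isEquivalence = record
                    { refl = ≈⇒~ refl
                    ; sym = λ (~by p) → ~by (∣-resp (solve 2 (λ a b → :- (a :- b) := b :- a) refl _ _) (∣-neg p))
                    ; trans = λ (~by p) (~by q) → ~by (∣-resp (solve 3 (λ a b c → (a :- b) :+ (b :- c) := a :- c) refl _ _ _) (∣-+ p q)) }
                  ; ∙-cong = λ (~by p) (~by q) → ~by (∣-resp (solve 4 (λ a b c d → (a :- b) :+ (c :- d) := (a :+ c) :- (b :+ d)) refl _ _ _ _) (∣-+ p q)) }
                ; assoc = λ a b c → ≈⇒~ (+-assoc a b c) }
              ; identity = (λ a → ≈⇒~ (+-identityˡ a)) , (λ a → ≈⇒~ (+-identityʳ a)) }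
            ; inverse = (λ a → ≈⇒~ (-‿inverseˡ a)) , (λ a → ≈⇒~ (-‿inverseʳ a))
            ; ⁻¹-cong = λ (~by p) → ~by (∣-resp (solve 2 (λ a b → :- (a :- b) := :- a :- :- b) refl _ _) (∣-neg p)) }
          ; comm = λ a b → ≈⇒~ (+-comm a b) }
        ; *-cong = λ {a} {b} {c} {d} (~by p) (~by q) → ~by (∣-resp (solve 4 (λ a b c d → (a :- b) :* c :+ b :* (c :- d) := a :* c :- b :* d) refl a b c d)
                     (∣-+ (∣-* c p) (∣-*ˡ b q)))
        ; *-assoc = λ a b c → ≈⇒~ (*-assoc a b c)
        ; *-identity = (λ a → ≈⇒~ (*-identityˡ a)) , (λ a → ≈⇒~ (*-identityʳ a))
        ; distrib = (λ a b c → ≈⇒~ (distribˡ a b c)) , (λ a b c → ≈⇒~ (distribʳ a b c)) }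
      ; *-comm = λ a b → ≈⇒~ (*-comm a b) } }

  proj : Hom R /ring
  proj = record { fn = λ x → x ; resp = ≈⇒~ ; +-homo = λ _ _ → ≈⇒~ refl ; *-homo = λ _ _ → ≈⇒~ refl
                ; 0-homo = ≈⇒~ refl ; 1-homo = ≈⇒~ refl }

  lift : ∀ {S} (φ : Hom R S) → CommutativeRing._≈_ S (Hom.fn φ m) (CommutativeRing.0# S) → Hom /ring S
  lift {S} φ φm≈0 = record { fn = fn ; resp = λ { {x} {y} (~by (w by e)) → S.x∙y⁻¹≈ε⇒x≈y _ _ (S.trans (S.sym (sub-homo x y))
                                 (S.trans (Hom.resp φ e) (S.trans (*-homo m w) (S.trans (S.*-congʳ φm≈0) (S.zeroˡ _))))) }
                       ; +-homo = +-homo ; *-homo = *-homo ; 0-homo = 0-homo ; 1-homo = 1-homo }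
    where
    module S = RingKit S
    open HomP φ

-- Polynomial rings, division and roots

-- Polynomials as coefficient lists, lowest degree first and up to trailing zeros.
module ListPoly (R : CommutativeRing 0ℓ 0ℓ) where
  open RingKit R
  open import Relation.Binary.Reasoning.Setoid setoid

  infix 8 _‼_
  _‼_ : List Carrier → ℕ → Carrier
  [] ‼ i = 0#
  (a ∷ p) ‼ zero = a
  (a ∷ p) ‼ suc i = p ‼ i

  infix 4 _≋_
  record _≋_ (p q : List Carrier) : Set where
    constructor coefs
    field at : ∀ i → p ‼ i ≈ q ‼ i
  open _≋_ public

  infixl 6 _⊕_
  _⊕_ : List Carrier → List Carrier → List Carrier
  [] ⊕ q = q
  (a ∷ p) ⊕ [] = a ∷ p
  (a ∷ p) ⊕ (b ∷ q) = a + b ∷ p ⊕ q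

  neg : List Carrier → List Carrier
  neg = map (λ a → - a)

  infixl 7 _⊙_ _⊗_
  _⊙_ : Carrier → List Carrier → List Carrier
  a ⊙ p = map (a *_) p

  _⊗_ : List Carrier → List Carrier → List Carrier
  [] ⊗ q = []
  (a ∷ p) ⊗ q = a ⊙ q ⊕ (0# ∷ p ⊗ q)

  ‼-⊕ : ∀ p q i → (p ⊕ q) ‼ i ≈ p ‼ i + q ‼ i
  ‼-⊕ [] q i = sym (+-identityˡ _)
  ‼-⊕ (a ∷ p) [] i = sym (+-identityʳ _)
  ‼-⊕ (a ∷ p) (b ∷ q) zero = refl
  ‼-⊕ (a ∷ p) (b ∷ q) (suc i) = ‼-⊕ p q i

  ‼-neg : ∀ p i → neg p ‼ i ≈ - (p ‼ i)
  ‼-neg [] i = sym -0#≈0#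
  ‼-neg (a ∷ p) zero = refl
  ‼-neg (a ∷ p) (suc i) = ‼-neg p i

  ‼-⊙ : ∀ a p i → (a ⊙ p) ‼ i ≈ a * p ‼ i
  ‼-⊙ a [] i = sym (zeroʳ a)
  ‼-⊙ a (b ∷ p) zero = refl
  ‼-⊙ a (b ∷ p) (suc i) = ‼-⊙ a p i

  ‼-⊗ : ∀ a p q i → ((a ∷ p) ⊗ q) ‼ i ≈ a * q ‼ i + (0# ∷ p ⊗ q) ‼ i
  ‼-⊗ a p q i = trans (‼-⊕ (a ⊙ q) _ i) (+-congʳ (‼-⊙ a q i))

  ∷-cong : ∀ {a b p q} → a ≈ b → p ≋ q → (a ∷ p) ≋ (b ∷ q)
  at (∷-cong e f) zero = e
  at (∷-cong e f) (suc i) = at f i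

  ⊕-cong : ∀ {p p′ q q′} → p ≋ p′ → q ≋ q′ → p ⊕ q ≋ p′ ⊕ q′
  at (⊕-cong {p} {p′} {q} {q′} e f) i = trans (‼-⊕ p q i) (trans (+-cong (at e i) (at f i)) (sym (‼-⊕ p′ q′ i)))

  ⊗-congˡ : ∀ p {q q′} → q ≋ q′ → p ⊗ q ≋ p ⊗ q′
  at (⊗-congˡ [] e) i = refl
  at (⊗-congˡ (a ∷ p) {q} {q′} e) i = begin
    ((a ∷ p) ⊗ q) ‼ i               ≈⟨ ‼-⊗ a p q i ⟩
    a * q ‼ i + (0# ∷ p ⊗ q) ‼ i    ≈⟨ +-cong (*-congˡ (at e i)) (at (∷-cong refl (⊗-congˡ p e)) i) ⟩
    a * q′ ‼ i + (0# ∷ p ⊗ q′) ‼ i  ≈⟨ sym (‼-⊗ a p q′ i) ⟩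
    ((a ∷ p) ⊗ q′) ‼ i ∎

  ⊗-[] : ∀ p → p ⊗ [] ≋ []
  at (⊗-[] []) i = refl
  at (⊗-[] (a ∷ p)) zero = refl
  at (⊗-[] (a ∷ p)) (suc i) = at (⊗-[] p) i

  ⊗-∷ : ∀ p b q → p ⊗ (b ∷ q) ≋ b ⊙ p ⊕ (0# ∷ p ⊗ q)
  at (⊗-∷ [] b q) zero = refl
  at (⊗-∷ [] b q) (suc i) = refl
  at (⊗-∷ (a ∷ p) b q) zero = +-congʳ (*-comm a b)
  at (⊗-∷ (a ∷ p) b q) (suc i) = begin
    (a ⊙ q ⊕ p ⊗ (b ∷ q)) ‼ i                   ≈⟨ ‼-⊕ (a ⊙ q) _ i ⟩
    (a ⊙ q) ‼ i + (p ⊗ (b ∷ q)) ‼ i             ≈⟨ +-cong (‼-⊙ a q i) (trans (at (⊗-∷ p b q) i) (‼-⊕ (b ⊙ p) _ i)) ⟩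
    a * q ‼ i + ((b ⊙ p) ‼ i + (0# ∷ p ⊗ q) ‼ i) ≈⟨ solve 3 (λ x y z → x :+ (y :+ z) := y :+ (x :+ z)) refl _ _ _ ⟩
    (b ⊙ p) ‼ i + (a * q ‼ i + (0# ∷ p ⊗ q) ‼ i) ≈⟨ +-congˡ (sym (‼-⊗ a p q i)) ⟩
    (b ⊙ p) ‼ i + ((a ∷ p) ⊗ q) ‼ i             ≈⟨ sym (‼-⊕ (b ⊙ p) _ i) ⟩
    (b ⊙ p ⊕ (a ∷ p) ⊗ q) ‼ i ∎

  ≋-refl : ∀ {p} → p ≋ p
  at ≋-refl i = refl

  ≋-sym : ∀ {p q} → p ≋ q → q ≋ p
  at (≋-sym e) i = sym (at e i)

  ≋-trans : ∀ {p q r} → p ≋ q → q ≋ r → p ≋ r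
  at (≋-trans e f) i = trans (at e i) (at f i)

  ⊗-comm : ∀ p q → p ⊗ q ≋ q ⊗ p
  ⊗-comm [] q = ≋-sym (⊗-[] q)
  ⊗-comm (a ∷ p) q = ≋-trans (⊕-cong {a ⊙ q} ≋-refl (∷-cong refl (⊗-comm p q))) (≋-sym (⊗-∷ q a p))

  ⊗-cong : ∀ {p p′ q q′} → p ≋ p′ → q ≋ q′ → p ⊗ q ≋ p′ ⊗ q′
  ⊗-cong {p} {p′} {q} {q′} e f = ≋-trans (⊗-congˡ p f) (≋-trans (⊗-comm p q′) (≋-trans (⊗-congˡ q′ e) (⊗-comm q′ p′)))

  ⊗-distribˡ : ∀ p q r → p ⊗ (q ⊕ r) ≋ p ⊗ q ⊕ p ⊗ r
  at (⊗-distribˡ [] q r) i = refl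
  at (⊗-distribˡ (a ∷ p) q r) i = begin
    ((a ∷ p) ⊗ (q ⊕ r)) ‼ i                          ≈⟨ ‼-⊗ a p (q ⊕ r) i ⟩
    a * (q ⊕ r) ‼ i + (0# ∷ p ⊗ (q ⊕ r)) ‼ i         ≈⟨ +-cong (trans (*-congˡ (‼-⊕ q r i)) (distribˡ _ _ _)) (shift i) ⟩
    (a * q ‼ i + a * r ‼ i) + ((0# ∷ p ⊗ q) ‼ i + (0# ∷ p ⊗ r) ‼ i)
      ≈⟨ solve 4 (λ x y z w → (x :+ y) :+ (z :+ w) := (x :+ z) :+ (y :+ w)) refl _ _ _ _ ⟩
    (a * q ‼ i + (0# ∷ p ⊗ q) ‼ i) + (a * r ‼ i + (0# ∷ p ⊗ r) ‼ i) ≈⟨ sym (+-cong (‼-⊗ a p q i) (‼-⊗ a p r i)) ⟩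
    ((a ∷ p) ⊗ q) ‼ i + ((a ∷ p) ⊗ r) ‼ i            ≈⟨ sym (‼-⊕ ((a ∷ p) ⊗ q) _ i) ⟩
    ((a ∷ p) ⊗ q ⊕ (a ∷ p) ⊗ r) ‼ i ∎
    where
    shift : ∀ i → (0# ∷ p ⊗ (q ⊕ r)) ‼ i ≈ (0# ∷ p ⊗ q) ‼ i + (0# ∷ p ⊗ r) ‼ i
    shift zero = sym (+-identityˡ _)
    shift (suc i) = trans (at (⊗-distribˡ p q r) i) (‼-⊕ (p ⊗ q) _ i)

  ⊗-distribʳ : ∀ r p q → (p ⊕ q) ⊗ r ≋ p ⊗ r ⊕ q ⊗ r
  ⊗-distribʳ r p q = ≋-trans (⊗-comm (p ⊕ q) r) (≋-trans (⊗-distribˡ r p q) (⊕-cong {r ⊗ p} (⊗-comm r p) (⊗-comm r q)))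

  0∷-⊗ : ∀ p q → (0# ∷ p) ⊗ q ≋ (0# ∷ p ⊗ q)
  at (0∷-⊗ p q) i = trans (‼-⊗ 0# p q i) (trans (+-congʳ (zeroˡ _)) (+-identityˡ _))

  ⊙-⊗ : ∀ a p q → (a ⊙ p) ⊗ q ≋ a ⊙ (p ⊗ q)
  at (⊙-⊗ a [] q) i = refl
  at (⊙-⊗ a (b ∷ p) q) i = begin
    ((a * b ∷ a ⊙ p) ⊗ q) ‼ i                    ≈⟨ ‼-⊗ (a * b) (a ⊙ p) q i ⟩
    a * b * q ‼ i + (0# ∷ (a ⊙ p) ⊗ q) ‼ i       ≈⟨ +-cong (*-assoc _ _ _) (shift i) ⟩
    a * (b * q ‼ i) + a * (0# ∷ p ⊗ q) ‼ i       ≈⟨ sym (distribˡ _ _ _) ⟩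
    a * (b * q ‼ i + (0# ∷ p ⊗ q) ‼ i)           ≈⟨ *-congˡ (sym (‼-⊗ b p q i)) ⟩
    a * ((b ∷ p) ⊗ q) ‼ i                        ≈⟨ sym (‼-⊙ a ((b ∷ p) ⊗ q) i) ⟩
    (a ⊙ ((b ∷ p) ⊗ q)) ‼ i ∎
    where
    shift : ∀ i → (0# ∷ (a ⊙ p) ⊗ q) ‼ i ≈ a * (0# ∷ p ⊗ q) ‼ i
    shift zero = sym (zeroʳ a)
    shift (suc i) = trans (at (⊙-⊗ a p q) i) (‼-⊙ a (p ⊗ q) i)

  ⊗-assoc : ∀ p q r → (p ⊗ q) ⊗ r ≋ p ⊗ (q ⊗ r)
  ⊗-assoc [] q r = ≋-refl
  ⊗-assoc (a ∷ p) q r = ≋-trans (⊗-distribʳ r (a ⊙ q) (0# ∷ p ⊗ q))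
    (⊕-cong {(a ⊙ q) ⊗ r} (⊙-⊗ a q r) (≋-trans (0∷-⊗ (p ⊗ q) r) (∷-cong refl (⊗-assoc p q r))))

  [_]-⊗ : ∀ a p → (a ∷ []) ⊗ p ≋ a ⊙ p
  at ([ a ]-⊗ p) i = trans (‼-⊗ a [] p i) (trans (+-cong (sym (‼-⊙ a p i)) (z i)) (+-identityʳ _))
    where
    z : ∀ i → (0# ∷ []) ‼ i ≈ 0#
    z zero = refl
    z (suc i) = refl

  ⊗-identityˡ : ∀ p → (1# ∷ []) ⊗ p ≋ p
  ⊗-identityˡ p = ≋-trans ([ 1# ]-⊗ p) (coefs λ i → trans (‼-⊙ 1# p i) (*-identityˡ _))

  polyRing : CommutativeRing 0ℓ 0ℓ
  polyRing = record
    { Carrier = List Carrier ; _≈_ = _≋_ ; _+_ = _⊕_ ; _*_ = _⊗_ ; -_ = neg ; 0# = [] ; 1# = 1# ∷ []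
    ; isCommutativeRing = record
      { isRing = record
        { +-isAbelianGroup = record
          { isGroup = record
            { isMonoid = record
              { isSemigroup = record
                { isMagma = record
                  { isEquivalence = record { refl = ≋-refl ; sym = ≋-sym ; trans = ≋-trans }
                  ; ∙-cong = λ {p} {p′} {q} {q′} → ⊕-cong {p} {p′} {q} {q′} }
                ; assoc = λ p q r → coefs λ i → trans (‼-⊕ (p ⊕ q) r i) (trans (+-congʳ (‼-⊕ p q i))
                    (trans (+-assoc _ _ _) (trans (+-congˡ (sym (‼-⊕ q r i))) (sym (‼-⊕ p (q ⊕ r) i))))) }
              ; identity = (λ p → ≋-refl) , (λ p → coefs λ i → trans (‼-⊕ p [] i) (+-identityʳ _)) }
            ; inverse = (λ p → coefs λ i → trans (‼-⊕ (neg p) p i) (trans (+-congʳ (‼-neg p i)) (-‿inverseˡ _)))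
                      , (λ p → coefs λ i → trans (‼-⊕ p (neg p) i) (trans (+-congˡ (‼-neg p i)) (-‿inverseʳ _)))
            ; ⁻¹-cong = λ {p} {q} e → coefs λ i → trans (‼-neg p i) (trans (-‿cong (at e i)) (sym (‼-neg q i))) }
          ; comm = λ p q → coefs λ i → trans (‼-⊕ p q i) (trans (+-comm _ _) (sym (‼-⊕ q p i))) }
        ; *-cong = ⊗-cong
        ; *-assoc = ⊗-assoc
        ; *-identity = ⊗-identityˡ , λ p → ≋-trans (⊗-comm p _) (⊗-identityˡ p)
        ; distrib = ⊗-distribˡ , ⊗-distribʳ }
      ; *-comm = ⊗-comm } }

-- The polynomial ring is kept abstract so that unification treats its operations as rigid.
module Poly (R : CommutativeRing 0ℓ 0ℓ) where
  private
    module R = RingKit R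
    module L = ListPoly R

  abstract
    poly : CommutativeRing 0ℓ 0ℓ
    poly = L.polyRing

  private module P = RingKit poly

  infix 8 _‼_
  abstract
    _‼_ : P.Carrier → ℕ → R.Carrier
    _‼_ = L._‼_

    ‼-cong : ∀ {p q} → p P.≈ q → ∀ i → p ‼ i R.≈ q ‼ i
    ‼-cong = L.at

    ≈-intro : ∀ {p q} → (∀ i → p ‼ i R.≈ q ‼ i) → p P.≈ q
    ≈-intro = L.coefs

    ‼-+ : ∀ p q i → (p P.+ q) ‼ i R.≈ p ‼ i R.+ q ‼ i
    ‼-+ = L.‼-⊕

    ‼-neg : ∀ p i → (P.- p) ‼ i R.≈ R.- (p ‼ i)
    ‼-neg = L.‼-neg

    ‼-0 : ∀ i → P.0# ‼ i R.≈ R.0#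
    ‼-0 i = R.refl

    C : R.Carrier → P.Carrier
    C a = a ∷ []

    X : P.Carrier
    X = R.0# ∷ R.1# ∷ []

    C‼0 : ∀ a → C a ‼ 0 R.≈ a
    C‼0 a = R.refl

    C‼suc : ∀ a i → C a ‼ suc i R.≈ R.0#
    C‼suc a i = R.refl

    X*‼0 : ∀ p → (X P.* p) ‼ 0 R.≈ R.0#
    X*‼0 p = R.trans (L.‼-⊗ R.0# (R.1# ∷ []) p 0) (R.trans (R.+-congʳ (R.zeroˡ _)) (R.+-identityˡ _))

    X*‼suc : ∀ p i → (X P.* p) ‼ suc i R.≈ p ‼ i
    X*‼suc p i = R.trans (L.‼-⊗ R.0# (R.1# ∷ []) p (suc i)) (R.trans (R.+-congʳ (R.zeroˡ _))
                   (R.trans (R.+-identityˡ _) (L.at (L.⊗-identityˡ p) i)))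

    C*‼ : ∀ a p i → (C a P.* p) ‼ i R.≈ a R.* p ‼ i
    C*‼ a p i = R.trans (L.at (L.[ a ]-⊗ p) i) (L.‼-⊙ a p i)

    fromList : List R.Carrier → P.Carrier
    fromList l = l

    toList : P.Carrier → List R.Carrier
    toList p = p

    fromList-toList : ∀ p → fromList (toList p) P.≈ p
    fromList-toList p = P.refl

    fromList-[] : fromList [] P.≈ P.0#
    fromList-[] = P.refl

    fromList-∷ : ∀ a l → fromList (a ∷ l) P.≈ C a P.+ X P.* fromList l
    fromList-∷ a l = L.coefs λ
      { zero → R.sym (R.trans (‼-+ (C a) (X P.* l) 0) (R.trans (R.+-congˡ (X*‼0 l)) (R.+-identityʳ _)))
      ; (suc i) → R.sym (R.trans (‼-+ (C a) (X P.* l) (suc i)) (R.trans (R.+-identityˡ _) (X*‼suc l i))) }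

    fromList-‼0 : ∀ a l → fromList (a ∷ l) ‼ 0 R.≈ a
    fromList-‼0 a l = R.refl

    fromList-‼suc : ∀ a l i → fromList (a ∷ l) ‼ suc i R.≈ fromList l ‼ i
    fromList-‼suc a l i = R.refl

    fromList-‼≥ : ∀ l i → length l ≤ i → fromList l ‼ i R.≈ R.0#
    fromList-‼≥ [] i le = R.refl
    fromList-‼≥ (a ∷ l) (suc i) (s≤s le) = fromList-‼≥ l i le

    C-cong : ∀ {a b} → a R.≈ b → C a P.≈ C b
    C-cong e = L.∷-cong e L.≋-refl

    C-+ : ∀ a b → C (a R.+ b) P.≈ C a P.+ C b
    C-+ a b = L.≋-refl

    C-* : ∀ a b → C (a R.* b) P.≈ C a P.* C b
    C-* a b = L.coefs λ { zero → R.sym (R.+-identityʳ _) ; (suc i) → R.refl }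

    C-0 : C R.0# P.≈ P.0#
    C-0 = L.coefs λ { zero → R.refl ; (suc i) → R.refl }

    C-1 : C R.1# P.≈ P.1#
    C-1 = L.≋-refl

  constHom : Hom R poly
  constHom = record { fn = C ; resp = C-cong ; +-homo = C-+ ; *-homo = C-* ; 0-homo = C-0 ; 1-homo = C-1 }

  module Eval {S : CommutativeRing 0ℓ 0ℓ} (φ : Hom R S) (z : CommutativeRing.Carrier S) where
    private
      module S = RingKit S
      module φ = HomP φ

    horner : List R.Carrier → S.Carrier
    horner [] = S.0#
    horner (a ∷ p) = φ.fn a S.+ z S.* horner p

    horner-zero : ∀ p → (∀ i → p L.‼ i R.≈ R.0#) → horner p S.≈ S.0#
    horner-zero [] e = S.refl
    horner-zero (a ∷ p) e = S.trans (S.+-cong (S.trans (φ.resp (e 0)) φ.0-homo) (S.trans (S.*-congˡ (horner-zero p (λ i → e (suc i)))) (S.zeroʳ z)))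
                              (S.+-identityˡ _)

    horner-cong : ∀ p q → (∀ i → p L.‼ i R.≈ q L.‼ i) → horner p S.≈ horner q
    horner-cong [] q e = S.sym (horner-zero q (λ i → R.sym (e i)))
    horner-cong (a ∷ p) [] e = horner-zero (a ∷ p) e
    horner-cong (a ∷ p) (b ∷ q) e = S.+-cong (φ.resp (e 0)) (S.*-congˡ (horner-cong p q (λ i → e (suc i))))

    horner-⊕ : ∀ p q → horner (p L.⊕ q) S.≈ horner p S.+ horner q
    horner-⊕ [] q = S.sym (S.+-identityˡ _)
    horner-⊕ (a ∷ p) [] = S.sym (S.+-identityʳ _)
    horner-⊕ (a ∷ p) (b ∷ q) = S.trans (S.+-cong (φ.+-homo a b) (S.*-congˡ (horner-⊕ p q)))
      (S.solve 5 (λ a b z p q → (a S.:+ b) S.:+ z S.:* (p S.:+ q) S.:= (a S.:+ z S.:* p) S.:+ (b S.:+ z S.:* q)) S.refl _ _ _ _ _)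

    horner-⊙ : ∀ a p → horner (a L.⊙ p) S.≈ φ.fn a S.* horner p
    horner-⊙ a [] = S.sym (S.zeroʳ _)
    horner-⊙ a (b ∷ p) = S.trans (S.+-cong (φ.*-homo a b) (S.*-congˡ (horner-⊙ a p)))
      (S.solve 4 (λ a b z p → a S.:* b S.:+ z S.:* (a S.:* p) S.:= a S.:* (b S.:+ z S.:* p)) S.refl _ _ _ _)

    horner-⊗ : ∀ p q → horner (p L.⊗ q) S.≈ horner p S.* horner q
    horner-⊗ [] q = S.sym (S.zeroˡ _)
    horner-⊗ (a ∷ p) q = S.trans (horner-⊕ (a L.⊙ q) _)
      (S.trans (S.+-cong (horner-⊙ a q) (S.+-cong φ.0-homo (S.*-congˡ (horner-⊗ p q))))
        (S.solve 4 (λ a q z p → a S.:* q S.:+ (S.con (+ 0) S.:+ z S.:* (p S.:* q)) S.:= (a S.:+ z S.:* p) S.:* q) S.refl _ _ _ _))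

    abstract
      evalHom : Hom poly S
      evalHom = record
        { fn = horner ; resp = λ {p} {q} e → horner-cong p q (L.at e)
        ; +-homo = horner-⊕ ; *-homo = horner-⊗ ; 0-homo = S.refl
        ; 1-homo = S.trans (S.+-cong φ.1-homo (S.zeroʳ z)) (S.+-identityʳ _) }

      eval-C : ∀ a → Hom.fn evalHom (C a) S.≈ φ.fn a
      eval-C a = S.trans (S.+-congˡ (S.zeroʳ z)) (S.+-identityʳ _)

      eval-X : Hom.fn evalHom X S.≈ z
      eval-X = S.trans (S.+-cong φ.0-homo (S.*-congˡ (S.trans (S.+-cong φ.1-homo (S.zeroʳ z)) (S.+-identityʳ _))))
                 (S.trans (S.+-identityˡ _) (S.*-identityʳ z))

module PolyFacts (R : CommutativeRing 0ℓ 0ℓ) where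
  module R = RingKit R
  open Poly R public
  module P = RingKit poly

  -- Since `poly` is abstract, this replaces pattern matching on coefficient lists.
  poly-ind : (Q : P.Carrier → Set) → (∀ {p q} → p P.≈ q → Q p → Q q) → Q P.0# →
             (∀ a p → Q p → Q (C a P.+ X P.* p)) → ∀ p → Q p
  poly-ind Q resp z s p = resp (fromList-toList p) (go (toList p))
    where
    go : ∀ l → Q (fromList l)
    go [] = resp (P.sym fromList-[]) z
    go (a ∷ l) = resp (P.sym (fromList-∷ a l)) (s a _ (go l))

  -- All later comparisons of evaluations, coefficient maps and Frobenius twists are reduced by this
  -- to constants and `X`.
  hom-ext : ∀ {S} (f g : Hom poly S) → (∀ a → CommutativeRing._≈_ S (Hom.fn f (C a)) (Hom.fn g (C a))) →
            CommutativeRing._≈_ S (Hom.fn f X) (Hom.fn g X) → ∀ p → CommutativeRing._≈_ S (Hom.fn f p) (Hom.fn g p)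
  hom-ext {S} f g eC eX = poly-ind _ (λ e h → S.trans (f.resp (P.sym e)) (S.trans h (g.resp e)))
    (S.trans f.0-homo (S.sym g.0-homo))
    (λ a p h → S.trans (S.trans (f.+-homo _ _) (S.+-cong (eC a) (S.trans (f.*-homo _ _) (S.*-cong eX h))))
                 (S.sym (S.trans (g.+-homo _ _) (S.+-congˡ (g.*-homo _ _)))))
    where
    module S = CommutativeRing S
    module f = Hom f
    module g = Hom g

  step‼0 : ∀ a p → (C a P.+ X P.* p) ‼ 0 R.≈ a
  step‼0 a p = R.trans (‼-+ _ _ 0) (R.trans (R.+-cong (C‼0 a) (X*‼0 p)) (R.+-identityʳ a))

  step‼suc : ∀ a p i → (C a P.+ X P.* p) ‼ suc i R.≈ p ‼ i
  step‼suc a p i = R.trans (‼-+ _ _ (suc i)) (R.trans (R.+-cong (C‼suc a i) (X*‼suc p i)) (R.+-identityˡ _))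

  decompose : ∀ p → Σ P.Carrier λ t → p P.≈ C (p ‼ 0) P.+ X P.* t
  decompose p = go (toList p) (fromList-toList p)
    where
    go : ∀ l → fromList l P.≈ p → Σ P.Carrier λ t → p P.≈ C (p ‼ 0) P.+ X P.* t
    go [] e = P.0# , ≈-intro λ { zero → R.sym (step‼0 _ _)
                               ; (suc i) → R.trans (‼-cong (P.sym (P.trans (P.sym fromList-[]) e)) (suc i))
                                   (R.trans (‼-0 _) (R.sym (R.trans (step‼suc _ _ i) (‼-0 i)))) }
    go (a ∷ l) e = fromList l , P.trans (P.sym e) (≈-intro λ
      { zero → R.trans (fromList-‼0 a l) (R.sym (R.trans (step‼0 _ _) (R.trans (‼-cong (P.sym e) 0) (fromList-‼0 a l))))
      ; (suc i) → R.trans (fromList-‼suc a l i) (R.sym (step‼suc _ _ i)) })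

  ‼-sub : ∀ p q i → (p P.- q) ‼ i R.≈ p ‼ i R.- q ‼ i
  ‼-sub p q i = R.trans (‼-+ p (P.- q) i) (R.+-congˡ (‼-neg q i))

  step*‼0 : ∀ a t q → ((C a P.+ X P.* t) P.* q) ‼ 0 R.≈ a R.* q ‼ 0
  step*‼0 a t q = R.trans (‼-cong (P.trans (P.distribʳ _ _ _) (P.+-congˡ (P.*-assoc X t q))) 0)
    (R.trans (‼-+ _ _ 0) (R.trans (R.+-cong (C*‼ a q 0) (X*‼0 _)) (R.+-identityʳ _)))

  step*‼suc : ∀ a t q i → ((C a P.+ X P.* t) P.* q) ‼ suc i R.≈ a R.* q ‼ suc i R.+ (t P.* q) ‼ i
  step*‼suc a t q i = R.trans (‼-cong (P.trans (P.distribʳ _ _ _) (P.+-congˡ (P.*-assoc X t q))) (suc i))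
    (R.trans (‼-+ _ _ (suc i)) (R.+-cong (C*‼ a q (suc i)) (X*‼suc _ i)))

  -- deg p < N
  Bnd : ℕ → P.Carrier → Set
  Bnd N p = ∀ i → N ≤ i → p ‼ i R.≈ R.0#

  bnd-resp : ∀ {N p q} → p P.≈ q → Bnd N p → Bnd N q
  bnd-resp e b i le = R.trans (‼-cong (P.sym e) i) (b i le)

  bnd-mono : ∀ {M N p} → M ≤ N → Bnd M p → Bnd N p
  bnd-mono le b i le′ = b i (≤-trans le le′)

  bnd-0 : ∀ {N} → Bnd N P.0#
  bnd-0 i _ = ‼-0 i

  bnd0 : ∀ {p} → Bnd 0 p → p P.≈ P.0#
  bnd0 b = ≈-intro λ i → R.trans (b i z≤n) (R.sym (‼-0 i))

  bnd-+ : ∀ {N p q} → Bnd N p → Bnd N q → Bnd N (p P.+ q)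
  bnd-+ {p = p} {q} b c i le = R.trans (‼-+ p q i) (R.trans (R.+-cong (b i le) (c i le)) (R.+-identityʳ _))

  bnd-neg : ∀ {N p} → Bnd N p → Bnd N (P.- p)
  bnd-neg {p = p} b i le = R.trans (‼-neg p i) (R.trans (R.-‿cong (b i le)) R.-0#≈0#)

  bnd-sub : ∀ {N p q} → Bnd N p → Bnd N q → Bnd N (p P.- q)
  bnd-sub b c = bnd-+ b (bnd-neg c)

  bnd-C : ∀ a → Bnd 1 (C a)
  bnd-C a (suc i) le = C‼suc a i

  bnd-C* : ∀ {N} a {p} → Bnd N p → Bnd N (C a P.* p)
  bnd-C* a {p} b i le = R.trans (C*‼ a p i) (R.trans (R.*-congˡ (b i le)) (R.zeroʳ a))

  bnd-X* : ∀ {N p} → Bnd N p → Bnd (suc N) (X P.* p)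
  bnd-X* {p = p} b (suc i) (s≤s le) = R.trans (X*‼suc p i) (b i le)

  bnd-step : ∀ {N} a {p} → Bnd N p → Bnd (suc N) (C a P.+ X P.* p)
  bnd-step a b = bnd-+ (bnd-mono (s≤s z≤n) (bnd-C a)) (bnd-X* b)

  bnd-tail : ∀ {N} {p a t} → p P.≈ C a P.+ X P.* t → Bnd (suc N) p → Bnd N t
  bnd-tail e b i le = R.trans (R.sym (step‼suc _ _ i)) (bnd-resp e b (suc i) (s≤s le))

  bnd-fromList : ∀ l → Bnd (length l) (fromList l)
  bnd-fromList l = fromList-‼≥ l

  bound : P.Carrier → ℕ
  bound p = length (toList p)

  bnd-bound : ∀ p → Bnd (bound p) p
  bnd-bound p = bnd-resp (fromList-toList p) (bnd-fromList (toList p))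

  constant : ∀ {p} → Bnd 1 p → p P.≈ C (p ‼ 0)
  constant b = ≈-intro λ { zero → R.sym (C‼0 _) ; (suc i) → R.trans (b (suc i) (s≤s z≤n)) (R.sym (C‼suc _ i)) }

  -- The degrees are formal bounds, so the top coefficients may vanish; the bound and the top
  -- coefficient are carried together through the induction on `a`.
  *-bnd-top : ∀ a b p q → Bnd (suc a) p → Bnd (suc b) q → Bnd (suc (a ℕ.+ b)) (p P.* q) × ((p P.* q) ‼ (a ℕ.+ b) R.≈ p ‼ a R.* q ‼ b)
  *-bnd-top zero b p q bp bq = (λ i le → R.trans (eq i) (bnd-C* _ bq i le)) , R.trans (eq b) (C*‼ _ q b)
    where
    eq : ∀ i → (p P.* q) ‼ i R.≈ (C (p ‼ 0) P.* q) ‼ i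
    eq = ‼-cong (P.*-congʳ (constant bp))
  *-bnd-top (suc a) b p q bp bq with decompose p
  ... | t , e with *-bnd-top a b t q (bnd-tail e bp) bq
  ...   | bt , top = bd , (R.trans (eq (a ℕ.+ b)) (R.trans (R.+-cong (R.trans (R.*-congˡ (bq _ (s≤s (m≤n+m b a)))) (R.zeroʳ _)) top)
                        (R.trans (R.+-identityˡ _) (R.*-congʳ (R.sym (R.trans (‼-cong e (suc a)) (step‼suc _ _ a)))))))
    where
    eq : ∀ i → (p P.* q) ‼ suc i R.≈ p ‼ 0 R.* q ‼ suc i R.+ (t P.* q) ‼ i
    eq i = R.trans (‼-cong (P.*-congʳ e) (suc i)) (step*‼suc _ t q i)
    bd : Bnd (suc (suc a ℕ.+ b)) (p P.* q)
    bd (suc i) (s≤s le) = R.trans (eq i) (R.trans (R.+-cong (R.trans (R.*-congˡ (bq _ (s≤s (≤-trans (m≤n+m b a) (≤-trans (n≤1+n _) le))))) (R.zeroʳ _)) (bt i le)) (R.+-identityʳ _))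

  bnd-* : ∀ a {b p q} → Bnd (suc a) p → Bnd b q → Bnd (a ℕ.+ b) (p P.* q)
  bnd-* a {zero} {p} {q} bp bq = bnd-resp (P.sym (P.trans (P.*-congˡ (bnd0 bq)) (P.zeroʳ p))) bnd-0
  bnd-* a {suc b} {p} {q} bp bq = subst (λ z → Bnd z (p P.* q)) (≡.sym (ℕP.+-suc a b)) (proj₁ (*-bnd-top a b p q bp bq))

  bnd-^ : ∀ a {p} n → Bnd (suc a) p → Bnd (suc (n ℕ.* a)) (p P.^ n)
  bnd-^ a zero b i (s≤s {n = i′} le) = R.trans (‼-cong (P.sym C-1) _) (C‼suc _ i′)
  bnd-^ a {p} (suc n) b = proj₁ (*-bnd-top a (n ℕ.* a) p (p P.^ n) b (bnd-^ a n b))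

  record Mon (N : ℕ) (p : P.Carrier) : Set where
    constructor mon
    field
      bnd : Bnd (suc N) p
      lead : p ‼ N R.≈ R.1#
  open Mon public

  mon-resp : ∀ {N p q} → p P.≈ q → Mon N p → Mon N q
  mon-resp e (mon b l) = mon (bnd-resp e b) (R.trans (‼-cong (P.sym e) _) l)

  mon-1 : Mon 0 P.1#
  mon-1 = mon-resp C-1 (mon (bnd-C _) (C‼0 _))

  mon-* : ∀ {a b p q} → Mon a p → Mon b q → Mon (a ℕ.+ b) (p P.* q)
  mon-* {a} {b} {p} {q} (mon bp lp) (mon bq lq) with *-bnd-top a b p q bp bq
  ... | bd , top = mon bd (R.trans top (R.trans (R.*-cong lp lq) (R.*-identityʳ _)))

  mon-^ : ∀ {a p} n → Mon a p → Mon (n ℕ.* a) (p P.^ n)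
  mon-^ zero m = mon-1
  mon-^ (suc n) m = mon-* m (mon-^ n m)

  mon0 : ∀ {p} → Mon 0 p → p P.≈ P.1#
  mon0 (mon b l) = P.trans (constant b) (P.trans (C-cong l) C-1)

  -- The coefficient of `w` at its formal top survives in the product, at an index of at least `N`.
  -- It is therefore zero, and the bound for `w` descends to nothing. Zero divisors do no harm
  -- because `m` is monic.
  monic-cancel : ∀ {N m w} → Mon N m → Bnd N (m P.* w) → w P.≈ P.0#
  monic-cancel {N} {m} {w} (mon bm lm) bmw = go (bound w) (bnd-bound w)
    where
    go : ∀ L → Bnd L w → w P.≈ P.0#
    go zero b = bnd0 b
    go (suc L) b = go L λ i le → case m≤n⇒m<n∨m≡n le of λ
      { (inj₁ lt) → b i lt
      ; (inj₂ ≡.refl) → R.trans (R.sym (R.trans (proj₂ (*-bnd-top N L m w bm b)) (R.trans (R.*-congʳ lm) (R.*-identityˡ _))))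
                          (bmw (N ℕ.+ L) (m≤m+n N L)) }

  monic-cancelˡ : ∀ {N m u v} → Mon N m → m P.* u P.≈ m P.* v → u P.≈ v
  monic-cancelˡ {N} {m} {u} {v} M e = P.x∙y⁻¹≈ε⇒x≈y _ _ (monic-cancel M
    (bnd-resp (P.sym (P.trans (P.solve 3 (λ m u v → m P.:* (u P.:- v) P.:= m P.:* u P.:- m P.:* v) P.refl m u v) (P.x≈y⇒x∙y⁻¹≈ε e))) bnd-0))

  monic∣⇒≈0 : ∀ {N m p} → Mon N m → Bnd N p → m P.∣ p → p P.≈ P.0#
  monic∣⇒≈0 {N} {m} M b (w P.by e) = P.trans e (P.trans (P.*-congˡ (monic-cancel M (bnd-resp e b))) (P.zeroʳ m))

  record Division (N : ℕ) (m p : P.Carrier) : Set where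
    constructor division
    field
      quot rem : P.Carrier
      eq : p P.≈ m P.* quot P.+ rem
      small : Bnd N rem

  abstract
    -- Horner-style division: the remainder of `a + X p` is `a + X r` minus the multiple of `m` that
    -- cancels the coefficient of degree `N`.
    divide : ∀ {N m} → Mon N m → ∀ p → Division N m p
    divide {N} {m} (mon bm lm) = poly-ind (Division N m) (λ e (division w r q b) → division w r (P.trans (P.sym e) q) b)
      (division P.0# P.0# (P.sym (P.trans (P.+-identityʳ _) (P.zeroʳ m))) bnd-0)
      λ a p (division w r q b) →
        let s = C a P.+ X P.* r
            c = s ‼ N
        in division (X P.* w P.+ C c) (s P.- C c P.* m)
             (P.trans (P.+-congˡ (P.*-congˡ q))
                (P.solve 6 (λ a x m w r c → a P.:+ x P.:* (m P.:* w P.:+ r) P.:= m P.:* (x P.:* w P.:+ c) P.:+ ((a P.:+ x P.:* r) P.:- c P.:* m))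
                   P.refl (C a) X m w r (C c)))
             λ i le → case m≤n⇒m<n∨m≡n le of λ
               { (inj₁ lt) → bnd-sub (bnd-step a b) (bnd-C* c bm) i lt
               ; (inj₂ ≡.refl) → R.trans (‼-sub s _ N) (R.trans (R.+-congˡ (R.-‿cong (R.trans (C*‼ c m N) (R.trans (R.*-congˡ lm) (R.*-identityʳ c)))))
                                   (R.-‿inverseʳ c)) }

  X-C : R.Carrier → P.Carrier
  X-C z = X P.- C z

  X‼ : ∀ i → X ‼ i R.≈ (C R.0# P.+ X P.* C R.1#) ‼ i
  X‼ = ‼-cong (P.trans (P.sym (P.*-identityʳ X)) (P.trans (P.sym (P.+-identityˡ _)) (P.+-cong (P.sym C-0)
         (P.*-congˡ (P.sym C-1)))))

  X‼1 : X ‼ 1 R.≈ R.1#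
  X‼1 = R.trans (X‼ 1) (R.trans (step‼suc _ _ 0) (C‼0 _))

  mon-X : Mon 1 X
  mon-X = mon (λ { (suc (suc i)) _ → R.trans (X‼ (suc (suc i))) (R.trans (step‼suc _ _ (suc i)) (C‼suc _ i)) ; (suc zero) (s≤s ()) }) X‼1

  mon-X-C : ∀ z → Mon 1 (X-C z)
  mon-X-C z = mon (bnd-sub (bnd mon-X) (bnd-mono (s≤s z≤n) (bnd-C z)))
    (R.trans (‼-sub X (C z) 1) (R.trans (R.+-cong X‼1 (R.trans (R.-‿cong (C‼suc z 0)) R.-0#≈0#)) (R.+-identityʳ _)))

  eval : R.Carrier → P.Carrier → R.Carrier
  eval z = Hom.fn (Eval.evalHom idHom z)

  module EvalP (z : R.Carrier) = HomP (Eval.evalHom {R} idHom z)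

  eval-C : ∀ z a → eval z (C a) R.≈ a
  eval-C z a = Eval.eval-C idHom z a

  eval-X : ∀ z → eval z X R.≈ z
  eval-X z = Eval.eval-X idHom z

  eval-X-C : ∀ z y → eval z (X-C y) R.≈ z R.- y
  eval-X-C z y = R.trans (EvalP.sub-homo z X (C y)) (R.+-cong (eval-X z) (R.-‿cong (eval-C z y)))

  factor : ∀ z p → eval z p R.≈ R.0# → X-C z P.∣ p
  factor z p ez = go (divide (mon-X-C z) p)
    where
    module E = EvalP z
    go : Division 1 (X-C z) p → X-C z P.∣ p
    go (division w r q b) = w P.by P.trans q (P.trans (P.+-congˡ (P.trans (constant b) (P.trans (C-cong r0≈0) C-0))) (P.+-identityʳ _))
      where
      r0≈0 : r ‼ 0 R.≈ R.0#
      r0≈0 = R.trans (R.sym (eval-C z _)) (R.trans (E.resp (P.sym (constant b)))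
        (R.trans (R.sym (R.trans (R.+-congʳ (R.trans (R.*-congʳ (R.trans (eval-X-C z z) (R.-‿inverseʳ z))) (R.zeroˡ _))) (R.+-identityˡ _)))
          (R.trans (R.+-congʳ (R.sym (E.*-homo _ _))) (R.trans (R.sym (E.+-homo _ _)) (R.trans (E.resp (P.sym q)) ez)))))

  linears : List R.Carrier → P.Carrier
  linears [] = P.1#
  linears (z ∷ zs) = X-C z P.* linears zs

  mon-linears : ∀ zs → Mon (length zs) (linears zs)
  mon-linears [] = mon-1
  mon-linears (z ∷ zs) = mon-* (mon-X-C z) (mon-linears zs)

  module Domain (dom : ∀ a b → a R.* b R.≈ R.0# → a R.≈ R.0# ⊎ b R.≈ R.0#) where

    abstract
      -- Once `X - z` is split off, another root `y` stays a root of the cofactor, because `y - z`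
      -- is not zero in a domain.
      roots-factor : ∀ zs p → AllPairs (λ a b → ¬ (a R.≈ b)) zs → All (λ z → eval z p R.≈ R.0#) zs → linears zs P.∣ p
      roots-factor [] p _ _ = P.1∣
      roots-factor (z ∷ zs) p (z∉ ∷ u) (ez ∷ es) = step (factor z p ez)
        where
        step : X-C z P.∣ p → linears (z ∷ zs) P.∣ p
        step (w P.by e) = P.∣-resp (P.sym e) (P.*-mono-∣ P.∣-refl (roots-factor zs w u (All.zipWith rest (z∉ , es))))
          where
          rest : ∀ {y} → ¬ (z R.≈ y) × (eval y p R.≈ R.0#) → eval y w R.≈ R.0#
          rest {y} (z≢y , ey) = case dom (y R.- z) (eval y w) (R.trans (R.*-congʳ (R.sym (eval-X-C y z)))
              (R.trans (R.sym (EvalP.*-homo y _ _)) (R.trans (EvalP.resp y (P.sym e)) ey))) of λ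
            { (inj₁ q) → ⊥-elim (z≢y (R.sym (R.x∙y⁻¹≈ε⇒x≈y _ _ q)))
            ; (inj₂ q) → q }

    root-bound : ∀ zs p → AllPairs (λ a b → ¬ (a R.≈ b)) zs → All (λ z → eval z p R.≈ R.0#) zs → Bnd (length zs) p → p P.≈ P.0#
    root-bound zs p u es b = monic∣⇒≈0 (mon-linears zs) b (roots-factor zs p u es)

    linears-unique : ∀ zs p → AllPairs (λ a b → ¬ (a R.≈ b)) zs → All (λ z → eval z p R.≈ R.0#) zs → Mon (length zs) p → p P.≈ linears zs
    linears-unique zs p u es m = P.x∙y⁻¹≈ε⇒x≈y _ _ (root-bound zs (p P.- linears zs) u (All.zipWith
        (λ {z} (e , e′) → R.trans (EvalP.sub-homo z p _) (R.trans (R.+-cong e (R.trans (R.-‿cong e′) R.-0#≈0#)) (R.+-identityʳ _))) (es , vanish zs))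
        λ i le → case m≤n⇒m<n∨m≡n le of λ
          { (inj₁ lt) → bnd-sub (bnd m) (bnd (mon-linears zs)) i lt
          ; (inj₂ ≡.refl) → R.trans (‼-sub p _ i) (R.trans (R.+-cong (lead m) (R.-‿cong (lead (mon-linears zs)))) (R.-‿inverseʳ _)) })
      where
      vanish : ∀ zs → All (λ z → eval z (linears zs) R.≈ R.0#) zs
      vanish [] = []
      vanish (z ∷ zs) = R.trans (EvalP.*-homo z _ _) (R.trans (R.*-congʳ (R.trans (eval-X-C z z) (R.-‿inverseʳ z))) (R.zeroˡ _))
        ∷ All.map (λ {y} e → R.trans (EvalP.*-homo y _ _) (R.trans (R.*-congˡ e) (R.zeroʳ _))) (vanish zs)

module PolyMap {R S : CommutativeRing 0ℓ 0ℓ} (φ : Hom R S) where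
  private
    module A = PolyFacts R
    module B = PolyFacts S
    module S = RingKit S

  mapHom : Hom A.poly B.poly
  mapHom = A.Eval.evalHom (B.constHom ∘ₕ φ) B.X

  map-C : ∀ a → Hom.fn mapHom (A.C a) B.P.≈ B.C (Hom.fn φ a)
  map-C a = A.Eval.eval-C (B.constHom ∘ₕ φ) B.X a

  map-X : Hom.fn mapHom A.X B.P.≈ B.X
  map-X = A.Eval.eval-X (B.constHom ∘ₕ φ) B.X

  private
    module M = HomP mapHom
    map-step : ∀ a p → M.fn (A.C a A.P.+ A.X A.P.* p) B.P.≈ B.C (Hom.fn φ a) B.P.+ B.X B.P.* M.fn p
    map-step a p = B.P.trans (M.+-homo _ _) (B.P.+-cong (map-C a) (B.P.trans (M.*-homo _ _) (B.P.*-congʳ map-X)))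

  map-‼ : ∀ p i → M.fn p B.‼ i S.≈ Hom.fn φ (p A.‼ i)
  map-‼ = A.poly-ind (λ p → ∀ i → M.fn p B.‼ i S.≈ Hom.fn φ (p A.‼ i))
    (λ e h i → S.trans (B.‼-cong (M.resp (A.P.sym e)) i) (S.trans (h i) (Hom.resp φ (A.‼-cong e i))))
    (λ i → S.trans (B.‼-cong M.0-homo i) (S.trans (B.‼-0 i) (S.sym (S.trans (Hom.resp φ (A.‼-0 i)) (Hom.0-homo φ)))))
    λ a p h → λ { zero → S.trans (B.‼-cong (map-step a p) 0) (S.trans (B.step‼0 _ _) (S.sym (Hom.resp φ (A.step‼0 a p))))
                ; (suc i) → S.trans (B.‼-cong (map-step a p) (suc i)) (S.trans (B.step‼suc _ _ i) (S.trans (h i) (S.sym (Hom.resp φ (A.step‼suc a p i))))) }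

  map-bnd : ∀ {N p} → A.Bnd N p → B.Bnd N (M.fn p)
  map-bnd b i le = S.trans (map-‼ _ i) (S.trans (Hom.resp φ (b i le)) (Hom.0-homo φ))

  map-mon : ∀ {N p} → A.Mon N p → B.Mon N (M.fn p)
  map-mon (A.mon b l) = B.mon (map-bnd b) (S.trans (map-‼ _ _) (S.trans (Hom.resp φ l) (Hom.1-homo φ)))

  eval-map : ∀ {T} (ψ : Hom S T) z p → CommutativeRing._≈_ T (Hom.fn (B.Eval.evalHom ψ z) (M.fn p)) (Hom.fn (A.Eval.evalHom (ψ ∘ₕ φ) z) p)
  eval-map {T} ψ z = A.hom-ext (B.Eval.evalHom ψ z ∘ₕ mapHom) (A.Eval.evalHom (ψ ∘ₕ φ) z)
    (λ a → T.trans (Hom.resp (B.Eval.evalHom ψ z) (map-C a)) (T.trans (B.Eval.eval-C ψ z _) (T.sym (A.Eval.eval-C (ψ ∘ₕ φ) z a))))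
    (T.trans (Hom.resp (B.Eval.evalHom ψ z) map-X) (T.trans (B.Eval.eval-X ψ z) (T.sym (A.Eval.eval-X (ψ ∘ₕ φ) z))))
    where module T = CommutativeRing T

-- Finite sums and products, enumeration and the pigeonhole principle

module BigOp (M : CommutativeMonoid 0ℓ 0ℓ) where
  open CommutativeMonoid M
  open import Relation.Binary.Reasoning.Setoid setoid

  ⨁ : ∀ {X : Set} → List X → (X → Carrier) → Carrier
  ⨁ [] f = ε
  ⨁ (x ∷ xs) f = f x ∙ ⨁ xs f

  private
    interchange : ∀ a b c d → (a ∙ b) ∙ (c ∙ d) ≈ (a ∙ c) ∙ (b ∙ d)
    interchange a b c d = begin
      (a ∙ b) ∙ (c ∙ d) ≈⟨ assoc a b _ ⟩
      a ∙ (b ∙ (c ∙ d)) ≈⟨ ∙-congˡ (trans (sym (assoc b c d)) (trans (∙-congʳ (comm b c)) (assoc c b d))) ⟩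
      a ∙ (c ∙ (b ∙ d)) ≈⟨ sym (assoc a c _) ⟩
      (a ∙ c) ∙ (b ∙ d) ∎

  ⨁-cong∈ : ∀ {X : Set} (xs : List X) {f g} → (∀ x → x ∈ xs → f x ≈ g x) → ⨁ xs f ≈ ⨁ xs g
  ⨁-cong∈ [] e = refl
  ⨁-cong∈ (x ∷ xs) e = ∙-cong (e x (here ≡.refl)) (⨁-cong∈ xs (λ y i → e y (there i)))

  ⨁-cong : ∀ {X : Set} (xs : List X) {f g} → (∀ x → f x ≈ g x) → ⨁ xs f ≈ ⨁ xs g
  ⨁-cong xs e = ⨁-cong∈ xs (λ x _ → e x)

  ⨁-ε : ∀ {X : Set} (xs : List X) → ⨁ xs (λ _ → ε) ≈ ε
  ⨁-ε [] = refl
  ⨁-ε (x ∷ xs) = trans (identityˡ _) (⨁-ε xs)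

  ⨁-∙ : ∀ {X : Set} (xs : List X) f g → ⨁ xs (λ x → f x ∙ g x) ≈ ⨁ xs f ∙ ⨁ xs g
  ⨁-∙ [] f g = sym (identityˡ _)
  ⨁-∙ (x ∷ xs) f g = trans (∙-congˡ (⨁-∙ xs f g)) (interchange _ _ _ _)

  ⨁-swap : ∀ {X : Set} {Y : Set} (xs : List X) (ys : List Y) (f : X → Y → Carrier) → ⨁ xs (λ x → ⨁ ys (f x)) ≈ ⨁ ys (λ y → ⨁ xs (λ x → f x y))
  ⨁-swap [] ys f = sym (⨁-ε ys)
  ⨁-swap (x ∷ xs) ys f = trans (∙-congˡ (⨁-swap xs ys f)) (sym (⨁-∙ ys (f x) _))

  ⨁-++ : ∀ {X : Set} (xs ys : List X) f → ⨁ (xs ++ ys) f ≈ ⨁ xs f ∙ ⨁ ys f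
  ⨁-++ [] ys f = sym (identityˡ _)
  ⨁-++ (x ∷ xs) ys f = trans (∙-congˡ (⨁-++ xs ys f)) (sym (assoc _ _ _))

  ⨁-map : ∀ {X : Set} {Y : Set} (e : Y → X) ys f → ⨁ (map e ys) f ≡ ⨁ ys (f ∘ e)
  ⨁-map e [] f = ≡.refl
  ⨁-map e (y ∷ ys) f = cong (f (e y) ∙_) (⨁-map e ys f)

  ⨁-↭ : ∀ {X : Set} {xs ys : List X} f → xs ↭ ys → ⨁ xs f ≈ ⨁ ys f
  ⨁-↭ f _↭_.refl = refl
  ⨁-↭ f (prep x r) = ∙-congˡ (⨁-↭ f r)
  ⨁-↭ f (swap x y r) = trans (sym (assoc _ _ _)) (trans (∙-cong (comm _ _) (⨁-↭ f r)) (assoc _ _ _))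
  ⨁-↭ f (_↭_.trans r s) = trans (⨁-↭ f r) (⨁-↭ f s)

  ⨁-filter : ∀ {X : Set} {P : X → Set} (P? : ∀ x → Dec (P x)) xs f → ⨁ (filter P? xs) f ≈ ⨁ xs (λ x → if does (P? x) then f x else ε)
  ⨁-filter P? [] f = refl
  ⨁-filter P? (x ∷ xs) f with does (P? x)
  ... | true = ∙-congˡ (⨁-filter P? xs f)
  ... | false = trans (⨁-filter P? xs f) (sym (identityˡ _))

  ⨁-pick : ∀ {X : Set} (xs : List X) x f → Unique xs → x ∈ xs → (∀ y → y ∈ xs → y ≢ x → f y ≈ ε) → ⨁ xs f ≈ f x
  ⨁-pick (x ∷ xs) .x f (u ∷ us) (here ≡.refl) z = trans (∙-congˡ (trans (⨁-cong∈ xs (λ y i → z y (there i) (λ e → All.lookup u i (≡.sym e)))) (⨁-ε xs))) (identityʳ _)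
  ⨁-pick (y ∷ xs) x f (u ∷ us) (there i) z = trans (∙-cong (z y (here ≡.refl) (All.lookup u i)) (⨁-pick xs x f us i (λ y′ j → z y′ (there j)))) (identityˡ _)

  ⨁-product : ∀ {X Y Z : Set} (e : X → Y → Z) xs ys f → ⨁ (cartesianProductWith e xs ys) f ≈ ⨁ xs (λ x → ⨁ ys (λ y → f (e x y)))
  ⨁-product e [] ys f = refl
  ⨁-product e (x ∷ xs) ys f = trans (⨁-++ (map (e x) ys) _ f) (∙-cong (reflexive (⨁-map (e x) ys f)) (⨁-product e xs ys f))

  ⨁-bij : ∀ {X Y : Set} {xs : List X} {ys : List Y} (e : X → Y) (e′ : Y → X) f → Unique xs → Unique ys →
          (∀ x → x ∈ xs → e x ∈ ys × e′ (e x) ≡ x) → (∀ y → y ∈ ys → e′ y ∈ xs × e (e′ y) ≡ y) → ⨁ xs (f ∘ e) ≈ ⨁ ys f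
  ⨁-bij {X} {Y} {xs} {ys} e e′ f u v to from = trans (reflexive (≡.sym (⨁-map e xs f))) (⨁-↭ f
    (∼bag⇒↭ (unique∧set⇒bag (uniq xs u (λ x i → proj₂ (to x i))) v (mk⇔
      (λ i → let (x , j , eq) = ∈-map⁻ e i in subst (_∈ ys) (≡.sym eq) (proj₁ (to x j)))
      (λ i → let (j , eq) = from _ i in subst (_∈ map e xs) eq (∈-map⁺ e j))))))
    where
    uniq : ∀ xs → Unique xs → (∀ x → x ∈ xs → e′ (e x) ≡ x) → Unique (map e xs)
    uniq [] _ _ = []
    uniq (x ∷ xs) (p ∷ ps) h = All.tabulate (λ {y} i eq → let (z , j , eq′) = ∈-map⁻ e i in
        All.lookup p j (≡.trans (≡.sym (h x (here ≡.refl))) (≡.trans (cong e′ (≡.trans eq eq′)) (h z (there j)))))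
      ∷ uniq xs ps (λ y i → h y (there i))

-- All lists of length m with entries in xs.
seqs : ∀ {X : Set} → List X → ℕ → List (List X)
seqs xs zero = [] ∷ []
seqs xs (suc m) = cartesianProductWith _∷_ xs (seqs xs m)

module _ {X : Set} {xs : List X} where

  seqs-unique : Unique xs → ∀ m → Unique (seqs xs m)
  seqs-unique u zero = [] ∷ []
  seqs-unique u (suc m) = Uniq.cartesianProductWith⁺ _∷_ (λ { ≡.refl → ≡.refl , ≡.refl }) u (seqs-unique u m)

  seqs-∈ : ∀ {l} → All (_∈ xs) l → l ∈ seqs xs (length l)
  seqs-∈ [] = here ≡.refl
  seqs-∈ (i ∷ is) = ∈-cartesianProductWith⁺ _∷_ i (seqs-∈ is)

  seqs-length : ∀ m {l} → l ∈ seqs xs m → length l ≡ m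
  seqs-length zero (here ≡.refl) = ≡.refl
  seqs-length (suc m) i with ∈-cartesianProductWith⁻ _∷_ xs (seqs xs m) i
  ... | _ , _ , _ , j , ≡.refl = cong suc (seqs-length m j)

  seqs-All : ∀ m {l} → l ∈ seqs xs m → All (_∈ xs) l
  seqs-All zero (here ≡.refl) = []
  seqs-All (suc m) i with ∈-cartesianProductWith⁻ _∷_ xs (seqs xs m) i
  ... | _ , _ , j , k , ≡.refl = j ∷ seqs-All m k

  length-product : ∀ {Y Z : Set} (e : X → Y → Z) (as : List X) (ys : List Y) → length (cartesianProductWith e as ys) ≡ length as ℕ.* length ys
  length-product e [] ys = ≡.refl
  length-product e (a ∷ as) ys = ≡.trans (ListP.length-++ (map (e a) ys)) (cong₂ ℕ._+_ (ListP.length-map (e a) ys) (length-product e as ys))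

  length-seqs : ∀ m → length (seqs xs m) ≡ length xs ℕ.^ m
  length-seqs zero = ≡.refl
  length-seqs (suc m) = ≡.trans (length-product _∷_ xs (seqs xs m)) (cong (length xs ℕ.*_) (length-seqs m))

list-pigeonhole : ∀ {X Y : Set} (xs : List X) (ys : List Y) (φ : X → Y) → Unique xs → (∀ x → x ∈ xs → φ x ∈ ys) →
                  length ys < length xs → Σ X λ x → Σ X λ x′ → x ∈ xs × x′ ∈ xs × x ≢ x′ × φ x ≡ φ x′
list-pigeonhole xs ys φ u h lt with FinP.pigeonhole lt (λ i → Any.index (h (lookup xs i) (∈-lookup i)))
... | i , j , i<j , e = lookup xs i , lookup xs j , ∈-lookup i , ∈-lookup j , distinct xs u i j i<j ,
    ≡.trans (lookup-index (h _ (∈-lookup i))) (≡.trans (cong (lookup ys) e) (≡.sym (lookup-index (h _ (∈-lookup j)))))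
  where
  distinct : ∀ {X : Set} (xs : List X) → Unique xs → ∀ i j → i Fin.< j → lookup xs i ≢ lookup xs j
  distinct (x ∷ xs) (p ∷ ps) Fin.zero (Fin.suc j) _ = All.lookup p (∈-lookup j)
  distinct (x ∷ xs) (p ∷ ps) (Fin.suc i) (Fin.suc j) (s≤s lt) = distinct xs ps i j lt

module SemiringSum (S : CommutativeSemiring 0ℓ 0ℓ) where
  open CommutativeSemiring S
  open BigOp +-commutativeMonoid public renaming
    ( ⨁ to ∑; ⨁-cong to ∑-cong; ⨁-cong∈ to ∑-cong∈; ⨁-ε to ∑-0; ⨁-∙ to ∑-+; ⨁-swap to ∑-swap; ⨁-++ to ∑-++; ⨁-map to ∑-map
    ; ⨁-↭ to ∑-↭; ⨁-filter to ∑-filter; ⨁-pick to ∑-pick; ⨁-product to ∑-product; ⨁-bij to ∑-bij)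
  open BigOp *-commutativeMonoid public renaming
    ( ⨁ to ∏; ⨁-cong to ∏-cong; ⨁-cong∈ to ∏-cong∈; ⨁-ε to ∏-1; ⨁-∙ to ∏-*; ⨁-swap to ∏-swap; ⨁-++ to ∏-++; ⨁-map to ∏-map
    ; ⨁-↭ to ∏-↭; ⨁-filter to ∏-filter; ⨁-pick to ∏-pick; ⨁-product to ∏-product; ⨁-bij to ∏-bij)
  open import Algebra.Properties.Semiring.Mult semiring using () renaming (_×_ to _·_)

  [_]ᵢ : ∀ {P : Set} → Dec P → Carrier
  [ d ]ᵢ = if does d then 1# else 0#

  ind-yes : ∀ {P : Set} (d : Dec P) → P → [ d ]ᵢ ≈ 1#
  ind-yes (yes _) _ = refl
  ind-yes (no n) p = ⊥-elim (n p)

  ind-no : ∀ {P : Set} (d : Dec P) → ¬ P → [ d ]ᵢ ≈ 0#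
  ind-no (yes p) n = ⊥-elim (n p)
  ind-no (no _) _ = refl

  ind-⇔ : ∀ {P Q : Set} (d : Dec P) (e : Dec Q) → (P → Q) → (Q → P) → [ d ]ᵢ ≈ [ e ]ᵢ
  ind-⇔ (yes p) e f g = sym (ind-yes e (f p))
  ind-⇔ (no n) e f g = sym (ind-no e (λ q → n (g q)))

  ∑-*ˡ : ∀ {X : Set} (xs : List X) a f → ∑ xs (λ x → a * f x) ≈ a * ∑ xs f
  ∑-*ˡ [] a f = sym (zeroʳ a)
  ∑-*ˡ (x ∷ xs) a f = trans (+-congˡ (∑-*ˡ xs a f)) (sym (distribˡ a _ _))

  ∑-*ʳ : ∀ {X : Set} (xs : List X) a f → ∑ xs (λ x → f x * a) ≈ ∑ xs f * a
  ∑-*ʳ xs a f = trans (∑-cong xs (λ x → *-comm _ a)) (trans (∑-*ˡ xs a f) (*-comm a _))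

  ∑-zero : ∀ {X : Set} (xs : List X) {f} → (∀ x → x ∈ xs → f x ≈ 0#) → ∑ xs f ≈ 0#
  ∑-zero xs e = trans (∑-cong∈ xs e) (∑-0 xs)

  ∑-const : ∀ {X : Set} (xs : List X) a → ∑ xs (λ _ → a) ≈ length xs · a
  ∑-const [] a = refl
  ∑-const (x ∷ xs) a = +-congˡ (∑-const xs a)

  module Delta {X : Set} (_≟_ : (x y : X) → Dec (x ≡ y)) where

    δ : X → X → Carrier
    δ x y = [ x ≟ y ]ᵢ

    δ-refl : ∀ x → δ x x ≈ 1#
    δ-refl x = ind-yes (x ≟ x) ≡.refl

    δ-≢ : ∀ {x y} → x ≢ y → δ x y ≈ 0#
    δ-≢ {x} {y} = ind-no (x ≟ y)

    ∑-δ : ∀ xs x (f : X → Carrier) → Unique xs → x ∈ xs → ∑ xs (λ y → δ y x * f y) ≈ f x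
    ∑-δ xs x f u i = trans (∑-pick xs x _ u i (λ y _ ne → trans (*-congʳ (δ-≢ ne)) (zeroˡ _))) (trans (*-congʳ (δ-refl x)) (*-identityˡ _))

  

-- Arithmetic of a finite field

module FieldFacts {q : ℕ} (F : FiniteField q) where
  open FiniteField F using (elements; _≟_; 0≢1; inverse; enum) public
  open Inverse enum using (to; from; strictlyInverseʳ)

  Fr : CommutativeRing 0ℓ 0ℓ
  Fr = record { isCommutativeRing = FiniteField.isCommutativeRing F }

  open RingKit Fr public
  open import Relation.Binary.Reasoning.Setoid setoid
  module Pol = PolyFacts Fr
  open SemiringSum commutativeSemiring public
  open Delta _≟_ public
  module ℕSum = SemiringSum ℕP.+-*-commutativeSemiring

  elements-unique : Unique elements
  elements-unique = Uniq.map⁺ inj (Uniq.allFin⁺ q)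
    where
    inj : ∀ {i j} → from i ≡ from j → i ≡ j
    inj {i} {j} e = ≡.trans (≡.sym (Inverse.strictlyInverseˡ enum i)) (≡.trans (cong to e) (Inverse.strictlyInverseˡ enum j))

  ∈elements : ∀ x → x ∈ elements
  ∈elements x = subst (_∈ elements) (strictlyInverseʳ x) (∈-map⁺ from (∈-allFin (to x)))

  length-elements : length elements ≡ q
  length-elements = ≡.trans (ListP.length-map from (allFin q)) (ListP.length-tabulate (λ i → i))

  1≢0 : 1# ≢ 0#
  1≢0 e = 0≢1 (≡.sym e)

  domain : ∀ x y → x * y ≡ 0# → x ≡ 0# ⊎ y ≡ 0#
  domain x y e = go (x ≟ 0#)
    where
    go : Dec (x ≡ 0#) → x ≡ 0# ⊎ y ≡ 0#
    go (yes z) = inj₁ z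
    go (no x≢0) = let (x⁻¹ , i) = inverse x x≢0 in inj₂ (begin
      y              ≈⟨ sym (*-identityˡ y) ⟩
      1# * y         ≈⟨ *-congʳ (sym i) ⟩
      (x * x⁻¹) * y  ≈⟨ solve 3 (λ x i y → (x :* i) :* y := i :* (x :* y)) refl x x⁻¹ y ⟩
      x⁻¹ * (x * y)  ≈⟨ *-congˡ e ⟩
      x⁻¹ * 0#       ≈⟨ zeroʳ _ ⟩
      0# ∎)

  *-≢0 : ∀ {x y} → x ≢ 0# → y ≢ 0# → x * y ≢ 0#
  *-≢0 {x} {y} nx ny e = case domain x y e of λ { (inj₁ z) → nx z ; (inj₂ z) → ny z }

  ^-≢0 : ∀ {x} n → x ≢ 0# → x ^ n ≢ 0#
  ^-≢0 zero nx = 1≢0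
  ^-≢0 (suc n) nx = *-≢0 nx (^-≢0 n nx)

  ^≡0 : ∀ {x} n → x ^ n ≡ 0# → x ≡ 0#
  ^≡0 {x} n e = case x ≟ 0# of λ { (yes z) → z ; (no nx) → ⊥-elim (^-≢0 n nx e) }

  *-cancelˡ : ∀ a {x y} → a ≢ 0# → a * x ≡ a * y → x ≡ y
  *-cancelˡ a {x} {y} na e = case domain a (x - y) (trans (solve 3 (λ a x y → a :* (x :- y) := a :* x :- a :* y) refl a x y) (x≈y⇒x∙y⁻¹≈ε e)) of λ
    { (inj₁ z) → ⊥-elim (na z) ; (inj₂ z) → x∙y⁻¹≈ε⇒x≈y _ _ z }

  private
    inverseIf : ∀ x → Dec (x ≡ 0#) → Carrier
    inverseIf x (yes _) = 0#
    inverseIf x (no nx) = proj₁ (inverse x nx)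

  infix 9 _⁻¹
  _⁻¹ : Carrier → Carrier
  x ⁻¹ = inverseIf x (x ≟ 0#)

  *-inverseʳ : ∀ {x} → x ≢ 0# → x * x ⁻¹ ≡ 1#
  *-inverseʳ {x} nx = go (x ≟ 0#)
    where
    go : (d : Dec (x ≡ 0#)) → x * inverseIf x d ≡ 1#
    go (yes z) = ⊥-elim (nx z)
    go (no nx) = proj₂ (inverse x nx)

  *-inverseˡ : ∀ {x} → x ≢ 0# → x ⁻¹ * x ≡ 1#
  *-inverseˡ nx = trans (*-comm _ _) (*-inverseʳ nx)

  0⁻¹ : 0# ⁻¹ ≡ 0#
  0⁻¹ = go (0# ≟ 0#)
    where
    go : (d : Dec (0# ≡ 0#)) → inverseIf 0# d ≡ 0#
    go (yes z) = refl
    go (no n) = ⊥-elim (n refl)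

  ⁻¹-≢0 : ∀ {x} → x ≢ 0# → x ⁻¹ ≢ 0#
  ⁻¹-≢0 {x} nx e = 1≢0 (trans (sym (*-inverseʳ nx)) (trans (*-congˡ e) (zeroʳ x)))

  a[a⁻¹x] : ∀ {a} x → a ≢ 0# → a * (a ⁻¹ * x) ≡ x
  a[a⁻¹x] x na = trans (sym (*-assoc _ _ _)) (trans (*-congʳ (*-inverseʳ na)) (*-identityˡ x))

  a⁻¹[ax] : ∀ {a} x → a ≢ 0# → a ⁻¹ * (a * x) ≡ x
  a⁻¹[ax] x na = trans (sym (*-assoc _ _ _)) (trans (*-congʳ (*-inverseˡ na)) (*-identityˡ x))

  nonzeros : List Carrier
  nonzeros = filter (λ x → ¬? (x ≟ 0#)) elements

  nonzeros-unique : Unique nonzeros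
  nonzeros-unique = Uniq.filter⁺ _ elements-unique

  ∈nonzeros : ∀ {x} → x ≢ 0# → x ∈ nonzeros
  ∈nonzeros nx = ∈-filter⁺ _ (∈elements _) nx

  nonzeros≢0 : ∀ {x} → x ∈ nonzeros → x ≢ 0#
  nonzeros≢0 i = proj₂ (∈-filter⁻ _ {xs = elements} i)

  elements↭ : elements ↭ 0# ∷ nonzeros
  elements↭ = ∼bag⇒↭ (unique∧set⇒bag elements-unique (All.tabulate (λ i e → nonzeros≢0 i (≡.sym e)) ∷ nonzeros-unique)
    (λ {x} → mk⇔ (λ _ → case x ≟ 0# of λ { (yes z) → here z ; (no nx) → there (∈nonzeros nx) }) (λ _ → ∈elements _)))

  suc-length-nonzeros : suc (length nonzeros) ≡ q
  suc-length-nonzeros = ≡.trans (≡.sym (↭-length elements↭)) length-elements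

  ∏-≢0 : ∀ (xs : List Carrier) → All (_≢ 0#) xs → ∏ xs (λ x → x) ≢ 0#
  ∏-≢0 [] _ = 1≢0
  ∏-≢0 (x ∷ xs) (n ∷ ns) = *-≢0 n (∏-≢0 xs ns)

  ∏-const : ∀ {X : Set} (xs : List X) a → ∏ xs (λ _ → a) ≡ a ^ length xs
  ∏-const [] a = refl
  ∏-const (x ∷ xs) a = *-congˡ (∏-const xs a)

  -- Multiplication by `a` permutes the units; comparing the products of all units before and after
  -- gives the power of `a`.
  fermat-unit : ∀ {a} → a ≢ 0# → a ^ length nonzeros ≡ 1#
  fermat-unit {a} na = *-cancelˡ (∏ nonzeros (λ x → x)) (∏-≢0 nonzeros (All.tabulate nonzeros≢0)) (begin
    ∏ nonzeros (λ x → x) * a ^ length nonzeros             ≈⟨ *-comm _ _ ⟩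
    a ^ length nonzeros * ∏ nonzeros (λ x → x)             ≈⟨ *-congʳ (sym (∏-const nonzeros a)) ⟩
    ∏ nonzeros (λ _ → a) * ∏ nonzeros (λ x → x)            ≈⟨ sym (∏-* nonzeros _ _) ⟩
    ∏ nonzeros (λ x → a * x)                               ≈⟨ ∏-bij (a *_) (a ⁻¹ *_) (λ x → x) nonzeros-unique nonzeros-unique
                                                               (λ x i → ∈nonzeros (*-≢0 na (nonzeros≢0 i)) , a⁻¹[ax] x na)
                                                               (λ x i → ∈nonzeros (*-≢0 (⁻¹-≢0 na) (nonzeros≢0 i)) , a[a⁻¹x] x na) ⟩
    ∏ nonzeros (λ x → x)                                   ≈⟨ sym (*-identityʳ _) ⟩
    ∏ nonzeros (λ x → x) * 1# ∎)

  fermat : ∀ a → a ^ q ≡ a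
  fermat a = trans (reflexive (cong (a ^_) (≡.sym suc-length-nonzeros))) (case a ≟ 0# of λ
    { (yes z) → trans (^-congˡ (suc (length nonzeros)) z) (trans (0^ (length nonzeros)) (sym z))
    ; (no na) → trans (*-congˡ (fermat-unit na)) (*-identityʳ a) })

  fermat^ : ∀ j a → a ^ (q ℕ.^ j) ≡ a
  fermat^ zero a = ^-1 a
  fermat^ (suc j) a = trans (sym (^-assocʳ a q (q ℕ.^ j))) (trans (^-congˡ (q ℕ.^ j) (fermat a)) (fermat^ j a))

  ∑-shift : ∀ (c : Carrier) (f : Carrier → Carrier) → ∑ elements (λ x → f (x + c)) ≡ ∑ elements f
  ∑-shift c f = ∑-bij (_+ c) (_- c) f elements-unique elements-unique
    (λ x _ → ∈elements _ , solve 2 (λ x c → (x :+ c) :- c := x) refl x c)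
    (λ x _ → ∈elements _ , solve 2 (λ x c → (x :- c) :+ c := x) refl x c)

  -- The translation `x ↦ x + 1` permutes the field and adds `nat q` to the sum of all elements.
  nat-q : nat q ≡ 0#
  nat-q = +-cancelˡ (∑ elements (λ x → x)) _ _ (begin
    ∑ elements (λ x → x) + nat q                ≈⟨ +-congˡ (reflexive (cong nat (≡.sym length-elements))) ⟩
    ∑ elements (λ x → x) + nat (length elements) ≈⟨ +-congˡ (sym (∑-const elements 1#)) ⟩
    ∑ elements (λ x → x) + ∑ elements (λ _ → 1#) ≈⟨ sym (∑-+ elements _ _) ⟩
    ∑ elements (λ x → x + 1#)                   ≈⟨ ∑-shift 1# (λ x → x) ⟩
    ∑ elements (λ x → x)                        ≈⟨ sym (+-identityʳ _) ⟩
    ∑ elements (λ x → x) + 0# ∎)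

  -- A nonzero polynomial of degree < N has fewer than N roots.
  few-roots : ∀ {N} p → Pol.Bnd N p → ¬ (p Pol.P.≈ Pol.P.0#) → ∀ zs → Unique zs → All (λ z → Pol.eval z p ≡ 0#) zs → length zs < N
  few-roots {N} p b np zs u rs = ≰⇒> λ le → np (Pol.Domain.root-bound domain zs p u rs (Pol.bnd-mono le b))

  power-roots : ∀ N c zs → Unique zs → All (λ z → z ^ suc N ≡ c) zs → length zs ≤ suc N
  power-roots N c zs u rs = ≤-pred (few-roots p (M.bnd) (λ e → 1≢0 (trans (sym M.lead) (trans (Pol.‼-cong e _) (Pol.‼-0 _)))) zs u
    (All.map (λ {z} e → trans (Pol.EvalP.sub-homo z _ _) (trans (+-cong (trans (Pol.EvalP.^-homo z Pol.X (suc N)) (trans (^-congˡ (suc N) (Pol.eval-X z)) e))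
       (-‿cong (Pol.eval-C z c))) (-‿inverseʳ c))) rs))
    where
    p = Pol.X Pol.P.^ suc N Pol.P.- Pol.C c
    mX : Pol.Mon (suc N) (Pol.X Pol.P.^ suc N)
    mX = subst (λ n → Pol.Mon n (Pol.X Pol.P.^ suc N)) (ℕP.*-identityʳ (suc N)) (Pol.mon-^ (suc N) Pol.mon-X)
    module M where
      bnd : Pol.Bnd (suc (suc N)) p
      bnd = Pol.bnd-sub (Pol.bnd mX) (Pol.bnd-mono (s≤s z≤n) (Pol.bnd-C c))
      lead : p Pol.‼ suc N ≡ 1#
      lead = trans (Pol.‼-sub _ _ (suc N)) (trans (+-cong (Pol.lead mX) (trans (-‿cong (Pol.C‼suc c N)) -0#≈0#)) (+-identityʳ _))

-- Factorization of polynomials over a finite field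

module FieldPoly {q : ℕ} (F : FiniteField q) where
  open FieldFacts F public
  open Pol using (C; X; _‼_; Bnd; Mon; mon; bnd; lead; C-cong; C-0; C-1; C-*; ‼-cong; C*‼; module P) public

  zero? : ∀ p → Dec (p P.≈ P.0#)
  zero? p = case ℕP.allUpTo? (λ i → (p ‼ i) ≟ 0#) (Pol.bound p) of λ
    { (yes z) → yes (Pol.≈-intro λ i → trans (case i ℕP.<? Pol.bound p of λ { (yes lt) → z lt ; (no ge) → Pol.bnd-bound p i (≮⇒≥ ge) }) (sym (Pol.‼-0 i)))
    ; (no n) → no (λ e → n (λ {i} _ → trans (‼-cong e i) (Pol.‼-0 i))) }

  -- A list stands for the monic polynomial whose lower coefficients it records.
  ⟦_⟧ : List Carrier → P.Carrier
  ⟦ [] ⟧ = P.1#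
  ⟦ a ∷ l ⟧ = C a P.+ X P.* ⟦ l ⟧

  mon-⟦⟧ : ∀ l → Mon (length l) ⟦ l ⟧
  mon-⟦⟧ [] = Pol.mon-1
  mon-⟦⟧ (a ∷ l) = mon (Pol.bnd-step a (bnd (mon-⟦⟧ l))) (trans (Pol.step‼suc a ⟦ l ⟧ (length l)) (lead (mon-⟦⟧ l)))

  mon-degree : ∀ {M N p} → Mon M p → Mon N p → M ≡ N
  mon-degree {M} {N} (mon b l) (mon b′ l′) = ≤-antisym (le b′ l) (le b l′)
    where
    le : ∀ {M N p} → Bnd (suc N) p → p ‼ M ≡ 1# → M ≤ N
    le {M} {N} b l = ≮⇒≥ λ lt → 1≢0 (trans (sym l) (b M lt))

  toMonic : ∀ N p → Mon N p → Σ (List Carrier) λ l → length l ≡ N × p P.≈ ⟦ l ⟧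
  toMonic zero p m = [] , ≡.refl , Pol.mon0 m
  toMonic (suc N) p (mon b l) =
    let (t , e) = Pol.decompose p
        (l′ , len , e′) = toMonic N t (mon (Pol.bnd-tail e b) (trans (sym (Pol.step‼suc _ t N)) (trans (sym (‼-cong e (suc N))) l)))
    in p ‼ 0 ∷ l′ , cong suc len , P.trans e (P.+-congˡ (P.*-congˡ e′))

  ⟦⟧-injective : ∀ {l l′} → ⟦ l ⟧ P.≈ ⟦ l′ ⟧ → l ≡ l′
  ⟦⟧-injective {l} {l′} e = go l l′ (mon-degree (mon-⟦⟧ l) (Pol.mon-resp (P.sym e) (mon-⟦⟧ l′))) e
    where
    go : ∀ l l′ → length l ≡ length l′ → ⟦ l ⟧ P.≈ ⟦ l′ ⟧ → l ≡ l′
    go [] [] _ _ = ≡.refl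
    go (a ∷ l) (b ∷ l′) len e = cong₂ _∷_ (trans (sym (Pol.step‼0 a ⟦ l ⟧)) (trans (‼-cong e 0) (Pol.step‼0 b ⟦ l′ ⟧)))
      (go l l′ (ℕP.suc-injective len) (Pol.≈-intro λ i → trans (sym (Pol.step‼suc a _ i)) (trans (‼-cong e (suc i)) (Pol.step‼suc b _ i))))

  _⊛_ : List Carrier → List Carrier → List Carrier
  a ⊛ b = proj₁ (toMonic (length a ℕ.+ length b) (⟦ a ⟧ P.* ⟦ b ⟧) (Pol.mon-* (mon-⟦⟧ a) (mon-⟦⟧ b)))

  abstract
    ⟦⊛⟧ : ∀ a b → ⟦ a ⊛ b ⟧ P.≈ ⟦ a ⟧ P.* ⟦ b ⟧
    ⟦⊛⟧ a b = P.sym (proj₂ (proj₂ (toMonic (length a ℕ.+ length b) (⟦ a ⟧ P.* ⟦ b ⟧) (Pol.mon-* (mon-⟦⟧ a) (mon-⟦⟧ b)))))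

    length-⊛ : ∀ a b → length (a ⊛ b) ≡ length a ℕ.+ length b
    length-⊛ a b = proj₁ (proj₂ (toMonic (length a ℕ.+ length b) (⟦ a ⟧ P.* ⟦ b ⟧) (Pol.mon-* (mon-⟦⟧ a) (mon-⟦⟧ b))))

  -- A quotient of monic polynomials is monic: the bound on `w` is lowered to its true degree, where
  -- the leading coefficients can be compared.
  cofactor : ∀ a l → ⟦ a ⟧ P.∣ ⟦ l ⟧ → Σ (List Carrier) λ b → ⟦ l ⟧ P.≈ ⟦ a ⟧ P.* ⟦ b ⟧ × length l ≡ length a ℕ.+ length b
  cofactor a l (w P.by e) = go (Pol.bound w) (Pol.bnd-bound w)
    where
    go : ∀ N → Bnd N w → Σ (List Carrier) λ b → ⟦ l ⟧ P.≈ ⟦ a ⟧ P.* ⟦ b ⟧ × length l ≡ length a ℕ.+ length b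
    go zero b = ⊥-elim (1≢0 (trans (sym (lead (mon-⟦⟧ l))) (trans (‼-cong (P.trans e (P.trans (P.*-congˡ (Pol.bnd0 b)) (P.zeroʳ _))) _) (Pol.‼-0 _))))
    go (suc N) b = case (w ‼ N) ≟ 0# of λ
      { (yes z) → go N (λ i le → case m≤n⇒m<n∨m≡n le of λ { (inj₁ lt) → b i lt ; (inj₂ ≡.refl) → z })
      ; (no nz) →
        let (bd , top) = Pol.*-bnd-top (length a) N ⟦ a ⟧ w (bnd (mon-⟦⟧ a)) b
            top′ = trans top (trans (*-congʳ (lead (mon-⟦⟧ a))) (*-identityˡ _))
            deg : length l ≡ length a ℕ.+ N
            deg = ≤-antisym
              (≮⇒≥ λ lt → 1≢0 (trans (sym (lead (mon-⟦⟧ l))) (trans (‼-cong e _) (bd _ lt))))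
              (≮⇒≥ λ lt → nz (trans (sym top′) (trans (sym (‼-cong e _)) (bnd (mon-⟦⟧ l) _ lt))))
            (b′ , len , eb) = toMonic N w (mon b (trans (sym top′) (trans (sym (‼-cong e _)) (subst (λ z → ⟦ l ⟧ ‼ z ≡ 1#) deg (lead (mon-⟦⟧ l))))))
        in b′ , P.trans e (P.*-congˡ eb) , ≡.trans deg (cong (length a ℕ.+_) (≡.sym len)) }

  data NormalForm (p : P.Carrier) : Set where
    isZero : p P.≈ P.0# → NormalForm p
    scaled : ∀ c l → c ≢ 0# → p P.≈ C c P.* ⟦ l ⟧ → NormalForm p

  C-inverse : ∀ {c} p → c ≢ 0# → C (c ⁻¹) P.* (C c P.* p) P.≈ p
  C-inverse p nc = P.trans (P.sym (P.*-assoc _ _ _)) (P.trans (P.*-congʳ (P.trans (P.sym (C-* _ _)) (P.trans (C-cong (*-inverseˡ nc)) C-1))) (P.*-identityˡ p))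

  C-inverse′ : ∀ {c} p → c ≢ 0# → C c P.* (C (c ⁻¹) P.* p) P.≈ p
  C-inverse′ p nc = P.trans (P.sym (P.*-assoc _ _ _)) (P.trans (P.*-congʳ (P.trans (P.sym (C-* _ _)) (P.trans (C-cong (*-inverseʳ nc)) C-1))) (P.*-identityˡ p))

  abstract
    normalForm : ∀ p → NormalForm p
    normalForm p = go (Pol.bound p) (Pol.bnd-bound p)
      where
      go : ∀ N → Bnd N p → NormalForm p
      go zero b = isZero (Pol.bnd0 b)
      go (suc N) b = case (p ‼ N) ≟ 0# of λ
        { (yes z) → go N (λ i le → case m≤n⇒m<n∨m≡n le of λ { (inj₁ lt) → b i lt ; (inj₂ ≡.refl) → z })
        ; (no nz) →
          let c = p ‼ N
              (l , len , e) = toMonic N (C (c ⁻¹) P.* p) (mon (Pol.bnd-C* _ b) (trans (C*‼ _ p N) (*-inverseˡ nz)))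
          in scaled c l nz (P.trans (P.sym (C-inverse′ p nz)) (P.*-congˡ e)) }

  record Gcd (a b : P.Carrier) : Set where
    constructor gcd-by
    field
      g u v : P.Carrier
      combination : g P.≈ u P.* a P.+ v P.* b
      g∣a : g P.∣ a
      g∣b : g P.∣ b

  abstract
    -- Euclid's algorithm; `N` bounds the degree of the second argument and decreases at each step.
    gcd : ∀ N a b → Bnd N b → Gcd a b
    gcd N a b bb = go N (normalForm b) bb
      where
      trivial : ∀ {b} → b P.≈ P.0# → Gcd a b
      trivial {b} z = gcd-by a P.1# P.0# (P.solve 2 (λ a b → a P.:= P.con (+ 1) P.:* a P.:+ P.con (+ 0) P.:* b) P.refl a b) P.∣-refl (P.∣-resp (P.sym z) P.∣0)
      go : ∀ N → NormalForm b → Bnd N b → Gcd a b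
      go N (isZero z) _ = trivial z
      go zero _ bb = trivial (Pol.bnd0 bb)
      go (suc N) (scaled c l nc e) bb = step (Pol.divide (mon-⟦⟧ l) a)
        where
        ⟦l⟧≈ : ⟦ l ⟧ P.≈ C (c ⁻¹) P.* b
        ⟦l⟧≈ = P.trans (P.sym (C-inverse ⟦ l ⟧ nc)) (P.*-congˡ (P.sym e))
        l≤N : length l ≤ N
        l≤N = ≮⇒≥ λ lt → nc (trans (sym (*-identityʳ c)) (trans (*-congˡ (sym (lead (mon-⟦⟧ l)))) (trans (sym (C*‼ c ⟦ l ⟧ (length l))) (trans (‼-cong (P.sym e) _) (bb _ lt)))))
        step : Pol.Division (length l) ⟦ l ⟧ a → Gcd a b
        step (Pol.division w r eq br) =
          let (gcd-by g u v cmb g∣b g∣r) = gcd N b r (Pol.bnd-mono l≤N br)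
              r≈ = P.trans (P.sym (P.trans (P.+-congˡ (P.-‿cong (P.*-congʳ (P.sym ⟦l⟧≈)))) (P.trans (P.+-congʳ eq)
                     (P.solve 3 (λ m w r → (m P.:* w P.:+ r) P.:- m P.:* w P.:= r) P.refl ⟦ l ⟧ w r)))) P.refl
          in gcd-by g v (u P.- v P.* C (c ⁻¹) P.* w)
               (P.trans cmb (P.trans (P.+-congˡ (P.*-congˡ r≈))
                 (P.solve 6 (λ u b v a c w → u P.:* b P.:+ v P.:* (a P.:- (c P.:* b) P.:* w) P.:= v P.:* a P.:+ (u P.:- v P.:* c P.:* w) P.:* b) P.refl u b v a (C (c ⁻¹)) w)))
               (P.∣-resp (P.sym eq) (P.∣-+ (P.∣-* w (P.∣-resp (P.sym ⟦l⟧≈) (P.∣-*ˡ _ g∣b))) g∣r)) g∣b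

    divides? : ∀ l p → Dec (⟦ l ⟧ P.∣ p)
    divides? l p = go (Pol.divide (mon-⟦⟧ l) p)
      where
      go : Pol.Division (length l) ⟦ l ⟧ p → Dec (⟦ l ⟧ P.∣ p)
      go (Pol.division w r eq br) = case zero? r of λ
        { (yes z) → yes (w P.by P.trans eq (P.trans (P.+-congˡ z) (P.+-identityʳ _)))
        ; (no nz) → no (λ d → nz (Pol.monic∣⇒≈0 (mon-⟦⟧ l) br
            (P.∣-resp (P.trans (P.+-congʳ eq) (P.solve 2 (λ m r → (m P.:+ r) P.:- m P.:= r) P.refl (⟦ l ⟧ P.* w) r)) (P.∣-sub d (w P.by P.refl))))) }

  record Irr (l : List Carrier) : Set where
    constructor irr
    field
      positive : 1 ≤ length l
      only : ∀ a b → ⟦ l ⟧ P.≈ ⟦ a ⟧ P.* ⟦ b ⟧ → a ≡ [] ⊎ b ≡ []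
  open Irr public

  length≡0 : ∀ {X : Set} {l : List X} → length l ≡ 0 → l ≡ []
  length≡0 {l = []} _ = ≡.refl

  data Split (l : List Carrier) : Set where
    trivial : l ≡ [] → Split l
    prime : Irr l → Split l
    split : ∀ a b → 1 ≤ length a → 1 ≤ length b → ⟦ l ⟧ P.≈ ⟦ a ⟧ P.* ⟦ b ⟧ → length l ≡ length a ℕ.+ length b → Split l

  private
    -- Over a finite field the monic polynomials of smaller degree form a finite list, so a proper
    -- divisor can be searched for.
    findSplit : ∀ l → Split l
    findSplit [] = trivial ≡.refl
    findSplit l@(_ ∷ _) = go (All.all? ok? candidates)
      where
      candidates : List (List Carrier)
      candidates = concatMap (seqs elements) (upTo (length l))
      OK : List Carrier → Set
      OK a = ¬ (1 ≤ length a × ⟦ a ⟧ P.∣ ⟦ l ⟧)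
      proper? : ∀ a → Dec (1 ≤ length a × ⟦ a ⟧ P.∣ ⟦ l ⟧)
      proper? a = (1 ℕP.≤? length a) ×-dec divides? a ⟦ l ⟧
      ok? : ∀ a → Dec (OK a)
      ok? a = ¬? (proper? a)
      smaller : ∀ {a} → a ∈ candidates → length a < length l
      smaller i = let (m , j , k) = find (∈-concatMap⁻ (seqs elements) {xs = upTo (length l)} i) in
        subst (_< length l) (≡.sym (seqs-length m k)) (∈-upTo⁻ j)
      candidate : ∀ {a} → length a < length l → a ∈ candidates
      candidate {a} lt = ∈-concatMap⁺ (seqs elements) (lose (∈-upTo⁺ lt) (seqs-∈ (All.tabulate (λ _ → ∈elements _))))
      go : Dec (All OK candidates) → Split l
      go (yes ok) = prime (irr (s≤s z≤n) only′)
        where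
        only′ : ∀ a b → ⟦ l ⟧ P.≈ ⟦ a ⟧ P.* ⟦ b ⟧ → a ≡ [] ⊎ b ≡ []
        only′ [] b e = inj₁ ≡.refl
        only′ a@(_ ∷ _) [] e = inj₂ ≡.refl
        only′ a@(_ ∷ _) b@(_ ∷ b′) e = ⊥-elim (All.lookup ok (candidate {a} lt) (s≤s z≤n , (⟦ b ⟧ P.by e)))
          where
          deg : length l ≡ length a ℕ.+ length b
          deg = mon-degree (mon-⟦⟧ l) (Pol.mon-resp (P.sym e) (Pol.mon-* (mon-⟦⟧ a) (mon-⟦⟧ b)))
          lt : length a < length l
          lt = subst (length a <_) (≡.sym deg) (m<m+n (length a) (s≤s z≤n))
      go (no ¬ok) =
        let (a , i , na) = find (AllP.¬All⇒Any¬ ok? candidates ¬ok)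
            (le , d) = decidable-stable (proper? a) na
            (b , e , len) = cofactor a l d
        in split a b le (≮⇒≥ λ lt → <-irrefl (≡.sym (≡.trans len (≡.trans (cong (length a ℕ.+_) (n<1⇒n≡0 lt)) (ℕP.+-identityʳ _)))) (smaller i)) e len

  abstract
    splits : ∀ l → Split l
    splits = findSplit

    irr? : ∀ l → Dec (Irr l)
    irr? l = case splits l of λ
      { (trivial ≡.refl) → no (λ { (irr () _) })
      ; (prime i) → yes i
      ; (split a b la lb e _) → no (λ i → case only i a b e of λ
          { (inj₁ ≡.refl) → case la of λ () ; (inj₂ ≡.refl) → case lb of λ () }) }

    irreducible-factor : ∀ N l → length l ≤ N → 1 ≤ length l → Σ (List Carrier) λ a → Irr a × ⟦ a ⟧ P.∣ ⟦ l ⟧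
    irreducible-factor zero l le le′ = ⊥-elim (<⇒≱ le′ le)
    irreducible-factor (suc N) l le le′ = case splits l of λ
      { (trivial ≡.refl) → case le′ of λ ()
      ; (prime i) → l , i , P.∣-refl
      ; (split a b la lb e len) →
          let (c , i , d) = irreducible-factor N a (≤-pred (≤-trans (subst (length a <_) (≡.sym len) (m<m+n (length a) lb)) le)) la
          in c , i , P.∣-trans d (⟦ b ⟧ P.by e) }

  module _ {l : List Carrier} (il : Irr l) where

    abstract
      irr-bezout : ∀ a → ¬ (⟦ l ⟧ P.∣ a) → Σ P.Carrier λ u → ⟦ l ⟧ P.∣ (u P.* a P.- P.1#)
      irr-bezout a nd = go (gcd (Pol.bound a) ⟦ l ⟧ a (Pol.bnd-bound a))
        where
        go : Gcd ⟦ l ⟧ a → Σ P.Carrier λ u → ⟦ l ⟧ P.∣ (u P.* a P.- P.1#)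
        go (gcd-by g u v cmb g∣l g∣a) = case normalForm g of λ
          { (isZero z) → ⊥-elim (1≢0 (trans (sym (lead (mon-⟦⟧ l))) (trans (‼-cong (P.trans (P._∣_.equation g∣l) (P.trans (P.*-congʳ z) (P.zeroˡ _))) _) (Pol.‼-0 _))))
          ; (scaled c m nc e) →
            let m∣g : ⟦ m ⟧ P.∣ g
                m∣g = C c P.by P.trans e (P.*-comm _ _)
            in unit g u v cmb g∣a c m nc e m∣g (cofactor m l (P.∣-trans m∣g g∣l)) }
          where
          unit : ∀ g u v → g P.≈ u P.* ⟦ l ⟧ P.+ v P.* a → g P.∣ a → ∀ c m → c ≢ 0# → g P.≈ C c P.* ⟦ m ⟧ → ⟦ m ⟧ P.∣ g →
                 (Σ (List Carrier) λ b → ⟦ l ⟧ P.≈ ⟦ m ⟧ P.* ⟦ b ⟧ × length l ≡ length m ℕ.+ length b) → Σ P.Carrier λ u → ⟦ l ⟧ P.∣ (u P.* a P.- P.1#)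
          unit g u v cmb g∣a c m nc e m∣g (m′ , em , _) = case only il m m′ em of λ
            { (inj₁ ≡.refl) → C (c ⁻¹) P.* v , (P.- (C (c ⁻¹) P.* u) P.by
                 P.trans (P.+-congˡ (P.-‿cong (P.sym (P.trans (P.*-congˡ (P.trans (P.sym cmb) e)) (C-inverse P.1# nc)))))
                   (P.solve 5 (λ c v a u l → (c P.:* v) P.:* a P.:- c P.:* (u P.:* l P.:+ v P.:* a) P.:= l P.:* (P.:- (c P.:* u))) P.refl (C (c ⁻¹)) v a u ⟦ l ⟧))
            ; (inj₂ ≡.refl) → ⊥-elim (nd (P.∣-trans (P.∣-respˡ (P.sym (P.trans em (P.*-identityʳ _))) P.∣-refl) (P.∣-trans m∣g g∣a))) }

      irr-prime : ∀ a b → ⟦ l ⟧ P.∣ a P.* b → ⟦ l ⟧ P.∣ a ⊎ ⟦ l ⟧ P.∣ b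
      irr-prime a b d = case divides? l a of λ
        { (yes y) → inj₁ y
        ; (no n) → inj₂ (let (u , e) = irr-bezout a n in
            P.∣-resp (P.solve 3 (λ u a b → u P.:* (a P.:* b) P.:- (u P.:* a P.:- P.con (+ 1)) P.:* b P.:= b) P.refl u a b)
              (P.∣-sub (P.∣-*ˡ u d) (P.∣-* b e))) }

      irr∤1 : ¬ (⟦ l ⟧ P.∣ P.1#)
      irr∤1 d = let (b , _ , len) = cofactor l [] d in <⇒≱ (positive il) (subst (length l ≤_) (≡.sym len) (m≤m+n (length l) (length b)))

      irr-^ : ∀ a n → ⟦ l ⟧ P.∣ a P.^ n → ⟦ l ⟧ P.∣ a
      irr-^ a zero d = ⊥-elim (irr∤1 d)
      irr-^ a (suc n) d = case irr-prime a (a P.^ n) d of λ { (inj₁ y) → y ; (inj₂ y) → irr-^ a n y }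

      irr-^-∤ : ∀ {a} n → ¬ (⟦ l ⟧ P.∣ a) → ¬ (⟦ l ⟧ P.∣ a P.^ n)
      irr-^-∤ {a} n na d = na (irr-^ a n d)

      -- One factor `l` at a time is moved out of `w`, using primality of `l` and cancellation of a
      -- monic factor.
      irr-^-coprime : ∀ {u} N w → ¬ (⟦ l ⟧ P.∣ u) → ⟦ l ⟧ P.^ N P.∣ u P.* w → ⟦ l ⟧ P.^ N P.∣ w
      irr-^-coprime zero w nu d = P.1∣
      irr-^-coprime {u} (suc N) w nu d = case irr-prime u w (P.∣-trans (P.∣-* _ P.∣-refl) d) of λ
        { (inj₁ y) → ⊥-elim (nu y)
        ; (inj₂ (w′ P.by e)) → P.∣-resp (P.sym e) (P.*-mono-∣ P.∣-refl (irr-^-coprime N w′ nu (reduce d e))) }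
        where
        reduce : ∀ {w w′} → ⟦ l ⟧ P.* ⟦ l ⟧ P.^ N P.∣ u P.* w → w P.≈ ⟦ l ⟧ P.* w′ → ⟦ l ⟧ P.^ N P.∣ u P.* w′
        reduce {w} {w′} (v P.by ev) e = v P.by Pol.monic-cancelˡ (mon-⟦⟧ l)
          (P.trans (P.solve 3 (λ l u w → l P.:* (u P.:* w) P.:= u P.:* (l P.:* w)) P.refl ⟦ l ⟧ u w′)
            (P.trans (P.*-congˡ (P.sym e)) (P.trans ev (P.*-assoc _ _ _))))

  irr-∣-irr : ∀ {a b} → Irr a → Irr b → ⟦ a ⟧ P.∣ ⟦ b ⟧ → a ≡ b
  irr-∣-irr {a} {b} ia ib d = go (cofactor a b d)
    where
    go : (Σ (List Carrier) λ c → ⟦ b ⟧ P.≈ ⟦ a ⟧ P.* ⟦ c ⟧ × length b ≡ length a ℕ.+ length c) → a ≡ b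
    go (c , e , _) = case only ib a c e of λ
      { (inj₁ ≡.refl) → case positive ia of λ ()
      ; (inj₂ ≡.refl) → ⟦⟧-injective (P.sym (P.trans e (P.*-identityʳ _))) }

-- Residue fields of irreducible polynomials and Frobenius conjugates

record PrimePowerField : Set₁ where
  field
    {p k} : ℕ
    pr : Prime p
    F : FiniteField (p ℕ.^ k)

module PrimePower (base : PrimePowerField) where
  open PrimePowerField base
  open FieldPoly F public

  -- `nat q` is the `k`-th power of `nat p`, and a field has no nilpotent elements.
  charp : nat p ≡ 0#
  charp = ^≡0 k (trans (sym (nat-^ k)) nat-q)
    where
    nat-^ : ∀ k → nat (p ℕ.^ k) ≡ nat p ^ k
    nat-^ zero = +-identityʳ 1#
    nat-^ (suc k) = trans (nat-* p (p ℕ.^ k)) (*-congˡ (nat-^ k))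

  -- Otherwise `p` and `n` are coprime, and a Bézout relation maps to `1 = 0`.
  nat≡0⇒∣ : ∀ n → nat n ≡ 0# → p ℕD.∣ n
  nat≡0⇒∣ n e = case p ℕD.∣? n of λ { (yes d) → d ; (no nd) → ⊥-elim (1≢0 (bezout (Coprime.coprime-Bézout (coprime nd)))) }
    where
    coprime : ¬ (p ℕD.∣ n) → Coprime.Coprime p n
    coprime nd (d∣p , d∣n) = case Primality.prime⇒irreducible pr d∣p of λ
      { (inj₁ d≡1) → d≡1 ; (inj₂ ≡.refl) → ⊥-elim (nd d∣n) }
    kill : ∀ x {m} → nat m ≡ 0# → nat (x ℕ.* m) ≡ 0#
    kill x z = trans (nat-* x _) (trans (*-congˡ z) (zeroʳ _))
    finish : ∀ u v → nat u ≡ 0# → nat v ≡ 0# → 1 ℕ.+ v ≡ u → 1# ≡ 0#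
    finish u v eu ev eq = trans (sym (+-identityʳ 1#)) (trans (+-congˡ (sym ev)) (trans (reflexive (cong nat eq)) eu))
    bezout : GCD.Bézout.Identity 1 p n → 1# ≡ 0#
    bezout (GCD.Bézout.+- x y eq) = finish _ _ (kill x charp) (kill y e) eq
    bezout (GCD.Bézout.-+ x y eq) = finish _ _ (kill y e) (kill x charp) eq

  ∣⇒nat≡0 : ∀ {n} → p ℕD.∣ n → nat n ≡ 0#
  ∣⇒nat≡0 (ℕD.divides m ≡.refl) = trans (nat-* m p) (trans (*-congˡ charp) (zeroʳ _))

  q : ℕ
  q = p ℕ.^ k

  1<q : 1 < q
  1<q = subst (1 <_) suc-length-nonzeros (s≤s (nonempty (∈nonzeros 1≢0)))
    where
    nonempty : ∀ {X : Set} {x : X} {xs} → x ∈ xs → 1 ≤ length xs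
    nonempty {xs = _ ∷ _} _ = s≤s z≤n

  module FrobeniusQ (R : CommutativeRing 0ℓ 0ℓ) (φ : Hom Fr R) where
    private
      module R = RingKit R
      module φ = HomP φ

    charp′ : R.nat p R.≈ R.0#
    charp′ = R.trans (R.sym (φ.nat-homo p)) (R.trans (φ.resp charp) φ.0-homo)

    private module Fb = Frobenius R p pr charp′

    q^ : ∀ j → q ℕ.^ j ≡ p ℕ.^ (k ℕ.* j)
    q^ j = ℕP.^-*-assoc p k j

    ^q-+ : ∀ j x y → (x R.+ y) R.^ (q ℕ.^ j) R.≈ x R.^ (q ℕ.^ j) R.+ y R.^ (q ℕ.^ j)
    ^q-+ j x y rewrite q^ j = Fb.frob-+^ (k ℕ.* j) x y

    ^q-sub : ∀ j x y → (x R.- y) R.^ (q ℕ.^ j) R.≈ x R.^ (q ℕ.^ j) R.- y R.^ (q ℕ.^ j)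
    ^q-sub j x y rewrite q^ j = Fb.frob-sub (k ℕ.* j) x y

    ^q-0 : ∀ j → R.0# R.^ (q ℕ.^ j) R.≈ R.0#
    ^q-0 j rewrite q^ j = Fb.0^p^ (k ℕ.* j)

    frobHom : ℕ → Hom R R
    frobHom j = record
      { fn = R._^ (q ℕ.^ j) ; resp = R.^-congˡ (q ℕ.^ j) ; +-homo = ^q-+ j
      ; *-homo = λ x y → R.^-distrib-* x y (q ℕ.^ j) ; 0-homo = ^q-0 j ; 1-homo = R.1^ (q ℕ.^ j) }

    fixes-scalars : ∀ j a → φ.fn a R.^ (q ℕ.^ j) R.≈ φ.fn a
    fixes-scalars j a = R.trans (R.sym (φ.^-homo a (q ℕ.^ j))) (φ.resp (fermat^ j a))

    -- Raising to the power q^j commutes with evaluating polynomials over F.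
    eval-^q : ∀ j z a → Hom.fn (Pol.Eval.evalHom φ z) a R.^ (q ℕ.^ j) R.≈ Hom.fn (Pol.Eval.evalHom φ (z R.^ (q ℕ.^ j))) a
    eval-^q j z = Pol.hom-ext (frobHom j ∘ₕ Pol.Eval.evalHom φ z) (Pol.Eval.evalHom φ (z R.^ (q ℕ.^ j)))
      (λ a → R.trans (R.^-congˡ (q ℕ.^ j) (Pol.Eval.eval-C φ z a)) (R.trans (fixes-scalars j a) (R.sym (Pol.Eval.eval-C φ _ a))))
      (R.trans (R.^-congˡ (q ℕ.^ j) (Pol.Eval.eval-X φ z)) (R.sym (Pol.Eval.eval-X φ _)))

    ^q^-+ : ∀ z i j → (z R.^ (q ℕ.^ i)) R.^ (q ℕ.^ j) R.≈ z R.^ (q ℕ.^ (i ℕ.+ j))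
    ^q^-+ z i j = R.trans (R.^-assocʳ z (q ℕ.^ i) (q ℕ.^ j)) (R.reflexive (cong (z R.^_) (≡.sym (ℕP.^-distribˡ-+-* q i j))))

  fromList-injective : ∀ {a b : List Carrier} → length a ≡ length b → (∀ i → Pol.fromList a ‼ i ≡ Pol.fromList b ‼ i) → a ≡ b
  fromList-injective {[]} {[]} _ _ = ≡.refl
  fromList-injective {x ∷ a} {y ∷ b} len h = cong₂ _∷_ (trans (sym (Pol.fromList-‼0 x a)) (trans (h 0) (Pol.fromList-‼0 y b)))
    (fromList-injective (ℕP.suc-injective len) λ i → trans (sym (Pol.fromList-‼suc x a i)) (trans (h (suc i)) (Pol.fromList-‼suc y b i)))

  -- The field F[x]/(P) for an irreducible P.
  module Residue {l : List Carrier} (il : Irr l) where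
    open Quotient Pol.poly ⟦ l ⟧ public using (_~_; ~by; divides; ≈⇒~; ∣⇒~0; ~0⇒∣; proj; lift) renaming (/ring to κ)
    module κ = RingKit κ
    module κT = PolyFacts κ

    emb : Hom Fr κ
    emb = proj ∘ₕ Pol.constHom
    module emb = HomP emb

    open FrobeniusQ κ emb public

    e : ℕ
    e = length l

    κ-domain : ∀ a b → a κ.* b κ.≈ κ.0# → a κ.≈ κ.0# ⊎ b κ.≈ κ.0#
    κ-domain a b z = case irr-prime il a b (~0⇒∣ z) of λ { (inj₁ d) → inj₁ (∣⇒~0 d) ; (inj₂ d) → inj₂ (∣⇒~0 d) }

    κ-1≉0 : ¬ (κ.1# κ.≈ κ.0#)
    κ-1≉0 z = irr∤1 il (~0⇒∣ z)

    κ-^≈0 : ∀ {a} n → a κ.^ n κ.≈ κ.0# → a κ.≈ κ.0#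
    κ-^≈0 zero z = ⊥-elim (κ-1≉0 z)
    κ-^≈0 {a} (suc n) z = case κ-domain a (a κ.^ n) z of λ { (inj₁ y) → y ; (inj₂ y) → κ-^≈0 n y }

    ^q-injective : ∀ j {a b} → a κ.^ (q ℕ.^ j) κ.≈ b κ.^ (q ℕ.^ j) → a κ.≈ b
    ^q-injective j {a} {b} z = κ.x∙y⁻¹≈ε⇒x≈y _ _ (κ-^≈0 (q ℕ.^ j) (κ.trans (^q-sub j a b) (κ.x≈y⇒x∙y⁻¹≈ε z)))

    y : κ.Carrier
    y = X

    evalκ : κ.Carrier → Hom Pol.poly κ
    evalκ z = Pol.Eval.evalHom emb z

    evalκ-y : ∀ a → Hom.fn (evalκ y) a κ.≈ a
    evalκ-y = Pol.hom-ext (evalκ y) proj (Pol.Eval.eval-C emb y) (Pol.Eval.eval-X emb y)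

    a^q^≈ : ∀ j (a : κ.Carrier) → a κ.^ (q ℕ.^ j) κ.≈ Hom.fn (evalκ (y κ.^ (q ℕ.^ j))) a
    a^q^≈ j a = κ.trans (κ.^-congˡ (q ℕ.^ j) (κ.sym (evalκ-y a))) (eval-^q j y a)

    evalκ-cong : ∀ {z z′} → z κ.≈ z′ → ∀ a → Hom.fn (evalκ z) a κ.≈ Hom.fn (evalκ z′) a
    evalκ-cong {z} {z′} e = Pol.hom-ext (evalκ z) (evalκ z′)
      (λ a → κ.trans (Pol.Eval.eval-C emb z a) (κ.sym (Pol.Eval.eval-C emb z′ a)))
      (κ.trans (Pol.Eval.eval-X emb z) (κ.trans e (κ.sym (Pol.Eval.eval-X emb z′))))

    fixed-by : ∀ j → y κ.^ (q ℕ.^ j) κ.≈ y → ∀ a → a κ.^ (q ℕ.^ j) κ.≈ a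
    fixed-by j h a = κ.trans (a^q^≈ j a) (κ.trans (evalκ-cong h a) (evalκ-y a))

    residues : List κ.Carrier
    residues = map Pol.fromList (seqs elements e)

    length-residues : length residues ≡ q ℕ.^ e
    length-residues = ≡.trans (ListP.length-map Pol.fromList (seqs elements e)) (≡.trans (length-seqs e) (cong (ℕ._^ e) length-elements))

    residue-injective : ∀ a b → length a ≡ e → length b ≡ e → Pol.fromList a κ.≈ Pol.fromList b → a ≡ b
    residue-injective a b la lb (~by d) = fromList-injective (≡.trans la (≡.sym lb)) (‼-cong (P.x∙y⁻¹≈ε⇒x≈y _ _ (Pol.monic∣⇒≈0 (mon-⟦⟧ l)
      (Pol.bnd-sub (subst (λ n → Bnd n (Pol.fromList a)) la (Pol.bnd-fromList a)) (subst (λ n → Bnd n (Pol.fromList b)) lb (Pol.bnd-fromList b))) d)))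

    residues-distinct : AllPairs (λ a b → ¬ (a κ.≈ b)) residues
    residues-distinct = go (seqs elements e) (λ i → seqs-length e i) (seqs-unique elements-unique e)
      where
      go : ∀ ls → (∀ {a} → a ∈ ls → length a ≡ e) → Unique ls → AllPairs (λ a b → ¬ (a κ.≈ b)) (map Pol.fromList ls)
      go [] _ _ = []
      go (a ∷ ls) len (u ∷ us) = AllP.map⁺ (All.tabulate λ {b} i z → All.lookup u i (residue-injective a b (len (here ≡.refl)) (len (there i)) z)) ∷ go ls (λ i → len (there i)) us

    q^-mono : ∀ {i j} → i < j → q ℕ.^ i < q ℕ.^ j
    q^-mono = ^-monoʳ-< q 1<q

    -- If `q^j`-th powering fixes the class of `X`, it fixes all `q^e` residues, too many roots for
    -- `T^(q^j) - T`.
    no-short-orbit : ∀ j → 0 < j → j < e → ¬ (y κ.^ (q ℕ.^ j) κ.≈ y)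
    no-short-orbit j 0<j j<e h = κ-1≉0 (κ.trans (κ.sym lead1) (κ.trans (κT.‼-cong p≈0 (q ℕ.^ j)) (κT.‼-0 _)))
      where
      N = q ℕ.^ j
      1<N : 1 < N
      1<N = q^-mono {0} 0<j
      poly : κT.P.Carrier
      poly = κT.X κT.P.^ N κT.P.- κT.X
      mX : κT.Mon N (κT.X κT.P.^ N)
      mX = subst (λ n → κT.Mon n (κT.X κT.P.^ N)) (ℕP.*-identityʳ N) (κT.mon-^ N κT.mon-X)
      lead1 : poly κT.‼ N κ.≈ κ.1#
      lead1 = κ.trans (κT.‼-sub _ _ N) (κ.trans (κ.+-cong (κT.lead mX) (κ.trans (κ.-‿cong (κT.bnd κT.mon-X N 1<N)) κ.-0#≈0#)) (κ.+-identityʳ _))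
      bd : κT.Bnd (suc N) poly
      bd = κT.bnd-sub (κT.bnd mX) (κT.bnd-mono (s≤s (<⇒≤ 1<N)) (κT.bnd κT.mon-X))
      p≈0 : poly κT.P.≈ κT.P.0#
      p≈0 = κT.Domain.root-bound κ-domain residues poly residues-distinct
        (All.tabulate λ {z} _ → κ.trans (κT.EvalP.sub-homo z _ _) (κ.x≈y⇒x∙y⁻¹≈ε (κ.trans (κT.EvalP.^-homo z κT.X N)
           (κ.trans (κ.^-congˡ N (κT.eval-X z)) (κ.trans (fixed-by j h z) (κ.sym (κT.eval-X z)))))))
        (κT.bnd-mono (subst (suc N ≤_) (≡.sym length-residues) (q^-mono j<e)) bd)

    conj : ℕ → κ.Carrier
    conj j = y κ.^ (q ℕ.^ j)

    conj-distinct : ∀ {i j} → i < j → j < e → ¬ (conj i κ.≈ conj j)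
    conj-distinct {i} {j} i<j j<e h = no-short-orbit (j ∸ i) (m<n⇒0<n∸m i<j) (≤-<-trans (m∸n≤m j i) j<e)
      (^q-injective i (κ.trans (^q^-+ y (j ∸ i) i) (κ.trans (κ.reflexive (cong conj (m∸n+n≡m (<⇒≤ i<j)))) (κ.sym h))))

    module mapκ = PolyMap emb
    open mapκ using (mapHom) public

    eval-mapκ : ∀ z a → κT.eval z (Hom.fn mapHom a) κ.≈ Hom.fn (evalκ z) a
    eval-mapκ z a = κ.trans (mapκ.eval-map idHom z a) (Pol.hom-ext (Pol.Eval.evalHom (idHom ∘ₕ emb) z) (evalκ z)
      (λ a → κ.trans (Pol.Eval.eval-C (idHom ∘ₕ emb) z a) (κ.sym (Pol.Eval.eval-C emb z a)))
      (κ.trans (Pol.Eval.eval-X (idHom ∘ₕ emb) z) (κ.sym (Pol.Eval.eval-X emb z))) a)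

    conj-root : ∀ j → κT.eval (conj j) (Hom.fn mapHom ⟦ l ⟧) κ.≈ κ.0#
    conj-root j = κ.trans (eval-mapκ (conj j) ⟦ l ⟧) (κ.trans (κ.sym (a^q^≈ j ⟦ l ⟧)) (κ.trans (κ.^-congˡ (q ℕ.^ j) (∣⇒~0 P.∣-refl)) (^q-0 j)))

    conjs : List κ.Carrier
    conjs = map conj (upTo e)

    private
      upTo-pairs : AllPairs _<_ (upTo e)
      upTo-pairs = AllPairsP.applyUpTo⁺₁ (λ i → i) e (λ i<j _ → i<j)

      conjs-distinct : AllPairs (λ a b → ¬ (a κ.≈ b)) conjs
      conjs-distinct = go (upTo e) (All.tabulate ∈-upTo⁻) upTo-pairs
        where
        go : ∀ ns → All (_< e) ns → AllPairs _<_ ns → AllPairs (λ a b → ¬ (a κ.≈ b)) (map conj ns)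
        go [] _ _ = []
        go (i ∷ ns) (_ ∷ bs) (lts ∷ ps) = AllP.map⁺ (All.zipWith (λ (lt , b) → conj-distinct lt b) (lts , bs)) ∷ go ns bs ps

      length-conjs : length conjs ≡ e
      length-conjs = ≡.trans (ListP.length-map conj (upTo e)) (ListP.length-upTo e)

    abstract
      -- The conjugates are roots because powering by `q^j` commutes with evaluation; they are
      -- distinct, and there are as many as the degree.
      factorization : Hom.fn mapHom ⟦ l ⟧ κT.P.≈ κT.linears conjs
      factorization = κT.Domain.linears-unique κ-domain conjs _ conjs-distinct
        (AllP.map⁺ (All.tabulate (λ {j} _ → conj-root j))) (subst (λ n → κT.Mon n (Hom.fn mapHom ⟦ l ⟧)) (≡.sym length-conjs) (mapκ.map-mon (mon-⟦⟧ l)))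

      -- The `e`-th conjugate is a root of `l`, hence one of the first `e` conjugates. Equality with
      -- the `j`-th one for `j > 0` would give, by injectivity of Frobenius, an orbit of length
      -- `e - j`.
      orbit : y κ.^ (q ℕ.^ e) κ.≈ y
      orbit = go (upTo e) (All.tabulate ∈-upTo⁻) (κ.trans (κ.sym (κT.EvalP.resp (conj e) factorization)) (conj-root e))
        where
        go : ∀ ns → All (_< e) ns → κT.eval (conj e) (κT.linears (map conj ns)) κ.≈ κ.0# → conj e κ.≈ y
        go [] _ z = ⊥-elim (κ-1≉0 (κ.trans (κ.sym (κT.EvalP.1-homo (conj e))) z))
        go (j ∷ ns) (j<e ∷ bs) z = case κ-domain (conj e κ.- conj j) (κT.eval (conj e) (κT.linears (map conj ns)))
            (κ.trans (κ.*-congʳ (κ.sym (κT.eval-X-C _ _))) (κ.trans (κ.sym (κT.EvalP.*-homo _ _ _)) z)) of λ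
          { (inj₂ z′) → go ns bs z′
          ; (inj₁ z′) → short j j<e (κ.x∙y⁻¹≈ε⇒x≈y _ _ z′) }
          where
          short : ∀ j → j < e → conj e κ.≈ conj j → conj e κ.≈ y
          short zero _ h = κ.trans h (κ.^-1 y)
          short (suc i) lt h = ⊥-elim (no-short-orbit (e ∸ suc i) (m<n⇒0<n∸m lt) (∸-monoʳ-< (s≤s z≤n) (<⇒≤ lt))
            (^q-injective (suc i) (κ.trans (^q^-+ y (e ∸ suc i) (suc i)) (κ.trans (κ.reflexive (cong conj (m∸n+n≡m (<⇒≤ lt)))) h))))

    fermatκ : ∀ (a : κ.Carrier) → a κ.^ (q ℕ.^ e) κ.≈ a
    fermatκ = fixed-by e orbit

    fermatκ^ : ∀ i (a : κ.Carrier) → a κ.^ (q ℕ.^ (i ℕ.* e)) κ.≈ a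
    fermatκ^ zero a = κ.^-1 a
    fermatκ^ (suc i) a = κ.trans (κ.sym (^q^-+ a e (i ℕ.* e))) (κ.trans (κ.^-congˡ (q ℕ.^ (i ℕ.* e)) (fermatκ a)) (fermatκ^ i a))

    abstract
      -- The `q` scalars already exhaust the roots of `T^q - T`.
      fixed⇒scalar : ∀ (w : κ.Carrier) → w κ.^ q κ.≈ w → Σ Carrier λ c → w κ.≈ emb.fn c
      fixed⇒scalar w h = go elements (λ x → x∈ x) prod≈0
        where
        x∈ : ∀ x → x ∈ elements
        x∈ = ∈elements
        T^q-T : κT.P.Carrier
        T^q-T = κT.X κT.P.^ q κT.P.- κT.X
        scalars : List κ.Carrier
        scalars = map emb.fn elements
        emb-injective : ∀ {a b} → emb.fn a κ.≈ emb.fn b → a ≡ b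
        emb-injective {a} {b} z = x∙y⁻¹≈ε⇒x≈y a b (trans (sym (Pol.C‼0 _)) (trans (‼-cong (P.trans (HomP.sub-homo Pol.constHom a b)
          (Pol.monic∣⇒≈0 (mon-⟦⟧ l) (Pol.bnd-mono (positive il) (Pol.bnd-resp (HomP.sub-homo Pol.constHom a b) (Pol.bnd-C (a - b)))) (divides z))) 0) (Pol.‼-0 0)))
        distinct : ∀ xs → Unique xs → AllPairs (λ a b → ¬ (a κ.≈ b)) (map emb.fn xs)
        distinct [] _ = []
        distinct (x ∷ xs) (u ∷ us) = AllP.map⁺ (All.map (λ n z → n (emb-injective z)) u) ∷ distinct xs us
        root : ∀ {z} → z κ.^ q κ.≈ z → κT.eval z T^q-T κ.≈ κ.0#
        root {z} hz = κ.trans (κT.EvalP.sub-homo z _ _) (κ.x≈y⇒x∙y⁻¹≈ε (κ.trans (κT.EvalP.^-homo z κT.X q)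
           (κ.trans (κ.^-congˡ q (κT.eval-X z)) (κ.trans hz (κ.sym (κT.eval-X z))))))
        len : length scalars ≡ q
        len = ≡.trans (ListP.length-map emb.fn elements) length-elements
        mX : κT.Mon q (κT.X κT.P.^ q)
        mX = subst (λ n → κT.Mon n (κT.X κT.P.^ q)) (ℕP.*-identityʳ q) (κT.mon-^ q κT.mon-X)
        mT : κT.Mon q T^q-T
        mT = κT.mon (κT.bnd-sub (κT.bnd mX) (κT.bnd-mono (s≤s (<⇒≤ 1<q)) (κT.bnd κT.mon-X)))
          (κ.trans (κT.‼-sub _ _ q) (κ.trans (κ.+-cong (κT.lead mX) (κ.trans (κ.-‿cong (κT.bnd κT.mon-X q 1<q)) κ.-0#≈0#)) (κ.+-identityʳ _)))
        prod≈0 : κT.eval w (κT.linears scalars) κ.≈ κ.0#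
        prod≈0 = κ.trans (κ.sym (κT.EvalP.resp w (κT.Domain.linears-unique κ-domain scalars T^q-T (distinct elements elements-unique)
          (AllP.map⁺ (All.tabulate (λ {x} _ → root (κ.trans (κ.sym (emb.^-homo x q)) (emb.resp (fermat x)))))) (subst (λ n → κT.Mon n T^q-T) (≡.sym len) mT)))) (root h)
        go : ∀ xs → (∀ x → x ∈ elements) → κT.eval w (κT.linears (map emb.fn xs)) κ.≈ κ.0# → Σ Carrier λ c → w κ.≈ emb.fn c
        go [] _ z = ⊥-elim (κ-1≉0 (κ.trans (κ.sym (κT.EvalP.1-homo w)) z))
        go (x ∷ xs) h z = case κ-domain (w κ.- emb.fn x) (κT.eval w (κT.linears (map emb.fn xs)))
            (κ.trans (κ.*-congʳ (κ.sym (κT.eval-X-C _ _))) (κ.trans (κ.sym (κT.EvalP.*-homo _ _ _)) z)) of λ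
          { (inj₂ z′) → go xs h z′
          ; (inj₁ z′) → x , κ.x∙y⁻¹≈ε⇒x≈y _ _ z′ }

-- Splitting rings of monic polynomials

-- `B` may have zero divisors; injectivity of `ι` is what brings identities between expressions in
-- the roots back to `R`.
record Splitting (R : CommutativeRing 0ℓ 0ℓ) (f : CommutativeRing.Carrier (Poly.poly R)) : Set₁ where
  field
    B : CommutativeRing 0ℓ 0ℓ
    ι : Hom R B
    injective : ∀ {a b} → CommutativeRing._≈_ B (Hom.fn ι a) (Hom.fn ι b) → CommutativeRing._≈_ R a b
    roots : List (CommutativeRing.Carrier B)
    splits : CommutativeRing._≈_ (Poly.poly B) (Hom.fn (PolyMap.mapHom ι) f) (PolyFacts.linears B roots)

module _ (R : CommutativeRing 0ℓ 0ℓ) where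
  open PolyFacts R

  monic-quotient : ∀ {a b m w} → Mon a m → Mon (a ℕ.+ b) (m P.* w) → Mon b w
  monic-quotient {a} {b} {m} {w} (mon bm lm) (mon bmw lmw) =
    let bw = go (bound w) (bnd-mono (≤-trans (m≤n+m (bound w) b) (n≤1+n _)) (bnd-bound w))
    in mon bw (R.trans (R.sym (top b bw)) lmw)
    where
    top : ∀ L → Bnd (suc L) w → (m P.* w) ‼ (a ℕ.+ L) R.≈ w ‼ L
    top L bw = R.trans (proj₂ (*-bnd-top a L m w bm bw)) (R.trans (R.*-congʳ lm) (R.*-identityˡ _))
    go : ∀ j → Bnd (suc (b ℕ.+ j)) w → Bnd (suc b) w
    go zero bw = subst (λ n → Bnd (suc n) w) (ℕP.+-identityʳ b) bw
    go (suc j) bw = go j λ i le → case m≤n⇒m<n∨m≡n le of λ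
      { (inj₁ lt) → bw i (subst (_≤ i) (cong suc (≡.sym (ℕP.+-suc b j))) lt)
      ; (inj₂ ≡.refl) → R.trans (R.sym (top (suc (b ℕ.+ j)) (subst (λ n → Bnd (suc n) w) (ℕP.+-suc b j) bw)))
          (bmw _ (subst (_≤ a ℕ.+ suc (b ℕ.+ j)) (ℕP.+-suc a b) (+-monoʳ-≤ a (s≤s (m≤m+n b j))))) }

-- Adjoin one root at a time: over R[T]/(f) the class of T is a root of f.
splitting : ∀ N (R : CommutativeRing 0ℓ 0ℓ) f → PolyFacts.Mon R N f → Splitting R f
splitting zero R f m = record { B = R ; ι = idHom ; injective = λ e → e ; roots = []
  ; splits = P.trans (Hom.resp (PolyMap.mapHom idHom) (mon0 m)) (Hom.1-homo (PolyMap.mapHom idHom)) }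
  where open PolyFacts R
splitting (suc N) R f m = assemble (B₁.factor θ (M.fn f) θ-root)
  where
  module A = PolyFacts R
  open Quotient A.poly f using (proj; divides; ∣⇒~0) renaming (/ring to R₁)
  module R₁ = RingKit R₁
  module B₁ = PolyFacts R₁
  φ : Hom R R₁
  φ = proj ∘ₕ A.constHom
  module M = HomP (PolyMap.mapHom φ)
  θ : R₁.Carrier
  θ = A.X
  θ-root : B₁.eval θ (M.fn f) R₁.≈ R₁.0#
  θ-root = R₁.trans (PolyMap.eval-map φ idHom θ f) (R₁.trans
    (A.hom-ext (A.Eval.evalHom (idHom ∘ₕ φ) θ) proj (A.Eval.eval-C (idHom ∘ₕ φ) θ) (A.Eval.eval-X (idHom ∘ₕ φ) θ) f)
    (∣⇒~0 A.P.∣-refl))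
  φ-injective : ∀ {a b} → Hom.fn φ a R₁.≈ Hom.fn φ b → a A.R.≈ b
  φ-injective {a} {b} e = A.R.x∙y⁻¹≈ε⇒x≈y a b (A.R.trans (A.R.sym (A.C‼0 _)) (A.R.trans (A.‼-cong (A.P.trans (HomP.sub-homo A.constHom a b)
    (A.monic∣⇒≈0 m (A.bnd-mono (s≤s z≤n) (A.bnd-resp (HomP.sub-homo A.constHom a b) (A.bnd-C (a A.R.- b)))) (divides e))) 0) (A.‼-0 0)))
  assemble : B₁.X-C θ B₁.P.∣ M.fn f → Splitting R f
  assemble (w B₁.P.by e) = record
    { B = S.B ; ι = S.ι ∘ₕ φ ; injective = λ z → φ-injective (S.injective z) ; roots = Hom.fn S.ι θ ∷ S.roots
    ; splits = C.P.trans (A.hom-ext (PolyMap.mapHom (S.ι ∘ₕ φ)) (PolyMap.mapHom S.ι ∘ₕ PolyMap.mapHom φ)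
          (λ a → C.P.trans (PolyMap.map-C (S.ι ∘ₕ φ) a) (C.P.sym (C.P.trans (M′.resp (PolyMap.map-C φ a)) (PolyMap.map-C S.ι _))))
          (C.P.trans (PolyMap.map-X (S.ι ∘ₕ φ)) (C.P.sym (C.P.trans (M′.resp (PolyMap.map-X φ)) (PolyMap.map-X S.ι)))) f)
        (C.P.trans (M′.resp e) (C.P.trans (M′.*-homo _ _) (C.P.*-cong
          (C.P.trans (M′.sub-homo _ _) (C.P.+-cong (PolyMap.map-X S.ι) (C.P.-‿cong (PolyMap.map-C S.ι θ)))) S.splits))) }
    where
    S : Splitting R₁ w
    S = splitting N R₁ w (monic-quotient R₁ (B₁.mon-X-C θ) (B₁.mon-resp e (PolyMap.map-mon φ m)))
    module S = Splitting S
    module C = PolyFacts S.B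
    module M′ = HomP (PolyMap.mapHom S.ι)

-- Multiplicative weights and the logarithmic derivative of their Euler product

rng : ℕ → List ℕ
rng m = map suc (upTo m)

module _ (S : CommutativeSemiring 0ℓ 0ℓ) where
  open CommutativeSemiring S
  open SemiringSum S

  ∑-rng-last : ∀ m h → ∑ (rng (suc m)) h ≈ ∑ (rng m) h + h (suc m)
  ∑-rng-last m h = trans (reflexive (cong (λ ns → ∑ (map suc ns) h) (≡.sym (ListP.upTo-∷ʳ m))))
    (trans (reflexive (cong (λ ns → ∑ ns h) (ListP.map-++ suc (upTo m) (m ∷ []))))
      (trans (∑-++ (rng m) (suc m ∷ []) h) (+-congˡ (+-identityʳ _))))

  ∑-rng-first : ∀ m h → ∑ (rng (suc m)) h ≈ h 1 + ∑ (rng m) (λ i → h (suc i))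
  ∑-rng-first zero h = refl
  ∑-rng-first (suc m) h = trans (∑-rng-last (suc m) h) (trans (+-congʳ (∑-rng-first m h)) (trans (+-assoc _ _ _) (+-congˡ (sym (∑-rng-last m (λ i → h (suc i)))))))

  ∑-rng-extend : ∀ j m h → j ≤ m → (∀ i → j < i → h i ≈ 0#) → ∑ (rng m) h ≈ ∑ (rng j) h
  ∑-rng-extend j zero h z≤n z = refl
  ∑-rng-extend j (suc m) h le z = case m≤n⇒m<n∨m≡n le of λ
    { (inj₁ lt) → trans (∑-rng-last m h) (trans (+-cong (∑-rng-extend j m h (≤-pred lt) z) (z (suc m) lt)) (+-identityʳ _))
    ; (inj₂ ≡.refl) → refl }

rng-unique : ∀ m → Unique (rng m)
rng-unique m = Uniq.map⁺ ℕP.suc-injective (Uniq.upTo⁺ m)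

∈rng : ∀ {i m} → 1 ≤ i → i ≤ m → i ∈ rng m
∈rng {suc i} _ le = ∈-map⁺ suc (∈-upTo⁺ le)

rng⇒1≤ : ∀ {m i} → i ∈ rng m → 1 ≤ i
rng⇒1≤ j = let (_ , _ , eq) = ∈-map⁻ suc j in subst (1 ≤_) (≡.sym eq) (s≤s z≤n)

rng⇒≤ : ∀ {m i} → i ∈ rng m → i ≤ m
rng⇒≤ j = let (_ , k , eq) = ∈-map⁻ suc j in subst (_≤ _) (≡.sym eq) (∈-upTo⁻ k)

-- A completely multiplicative weight on monic polynomials. It is instantiated twice: by the
-- universal residue character and by the constant 1.
record Multiplicative : Set₁ where
  field
    {q} : ℕ
    F : FiniteField q
    R : CommutativeRing 0ℓ 0ℓ
    φ : List (FiniteField.Carrier F) → CommutativeRing.Carrier R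
    φ-[] : CommutativeRing._≈_ R (φ []) (CommutativeRing.1# R)
    φ-⊛ : ∀ a b → CommutativeRing._≈_ R (φ (FieldPoly._⊛_ F a b)) (CommutativeRing._*_ R (φ a) (φ b))

-- The logarithmic derivative of ∑ φ(g) T^deg(g), from deg g = ∑_{P^i ∣ g} deg P.
module Mangoldt (weight : Multiplicative) where
  open Multiplicative weight hiding (q)
  open FieldPoly F hiding ([_]ᵢ)
  private
    module R = RingKit R
    module ∑R = SemiringSum R.commutativeSemiring
  open ∑R using ([_]ᵢ)

  _≟L_ : (a b : List Carrier) → Dec (a ≡ b)
  _≟L_ = ListP.≡-dec _≟_

  mons : ℕ → List (List Carrier)
  mons = seqs elements

  ∈mons : ∀ l → l ∈ mons (length l)
  ∈mons l = seqs-∈ (All.tabulate (λ _ → ∈elements _))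

  irrs : ℕ → List (List Carrier)
  irrs e = filter irr? (mons e)

  irrs-unique : ∀ e → Unique (irrs e)
  irrs-unique e = Uniq.filter⁺ irr? (seqs-unique elements-unique e)

  irrs⇒ : ∀ {e l} → l ∈ irrs e → Irr l × length l ≡ e
  irrs⇒ {e} i = let (j , il) = ∈-filter⁻ irr? {xs = mons e} i in il , seqs-length e j

  ⊛-monic : ∀ a b {c} → ⟦ c ⟧ P.≈ ⟦ a ⟧ P.* ⟦ b ⟧ → c ≡ a ⊛ b
  ⊛-monic a b e = ⟦⟧-injective (P.trans e (P.sym (⟦⊛⟧ a b)))

  powM : List Carrier → ℕ → List Carrier
  powM l zero = []
  powM l (suc i) = l ⊛ powM l i

  ⟦powM⟧ : ∀ l i → ⟦ powM l i ⟧ P.≈ ⟦ l ⟧ P.^ i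
  ⟦powM⟧ l zero = P.refl
  ⟦powM⟧ l (suc i) = P.trans (⟦⊛⟧ l (powM l i)) (P.*-congˡ (⟦powM⟧ l i))

  length-powM : ∀ l i → length (powM l i) ≡ length l ℕ.* i
  length-powM l zero = ≡.sym (ℕP.*-zeroʳ (length l))
  length-powM l (suc i) = ≡.trans (length-⊛ l (powM l i)) (≡.trans (cong (length l ℕ.+_) (length-powM l i)) (≡.sym (ℕP.*-suc (length l) i)))

  φ-powM : ∀ l i → φ (powM l i) R.≈ φ l R.^ i
  φ-powM l zero = φ-[]
  φ-powM l (suc i) = R.trans (φ-⊛ l (powM l i)) (R.*-congˡ (φ-powM l i))

  coef : ℕ → R.Carrier
  coef m = ∑R.∑ (mons m) φ

  prim : ℕ → ℕ → R.Carrier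
  prim e i = ∑R.∑ (irrs e) (λ l → R.nat e R.* φ l R.^ i)

  -- The coefficient of `T^j` in `T L′/L` for `L = ∑ coef m T^m`, written as a sum over powers of
  -- primes.
  mangoldt : ℕ → R.Carrier
  mangoldt j = ∑R.∑ (rng j) λ e → ∑R.∑ (rng j) λ i → [ (e ℕ.* i) ℕP.≟ j ]ᵢ R.* prim e i

  length-∣ : ∀ {w g} → ⟦ w ⟧ P.∣ ⟦ g ⟧ → length w ≤ length g
  length-∣ {w} {g} d = let (_ , _ , len) = cofactor w g d in subst (length w ≤_) (≡.sym len) (m≤m+n _ _)

  private
    cofactorIf : ∀ w g → Dec (⟦ w ⟧ P.∣ ⟦ g ⟧) → List Carrier
    cofactorIf w g (yes d) = proj₁ (cofactor w g d)
    cofactorIf w g (no _) = []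

  -- The multiples of `w` of degree `m` correspond to their cofactors of degree `m - deg w`, and `φ`
  -- is multiplicative.
  multiples : ∀ w m → length w ≤ m → ∑R.∑ (mons m) (λ g → [ divides? w ⟦ g ⟧ ]ᵢ R.* φ g) R.≈ φ w R.* coef (m ∸ length w)
  multiples w m le = R.trans (∑R.∑-cong (mons m) (λ g → if-* (divides? w ⟦ g ⟧) (φ g))) (R.trans (R.sym (∑R.∑-filter (λ g → divides? w ⟦ g ⟧) (mons m) φ))
    (R.trans (R.sym (∑R.∑-bij (w ⊛_) (λ g → cofactorIf w g (divides? w ⟦ g ⟧)) φ (seqs-unique elements-unique m′) (Uniq.filter⁺ (λ g → divides? w ⟦ g ⟧) (seqs-unique elements-unique m)) to from))
      (R.trans (∑R.∑-cong (mons m′) (φ-⊛ w)) (∑R.∑-*ˡ (mons m′) (φ w) φ))))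
    where
    m′ : ℕ
    m′ = m ∸ length w
    if-* : ∀ {Q : Set} (d : Dec Q) x → [ d ]ᵢ R.* x R.≈ (if does d then x else R.0#)
    if-* (yes _) x = R.*-identityˡ x
    if-* (no _) x = R.zeroˡ x
    cofactorIf-eq : ∀ g (d : Dec (⟦ w ⟧ P.∣ ⟦ g ⟧)) → ⟦ w ⟧ P.∣ ⟦ g ⟧ → (g ≡ w ⊛ cofactorIf w g d) × (length g ≡ length w ℕ.+ length (cofactorIf w g d))
    cofactorIf-eq g (yes d) _ = let (b , e , len) = cofactor w g d in ⊛-monic w b e , len
    cofactorIf-eq g (no n) d = ⊥-elim (n d)
    ⊛-cancel : ∀ a b → w ⊛ a ≡ w ⊛ b → a ≡ b
    ⊛-cancel a b e = ⟦⟧-injective (Pol.monic-cancelˡ (mon-⟦⟧ w) (P.trans (P.sym (⟦⊛⟧ w a)) (P.trans (P.reflexive (cong ⟦_⟧ e)) (⟦⊛⟧ w b))))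
    divs : ∀ g → ⟦ w ⟧ P.∣ ⟦ w ⊛ g ⟧
    divs g = ⟦ g ⟧ P.by ⟦⊛⟧ w g
    to : ∀ x → x ∈ mons m′ → (w ⊛ x) ∈ filter (λ g → divides? w ⟦ g ⟧) (mons m) × cofactorIf w (w ⊛ x) (divides? w ⟦ w ⊛ x ⟧) ≡ x
    to x i = ∈-filter⁺ (λ g → divides? w ⟦ g ⟧) (subst (λ n → (w ⊛ x) ∈ mons n)
        (≡.trans (length-⊛ w x) (≡.trans (cong (length w ℕ.+_) (seqs-length m′ i)) (m+[n∸m]≡n le))) (∈mons (w ⊛ x))) (divs x)
      , ⊛-cancel _ _ (≡.sym (proj₁ (cofactorIf-eq (w ⊛ x) (divides? w ⟦ w ⊛ x ⟧) (divs x))))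
    from : ∀ g → g ∈ filter (λ g → divides? w ⟦ g ⟧) (mons m) → cofactorIf w g (divides? w ⟦ g ⟧) ∈ mons m′ × (w ⊛ cofactorIf w g (divides? w ⟦ g ⟧)) ≡ g
    from g i = let (j , d) = ∈-filter⁻ (λ g → divides? w ⟦ g ⟧) {xs = mons m} i
                   (e , len) = cofactorIf-eq g (divides? w ⟦ g ⟧) d
      in subst (λ n → cofactorIf w g (divides? w ⟦ g ⟧) ∈ mons n) (≡.trans (≡.sym (m+n∸m≡n (length w) _)) (cong (_∸ length w) (≡.trans (≡.sym len) (seqs-length m j)))) (∈mons _)
       , ≡.sym e

  no-multiples : ∀ w m → m < length w → ∑R.∑ (mons m) (λ g → [ divides? w ⟦ g ⟧ ]ᵢ R.* φ g) R.≈ R.0#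
  no-multiples w m lt = ∑R.∑-zero (mons m) λ g i → R.trans (R.*-congʳ (∑R.ind-no (divides? w ⟦ g ⟧)
    (λ d → <⇒≱ lt (subst (length w ≤_) (seqs-length m i) (length-∣ {w} {g} d))))) (R.zeroˡ _)

  ind : List Carrier → ℕ → List Carrier → R.Carrier
  ind l i g = [ divides? (powM l i) ⟦ g ⟧ ]ᵢ

  -- The `l`-adic valuation of `g`, capped at `M`.
  mult : ℕ → List Carrier → List Carrier → R.Carrier
  mult M l g = ∑R.∑ (rng M) (λ i → ind l i g)

  -- For `l ≠ l₀` the same powers of `l` divide `g` and `g′`. For `l = l₀` the exponents shift by
  -- one, and the term lost at the cap is zero because `l^M` has degree greater than that of `g′`.
  valuation-step : ∀ M {l l₀} g g′ → Irr l → Irr l₀ → ⟦ g ⟧ P.≈ ⟦ l₀ ⟧ P.* ⟦ g′ ⟧ → length g′ < M →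
                   mult M l g R.≈ [ l ≟L l₀ ]ᵢ R.+ mult M l g′
  valuation-step M {l} {l₀} g g′ il il₀ e lt = go (l ≟L l₀) M lt
    where
    go : (d : Dec (l ≡ l₀)) → ∀ M → length g′ < M → mult M l g R.≈ [ d ]ᵢ R.+ mult M l g′
    go (no ne) M _ = R.trans (∑R.∑-cong (rng M) λ i → ∑R.ind-⇔ (divides? (powM l i) ⟦ g ⟧) (divides? (powM l i) ⟦ g′ ⟧)
        (λ d → P.∣-respˡ (P.sym (⟦powM⟧ l i)) (irr-^-coprime il i ⟦ g′ ⟧ (λ h → ne (irr-∣-irr il il₀ h)) (P.∣-resp e (P.∣-respˡ (⟦powM⟧ l i) d))))
        (λ d → P.∣-resp (P.sym e) (P.∣-*ˡ ⟦ l₀ ⟧ d))) (R.sym (R.+-identityˡ _))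
    go (yes ≡.refl) (suc M) (s≤s le) = R.trans (∑-rng-first R.commutativeSemiring M (λ i → ind l i g)) (R.+-cong
        (∑R.ind-yes (divides? (powM l 1) ⟦ g ⟧) (P.∣-resp (P.sym e) (P.∣-* ⟦ g′ ⟧ (P.∣-respˡ (P.sym (P.trans (⟦powM⟧ l 1) (P.^-1 ⟦ l ⟧))) P.∣-refl))))
        (R.trans (∑R.∑-cong (rng M) λ i → ∑R.ind-⇔ (divides? (powM l (suc i)) ⟦ g ⟧) (divides? (powM l i) ⟦ g′ ⟧) (cancel i)
            (λ d → P.∣-resp (P.sym e) (P.∣-respˡ (P.sym (⟦⊛⟧ l (powM l i))) (P.*-mono-∣ P.∣-refl d))))
          (R.sym (R.trans (∑-rng-last R.commutativeSemiring M (λ i → ind l i g′)) (R.trans (R.+-congˡ (∑R.ind-no (divides? (powM l (suc M)) ⟦ g′ ⟧) too-big)) (R.+-identityʳ _))))))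
      where
      cancel : ∀ i → ⟦ powM l (suc i) ⟧ P.∣ ⟦ g ⟧ → ⟦ powM l i ⟧ P.∣ ⟦ g′ ⟧
      cancel i (w P.by h) = w P.by Pol.monic-cancelˡ (mon-⟦⟧ l) (P.trans (P.sym e) (P.trans h (P.trans (P.*-congʳ (⟦⊛⟧ l (powM l i))) (P.*-assoc _ _ _))))
      too-big : ¬ (⟦ powM l (suc M) ⟧ P.∣ ⟦ g′ ⟧)
      too-big d = <⇒≱ (s≤s le) (≤-trans (≤-trans (≤-reflexive (≡.sym (ℕP.*-identityˡ (suc M)))) (*-monoˡ-≤ (suc M) (positive il)))
        (≤-trans (≤-reflexive (≡.sym (length-powM l (suc M)))) (length-∣ {powM l (suc M)} {g′} d)))

  Λ : ℕ → List Carrier → R.Carrier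
  Λ M g = ∑R.∑ (rng M) λ e → ∑R.∑ (irrs e) λ l → R.nat e R.* mult M l g

  -- Splitting off one irreducible factor adds its degree to both sides; `N` is the induction
  -- measure.
  Λ-degree : ∀ N M g → length g ≤ N → length g ≤ M → Λ M g R.≈ R.nat (length g)
  Λ-degree N M [] _ _ = ∑R.∑-zero (rng M) λ e ie → ∑R.∑-zero (irrs e) λ l i → R.trans (R.*-congˡ (∑R.∑-zero (rng M) λ j ij →
      ∑R.ind-no (divides? (powM l j) ⟦ [] ⟧) λ d → <⇒≱ (*-mono-≤ (positive (proj₁ (irrs⇒ {e} i))) (rng⇒1≤ ij))
        (subst (_≤ 0) (length-powM l j) (length-∣ {powM l j} {[]} d)))) (R.zeroʳ _)
  Λ-degree zero M (_ ∷ _) () _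
  Λ-degree (suc N) M g@(_ ∷ _) leN leM = go (irreducible-factor (length g) g ≤-refl (s≤s z≤n))
    where
    go : (Σ (List Carrier) λ l₀ → Irr l₀ × ⟦ l₀ ⟧ P.∣ ⟦ g ⟧) → Λ M g R.≈ R.nat (length g)
    go (l₀ , il₀ , d) = R.trans (∑R.∑-cong (rng M) λ e → R.trans (∑R.∑-cong∈ (irrs e) λ l i → R.trans
          (R.*-congˡ (valuation-step M g g′ (proj₁ (irrs⇒ {e} i)) il₀ eg lt)) (R.distribˡ _ _ _)) (∑R.∑-+ (irrs e) _ _))
        (R.trans (∑R.∑-+ (rng M) _ _) (R.trans (R.+-cong this (Λ-degree N M g′ (≤-pred (≤-trans lt′ leN)) (≤-trans (<⇒≤ lt′) leM)))
          (R.trans (R.sym (R.nat-+ (length l₀) (length g′))) (R.reflexive (cong R.nat (≡.sym len))))))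
      where
      g′ : List Carrier
      g′ = proj₁ (cofactor l₀ g d)
      eg : ⟦ g ⟧ P.≈ ⟦ l₀ ⟧ P.* ⟦ g′ ⟧
      eg = proj₁ (proj₂ (cofactor l₀ g d))
      len : length g ≡ length l₀ ℕ.+ length g′
      len = proj₂ (proj₂ (cofactor l₀ g d))
      lt′ : length g′ < length g
      lt′ = subst (length g′ <_) (≡.sym len) (m<n+m (length g′) (positive il₀))
      lt : length g′ < M
      lt = <-≤-trans lt′ leM
      l₀≤M : length l₀ ≤ M
      l₀≤M = ≤-trans (subst (length l₀ ≤_) (≡.sym len) (m≤m+n _ _)) leM
      this : ∑R.∑ (rng M) (λ e → ∑R.∑ (irrs e) λ l → R.nat e R.* [ l ≟L l₀ ]ᵢ) R.≈ R.nat (length l₀)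
      this = R.trans (∑R.∑-pick (rng M) (length l₀) _ (rng-unique M) (∈rng (positive il₀) l₀≤M)
          (λ e _ ne → ∑R.∑-zero (irrs e) λ l i → R.trans (R.*-congˡ (∑R.ind-no (l ≟L l₀) λ { ≡.refl → ne (≡.sym (proj₂ (irrs⇒ {e} i))) })) (R.zeroʳ _)))
        (R.trans (∑R.∑-pick (irrs (length l₀)) l₀ _ (irrs-unique (length l₀)) (∈-filter⁺ irr? (∈mons l₀) il₀)
            (λ l _ ne → R.trans (R.*-congˡ (∑R.ind-no (l ≟L l₀) ne)) (R.zeroʳ _)))
          (R.trans (R.*-congˡ (∑R.ind-yes (l₀ ≟L l₀) ≡.refl)) (R.*-identityʳ _)))

  term : ℕ → ℕ → ℕ → R.Carrier
  term m e i = (if does ((e ℕ.* i) ℕP.≤? m) then prim e i R.* coef (m ∸ e ℕ.* i) else R.0#)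

  -- The factor `m` is the degree of each `g` in the sum and is expanded by `Λ-degree`. After
  -- exchanging the sums, the multiples of each prime power are summed by `multiples`.
  left : ∀ m → R.nat m R.* coef m R.≈ ∑R.∑ (rng m) λ e → ∑R.∑ (rng m) λ i → term m e i
  left m = R.trans (R.sym (∑R.∑-*ˡ (mons m) (R.nat m) φ)) (R.trans (∑R.∑-cong∈ (mons m) λ g i →
      R.trans (R.*-congʳ (R.sym (R.trans (Λ-degree m m g (≤-reflexive (seqs-length m i)) (≤-reflexive (seqs-length m i))) (R.reflexive (cong R.nat (seqs-length m i))))))
        (R.trans (R.sym (∑R.∑-*ʳ (rng m) (φ g) _)) (∑R.∑-cong (rng m) λ e → R.sym (∑R.∑-*ʳ (irrs e) (φ g) _))))
    (R.trans (∑R.∑-swap (mons m) (rng m) _) (∑R.∑-cong (rng m) λ e →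
      R.trans (∑R.∑-swap (mons m) (irrs e) _) (R.trans (∑R.∑-cong∈ (irrs e) λ l i → per-prime e l (proj₂ (irrs⇒ {e} i)))
        (R.trans (∑R.∑-swap (irrs e) (rng m) _) (∑R.∑-cong (rng m) λ i → collect e i ((e ℕ.* i) ℕP.≤? m)))))))
    where
    inner : ℕ → List Carrier → ℕ → R.Carrier
    inner e l i = (if does ((e ℕ.* i) ℕP.≤? m) then (R.nat e R.* φ l R.^ i) R.* coef (m ∸ e ℕ.* i) else R.0#)
    per-prime : ∀ e l → length l ≡ e → ∑R.∑ (mons m) (λ g → (R.nat e R.* mult m l g) R.* φ g) R.≈ ∑R.∑ (rng m) (inner e l)
    per-prime e l len = R.trans (∑R.∑-cong (mons m) λ g → R.trans (R.*-assoc _ _ _) (R.*-congˡ (R.sym (∑R.∑-*ʳ (rng m) (φ g) _))))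
      (R.trans (∑R.∑-*ˡ (mons m) (R.nat e) _) (R.trans (R.*-congˡ (∑R.∑-swap (mons m) (rng m) _))
        (R.trans (R.sym (∑R.∑-*ˡ (rng m) (R.nat e) _)) (∑R.∑-cong (rng m) λ i → at i ((e ℕ.* i) ℕP.≤? m)))))
      where
      lenP : ∀ i → length (powM l i) ≡ e ℕ.* i
      lenP i = ≡.trans (length-powM l i) (cong (ℕ._* i) len)
      at : ∀ i (d : Dec ((e ℕ.* i) ≤ m)) → R.nat e R.* ∑R.∑ (mons m) (λ g → ind l i g R.* φ g) R.≈ (if does d then (R.nat e R.* φ l R.^ i) R.* coef (m ∸ e ℕ.* i) else R.0#)
      at i (yes le) = R.trans (R.*-congˡ (multiples (powM l i) m (subst (_≤ m) (≡.sym (lenP i)) le)))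
        (R.trans (R.sym (R.*-assoc _ _ _)) (R.*-cong (R.*-congˡ (φ-powM l i)) (R.reflexive (cong (λ n → coef (m ∸ n)) (lenP i)))))
      at i (no nle) = R.trans (R.*-congˡ (no-multiples (powM l i) m (subst (m <_) (≡.sym (lenP i)) (≰⇒> nle)))) (R.zeroʳ _)
    collect : ∀ e i (d : Dec ((e ℕ.* i) ≤ m)) → ∑R.∑ (irrs e) (λ l → if does d then (R.nat e R.* φ l R.^ i) R.* coef (m ∸ e ℕ.* i) else R.0#)
                R.≈ (if does d then prim e i R.* coef (m ∸ e ℕ.* i) else R.0#)
    collect e i (yes _) = ∑R.∑-*ʳ (irrs e) _ _
    collect e i (no _) = ∑R.∑-0 (irrs e)

  -- A pair `(e, i)` with `e i ≤ m` occurs for exactly one `j`, namely `e i`.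
  right : ∀ m → ∑R.∑ (rng m) (λ j → mangoldt j R.* coef (m ∸ j)) R.≈ ∑R.∑ (rng m) λ e → ∑R.∑ (rng m) λ i → term m e i
  right m = R.trans (∑R.∑-cong∈ (rng m) λ j ij → R.trans (R.*-congʳ (R.sym (extend j (rng⇒≤ ij))))
      (R.trans (R.sym (∑R.∑-*ʳ (rng m) _ _)) (∑R.∑-cong (rng m) λ e → R.sym (∑R.∑-*ʳ (rng m) _ _))))
    (R.trans (∑R.∑-swap (rng m) (rng m) _) (∑R.∑-cong∈ (rng m) λ e ie → R.trans (∑R.∑-swap (rng m) (rng m) _) (∑R.∑-cong∈ (rng m) λ i ii →
      pick e i (*-mono-≤ (rng⇒1≤ ie) (rng⇒1≤ ii)) ((e ℕ.* i) ℕP.≤? m))))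
    where
    extend : ∀ j → j ≤ m → ∑R.∑ (rng m) (λ e → ∑R.∑ (rng m) λ i → [ (e ℕ.* i) ℕP.≟ j ]ᵢ R.* prim e i) R.≈ mangoldt j
    extend j le = R.trans (∑R.∑-cong∈ (rng m) λ e ie → ∑-rng-extend R.commutativeSemiring j m _ le λ i lt →
          R.trans (R.*-congʳ (∑R.ind-no ((e ℕ.* i) ℕP.≟ j) λ eq → <⇒≱ lt (≤-trans (≤-trans (≤-reflexive (≡.sym (ℕP.*-identityˡ i))) (*-monoˡ-≤ i (rng⇒1≤ ie))) (≤-reflexive eq)))) (R.zeroˡ _))
      (∑-rng-extend R.commutativeSemiring j m _ le λ e lt → ∑R.∑-zero (rng j) λ i ii →
          R.trans (R.*-congʳ (∑R.ind-no ((e ℕ.* i) ℕP.≟ j) λ eq → <⇒≱ lt (≤-trans (≤-trans (≤-reflexive (≡.sym (ℕP.*-identityʳ e))) (*-monoʳ-≤ e (rng⇒1≤ ii))) (≤-reflexive eq)))) (R.zeroˡ _))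
    pick : ∀ e i → 1 ≤ e ℕ.* i → (d : Dec (e ℕ.* i ≤ m)) → ∑R.∑ (rng m) (λ j → ([ (e ℕ.* i) ℕP.≟ j ]ᵢ R.* prim e i) R.* coef (m ∸ j))
             R.≈ (if does d then prim e i R.* coef (m ∸ e ℕ.* i) else R.0#)
    pick e i 1≤ (yes le) = R.trans (∑R.∑-pick (rng m) (e ℕ.* i) _ (rng-unique m) (∈rng 1≤ le)
        (λ j _ ne → R.trans (R.*-congʳ (R.trans (R.*-congʳ (∑R.ind-no ((e ℕ.* i) ℕP.≟ j) (λ eq → ne (≡.sym eq)))) (R.zeroˡ _))) (R.zeroˡ _)))
      (R.*-congʳ (R.trans (R.*-congʳ (∑R.ind-yes ((e ℕ.* i) ℕP.≟ (e ℕ.* i)) ≡.refl)) (R.*-identityˡ _)))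
    pick e i 1≤ (no nle) = ∑R.∑-zero (rng m) λ j ij → R.trans (R.*-congʳ (R.trans (R.*-congʳ (∑R.ind-no ((e ℕ.* i) ℕP.≟ j)
        (λ eq → nle (subst (_≤ m) (≡.sym eq) (rng⇒≤ ij))))) (R.zeroˡ _))) (R.zeroˡ _)

  abstract
    newton : ∀ m → R.nat m R.* coef m R.≈ ∑R.∑ (rng m) (λ j → mangoldt j R.* coef (m ∸ j))
    newton m = R.trans (left m) (R.sym (right m))

-- Determinants with movable rows and columns

-- Determinants of (h_j(a_i)), with rows indexed by numbers and columns by functions, expanded along the first row.
module Det (R : CommutativeRing 0ℓ 0ℓ) where
  open RingKit R
  open SemiringSum commutativeSemiring
  open import Relation.Binary.Reasoning.Setoid setoid

  Col : Set
  Col = ℕ → Carrier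

  -- `pre` holds the columns already passed, so the minor omitting `c` uses `pre ++ post`; the
  -- nested subtractions produce the alternating signs.
  expand : (List Col → Carrier) → ℕ → List Col → List Col → Carrier
  expand D a pre [] = 0#
  expand D a pre (c ∷ post) = c a * D (pre ++ post) - expand D a (pre ++ c ∷ []) post

  det : List ℕ → List Col → Carrier
  det [] [] = 1#
  det [] (_ ∷ _) = 0#
  det (a ∷ as) cols = expand (det as) a [] cols

  private
    0-minus-0 : ∀ {x y} → x ≈ 0# → y ≈ 0# → x - y ≈ 0#
    0-minus-0 e f = trans (+-cong e (-‿cong f)) (-‿inverseʳ 0#)

  Alternating : (List Col → Carrier) → Set
  Alternating D = ∀ xs c ys → D (xs ++ c ∷ c ∷ ys) ≈ 0#

  module _ {D : List Col → Carrier} (alt : Alternating D) (a : ℕ) where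

    expand-pre : ∀ xs c ys post → expand D a (xs ++ c ∷ c ∷ ys) post ≈ 0#
    expand-pre xs c ys [] = refl
    expand-pre xs c ys (d ∷ post) = 0-minus-0
      (trans (*-congˡ (trans (reflexive (cong D (ListP.++-assoc xs (c ∷ c ∷ ys) post))) (alt xs c (ys ++ post)))) (zeroʳ _))
      (trans (reflexive (cong (λ l → expand D a l post) (ListP.++-assoc xs (c ∷ c ∷ ys) (d ∷ [])))) (expand-pre xs c (ys ++ d ∷ []) post))

    expand-alternating : ∀ pre xs c ys → expand D a pre (xs ++ c ∷ c ∷ ys) ≈ 0#
    expand-alternating pre [] c ys = begin
      c a * D (pre ++ c ∷ ys) - (c a * D ((pre ++ c ∷ []) ++ ys) - expand D a ((pre ++ c ∷ []) ++ c ∷ []) ys)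
        ≈⟨ +-congˡ (-‿cong (+-cong (*-congˡ (reflexive (cong D (ListP.++-assoc pre (c ∷ []) ys))))
             (-‿cong (trans (reflexive (cong (λ l → expand D a l ys) (ListP.++-assoc pre (c ∷ []) (c ∷ [])))) (expand-pre pre c [] ys))))) ⟩
      c a * D (pre ++ c ∷ ys) - (c a * D (pre ++ c ∷ ys) - 0#)
        ≈⟨ solve 1 (λ x → x :- (x :- con (+ 0)) := con (+ 0)) refl _ ⟩
      0# ∎
    expand-alternating pre (x ∷ xs) c ys = 0-minus-0
      (trans (*-congˡ (trans (reflexive (cong D (≡.sym (ListP.++-assoc pre xs (c ∷ c ∷ ys))))) (alt (pre ++ xs) c ys))) (zeroʳ _))
      (expand-alternating (pre ++ x ∷ []) xs c ys)

  det-alternating : ∀ as → Alternating (det as)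
  det-alternating [] [] c ys = refl
  det-alternating [] (_ ∷ _) c ys = refl
  det-alternating (a ∷ as) xs c ys = expand-alternating (det-alternating as) a [] xs c ys

  Swapping : (List Col → Carrier) → Set
  Swapping D = ∀ xs c d ys → D (xs ++ c ∷ d ∷ ys) ≈ - D (xs ++ d ∷ c ∷ ys)

  module _ {D : List Col → Carrier} (sw : Swapping D) (a : ℕ) where

    expand-pre-swap : ∀ xs c d ys post → expand D a (xs ++ c ∷ d ∷ ys) post ≈ - expand D a (xs ++ d ∷ c ∷ ys) post
    expand-pre-swap xs c d ys [] = sym -0#≈0#
    expand-pre-swap xs c d ys (e ∷ post) = trans (+-cong
        (trans (*-congˡ (trans (reflexive (cong D (ListP.++-assoc xs (c ∷ d ∷ ys) post))) (trans (sw xs c d (ys ++ post))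
          (-‿cong (reflexive (cong D (≡.sym (ListP.++-assoc xs (d ∷ c ∷ ys) post)))))))) (sym (-‿distribʳ-* _ _)))
        (-‿cong (trans (reflexive (cong (λ l → expand D a l post) (ListP.++-assoc xs (c ∷ d ∷ ys) (e ∷ []))))
          (trans (expand-pre-swap xs c d (ys ++ e ∷ []) post) (-‿cong (reflexive (cong (λ l → expand D a l post) (≡.sym (ListP.++-assoc xs (d ∷ c ∷ ys) (e ∷ []))))))))))
      (solve 2 (λ x y → (:- x) :- (:- y) := :- (x :- y)) refl _ _)

    expand-swap : ∀ pre xs c d ys → expand D a pre (xs ++ c ∷ d ∷ ys) ≈ - expand D a pre (xs ++ d ∷ c ∷ ys)
    expand-swap pre [] c d ys = trans (+-congˡ (-‿cong (+-cong (*-congˡ (reflexive (cong D (ListP.++-assoc pre (c ∷ []) ys))))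
          (-‿cong (trans (reflexive (cong (λ l → expand D a l ys) (ListP.++-assoc pre (c ∷ []) (d ∷ [])))) (expand-pre-swap pre c d [] ys))))))
      (trans (solve 3 (λ x y z → x :- (y :- (:- z)) := :- (y :- (x :- z))) refl _ _ _)
        (-‿cong (+-congˡ (-‿cong (+-cong (*-congˡ (reflexive (cong D (≡.sym (ListP.++-assoc pre (d ∷ []) ys)))))
          (-‿cong (reflexive (cong (λ l → expand D a l ys) (≡.sym (ListP.++-assoc pre (d ∷ []) (c ∷ [])))))))))))
    expand-swap pre (x ∷ xs) c d ys = trans (+-cong
        (trans (*-congˡ (trans (reflexive (cong D (≡.sym (ListP.++-assoc pre xs (c ∷ d ∷ ys))))) (trans (sw (pre ++ xs) c d ys)
          (-‿cong (reflexive (cong D (ListP.++-assoc pre xs (d ∷ c ∷ ys)))))))) (sym (-‿distribʳ-* _ _)))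
        (-‿cong (expand-swap (pre ++ x ∷ []) xs c d ys)))
      (solve 2 (λ x y → (:- x) :- (:- y) := :- (x :- y)) refl _ _)

  det-swap : ∀ as → Swapping (det as)
  det-swap [] [] c d ys = sym -0#≈0#
  det-swap [] (_ ∷ _) c d ys = sym -0#≈0#
  det-swap (a ∷ as) xs c d ys = expand-swap (det-swap as) a [] xs c d ys

  -- Transpositions bring the two equal columns together.
  det-repeated : ∀ as xs c ys zs → det as (xs ++ c ∷ ys ++ c ∷ zs) ≈ 0#
  det-repeated as xs c [] zs = det-alternating as xs c zs
  det-repeated as xs c (y ∷ ys) zs = trans (det-swap as xs c y (ys ++ c ∷ zs)) (trans (-‿cong
    (trans (reflexive (cong (det as) (≡.sym (ListP.++-assoc xs (y ∷ []) (c ∷ ys ++ c ∷ zs))))) (det-repeated as (xs ++ y ∷ []) c ys zs))) -0#≈0#)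

  module Linear {K : Set} (ks : List K) (s : K → Carrier) (φ : K → Col) (w : Col) (w≈ : ∀ a → w a ≈ ∑ ks (λ k → s k * φ k a)) where

    LinearIn : (List Col → Carrier) → Set
    LinearIn D = ∀ xs ys → D (xs ++ w ∷ ys) ≈ ∑ ks (λ k → s k * D (xs ++ φ k ∷ ys))

    private
      ∑-neg : ∀ (f : K → Carrier) (ks : List K) → ∑ ks (λ k → - f k) ≈ - ∑ ks f
      ∑-neg f [] = sym -0#≈0#
      ∑-neg f (k ∷ ks) = trans (+-congˡ (∑-neg f ks)) (-‿+-comm _ _)

      ∑-sub : ∀ (f g : K → Carrier) → ∑ ks f - ∑ ks g ≈ ∑ ks (λ k → f k - g k)
      ∑-sub f g = trans (+-congˡ (sym (∑-neg g ks))) (sym (∑-+ ks f (λ k → - g k)))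

      combine : ∀ {x y} (f g : K → Carrier) → x ≈ ∑ ks (λ k → s k * f k) → y ≈ ∑ ks (λ k → s k * g k) → x - y ≈ ∑ ks (λ k → s k * (f k - g k))
      combine f g e e′ = trans (+-cong e (-‿cong e′)) (trans (∑-sub _ _) (∑-cong ks λ k → solve 3 (λ s f g → s :* f :- s :* g := s :* (f :- g)) refl (s k) (f k) (g k)))

      scale : ∀ x {y} (f : K → Carrier) → y ≈ ∑ ks (λ k → s k * f k) → x * y ≈ ∑ ks (λ k → s k * (x * f k))
      scale x f e = trans (*-congˡ e) (trans (sym (∑-*ˡ ks x _)) (∑-cong ks λ k → solve 3 (λ x s f → x :* (s :* f) := s :* (x :* f)) refl x (s k) (f k)))

    module _ {D : List Col → Carrier} (lin : LinearIn D) (a : ℕ) where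

      expand-pre-linear : ∀ xs ys post → expand D a (xs ++ w ∷ ys) post ≈ ∑ ks (λ k → s k * expand D a (xs ++ φ k ∷ ys) post)
      expand-pre-linear xs ys [] = sym (∑-zero ks (λ k _ → zeroʳ _))
      expand-pre-linear xs ys (c ∷ post) = combine (λ k → c a * D ((xs ++ φ k ∷ ys) ++ post)) (λ k → expand D a ((xs ++ φ k ∷ ys) ++ c ∷ []) post)
        (scale (c a) _ (trans (reflexive (cong D (ListP.++-assoc xs (w ∷ ys) post))) (trans (lin xs (ys ++ post))
          (∑-cong ks λ k → *-congˡ (reflexive (cong D (≡.sym (ListP.++-assoc xs (φ k ∷ ys) post))))))))
        (trans (reflexive (cong (λ l → expand D a l post) (ListP.++-assoc xs (w ∷ ys) (c ∷ [])))) (trans (expand-pre-linear xs (ys ++ c ∷ []) post)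
          (∑-cong ks λ k → *-congˡ (reflexive (cong (λ l → expand D a l post) (≡.sym (ListP.++-assoc xs (φ k ∷ ys) (c ∷ []))))))))

      expand-linear : ∀ pre xs ys → expand D a pre (xs ++ w ∷ ys) ≈ ∑ ks (λ k → s k * expand D a pre (xs ++ φ k ∷ ys))
      expand-linear pre [] ys = combine (λ k → φ k a * D (pre ++ ys)) (λ k → expand D a (pre ++ φ k ∷ []) ys)
        (trans (*-congʳ (w≈ a)) (trans (sym (∑-*ʳ ks _ _)) (∑-cong ks λ k → *-assoc _ _ _)))
        (expand-pre-linear pre [] ys)
      expand-linear pre (x ∷ xs) ys = combine (λ k → x a * D (pre ++ xs ++ φ k ∷ ys)) (λ k → expand D a (pre ++ x ∷ []) (xs ++ φ k ∷ ys))
        (scale (x a) _ (trans (reflexive (cong D (≡.sym (ListP.++-assoc pre xs (w ∷ ys))))) (trans (lin (pre ++ xs) ys)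
          (∑-cong ks λ k → *-congˡ (reflexive (cong D (ListP.++-assoc pre xs (φ k ∷ ys))))))))
        (expand-linear (pre ++ x ∷ []) xs ys)

    det-linear : ∀ as → LinearIn (det as)
    det-linear [] [] ys = sym (∑-zero ks (λ k _ → zeroʳ _))
    det-linear [] (_ ∷ _) ys = sym (∑-zero ks (λ k _ → zeroʳ _))
    det-linear (a ∷ as) xs ys = expand-linear (det-linear as) a [] xs ys

  increments : List ℕ → List (List ℕ)
  increments [] = []
  increments (a ∷ as) = (suc a ∷ as) ∷ map (a ∷_) (increments as)

  shifts : List Col → List (List Col)
  shifts [] = []
  shifts (c ∷ cs) = ((λ a → c (suc a)) ∷ cs) ∷ map (c ∷_) (shifts cs)

  ∑-shifts-++ : ∀ xs ys (f : List Col → Carrier) → ∑ (shifts (xs ++ ys)) f ≈ ∑ (shifts xs) (λ xs′ → f (xs′ ++ ys)) + ∑ (shifts ys) (λ ys′ → f (xs ++ ys′))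
  ∑-shifts-++ [] ys f = sym (+-identityˡ _)
  ∑-shifts-++ (x ∷ xs) ys f = trans (+-congˡ (trans (reflexive (∑-map (x ∷_) (shifts (xs ++ ys)) f)) (trans (∑-shifts-++ xs ys (λ l → f (x ∷ l)))
    (+-congʳ (reflexive (≡.sym (∑-map (x ∷_) (shifts xs) (λ xs′ → f (xs′ ++ ys)))))))))
    (sym (+-assoc _ _ _))

  private
    ∑-neg′ : ∀ {K : Set} (f : K → Carrier) (ks : List K) → ∑ ks (λ k → - f k) ≈ - ∑ ks f
    ∑-neg′ f [] = sym -0#≈0#
    ∑-neg′ f (k ∷ ks) = trans (+-congˡ (∑-neg′ f ks)) (-‿+-comm _ _)

    ∑-sub′ : ∀ {K : Set} (f g : K → Carrier) (ks : List K) → ∑ ks (λ k → f k - g k) ≈ ∑ ks f - ∑ ks g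
    ∑-sub′ f g ks = trans (∑-+ ks f (λ k → - g k)) (+-congˡ (∑-neg′ g ks))

  expand-∑ : ∀ {K : Set} (ks : List K) (D : K → List Col → Carrier) a pre post →
             ∑ ks (λ k → expand (D k) a pre post) ≈ expand (λ cs → ∑ ks (λ k → D k cs)) a pre post
  expand-∑ ks D a pre [] = ∑-0 ks
  expand-∑ ks D a pre (c ∷ post) = trans (∑-sub′ _ _ ks) (+-cong (∑-*ˡ ks (c a) _) (-‿cong (expand-∑ ks D a (pre ++ c ∷ []) post)))

  expand-cong : ∀ {D D′ : List Col → Carrier} → (∀ cs → D cs ≈ D′ cs) → ∀ a pre post → expand D a pre post ≈ expand D′ a pre post
  expand-cong e a pre [] = refl
  expand-cong e a pre (c ∷ post) = +-cong (*-congˡ (e _)) (-‿cong (expand-cong e a (pre ++ c ∷ []) post))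

  -- The Leibniz rule for one expansion step. Columns in `pre` no longer meet the current row but
  -- are still shifted inside the minors, whence the last sum.
  expand-derivation : ∀ D a pre post → expand D (suc a) pre post + expand (λ cs → ∑ (shifts cs) D) a pre post
                      ≈ ∑ (shifts post) (expand D a pre) + ∑ (shifts pre) (λ pre′ → expand D a pre′ post)
  expand-derivation D a pre [] = +-congˡ (sym (∑-0 (shifts pre)))
  expand-derivation D a pre (c ∷ ps) = begin
    (c (suc a) * D (pre ++ ps) - e₁) + (c a * ∑ (shifts (pre ++ ps)) D - e₂)
      ≈⟨ solve 4 (λ x y z w → (x :- y) :+ (z :- w) := (x :+ z) :- (y :+ w)) refl _ _ _ _ ⟩
    (c (suc a) * D (pre ++ ps) + c a * ∑ (shifts (pre ++ ps)) D) - (e₁ + e₂)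
      ≈⟨ +-cong (+-congˡ (*-congˡ (∑-shifts-++ pre ps D))) (-‿cong (expand-derivation D a (pre ++ c ∷ []) ps)) ⟩
    (c (suc a) * D (pre ++ ps) + c a * (s₁ + s₂)) - (s₃ + ∑ (shifts (pre ++ c ∷ [])) (λ pre′ → expand D a pre′ ps))
      ≈⟨ +-congˡ (-‿cong (+-congˡ (trans (∑-shifts-++ pre (c ∷ []) (λ pre′ → expand D a pre′ ps)) (+-congˡ (+-identityʳ _))))) ⟩
    (c (suc a) * D (pre ++ ps) + c a * (s₁ + s₂)) - (s₃ + (s₄ + s₅))
      ≈⟨ solve 7 (λ x y s1 s2 s3 s4 s5 → (x :+ y :* (s1 :+ s2)) :- (s3 :+ (s4 :+ s5)) := ((x :- s5) :+ (y :* s2 :- s3)) :+ (y :* s1 :- s4)) refl _ (c a) s₁ s₂ s₃ s₄ s₅ ⟩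
    ((c (suc a) * D (pre ++ ps) - s₅) + (c a * s₂ - s₃)) + (c a * s₁ - s₄)
      ≈⟨ sym (+-cong (+-congˡ (trans (reflexive (∑-map (c ∷_) (shifts ps) (expand D a pre))) (trans (∑-sub′ _ _ (shifts ps)) (+-congʳ (∑-*ˡ (shifts ps) (c a) _)))))
           (trans (∑-sub′ _ _ (shifts pre)) (+-congʳ (∑-*ˡ (shifts pre) (c a) _)))) ⟩
    ∑ (shifts (c ∷ ps)) (expand D a pre) + ∑ (shifts pre) (λ pre′ → expand D a pre′ (c ∷ ps)) ∎
    where
    c′ : Col
    c′ i = c (suc i)
    e₁ = expand D (suc a) (pre ++ c ∷ []) ps
    e₂ = expand (λ cs → ∑ (shifts cs) D) a (pre ++ c ∷ []) ps
    s₁ = ∑ (shifts pre) (λ pre′ → D (pre′ ++ ps))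
    s₂ = ∑ (shifts ps) (λ ps′ → D (pre ++ ps′))
    s₃ = ∑ (shifts ps) (expand D a (pre ++ c ∷ []))
    s₄ = ∑ (shifts pre) (λ pre′ → expand D a (pre′ ++ c ∷ []) ps)
    s₅ = expand D a (pre ++ c′ ∷ []) ps

  -- Differentiating a determinant by rows or by columns gives the same result.
  det-derivation : ∀ as cols → ∑ (increments as) (λ as′ → det as′ cols) ≈ ∑ (shifts cols) (det as)
  det-derivation [] cols = sym (trans (∑-cong∈ (shifts cols) (vanish cols)) (∑-0 (shifts cols)))
    where
    vanish : ∀ cols cs → cs ∈ shifts cols → det [] cs ≈ 0#
    vanish (c ∷ cols) cs (here ≡.refl) = refl
    vanish (c ∷ cols) cs (there i) = let (_ , _ , e) = ∈-map⁻ (c ∷_) i in reflexive (cong (det []) e)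
  det-derivation (a ∷ as) cols = begin
    expand (det as) (suc a) [] cols + ∑ (map (a ∷_) (increments as)) (λ as′ → det as′ cols)
      ≈⟨ +-congˡ (trans (reflexive (∑-map (a ∷_) (increments as) (λ as′ → det as′ cols))) (expand-∑ (increments as) det a [] cols)) ⟩
    expand (det as) (suc a) [] cols + expand (λ cs → ∑ (increments as) (λ as′ → det as′ cs)) a [] cols
      ≈⟨ +-congˡ (expand-cong (det-derivation as) a [] cols) ⟩
    expand (det as) (suc a) [] cols + expand (λ cs → ∑ (shifts cs) (det as)) a [] cols
      ≈⟨ expand-derivation (det as) a [] cols ⟩
    ∑ (shifts cols) (det (a ∷ as)) + 0# ≈⟨ +-identityʳ _ ⟩
    ∑ (shifts cols) (det (a ∷ as)) ∎

  expand-zero : ∀ D a pre post → All (λ c → c a ≈ 0#) post → expand D a pre post ≈ 0#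
  expand-zero D a pre [] _ = refl
  expand-zero D a pre (c ∷ post) (e ∷ es) = 0-minus-0 (trans (*-congʳ e) (zeroˡ _)) (expand-zero D a (pre ++ c ∷ []) post es)

-- From bounds on power sums to bounds on powers of the linear coefficient

module NatLemmas where
  open ℕP.≤-Reasoning
  open import Data.Nat.Solver using (module +-*-Solver)
  private module N = +-*-Solver
  private module ℕ∑ = SemiringSum ℕP.+-*-commutativeSemiring

  -- Bernoulli's inequality `(1 + 1/x)^e ≥ 1 + e/x`, cleared of denominators.
  bernoulli : ∀ x e → x ℕ.^ e ℕ.* (x ℕ.+ e) ≤ suc x ℕ.^ e ℕ.* x
  bernoulli x zero = ≤-reflexive (cong (1 ℕ.*_) (ℕP.+-identityʳ x))
  bernoulli x (suc e) = begin
    x ℕ.* x ℕ.^ e ℕ.* (x ℕ.+ suc e)                      ≤⟨ m≤m+n _ (x ℕ.^ e ℕ.* e) ⟩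
    x ℕ.* x ℕ.^ e ℕ.* (x ℕ.+ suc e) ℕ.+ x ℕ.^ e ℕ.* e    ≡⟨ N.solve 3 (λ x y e → x N.:* y N.:* (x N.:+ (N.con 1 N.:+ e)) N.:+ y N.:* e N.:= (N.con 1 N.:+ x) N.:* (y N.:* (x N.:+ e))) ≡.refl x (x ℕ.^ e) e ⟩
    suc x ℕ.* (x ℕ.^ e ℕ.* (x ℕ.+ e))                    ≤⟨ *-monoʳ-≤ (suc x) (bernoulli x e) ⟩
    suc x ℕ.* (suc x ℕ.^ e ℕ.* x)                        ≡⟨ ≡.sym (ℕP.*-assoc (suc x) (suc x ℕ.^ e) x) ⟩
    suc x ℕ.* suc x ℕ.^ e ℕ.* x ∎

  ∑≤ : ∀ {X : Set} (xs : List X) {f g : X → ℕ} → (∀ x → x ∈ xs → f x ≤ g x) → ℕ∑.∑ xs f ≤ ℕ∑.∑ xs g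
  ∑≤ [] _ = z≤n
  ∑≤ (x ∷ xs) e = +-mono-≤ (e x (here ≡.refl)) (∑≤ xs (λ y i → e y (there i)))

  -- A discrete form of integrating `x^e`. The factor `e` on the left is what lets the induction in
  -- `h-bound` close without losing a constant.
  power-sum : ∀ e m → e ℕ.* ℕ∑.∑ (rng m) (λ j → suc (m ∸ j) ℕ.^ e) ≤ m ℕ.* suc m ℕ.^ e
  power-sum e zero = ≤-reflexive (ℕP.*-zeroʳ e)
  power-sum e (suc m) = begin
    e ℕ.* ℕ∑.∑ (rng (suc m)) (λ j → suc (suc m ∸ j) ℕ.^ e)
      ≡⟨ cong (e ℕ.*_) (∑-rng-first ℕP.+-*-commutativeSemiring m (λ j → suc (suc m ∸ j) ℕ.^ e)) ⟩
    e ℕ.* (suc m ℕ.^ e ℕ.+ ℕ∑.∑ (rng m) (λ j → suc (m ∸ j) ℕ.^ e)) ≡⟨ ℕP.*-distribˡ-+ e (suc m ℕ.^ e) _ ⟩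
    e ℕ.* suc m ℕ.^ e ℕ.+ e ℕ.* ℕ∑.∑ (rng m) (λ j → suc (m ∸ j) ℕ.^ e) ≤⟨ +-monoʳ-≤ (e ℕ.* suc m ℕ.^ e) (power-sum e m) ⟩
    e ℕ.* suc m ℕ.^ e ℕ.+ m ℕ.* suc m ℕ.^ e ≤⟨ m≤n+m _ (suc m ℕ.^ e) ⟩
    suc m ℕ.^ e ℕ.+ (e ℕ.* suc m ℕ.^ e ℕ.+ m ℕ.* suc m ℕ.^ e)
      ≡⟨ N.solve 3 (λ y e m → y N.:+ (e N.:* y N.:+ m N.:* y) N.:= y N.:* (N.con 1 N.:+ m N.:+ e)) ≡.refl (suc m ℕ.^ e) e m ⟩
    suc m ℕ.^ e ℕ.* (suc m ℕ.+ e) ≤⟨ bernoulli (suc m) e ⟩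
    suc (suc m) ℕ.^ e ℕ.* suc m ≡⟨ ℕP.*-comm (suc (suc m) ℕ.^ e) (suc m) ⟩
    suc m ℕ.* suc (suc m) ℕ.^ e ∎

-- The last field is an equality, so that Newton's identities can be divided by `m` at the level of
-- norms.
record NormOn (R : CommutativeRing 0ℓ 0ℓ) : Set where
  open RingKit R
  field
    ‖_‖ : Carrier → ℕ
    ‖‖-cong : ∀ {x y} → x ≈ y → ‖ x ‖ ≡ ‖ y ‖
    ‖‖-+ : ∀ x y → ‖ x + y ‖ ≤ ‖ x ‖ ℕ.+ ‖ y ‖
    ‖‖-* : ∀ x y → ‖ x * y ‖ ≤ ‖ x ‖ ℕ.* ‖ y ‖
    ‖‖-neg : ∀ x → ‖ - x ‖ ≡ ‖ x ‖
    ‖‖-0 : ‖ 0# ‖ ≡ 0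
    ‖‖-nat : ∀ n x → ‖ nat n * x ‖ ≡ n ℕ.* ‖ x ‖

-- Coefficients and power sums of a polynomial ∑ c_m T^m of degree D.
record PolynomialSeries : Set₁ where
  field
    R : CommutativeRing 0ℓ 0ℓ
    norm : NormOn R
  open RingKit R
  open NormOn norm
  open SemiringSum commutativeSemiring using (∑)
  field
    w : ℕ → ℕ
    q : ℕ
    1≤q : 1 ≤ q
    w0 : w 0 ≡ 1
    w-mono : ∀ {i j} → i ≤ j → w i ≤ w j
    w-* : ∀ i j → w i ℕ.* w j ≤ q ℕ.* w (i ℕ.+ j)
    c ν : ℕ → Carrier
    c0 : c 0 ≈ 1#
    newton : ∀ m → nat m * c m ≈ ∑ (rng m) (λ j → ν j * c (m ∸ j))
    D : ℕ
    c-zero : ∀ m → D < m → c m ≈ 0#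
    K₀ : ℕ
    ν-bound : ∀ j → 1 ≤ j → ‖ ν j ‖ ≤ K₀ ℕ.* w j

-- If ∑ c_m T^m is a polynomial of degree D with power sums ν_j = O(w_j), then the powers of its linear coefficient c₁ are
-- O(poly(N) D^N w_N).  With h the coefficients of the inverse series, Δ(a) = det(h(a_i - j)) satisfies -c₁ Δ(a) = ∑_i Δ(a + ε_i).
module Arch (input : PolynomialSeries) where
  open PolynomialSeries input
  open NormOn norm
  open RingKit R
  open SemiringSum commutativeSemiring
  open Det R
  private
    module ℕ∑ = SemiringSum ℕP.+-*-commutativeSemiring
    ∑-rng-ext = ∑-rng-extend commutativeSemiring

  private
    -- The coefficients of the inverse series, by a recursion over all earlier ones; the first
    -- argument is fuel, and any fuel of at least the index gives the same value.
    hf : ℕ → ℕ → Carrier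
    hf _ zero = 1#
    hf zero (suc m) = 0#
    hf (suc n) (suc m) = - ∑ (rng (suc m)) (λ i → c i * hf n (suc m ∸ i))

    hf-stable : ∀ n n′ m → m ≤ n → m ≤ n′ → hf n m ≈ hf n′ m
    hf-stable n n′ zero _ _ = refl
    hf-stable (suc n) (suc n′) (suc m) (s≤s le) (s≤s le′) = -‿cong (∑-cong∈ (rng (suc m)) λ i j → *-congˡ
      (hf-stable n n′ (suc m ∸ i) (≤-trans (small (rng⇒1≤ j)) le) (≤-trans (small (rng⇒1≤ j)) le′)))
      where
      small : ∀ {i} → 1 ≤ i → suc m ∸ i ≤ m
      small {suc i} _ = m∸n≤m m i

  h : ℕ → Carrier
  h m = hf m m

  h-rec : ∀ m → h (suc m) ≈ - ∑ (rng (suc m)) (λ i → c i * h (suc m ∸ i))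
  h-rec m = -‿cong (∑-cong∈ (rng (suc m)) λ i j → *-congˡ (hf-stable m (suc m ∸ i) (suc m ∸ i) (small (rng⇒1≤ j)) ≤-refl))
    where
    small : ∀ {i} → 1 ≤ i → suc m ∸ i ≤ m
    small {suc i} _ = m∸n≤m m i

  idx : ℕ → List ℕ
  idx m = 0 ∷ rng m

  conv-suc : ∀ m → ∑ (idx (suc m)) (λ i → c i * h (suc m ∸ i)) ≈ 0#
  conv-suc m = trans (+-congʳ (trans (*-congʳ c0) (trans (*-identityˡ _) (h-rec m)))) (-‿inverseˡ _)

  conv-0 : ∑ (idx 0) (λ i → c i * h (0 ∸ i)) ≈ 1#
  conv-0 = trans (+-identityʳ _) (trans (*-identityʳ _) c0)

  -- Both sides run over pairs `(j, k)` with `j ≥ 1`, `k ≥ 0` and `j + k ≤ m`.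
  triangle : ∀ m (G : ℕ → ℕ → Carrier) → ∑ (rng m) (λ i → ∑ (rng i) (λ j → G j (i ∸ j))) ≈ ∑ (rng m) (λ j → ∑ (idx (m ∸ j)) (G j))
  triangle zero G = refl
  triangle (suc m) G = trans (∑-rng-last commutativeSemiring m _) (trans (+-cong (triangle m G) (∑-rng-last commutativeSemiring m _))
    (sym (trans (∑-rng-last commutativeSemiring m _) (trans (+-cong
        (trans (∑-cong∈ (rng m) λ j i → grow j (rng⇒≤ i)) (∑-+ (rng m) _ _))
        (trans (reflexive (cong (λ n → ∑ (idx n) (G (suc m))) (n∸n≡0 m))) (trans (+-identityʳ _) (reflexive (cong (G (suc m)) (≡.sym (n∸n≡0 m)))))))
      (+-assoc _ _ _)))))
    where
    grow : ∀ j → j ≤ m → ∑ (idx (suc m ∸ j)) (G j) ≈ ∑ (idx (m ∸ j)) (G j) + G j (suc m ∸ j)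
    grow j le = trans (reflexive (cong (λ n → ∑ (idx n) (G j)) (+-∸-assoc 1 le))) (trans (+-congˡ (∑-rng-last commutativeSemiring (m ∸ j) (G j)))
      (trans (sym (+-assoc _ _ _)) (+-congˡ (reflexive (cong (G j) (≡.sym (+-∸-assoc 1 le)))))))

  triangle′ : ∀ m (G : ℕ → ℕ → Carrier) → ∑ (rng m) (λ i → ∑ (rng (m ∸ i)) (G i)) ≈ ∑ (rng m) (λ j → ∑ (rng (m ∸ j)) (λ i → G i j))
  triangle′ m G = trans (∑-cong (rng m) λ i → sym (restrict (G i) i (λ j → (i ℕ.+ j) ℕP.≤? m) (λ j lt le → <⇒≱ lt (bigger i j le)) (λ j i≤ jm → ≤-trans (+-monoʳ-≤ i jm) (≤-reflexive (m+[n∸m]≡n i≤)))))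
    (trans (∑-swap (rng m) (rng m) _) (∑-cong (rng m) λ j → restrict (λ i → G i j) j (λ i → (i ℕ.+ j) ℕP.≤? m)
      (λ i lt le → <⇒≱ lt (bigger j i (subst (_≤ m) (ℕP.+-comm i j) le))) (λ i j≤ im → ≤-trans (+-monoˡ-≤ j im) (≤-reflexive (m∸n+n≡m j≤)))))
    where
    bigger : ∀ i j → i ℕ.+ j ≤ m → j ≤ m ∸ i
    bigger i j le = subst (_≤ m ∸ i) (m+n∸m≡n i j) (∸-monoˡ-≤ i le)
    if-yes : ∀ {Q : Set} (d : Dec Q) x → Q → (if does d then x else 0#) ≈ x
    if-yes (yes _) x _ = refl
    if-yes (no n) x p = ⊥-elim (n p)
    if-no : ∀ {Q : Set} (d : Dec Q) x → ¬ Q → (if does d then x else 0#) ≈ 0#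
    if-no (yes p) x n = ⊥-elim (n p)
    if-no (no _) x _ = refl
    restrict : ∀ (g : ℕ → Carrier) i {Q : ℕ → Set} (d : ∀ j → Dec (Q j)) → (∀ j → m ∸ i < j → ¬ Q j) → (∀ j → i ≤ m → j ≤ m ∸ i → Q j) →
               ∑ (rng m) (λ j → if does (d j) then g j else 0#) ≈ ∑ (rng (m ∸ i)) g
    restrict g i d out inn = trans (∑-rng-ext (m ∸ i) m _ (m∸n≤m m i) (λ j lt → if-no (d j) (g j) (out j lt)))
      (∑-cong∈ (rng (m ∸ i)) λ j k → if-yes (d j) (g j) (inn j (i≤m k) (rng⇒≤ k)))
      where
      i≤m : ∀ {j} → j ∈ rng (m ∸ i) → i ≤ m
      i≤m {j} k = <⇒≤ (m∸n≢0⇒n<m λ e → case ≤-trans (rng⇒1≤ k) (≤-trans (rng⇒≤ k) (≤-reflexive e)) of λ ())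

  private
    open import Relation.Binary.Reasoning.Setoid setoid

    ∑-neg : ∀ {X : Set} (xs : List X) f → ∑ xs (λ x → - f x) ≈ - ∑ xs f
    ∑-neg [] f = sym -0#≈0#
    ∑-neg (x ∷ xs) f = trans (+-congˡ (∑-neg xs f)) (-‿+-comm _ _)

    conv-δ : ∀ m j → j ≤ m → ∑ (idx (m ∸ j)) (λ k → c k * h (m ∸ j ∸ k)) ≈ [ j ℕP.≟ m ]ᵢ
    conv-δ m j le = go (m ∸ j) ≡.refl (j ℕP.≟ m)
      where
      go : ∀ n → m ∸ j ≡ n → (d : Dec (j ≡ m)) → ∑ (idx n) (λ k → c k * h (n ∸ k)) ≈ [ d ]ᵢ
      go zero e (yes _) = conv-0
      go zero e (no ne) = ⊥-elim (ne (≤-antisym le (m∸n≡0⇒m≤n e)))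
      go (suc n) e (yes ≡.refl) = case ≡.trans (≡.sym e) (n∸n≡0 m) of λ ()
      go (suc n) e (no _) = conv-suc n

  -- Inverting a series negates its logarithmic derivative. Multiplying `∑ c_i h_(m-i) = 0` by
  -- `m = i + (m - i)` splits it into `A`, treated by `newton`, and `B` with the term `m h_m`,
  -- treated by induction with fuel `N`.
  h-newton : ∀ N m → m ≤ N → nat m * h m ≈ - ∑ (rng m) (λ j → ν j * h (m ∸ j))
  h-newton N zero _ = trans (zeroˡ _) (sym -0#≈0#)
  h-newton (suc N) m@(suc m-1) (s≤s le) = begin
    nat m * h m                                  ≈⟨ solve 3 (λ a b x → x := (a :+ (b :+ x)) :- (a :+ b)) refl A B (nat m * h m) ⟩
    (A + (B + nat m * h m)) - (A + B)            ≈⟨ +-cong A+B (-‿cong (+-cong A≈ B≈)) ⟩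
    0# - (ν m + (- ν m + S))                     ≈⟨ solve 2 (λ v s → con (+ 0) :- (v :+ ((:- v) :+ s)) := :- s) refl (ν m) S ⟩
    - S ∎
    where
    A B S : Carrier
    A = ∑ (rng m) (λ i → (nat i * c i) * h (m ∸ i))
    B = ∑ (rng m) (λ i → c i * (nat (m ∸ i) * h (m ∸ i)))
    S = ∑ (rng m) (λ j → ν j * h (m ∸ j))
    A+B : A + (B + nat m * h m) ≈ 0#
    A+B = begin
      A + (B + nat m * h m)         ≈⟨ sym (+-assoc _ _ _) ⟩
      (A + B) + nat m * h m         ≈⟨ +-congʳ (sym (∑-+ (rng m) _ _)) ⟩
      ∑ (rng m) (λ i → (nat i * c i) * h (m ∸ i) + c i * (nat (m ∸ i) * h (m ∸ i))) + nat m * h m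
        ≈⟨ +-congʳ (∑-cong∈ (rng m) λ i k → trans (solve 4 (λ a c b h → (a :* c) :* h :+ c :* (b :* h) := (a :+ b) :* (c :* h)) refl _ _ _ _)
             (*-congʳ (trans (sym (nat-+ i (m ∸ i))) (reflexive (cong nat (m+[n∸m]≡n (rng⇒≤ k))))))) ⟩
      ∑ (rng m) (λ i → nat m * (c i * h (m ∸ i))) + nat m * h m ≈⟨ +-cong (∑-*ˡ (rng m) (nat m) _) (*-congˡ (h-rec m-1)) ⟩
      nat m * ∑ (rng m) (λ i → c i * h (m ∸ i)) + nat m * - ∑ (rng m) (λ i → c i * h (m ∸ i))
        ≈⟨ solve 2 (λ n s → n :* s :+ n :* (:- s) := con (+ 0)) refl _ _ ⟩
      0# ∎
    δ-sum : ∑ (rng m) (λ j → ν j * [ j ℕP.≟ m ]ᵢ) ≈ ν m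
    δ-sum = trans (∑-pick (rng m) m _ (rng-unique m) (∈rng (s≤s z≤n) ≤-refl) (λ j _ ne → trans (*-congˡ (ind-no (j ℕP.≟ m) ne)) (zeroʳ _)))
      (trans (*-congˡ (ind-yes (m ℕP.≟ m) ≡.refl)) (*-identityʳ _))
    A≈ : A ≈ ν m
    A≈ = begin
      A ≈⟨ ∑-cong (rng m) (λ i → trans (*-congʳ (newton i)) (sym (∑-*ʳ (rng i) _ _))) ⟩
      ∑ (rng m) (λ i → ∑ (rng i) (λ j → (ν j * c (i ∸ j)) * h (m ∸ i)))
        ≈⟨ ∑-cong (rng m) (λ i → ∑-cong∈ (rng i) λ j k → trans (*-assoc _ _ _) (*-congˡ (*-congˡ (reflexive (cong h (≡.trans (cong (m ∸_) (≡.sym (m+[n∸m]≡n (rng⇒≤ k)))) (≡.sym (∸-+-assoc m j (i ∸ j)))))))) ) ⟩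
      ∑ (rng m) (λ i → ∑ (rng i) (λ j → ν j * (c (i ∸ j) * h (m ∸ j ∸ (i ∸ j))))) ≈⟨ triangle m (λ j k → ν j * (c k * h (m ∸ j ∸ k))) ⟩
      ∑ (rng m) (λ j → ∑ (idx (m ∸ j)) (λ k → ν j * (c k * h (m ∸ j ∸ k)))) ≈⟨ ∑-cong∈ (rng m) (λ j k → trans (∑-*ˡ (idx (m ∸ j)) (ν j) _) (*-congˡ (conv-δ m j (rng⇒≤ k)))) ⟩
      ∑ (rng m) (λ j → ν j * [ j ℕP.≟ m ]ᵢ) ≈⟨ δ-sum ⟩
      ν m ∎
    B≈ : B ≈ - ν m + S
    B≈ = begin
      B ≈⟨ ∑-cong∈ (rng m) (λ i k → trans (*-congˡ (h-newton N (m ∸ i) (≤-trans (small (rng⇒1≤ k)) le))) (trans (sym (-‿distribʳ-* _ _)) (-‿cong (sym (∑-*ˡ (rng (m ∸ i)) (c i) _))))) ⟩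
      ∑ (rng m) (λ i → - ∑ (rng (m ∸ i)) (λ j → c i * (ν j * h (m ∸ i ∸ j)))) ≈⟨ ∑-neg (rng m) _ ⟩
      - ∑ (rng m) (λ i → ∑ (rng (m ∸ i)) (λ j → c i * (ν j * h (m ∸ i ∸ j)))) ≈⟨ -‿cong (triangle′ m _) ⟩
      - ∑ (rng m) (λ j → ∑ (rng (m ∸ j)) (λ i → c i * (ν j * h (m ∸ i ∸ j))))
        ≈⟨ -‿cong (∑-cong∈ (rng m) λ j k → trans (∑-cong (rng (m ∸ j)) λ i → trans (solve 3 (λ c v h → c :* (v :* h) := v :* (c :* h)) refl _ _ _)
             (*-congˡ (*-congˡ (reflexive (cong h (≡.trans (∸-+-assoc m i j) (≡.trans (cong (m ∸_) (ℕP.+-comm i j)) (≡.sym (∸-+-assoc m j i)))))))))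
             (trans (∑-*ˡ (rng (m ∸ j)) (ν j) _) (*-congˡ (tail j (rng⇒≤ k))))) ⟩
      - ∑ (rng m) (λ j → ν j * ([ j ℕP.≟ m ]ᵢ - h (m ∸ j)))
        ≈⟨ -‿cong (trans (∑-cong (rng m) λ j → solve 3 (λ v d h → v :* (d :- h) := v :* d :+ (:- (v :* h))) refl _ _ _) (trans (∑-+ (rng m) _ _) (+-cong δ-sum (∑-neg (rng m) _)))) ⟩
      - (ν m + - S) ≈⟨ solve 2 (λ v s → :- (v :+ (:- s)) := (:- v) :+ s) refl _ _ ⟩
      - ν m + S ∎
      where
      small : ∀ {i} → 1 ≤ i → m ∸ i ≤ m-1
      small {suc i} _ = m∸n≤m m-1 i
      tail : ∀ j → j ≤ m → ∑ (rng (m ∸ j)) (λ i → c i * h (m ∸ j ∸ i)) ≈ [ j ℕP.≟ m ]ᵢ - h (m ∸ j)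
      tail j le = trans (solve 2 (λ s x → s := (x :+ s) :- x) refl _ (h (m ∸ j))) (+-congʳ (trans (+-congʳ (sym (trans (*-congʳ c0) (*-identityˡ _)))) (conv-δ m j le)))

  ‖∑‖ : ∀ {X : Set} (xs : List X) f → ‖ ∑ xs f ‖ ≤ ℕ∑.∑ xs (λ x → ‖ f x ‖)
  ‖∑‖ [] f = ≤-reflexive ‖‖-0
  ‖∑‖ (x ∷ xs) f = ≤-trans (‖‖-+ _ _) (+-monoʳ-≤ ‖ f x ‖ (‖∑‖ xs f))

  private
    open import Data.Nat.Solver using (module +-*-Solver)
    module N = +-*-Solver
    open NatLemmas using (∑≤; power-sum)

  K e : ℕ
  K = ‖ 1# ‖
  e = K₀ ℕ.* q

  -- Newton's identity bounds `m ‖h m‖` by `K · w m · e` times a sum of `e`-th powers, where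
  -- `e = K₀ q` collects the constants of `ν-bound` and `w-*`; `power-sum` absorbs precisely this
  -- `e`.
  h-bound : ∀ N m → m ≤ N → ‖ h m ‖ ≤ K ℕ.* (suc m ℕ.^ e ℕ.* w m)
  h-bound N zero _ = ≤-reflexive (≡.sym (≡.trans (cong (λ z → K ℕ.* (z ℕ.* w 0)) (ℕP.^-zeroˡ e)) (≡.trans (cong (λ z → K ℕ.* (1 ℕ.* z)) w0) (ℕP.*-identityʳ K))))
  h-bound (suc N) m@(suc m-1) (s≤s le) = *-cancelˡ-≤ m (≤-trans (≤-reflexive (≡.trans (≡.sym (‖‖-nat m (h m))) (≡.trans (‖‖-cong (h-newton m m ≤-refl)) (‖‖-neg _))))
    (≤-trans (‖∑‖ (rng m) _) (≤-trans (∑≤ (rng m) (λ j k → term j (rng⇒1≤ k) (rng⇒≤ k)))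
      (≤-trans (≤-reflexive (≡.trans (ℕ∑.∑-*ˡ (rng m) (K ℕ.* w m ℕ.* e) (λ j → suc (m ∸ j) ℕ.^ e)) (ℕP.*-assoc (K ℕ.* w m) e _)))
        (≤-trans (*-monoʳ-≤ (K ℕ.* w m) (power-sum e m))
          (≤-reflexive (N.solve 4 (λ K w m y → K N.:* w N.:* (m N.:* y) N.:= m N.:* (K N.:* (y N.:* w))) ≡.refl K (w m) m (suc m ℕ.^ e))))))))
    where
    term : ∀ j → 1 ≤ j → j ≤ m → ‖ ν j * h (m ∸ j) ‖ ≤ K ℕ.* w m ℕ.* e ℕ.* suc (m ∸ j) ℕ.^ e
    term (suc j) _ j≤m = ≤-trans (‖‖-* _ _) (≤-trans (*-mono-≤ (ν-bound (suc j) (s≤s z≤n)) (h-bound N (m ∸ suc j) (≤-trans (m∸n≤m m-1 j) le)))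
      (≤-trans (≤-reflexive (N.solve 5 (λ k w K y v → (k N.:* w) N.:* (K N.:* (y N.:* v)) N.:= (K N.:* k N.:* y) N.:* (w N.:* v)) ≡.refl K₀ (w (suc j)) K y (w (m ∸ suc j))))
        (≤-trans (*-monoʳ-≤ (K ℕ.* K₀ ℕ.* y) (≤-trans (w-* (suc j) (m ∸ suc j)) (≤-reflexive (cong (λ z → q ℕ.* w z) (m+[n∸m]≡n j≤m)))))
          (≤-reflexive (N.solve 5 (λ K k y q w → K N.:* k N.:* y N.:* (q N.:* w) N.:= K N.:* w N.:* (k N.:* q) N.:* y) ≡.refl K K₀ y q (w m))))))
      where
      y : ℕ
      y = suc (m ∸ suc j) ℕ.^ e

  -- hh a j = h(a - j), zero for negative arguments
  hh : ℕ → ℕ → Carrier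
  hh a zero = h a
  hh zero (suc j) = 0#
  hh (suc a) (suc j) = hh a j

  col : ℕ → Col
  col j a = hh a j

  cols : ℕ → ℕ → List Col
  cols j zero = []
  cols j (suc n) = col j ∷ cols (suc j) n

  hh≡h : ∀ a j → j ≤ a → hh a j ≡ h (a ∸ j)
  hh≡h a zero _ = ≡.refl
  hh≡h (suc a) (suc j) (s≤s le) = hh≡h a j le

  hh≡0 : ∀ a j → a < j → hh a j ≡ 0#
  hh≡0 zero (suc j) _ = ≡.refl
  hh≡0 (suc a) (suc j) (s≤s lt) = hh≡0 a j lt

  ρ : ℕ → ℕ
  ρ a = K ℕ.* (suc a ℕ.^ e ℕ.* w a)

  hh-bound : ∀ a j → ‖ hh a j ‖ ≤ ρ a
  hh-bound a j = case j ℕP.≤? a of λ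
    { (yes le) → ≤-trans (≤-reflexive (cong ‖_‖ (hh≡h a j le))) (≤-trans (h-bound (a ∸ j) (a ∸ j) ≤-refl)
        (*-monoʳ-≤ K (*-mono-≤ (^-monoˡ-≤ e (s≤s (m∸n≤m a j))) (w-mono (m∸n≤m a j)))))
    ; (no nle) → ≤-trans (≤-reflexive (≡.trans (cong ‖_‖ (hh≡0 a j (≰⇒> nle))) ‖‖-0)) z≤n }

  Bounded : List Col → Set
  Bounded = All (λ c → ∀ a → ‖ c a ‖ ≤ ρ a)

  cols-bounded : ∀ j n → Bounded (cols j n)
  cols-bounded j zero = []
  cols-bounded j (suc n) = (λ a → hh-bound a j) ∷ cols-bounded (suc j) n

  length-cols : ∀ j n → length (cols j n) ≡ n
  length-cols j zero = ≡.refl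
  length-cols j (suc n) = cong suc (length-cols (suc j) n)

  rows-bound : List ℕ → ℕ
  rows-bound [] = K
  rows-bound (a ∷ as) = D ℕ.* ρ a ℕ.* rows-bound as

  det-bound : ∀ as cs → length cs ≤ D → Bounded cs → ‖ det as cs ‖ ≤ rows-bound as
  det-bound [] [] _ _ = ≤-refl
  det-bound [] (_ ∷ _) _ _ = ≤-trans (≤-reflexive ‖‖-0) z≤n
  det-bound (a ∷ as) cs le bc = ≤-trans (go [] cs le [] bc)
      (≤-trans (*-monoˡ-≤ (ρ a ℕ.* rows-bound as) le) (≤-reflexive (≡.sym (ℕP.*-assoc D (ρ a) (rows-bound as)))))
    where
    go : ∀ pre post → length pre ℕ.+ length post ≤ D → Bounded pre → Bounded post → ‖ expand (det as) a pre post ‖ ≤ length post ℕ.* (ρ a ℕ.* rows-bound as)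
    go pre [] _ _ _ = ≤-reflexive ‖‖-0
    go pre (c ∷ post) le bp (bc ∷ bs) = ≤-trans (‖‖-+ _ _) (+-mono-≤
      (≤-trans (‖‖-* _ _) (*-mono-≤ (bc a) (det-bound as (pre ++ post)
        (≤-trans (≤-reflexive (ListP.length-++ pre)) (≤-trans (+-monoʳ-≤ (length pre) (n≤1+n _)) le)) (AllP.++⁺ bp bs))))
      (≤-trans (≤-reflexive (‖‖-neg _)) (go (pre ++ c ∷ []) post
        (≤-trans (≤-reflexive (≡.trans (cong (ℕ._+ length post) (ListP.length-++ pre)) (ℕP.+-assoc (length pre) 1 (length post)))) le) (AllP.++⁺ bp (bc ∷ [])) bs)))

  sumℕ : List ℕ → ℕ
  sumℕ [] = 0
  sumℕ (a ∷ as) = a ℕ.+ sumℕ as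

  -- Each row costs one factor `q` from `w-*`, after which the weights of all rows combine into the
  -- weight of their sum.
  rows-bound≤ : ∀ as S → sumℕ as ≤ S → rows-bound as ≤ K ℕ.* ((D ℕ.* K ℕ.* suc S ℕ.^ e ℕ.* q) ℕ.^ length as ℕ.* w (sumℕ as))
  rows-bound≤ [] S _ = ≤-reflexive (≡.sym (≡.trans (cong (λ z → K ℕ.* (1 ℕ.* z)) w0) (ℕP.*-identityʳ K)))
  rows-bound≤ (a ∷ as) S le = ≤-trans (*-mono-≤ (*-monoʳ-≤ D (*-monoʳ-≤ K (*-monoˡ-≤ (w a) (^-monoˡ-≤ e (s≤s (≤-trans (m≤m+n a _) le)))))) (rows-bound≤ as S (≤-trans (m≤n+m _ a) le)))
    (≤-trans (≤-reflexive (N.solve 6 (λ D K y w P v → (D N.:* (K N.:* (y N.:* w))) N.:* (K N.:* (P N.:* v)) N.:= (K N.:* (D N.:* K N.:* y) N.:* P) N.:* (w N.:* v)) ≡.refl D K (suc S ℕ.^ e) (w a) P (w (sumℕ as))))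
      (≤-trans (*-monoʳ-≤ (K ℕ.* (D ℕ.* K ℕ.* suc S ℕ.^ e) ℕ.* P) (w-* a (sumℕ as)))
        (≤-reflexive (N.solve 5 (λ K x P q v → (K N.:* x N.:* P) N.:* (q N.:* v) N.:= K N.:* ((x N.:* q N.:* P) N.:* v)) ≡.refl K (D ℕ.* K ℕ.* suc S ℕ.^ e) P q (w (a ℕ.+ sumℕ as))))))
    where
    P : ℕ
    P = (D ℕ.* K ℕ.* suc S ℕ.^ e ℕ.* q) ℕ.^ length as

  rows : ℕ → ℕ → List ℕ
  rows j zero = []
  rows j (suc n) = j ∷ rows (suc j) n

  length-rows : ∀ j n → length (rows j n) ≡ n
  length-rows j zero = ≡.refl
  length-rows j (suc n) = cong suc (length-rows (suc j) n)

  -- The matrix `h(a_i - j)` with consecutive rows is triangular with `h 0 = 1` on the diagonal.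
  det-unit : ∀ j n → det (rows j n) (cols j n) ≈ 1#
  det-unit j zero = refl
  det-unit j (suc n) = trans (+-cong (trans (*-cong (reflexive (≡.trans (hh≡h j j ≤-refl) (cong h (n∸n≡0 j)))) (det-unit (suc j) n)) (*-identityˡ 1#))
      (trans (-‿cong (expand-zero (det (rows (suc j) n)) j (col j ∷ []) (cols (suc j) n) (zeros (suc j) n ≤-refl))) -0#≈0#))
    (+-identityʳ 1#)
    where
    zeros : ∀ i n → j < i → All (λ c → c j ≈ 0#) (cols i n)
    zeros i zero _ = []
    zeros i (suc n) lt = reflexive (hh≡0 j i lt) ∷ zeros (suc i) n (m<n⇒m<1+n lt)

  cols-split : ∀ j n i → i < n → Σ (List Col) λ ys → Σ (List Col) λ zs → cols j n ≡ ys ++ col (j ℕ.+ i) ∷ zs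
  cols-split j (suc n) zero _ = [] , cols (suc j) n , cong (λ z → col z ∷ cols (suc j) n) (≡.sym (ℕP.+-identityʳ j))
  cols-split j (suc n) (suc i) (s≤s lt) = let (ys , zs , e) = cols-split (suc j) n i lt in
    col j ∷ ys , zs , cong (col j ∷_) (≡.trans e (cong (λ z → ys ++ col z ∷ zs) (≡.sym (ℕP.+-suc j i))))

  -- Shifting column `j + 1` produces column `j`, so every such determinant has a repeated column.
  later-shifts : ∀ as pre j n → ∑ (shifts (cols (suc j) n)) (λ r → det as (pre ++ col j ∷ r)) ≈ 0#
  later-shifts as pre j zero = refl
  later-shifts as pre j (suc n) = trans (+-cong (det-alternating as pre (col j) (cols (suc (suc j)) n))
      (trans (reflexive (∑-map (col (suc j) ∷_) (shifts (cols (suc (suc j)) n)) _))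
        (trans (∑-cong (shifts (cols (suc (suc j)) n)) λ r → reflexive (cong (det as) (≡.sym (ListP.++-assoc pre (col j ∷ []) (col (suc j) ∷ r)))))
          (later-shifts as (pre ++ col j ∷ []) (suc j) n)))) (+-identityʳ 0#)

  -- The recursion for `h` expresses the shifted first column through columns `0` to `D - 1`; only
  -- `D` of them occur, because `c` vanishes beyond `D`.
  shifted-column : ∀ a → h (suc a) ≈ ∑ (rng D) (λ i → - c i * hh a (i ∸ 1))
  shifted-column a = trans (h-rec a) (trans (sym (∑-neg (rng (suc a)) _)) (trans (∑-cong∈ (rng (suc a)) λ i k → trans (-‿distribˡ-* _ _) (*-congˡ (reflexive (≡.sym (eq i (rng⇒1≤ k) (rng⇒≤ k))))))
    (case ≤-total D (suc a) of λ
      { (inj₁ le) → ∑-rng-ext D (suc a) _ le (λ i lt → trans (*-congʳ (trans (-‿cong (c-zero i lt)) -0#≈0#)) (zeroˡ _))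
      ; (inj₂ le) → sym (∑-rng-ext (suc a) D _ le (λ i lt → trans (*-congˡ (reflexive (hh≡0 a (i ∸ 1) (pred< lt)))) (zeroʳ _))) })))
    where
    eq : ∀ i → 1 ≤ i → i ≤ suc a → hh a (i ∸ 1) ≡ h (suc a ∸ i)
    eq (suc i) _ (s≤s le) = hh≡h a i le
    pred< : ∀ {i} → suc a < i → a < i ∸ 1
    pred< (s≤s lt) = lt

  -- By `det-derivation`, raising the rows amounts to shifting the columns. Only the first column
  -- contributes, and in its expansion all terms but `i = 1` repeat a column.
  pieri : ∀ as → 1 ≤ D → ∑ (increments as) (λ as′ → det as′ (cols 0 D)) ≈ - c 1 * det as (cols 0 D)
  pieri as 1≤D = go D ≡.refl 1≤D
    where
    go : ∀ n → n ≡ D → 1 ≤ n → ∑ (increments as) (λ as′ → det as′ (cols 0 n)) ≈ - c 1 * det as (cols 0 n)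
    go (suc n) eD _ = trans (det-derivation as (cols 0 (suc n))) (trans (+-cong
        (trans (Linear.det-linear (rng D) (λ i → - c i) (λ i → col (i ∸ 1)) (λ a → h (suc a)) shifted-column as [] (cols 1 n))
          (∑-pick (rng D) 1 _ (rng-unique D) (∈rng (s≤s z≤n) (subst (1 ≤_) eD (s≤s z≤n))) λ i k ne → trans (*-congˡ (repeated i (rng⇒1≤ k) (subst (i ≤_) (≡.sym eD) (rng⇒≤ k)) ne)) (zeroʳ _)))
        (trans (reflexive (∑-map (col 0 ∷_) (shifts (cols 1 n)) (det as))) (later-shifts as [] 0 n))) (+-identityʳ _))
      where
      repeated : ∀ i → 1 ≤ i → i ≤ suc n → i ≢ 1 → det as (col (i ∸ 1) ∷ cols 1 n) ≈ 0#
      repeated (suc zero) _ _ ne = ⊥-elim (ne ≡.refl)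
      repeated (suc (suc i)) _ (s≤s le) _ = let (ys , zs , eq) = cols-split 1 n i le in
        trans (reflexive (cong (λ l → det as (col (suc i) ∷ l)) eq)) (det-repeated as [] (col (suc i)) ys zs)

  length-increments : ∀ as → length (increments as) ≡ length as
  length-increments [] = ≡.refl
  length-increments (a ∷ as) = cong suc (≡.trans (ListP.length-map (a ∷_) (increments as)) (length-increments as))

  increment : ∀ as as′ → as′ ∈ increments as → length as′ ≡ length as × sumℕ as′ ≡ suc (sumℕ as)
  increment (a ∷ as) as′ (here ≡.refl) = ≡.refl , ≡.refl
  increment (a ∷ as) as′ (there i) = let (bs , j , e) = ∈-map⁻ (a ∷_) i ; (l , s) = increment as bs j in
    ≡.trans (cong length e) (cong suc l) , ≡.trans (cong sumℕ e) (≡.trans (cong (a ℕ.+_) s) (ℕP.+-suc a (sumℕ as)))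

  G : ℕ → ℕ
  G S = K ℕ.* ((D ℕ.* K ℕ.* suc S ℕ.^ e ℕ.* q) ℕ.^ D ℕ.* w S)

  -- Each application of `pieri` trades a factor `c₁` for `D` determinants whose row sum is larger
  -- by one. After `N` steps there are `D^N` of them, bounded by `det-bound`.
  det-power-bound : 1 ≤ D → ∀ N as → length as ≡ D → ‖ c 1 ^ N * det as (cols 0 D) ‖ ≤ D ℕ.^ N ℕ.* G (sumℕ as ℕ.+ N)
  det-power-bound 1≤D zero as la = ≤-trans (≤-reflexive (‖‖-cong (*-identityˡ _))) (≤-trans (det-bound as (cols 0 D) (≤-reflexive (length-cols 0 D)) (cols-bounded 0 D))
    (≤-trans (rows-bound≤ as (sumℕ as) ≤-refl) (≤-reflexive (≡.trans (cong₂ (λ n S → K ℕ.* ((D ℕ.* K ℕ.* suc S ℕ.^ e ℕ.* q) ℕ.^ n ℕ.* w S)) la (≡.sym (ℕP.+-identityʳ (sumℕ as)))) (≡.sym (ℕP.*-identityˡ _))) )))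
  det-power-bound 1≤D (suc N) as la = ≤-trans (≤-reflexive (≡.trans (‖‖-cong rewritten) (‖‖-neg _)))
    (≤-trans (‖∑‖ (increments as) _) (≤-trans (∑≤ (increments as) each)
      (≤-reflexive (≡.trans (ℕ∑.∑-cong (increments as) {g = λ _ → D ℕ.^ N ℕ.* G (sumℕ as ℕ.+ suc N)} (λ _ → ≡.refl)) (≡.trans (constant (increments as)) (≡.trans (cong (ℕ._* (D ℕ.^ N ℕ.* G (sumℕ as ℕ.+ suc N))) (≡.trans (length-increments as) la))
        (≡.sym (ℕP.*-assoc D (D ℕ.^ N) _))))))))
    where
    rewritten : c 1 ^ suc N * det as (cols 0 D) ≈ - ∑ (increments as) (λ as′ → c 1 ^ N * det as′ (cols 0 D))
    rewritten = trans (solve 3 (λ x y d → (x :* y) :* d := :- (y :* ((:- x) :* d))) refl (c 1) (c 1 ^ N) _)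
      (-‿cong (trans (*-congˡ (sym (pieri as 1≤D))) (sym (∑-*ˡ (increments as) (c 1 ^ N) _))))
    constant : ∀ {X : Set} (xs : List X) {k} → ℕ∑.∑ xs (λ _ → k) ≡ length xs ℕ.* k
    constant [] = ≡.refl
    constant (x ∷ xs) {k} = cong (k ℕ.+_) (constant xs)
    each : ∀ as′ → as′ ∈ increments as → ‖ c 1 ^ N * det as′ (cols 0 D) ‖ ≤ D ℕ.^ N ℕ.* G (sumℕ as ℕ.+ suc N)
    each as′ i = let (l , s) = increment as as′ i in ≤-trans (det-power-bound 1≤D N as′ (≡.trans l la))
      (≤-reflexive (cong (λ S → D ℕ.^ N ℕ.* G S) (≡.trans (cong (ℕ._+ N) s) (≡.sym (ℕP.+-suc (sumℕ as) N)))))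

  abstract
    power-bound : 1 ≤ D → Σ ℕ λ S₀ → ∀ N → ‖ c 1 ^ N ‖ ≤ D ℕ.^ N ℕ.* (K ℕ.* ((D ℕ.* K ℕ.* suc (S₀ ℕ.+ N) ℕ.^ e ℕ.* q) ℕ.^ D ℕ.* w (S₀ ℕ.+ N)))
    power-bound 1≤D = sumℕ (rows 0 D) , λ N → ≤-trans (≤-reflexive (‖‖-cong (trans (sym (*-identityʳ _)) (*-congˡ (sym (det-unit 0 D))))))
      (det-power-bound 1≤D N (rows 0 D) (length-rows 0 D))

-- Comparing exponential growth rates

module Growth where
  open ℕP.≤-Reasoning
  open import Data.Nat.Solver using (module +-*-Solver)
  private module N = +-*-Solver

  n<2^n : ∀ n → n < 2 ℕ.^ n
  n<2^n zero = s≤s z≤n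
  n<2^n (suc n) = ≤-trans (s≤s (n<2^n n)) (≤-trans (+-monoˡ-≤ (2 ℕ.^ n) (≤-trans (s≤s z≤n) (n<2^n n))) (≤-reflexive (cong (2 ℕ.^ n ℕ.+_) (≡.sym (ℕP.+-identityʳ _)))))

  linear<exponential : ∀ α β → Σ ℕ λ i → α ℕ.+ i ℕ.* β < 2 ℕ.^ i
  -- With `i = 2k` the left side is at most `k + k²`, which is below `(k + 1)² ≤ 4^k`.
  linear<exponential α β = k ℕ.+ k , (begin-strict
    α ℕ.+ (k ℕ.+ k) ℕ.* β       ≤⟨ +-mono-≤ (m≤m+n α (2 ℕ.* β)) (≤-trans (≤-reflexive (N.solve 2 (λ k b → (k N.:+ k) N.:* b N.:= k N.:* (N.con 2 N.:* b)) ≡.refl k β)) (*-monoʳ-≤ k (m≤n+m (2 ℕ.* β) α))) ⟩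
    k ℕ.+ k ℕ.* k               <⟨ s≤s (m≤n+m (k ℕ.+ k ℕ.* k) k) ⟩
    suc (k ℕ.+ (k ℕ.+ k ℕ.* k)) ≡⟨ N.solve 1 (λ k → N.con 1 N.:+ (k N.:+ (k N.:+ k N.:* k)) N.:= (N.con 1 N.:+ k) N.:* (N.con 1 N.:+ k)) ≡.refl k ⟩
    suc k ℕ.* suc k             ≤⟨ *-mono-≤ (n<2^n k) (n<2^n k) ⟩
    2 ℕ.^ k ℕ.* 2 ℕ.^ k         ≡⟨ ≡.sym (ℕP.^-distribˡ-+-* 2 k k) ⟩
    2 ℕ.^ (k ℕ.+ k) ∎)
    where
    k : ℕ
    k = α ℕ.+ 2 ℕ.* β

  ^-distribʳ-* : ∀ a b n → (a ℕ.* b) ℕ.^ n ≡ a ℕ.^ n ℕ.* b ℕ.^ n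
  ^-distribʳ-* a b zero = ≡.refl
  ^-distribʳ-* a b (suc n) = ≡.trans (cong (a ℕ.* b ℕ.*_) (^-distribʳ-* a b n)) (N.solve 4 (λ a b u v → (a N.:* b) N.:* (u N.:* v) N.:= (a N.:* u) N.:* (b N.:* v)) ≡.refl a b _ _)

  -- `bernoulli` with exponent `2^y ≥ y`.
  doubling : ∀ y → 1 ≤ y → 2 ℕ.* y ℕ.^ (2 ℕ.^ y) ≤ suc y ℕ.^ (2 ℕ.^ y)
  doubling y@(suc _) _ = *-cancelʳ-≤ _ _ y (begin
    2 ℕ.* y ℕ.^ e ℕ.* y    ≡⟨ N.solve 2 (λ p y → N.con 2 N.:* p N.:* y N.:= p N.:* (y N.:+ y)) ≡.refl (y ℕ.^ e) y ⟩
    y ℕ.^ e ℕ.* (y ℕ.+ y)  ≤⟨ *-monoʳ-≤ (y ℕ.^ e) (+-monoʳ-≤ y (<⇒≤ (n<2^n y))) ⟩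
    y ℕ.^ e ℕ.* (y ℕ.+ e)  ≤⟨ NatLemmas.bernoulli y e ⟩
    suc y ℕ.^ e ℕ.* y ∎)
    where
    e : ℕ
    e = 2 ℕ.^ y

  -- If `x ≥ y + 1`, then for `j = y + i` the ratio of the powers is at least `2^(2^i)` by
  -- `doubling`, while the polynomial factor is only `2^(K + jβ)`; `linear<exponential` supplies an
  -- `i` with a contradiction.
  growth : ∀ x y K β → (∀ j → 1 ≤ j → x ℕ.^ (2 ℕ.^ j) ≤ K ℕ.* (2 ℕ.^ j) ℕ.^ β ℕ.* y ℕ.^ (2 ℕ.^ j)) → x ≤ y
  growth x zero K β h = ≮⇒≥ λ lt → <⇒≱ (*-mono-≤ lt (*-mono-≤ lt (≤-refl {1}))) (≤-trans (h 1 (s≤s z≤n)) (≤-reflexive (ℕP.*-zeroʳ (K ℕ.* 2 ℕ.^ β))))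
  growth x y@(suc _) K β h = ≮⇒≥ λ y<x → contradiction y<x
    where
    i : ℕ
    i = proj₁ (linear<exponential (K ℕ.+ y ℕ.* β) β)
    big : K ℕ.+ y ℕ.* β ℕ.+ i ℕ.* β < 2 ℕ.^ i
    big = proj₂ (linear<exponential (K ℕ.+ y ℕ.* β) β)
    j : ℕ
    j = y ℕ.+ i
    Y : ℕ
    Y = y ℕ.^ (2 ℕ.^ j)
    j-split : 2 ℕ.^ j ≡ 2 ℕ.^ y ℕ.* 2 ℕ.^ i
    j-split = ℕP.^-distribˡ-+-* 2 y i
    contradiction : y < x → ⊥
    contradiction y<x = <⇒≱ big (≮⇒≥ λ lt → <-irrefl ≡.refl (<-≤-trans (^-monoʳ-< 2 (s≤s (s≤s z≤n)) lt) (begin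
      2 ℕ.^ (2 ℕ.^ i)                   ≤⟨ *-cancelʳ-≤ _ _ Y {{ℕP.m^n≢0 y (2 ℕ.^ j)}} chain ⟩
      K ℕ.* (2 ℕ.^ j) ℕ.^ β             ≤⟨ *-mono-≤ (<⇒≤ (n<2^n K)) (≤-reflexive (ℕP.^-*-assoc 2 j β)) ⟩
      2 ℕ.^ K ℕ.* 2 ℕ.^ (j ℕ.* β)       ≡⟨ ≡.sym (ℕP.^-distribˡ-+-* 2 K (j ℕ.* β)) ⟩
      2 ℕ.^ (K ℕ.+ j ℕ.* β)             ≡⟨ cong (2 ℕ.^_) (N.solve 4 (λ K y i b → K N.:+ (y N.:+ i) N.:* b N.:= K N.:+ y N.:* b N.:+ i N.:* b) ≡.refl K y i β) ⟩
      2 ℕ.^ (K ℕ.+ y ℕ.* β ℕ.+ i ℕ.* β) ∎)))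
      where
      chain : 2 ℕ.^ (2 ℕ.^ i) ℕ.* Y ≤ K ℕ.* (2 ℕ.^ j) ℕ.^ β ℕ.* Y
      chain = begin
        2 ℕ.^ (2 ℕ.^ i) ℕ.* Y                                   ≡⟨ cong (2 ℕ.^ (2 ℕ.^ i) ℕ.*_) (≡.trans (cong (y ℕ.^_) j-split) (≡.sym (ℕP.^-*-assoc y (2 ℕ.^ y) (2 ℕ.^ i)))) ⟩
        2 ℕ.^ (2 ℕ.^ i) ℕ.* (y ℕ.^ (2 ℕ.^ y)) ℕ.^ (2 ℕ.^ i)     ≡⟨ ≡.sym (^-distribʳ-* 2 (y ℕ.^ (2 ℕ.^ y)) (2 ℕ.^ i)) ⟩
        (2 ℕ.* y ℕ.^ (2 ℕ.^ y)) ℕ.^ (2 ℕ.^ i)                   ≤⟨ ^-monoˡ-≤ (2 ℕ.^ i) (doubling y (s≤s z≤n)) ⟩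
        (suc y ℕ.^ (2 ℕ.^ y)) ℕ.^ (2 ℕ.^ i)                     ≡⟨ ≡.trans (ℕP.^-*-assoc (suc y) (2 ℕ.^ y) (2 ℕ.^ i)) (cong (suc y ℕ.^_) (≡.sym j-split)) ⟩
        suc y ℕ.^ (2 ℕ.^ j)                                     ≤⟨ ^-monoˡ-≤ (2 ℕ.^ j) y<x ⟩
        x ℕ.^ (2 ℕ.^ j)                                         ≤⟨ h j (s≤s z≤n) ⟩
        K ℕ.* (2 ℕ.^ j) ℕ.^ β ℕ.* Y ∎

-- The convolution algebra, its norm and its involution

-- The ring of K-valued functions on F under multiplicative convolution.
module Convolution {q : ℕ} (F : FiniteField q) (K : CommutativeRing 0ℓ 0ℓ) where
  private
    module F = FieldFacts F
  open RingKit K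
  open SemiringSum commutativeSemiring
  open Delta F._≟_
  open F using (elements; elements-unique; ∈elements) renaming (Carrier to X; _*_ to _×F_; 1# to 1F)
  open import Relation.Binary.Reasoning.Setoid setoid

  private
    Fun : Set
    Fun = X → Carrier

    S : Fun → Carrier
    S = ∑ elements

    record _≐_ (a b : Fun) : Set where
      constructor pw
      field at′ : ∀ x → a x ≈ b x

    _∗_ : Fun → Fun → Fun
    (a ∗ b) z = S λ x → S λ y → δ (x ×F y) z * (a x * b y)

    pick : ∀ (x : X) (f : Fun) → S (λ y → δ x y * f y) ≈ f x
    pick x f = trans (∑-pick elements x _ elements-unique (∈elements x) (λ y _ ne → trans (*-congʳ (δ-≢ (λ e → ne (≡.sym e)))) (zeroˡ (f y))))
      (trans (*-congʳ (δ-refl x)) (*-identityˡ (f x)))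

    -- Testing a convolution against `ψ` eliminates the delta functions; associativity follows from
    -- two uses.
    pairing : ∀ (a b ψ : Fun) → S (λ z → (a ∗ b) z * ψ z) ≈ S λ x → S λ y → (a x * b y) * ψ (x ×F y)
    pairing a b ψ = begin
      S (λ z → (a ∗ b) z * ψ z)
        ≈⟨ ∑-cong elements (λ z → trans (sym (∑-*ʳ elements (ψ z) _)) (∑-cong elements λ x → trans (sym (∑-*ʳ elements (ψ z) _)) (∑-cong elements λ y → *-assoc _ _ _))) ⟩
      S (λ z → S λ x → S λ y → δ (x ×F y) z * ((a x * b y) * ψ z))
        ≈⟨ trans (∑-swap elements elements _) (∑-cong elements λ x → ∑-swap elements elements _) ⟩
      S (λ x → S λ y → S λ z → δ (x ×F y) z * ((a x * b y) * ψ z))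
        ≈⟨ ∑-cong elements (λ x → ∑-cong elements λ y → pick (x ×F y) (λ z → (a x * b y) * ψ z)) ⟩
      S (λ x → S λ y → (a x * b y) * ψ (x ×F y)) ∎

    ∗-cong : ∀ {a a′ b b′} → a ≐ a′ → b ≐ b′ → (a ∗ b) ≐ (a′ ∗ b′)
    ∗-cong (pw e) (pw f) = pw λ z → ∑-cong elements λ x → ∑-cong elements λ y → *-congˡ (*-cong (e x) (f y))

    ∗-comm : ∀ a b → (a ∗ b) ≐ (b ∗ a)
    ∗-comm a b = pw λ z → trans (∑-swap elements elements _) (∑-cong elements λ y → ∑-cong elements λ x → *-cong (reflexive (cong (λ u → δ u z) (F.*-comm x y))) (*-comm (a x) (b y)))

    ∗-assoc : ∀ a b c → ((a ∗ b) ∗ c) ≐ (a ∗ (b ∗ c))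
    ∗-assoc a b c = pw λ z → begin
      S (λ u → S λ w → δ (u ×F w) z * ((a ∗ b) u * c w))
        ≈⟨ ∑-cong elements (λ u → trans (∑-cong elements λ w → solve 3 (λ d m c → d :* (m :* c) := m :* (d :* c)) refl (δ (u ×F w) z) ((a ∗ b) u) (c w)) (∑-*ˡ elements ((a ∗ b) u) _)) ⟩
      S (λ u → (a ∗ b) u * S (λ w → δ (u ×F w) z * c w)) ≈⟨ pairing a b (λ u → S (λ w → δ (u ×F w) z * c w)) ⟩
      S (λ x → S λ y → (a x * b y) * S (λ w → δ ((x ×F y) ×F w) z * c w))
        ≈⟨ ∑-cong elements (λ x → trans (∑-cong elements λ y → trans (sym (∑-*ˡ elements (a x * b y) _)) (trans (∑-cong elements λ w →
             trans (reflexive (cong (λ u → (a x * b y) * (δ u z * c w)) (F.*-assoc x y w))) (solve 4 (λ a b d c → (a :* b) :* (d :* c) := a :* ((b :* c) :* d)) refl (a x) (b y) _ (c w)))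
               (∑-*ˡ elements (a x) _))) (∑-*ˡ elements (a x) _)) ⟩
      S (λ x → a x * S λ y → S λ w → (b y * c w) * δ (x ×F (y ×F w)) z)
        ≈⟨ ∑-cong elements (λ x → *-congˡ (sym (pairing b c (λ v → δ (x ×F v) z)))) ⟩
      S (λ x → a x * S λ v → (b ∗ c) v * δ (x ×F v) z)
        ≈⟨ ∑-cong elements (λ x → trans (sym (∑-*ˡ elements (a x) _)) (∑-cong elements λ v → solve 3 (λ a m d → a :* (m :* d) := d :* (a :* m)) refl (a x) ((b ∗ c) v) _)) ⟩
      S (λ x → S λ v → δ (x ×F v) z * (a x * (b ∗ c) v)) ∎

    ∗-identityˡ : ∀ a → (δ 1F ∗ a) ≐ a
    ∗-identityˡ a = pw λ z → begin
      S (λ x → S λ y → δ (x ×F y) z * (δ 1F x * a y))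
        ≈⟨ ∑-cong elements (λ x → trans (∑-cong elements λ y → solve 3 (λ d e a → d :* (e :* a) := e :* (d :* a)) refl (δ (x ×F y) z) (δ 1F x) (a y)) (∑-*ˡ elements (δ 1F x) _)) ⟩
      S (λ x → δ 1F x * S (λ y → δ (x ×F y) z * a y)) ≈⟨ pick 1F _ ⟩
      S (λ y → δ (1F ×F y) z * a y) ≈⟨ ∑-cong elements (λ y → *-congʳ (reflexive (cong (λ u → δ u z) (F.*-identityˡ y)))) ⟩
      S (λ y → δ y z * a y) ≈⟨ ∑-δ elements z a elements-unique (∈elements z) ⟩
      a z ∎

    ∗-distribˡ : ∀ a b c → (a ∗ (λ x → b x + c x)) ≐ (λ x → (a ∗ b) x + (a ∗ c) x)
    ∗-distribˡ a b c = pw λ z → trans (∑-cong elements λ x → trans (∑-cong elements λ y →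
        solve 4 (λ d a b c → d :* (a :* (b :+ c)) := d :* (a :* b) :+ d :* (a :* c)) refl (δ (x ×F y) z) (a x) (b y) (c y)) (∑-+ elements _ _))
      (∑-+ elements _ _)

    ≐-refl : ∀ {a} → a ≐ a
    ≐-refl = pw λ x → refl
    ≐-sym : ∀ {a b} → a ≐ b → b ≐ a
    ≐-sym (pw e) = pw λ x → sym (e x)
    ≐-trans : ∀ {a b c} → a ≐ b → b ≐ c → a ≐ c
    ≐-trans (pw e) (pw f) = pw λ x → trans (e x) (f x)
    +-cong′ : ∀ {a a′ b b′} → a ≐ a′ → b ≐ b′ → (λ x → a x + b x) ≐ (λ x → a′ x + b′ x)
    +-cong′ (pw e) (pw f) = pw λ x → +-cong (e x) (f x)

    algebraRing : CommutativeRing 0ℓ 0ℓ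
    algebraRing = record
      { Carrier = Fun ; _≈_ = _≐_ ; _+_ = λ a b x → a x + b x ; _*_ = _∗_ ; -_ = λ a x → - a x ; 0# = λ _ → 0# ; 1# = δ 1F
      ; isCommutativeRing = record
        { isRing = record
          { +-isAbelianGroup = record
            { isGroup = record
              { isMonoid = record
                { isSemigroup = record
                  { isMagma = record { isEquivalence = record { refl = ≐-refl ; sym = ≐-sym ; trans = ≐-trans } ; ∙-cong = +-cong′ }
                  ; assoc = λ a b c → pw λ x → +-assoc (a x) (b x) (c x) }
                ; identity = (λ a → pw λ x → +-identityˡ (a x)) , (λ a → pw λ x → +-identityʳ (a x)) }
              ; inverse = (λ a → pw λ x → -‿inverseˡ (a x)) , (λ a → pw λ x → -‿inverseʳ (a x))
              ; ⁻¹-cong = λ { (pw e) → pw λ x → -‿cong (e x) } }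
            ; comm = λ a b → pw λ x → +-comm (a x) (b x) }
          ; *-cong = ∗-cong
          ; *-assoc = ∗-assoc
          ; *-identity = ∗-identityˡ , λ a → ≐-trans (∗-comm a _) (∗-identityˡ a)
          ; distrib = ∗-distribˡ , λ a b c → ≐-trans (∗-comm _ a) (≐-trans (∗-distribˡ a b c) (+-cong′ (∗-comm a b) (∗-comm a c))) }
        ; *-comm = ∗-comm } }

  abstract
    algebra : CommutativeRing 0ℓ 0ℓ
    algebra = algebraRing

  module A = RingKit algebra

  infix 8 _⟨_⟩
  abstract
    _⟨_⟩ : A.Carrier → X → Carrier
    a ⟨ x ⟩ = a x

    fromFun : (X → Carrier) → A.Carrier
    fromFun a = a

    ⟨fromFun⟩ : ∀ a x → fromFun a ⟨ x ⟩ ≈ a x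
    ⟨fromFun⟩ a x = refl

    ⟨⟩-cong : ∀ {a b} → a A.≈ b → ∀ x → a ⟨ x ⟩ ≈ b ⟨ x ⟩
    ⟨⟩-cong = _≐_.at′

    ≈A-intro : ∀ {a b} → (∀ x → a ⟨ x ⟩ ≈ b ⟨ x ⟩) → a A.≈ b
    ≈A-intro = pw

    ⟨+⟩ : ∀ a b x → (a A.+ b) ⟨ x ⟩ ≈ a ⟨ x ⟩ + b ⟨ x ⟩
    ⟨+⟩ a b x = refl

    ⟨neg⟩ : ∀ a x → (A.- a) ⟨ x ⟩ ≈ - (a ⟨ x ⟩)
    ⟨neg⟩ a x = refl

    ⟨0⟩ : ∀ x → A.0# ⟨ x ⟩ ≈ 0#
    ⟨0⟩ x = refl

    ⟨*⟩ : ∀ a b z → (a A.* b) ⟨ z ⟩ ≈ S λ x → S λ y → δ (x ×F y) z * (a ⟨ x ⟩ * b ⟨ y ⟩)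
    ⟨*⟩ a b z = refl

    χ : X → A.Carrier
    χ x = δ x

    ⟨χ⟩ : ∀ x z → χ x ⟨ z ⟩ ≈ δ x z
    ⟨χ⟩ x z = refl

    χ-1 : χ 1F A.≈ A.1#
    χ-1 = A.refl

    χ-* : ∀ x y → χ (x ×F y) A.≈ χ x A.* χ y
    χ-* x y = pw λ z → sym (begin
      S (λ u → S λ v → δ (u ×F v) z * (δ x u * δ y v))
        ≈⟨ ∑-cong elements (λ u → trans (∑-cong elements λ v → solve 3 (λ d e f → d :* (e :* f) := e :* (f :* d)) refl (δ (u ×F v) z) (δ x u) (δ y v)) (∑-*ˡ elements (δ x u) _)) ⟩
      S (λ u → δ x u * S (λ v → δ y v * δ (u ×F v) z)) ≈⟨ pick x _ ⟩
      S (λ v → δ y v * δ (x ×F v) z) ≈⟨ pick y _ ⟩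
      δ (x ×F y) z ∎)

module GroupAlgebra {q : ℕ} (F : FiniteField q) where
  private
    module F = FieldFacts F
    module Z where
      open SemiringSum (CommutativeRing.commutativeSemiring ℤP.+-*-commutativeRing) public
      open Delta F._≟_ public
    module ℕ∑ = SemiringSum ℕP.+-*-commutativeSemiring
  open F using (elements; elements-unique; ∈elements; _⁻¹) renaming (Carrier to X; _*_ to _×F_; 1# to 1F; 0# to 0F)
  open Convolution F ℤP.+-*-commutativeRing public
  open import Data.Integer using (_+_; _*_)

  private
    S : (X → ℤ) → ℤ
    S = Z.∑ elements

  ∣∑∣ : ∀ {Y : Set} (ys : List Y) f → ℤ.∣ Z.∑ ys f ∣ ≤ ℕ∑.∑ ys (λ y → ℤ.∣ f y ∣)
  ∣∑∣ [] f = z≤n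
  ∣∑∣ (y ∷ ys) f = ≤-trans (ℤP.∣i+j∣≤∣i∣+∣j∣ (f y) _) (+-monoʳ-≤ ℤ.∣ f y ∣ (∣∑∣ ys f))

  -- The `ℓ¹` norm, which is submultiplicative under convolution.
  ∥_∥ : A.Carrier → ℕ
  ∥ a ∥ = ℕ∑.∑ elements (λ z → ℤ.∣ a ⟨ z ⟩ ∣)

  ∥∥-cong : ∀ {a b} → a A.≈ b → ∥ a ∥ ≡ ∥ b ∥
  ∥∥-cong e = ℕ∑.∑-cong elements (λ z → cong ℤ.∣_∣ (⟨⟩-cong e z))

  ∥∥-+ : ∀ a b → ∥ a A.+ b ∥ ≤ ∥ a ∥ ℕ.+ ∥ b ∥
  ∥∥-+ a b = ≤-trans (NatLemmas.∑≤ elements (λ z _ → ≤-trans (≤-reflexive (cong ℤ.∣_∣ (⟨+⟩ a b z))) (ℤP.∣i+j∣≤∣i∣+∣j∣ (a ⟨ z ⟩) (b ⟨ z ⟩))))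
    (≤-reflexive (ℕ∑.∑-+ elements _ _))

  ∥∥-neg : ∀ a → ∥ A.- a ∥ ≡ ∥ a ∥
  ∥∥-neg a = ℕ∑.∑-cong elements (λ z → ≡.trans (cong ℤ.∣_∣ (⟨neg⟩ a z)) (ℤP.∣-i∣≡∣i∣ (a ⟨ z ⟩)))

  ∥∥-0 : ∥ A.0# ∥ ≡ 0
  ∥∥-0 = ℕ∑.∑-zero elements (λ z _ → cong ℤ.∣_∣ (⟨0⟩ z))

  ⟨nat*⟩ : ∀ n a z → (A.nat n A.* a) ⟨ z ⟩ ≡ + n * a ⟨ z ⟩
  ⟨nat*⟩ zero a z = ≡.trans (⟨⟩-cong (A.zeroˡ a) z) (≡.trans (⟨0⟩ z) (≡.sym (ℤP.*-zeroˡ (a ⟨ z ⟩))))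
  ⟨nat*⟩ (suc n) a z = ≡.trans (⟨⟩-cong (A.trans (A.distribʳ a A.1# (A.nat n)) (A.+-congʳ (A.*-identityˡ a))) z)
    (≡.trans (⟨+⟩ a _ z) (≡.trans (cong (a ⟨ z ⟩ +_) (⟨nat*⟩ n a z)) (≡.sym (ℤP.suc-* (+ n) (a ⟨ z ⟩)))))

  ∥∥-nat : ∀ n a → ∥ A.nat n A.* a ∥ ≡ n ℕ.* ∥ a ∥
  ∥∥-nat n a = ≡.trans (ℕ∑.∑-cong elements (λ z → ≡.trans (cong ℤ.∣_∣ (⟨nat*⟩ n a z)) (ℤP.abs-* (+ n) (a ⟨ z ⟩)))) (ℕ∑.∑-*ˡ elements n _)

  private
    module ℕδ = ℕ∑.Delta F._≟_

    ∣δ∣ : ∀ x z → ℤ.∣ Z.δ x z ∣ ≡ ℕδ.δ x z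
    ∣δ∣ x z = go (x F.≟ z)
      where
      go : ∀ {Q : Set} (d : Dec Q) → ℤ.∣ Z.[ d ]ᵢ ∣ ≡ ℕ∑.[ d ]ᵢ
      go (yes _) = ≡.refl
      go (no _) = ≡.refl

    ℕpick : ∀ (x : X) k → ℕ∑.∑ elements (λ z → ℕδ.δ x z ℕ.* k) ≡ k
    ℕpick x k = ≡.trans (ℕ∑.∑-pick elements x _ elements-unique (∈elements x) (λ y _ ne → cong (ℕ._* k) (ℕδ.δ-≢ (λ e → ne (≡.sym e)))))
      (≡.trans (cong (ℕ._* k) (ℕδ.δ-refl x)) (ℕP.*-identityˡ k))

  ∥∥-* : ∀ a b → ∥ a A.* b ∥ ≤ ∥ a ∥ ℕ.* ∥ b ∥
  ∥∥-* a b = ≤-trans (NatLemmas.∑≤ elements (λ z _ → ≤-trans (≤-reflexive (cong ℤ.∣_∣ (⟨*⟩ a b z))) (≤-trans (∣∑∣ elements _)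
      (NatLemmas.∑≤ elements (λ x _ → ≤-trans (∣∑∣ elements _) (≤-reflexive (ℕ∑.∑-cong elements λ y →
        ≡.trans (ℤP.abs-* (Z.δ (x ×F y) z) _) (cong₂ ℕ._*_ (∣δ∣ (x ×F y) z) (ℤP.abs-* (a ⟨ x ⟩) (b ⟨ y ⟩)))))))) ))
    (≤-reflexive (≡.trans (≡.trans (ℕ∑.∑-swap elements elements _) (ℕ∑.∑-cong elements λ x → ℕ∑.∑-swap elements elements _))
      (≡.trans (ℕ∑.∑-cong elements λ x → ≡.trans (ℕ∑.∑-cong elements λ y → ℕpick (x ×F y) _) (ℕ∑.∑-*ˡ elements ℤ.∣ a ⟨ x ⟩ ∣ _)) (ℕ∑.∑-*ʳ elements ∥ b ∥ _))))

  ⁻¹-involutive : ∀ x → (x ⁻¹) ⁻¹ ≡ x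
  ⁻¹-involutive x = case x F.≟ 0F of λ
    { (yes ≡.refl) → ≡.trans (cong _⁻¹ F.0⁻¹) F.0⁻¹
    ; (no nx) → F.*-cancelˡ (x ⁻¹) (F.⁻¹-≢0 nx) (≡.trans (F.*-inverseʳ (F.⁻¹-≢0 nx)) (≡.sym (F.*-inverseˡ nx))) }

  ⁻¹-* : ∀ x y → (x ×F y) ⁻¹ ≡ x ⁻¹ ×F y ⁻¹
  ⁻¹-* x y = case x F.≟ 0F of λ
    { (yes ≡.refl) → ≡.trans (cong _⁻¹ (F.zeroˡ y)) (≡.trans F.0⁻¹ (≡.sym (≡.trans (cong (_×F y ⁻¹) F.0⁻¹) (F.zeroˡ _))))
    ; (no nx) → case y F.≟ 0F of λ
      { (yes ≡.refl) → ≡.trans (cong _⁻¹ (F.zeroʳ x)) (≡.trans F.0⁻¹ (≡.sym (≡.trans (cong (x ⁻¹ ×F_) F.0⁻¹) (F.zeroʳ _))))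
      ; (no ny) → F.*-cancelˡ (x ×F y) (F.*-≢0 nx ny) (≡.trans (F.*-inverseʳ (F.*-≢0 nx ny)) (≡.sym (≡.trans
          (F.solve 4 (λ x y u v → (x F.:* y) F.:* (u F.:* v) F.:= (x F.:* u) F.:* (y F.:* v)) ≡.refl x y (x ⁻¹) (y ⁻¹))
          (≡.trans (cong₂ _×F_ (F.*-inverseʳ nx) (F.*-inverseʳ ny)) (F.*-identityˡ 1F))))) } }

  -- The involution corresponding to complex conjugation of character values; it is defined at `0`
  -- through `0 ⁻¹ = 0`.
  star : A.Carrier → A.Carrier
  star a = fromFun (λ z → a ⟨ z ⁻¹ ⟩)

  ⟨star⟩ : ∀ a z → star a ⟨ z ⟩ ≡ a ⟨ z ⁻¹ ⟩
  ⟨star⟩ a z = ⟨fromFun⟩ _ z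

  ∑-⁻¹ : ∀ (f : X → ℤ) → S (λ x → f (x ⁻¹)) ≡ S f
  ∑-⁻¹ f = Z.∑-bij _⁻¹ _⁻¹ f elements-unique elements-unique (λ x _ → ∈elements _ , ⁻¹-involutive x) (λ x _ → ∈elements _ , ⁻¹-involutive x)

  star-* : ∀ a b → star (a A.* b) A.≈ star a A.* star b
  star-* a b = ≈A-intro λ z → ≡.trans (⟨star⟩ (a A.* b) z) (≡.trans (⟨*⟩ a b (z ⁻¹)) (≡.trans (≡.sym (≡.trans (Z.∑-cong elements λ x → ∑-⁻¹ _) (∑-⁻¹ _)))
    (≡.sym (≡.trans (⟨*⟩ (star a) (star b) z) (Z.∑-cong elements λ x → Z.∑-cong elements λ y → cong₂ _*_ (δ-⁻¹ x y z) (cong₂ _*_ (⟨star⟩ a x) (⟨star⟩ b y)))))))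
    where
    δ-⁻¹ : ∀ x y z → Z.δ (x ×F y) z ≡ Z.δ (x ⁻¹ ×F y ⁻¹) (z ⁻¹)
    δ-⁻¹ x y z = Z.ind-⇔ ((x ×F y) F.≟ z) ((x ⁻¹ ×F y ⁻¹) F.≟ (z ⁻¹))
      (λ e → ≡.trans (≡.sym (⁻¹-* x y)) (cong _⁻¹ e))
      (λ e → ≡.trans (≡.sym (⁻¹-involutive _)) (≡.trans (cong _⁻¹ (≡.trans (⁻¹-* x y) e)) (⁻¹-involutive z)))

  star-star : ∀ a → star (star a) A.≈ a
  star-star a = ≈A-intro λ z → ≡.trans (⟨star⟩ (star a) z) (≡.trans (⟨star⟩ a (z ⁻¹)) (cong (a ⟨_⟩) (⁻¹-involutive z)))

  star-cong : ∀ {a b} → a A.≈ b → star a A.≈ star b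
  star-cong {a} {b} e = ≈A-intro λ z → ≡.trans (⟨star⟩ a z) (≡.trans (⟨⟩-cong e (z ⁻¹)) (≡.sym (⟨star⟩ b z)))

  ∥star∥ : ∀ a → ∥ star a ∥ ≡ ∥ a ∥
  ∥star∥ a = ≡.trans (ℕ∑.∑-cong elements (λ z → cong ℤ.∣_∣ (⟨star⟩ a z)))
    (ℕ∑.∑-bij _⁻¹ _⁻¹ (λ z → ℤ.∣ a ⟨ z ⟩ ∣) elements-unique elements-unique (λ x _ → ∈elements _ , ⁻¹-involutive x) (λ x _ → ∈elements _ , ⁻¹-involutive x))

  -- (a a*)(1) is the sum of the squares of the values of a on units.
  square≤ : ∀ a t → t ≢ 0F → a ⟨ t ⟩ * a ⟨ t ⟩ ℤ.≤ (a A.* star a) ⟨ 1F ⟩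
  square≤ a t nt = subst (a ⟨ t ⟩ * a ⟨ t ⟩ ℤ.≤_) (≡.sym value) (ℤP.≤-trans (ℤP.≤-reflexive (≡.sym (term t nt))) (single elements (∈elements t)))
    where
    T : X → ℤ
    T x = S λ y → Z.δ (x ×F y) 1F * (a ⟨ x ⟩ * a ⟨ y ⁻¹ ⟩)
    value : (a A.* star a) ⟨ 1F ⟩ ≡ S T
    value = ≡.trans (⟨*⟩ a (star a) 1F) (Z.∑-cong elements λ x → Z.∑-cong elements λ y → cong (λ u → Z.δ (x ×F y) 1F * (a ⟨ x ⟩ * u)) (⟨star⟩ a y))
    term : ∀ x → x ≢ 0F → T x ≡ a ⟨ x ⟩ * a ⟨ x ⟩
    term x nx = ≡.trans (Z.∑-pick elements (x ⁻¹) _ elements-unique (∈elements _) (λ y _ ne → ≡.trans (cong (_* (a ⟨ x ⟩ * a ⟨ y ⁻¹ ⟩))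
        (Z.δ-≢ (λ e → ne (F.*-cancelˡ x nx (≡.trans e (≡.sym (F.*-inverseʳ nx))))))) (ℤP.*-zeroˡ (a ⟨ x ⟩ * a ⟨ y ⁻¹ ⟩))))
      (≡.trans (cong₂ _*_ (≡.trans (cong (λ u → Z.δ u 1F) (F.*-inverseʳ nx)) (Z.δ-refl 1F)) (cong (λ u → a ⟨ x ⟩ * a ⟨ u ⟩) (⁻¹-involutive x))) (ℤP.*-identityˡ _))
    zero-term : T 0F ≡ + 0
    zero-term = Z.∑-zero elements (λ y _ → ≡.trans (cong (_* (a ⟨ 0F ⟩ * a ⟨ y ⁻¹ ⟩)) (Z.δ-≢ (λ e → F.1≢0 (≡.trans (≡.sym e) (F.zeroˡ y))))) (ℤP.*-zeroˡ (a ⟨ 0F ⟩ * a ⟨ y ⁻¹ ⟩)))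
    0≤square : ∀ (i : ℤ) → + 0 ℤ.≤ i * i
    0≤square (+ n) = subst (+ 0 ℤ.≤_) (ℤP.pos-* n n) (ℤ.+≤+ z≤n)
    0≤square -[1+ n ] = ℤ.+≤+ z≤n
    nonneg : ∀ x → + 0 ℤ.≤ T x
    nonneg x = case x F.≟ 0F of λ { (yes ≡.refl) → ℤP.≤-reflexive (≡.sym zero-term) ; (no nx) → subst (+ 0 ℤ.≤_) (≡.sym (term x nx)) (0≤square (a ⟨ x ⟩)) }
    0≤∑ : ∀ xs → + 0 ℤ.≤ Z.∑ xs T
    0≤∑ [] = ℤP.≤-refl
    0≤∑ (x ∷ xs) = ℤP.+-mono-≤ (nonneg x) (0≤∑ xs)
    single : ∀ xs {x} → x ∈ xs → T x ℤ.≤ Z.∑ xs T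
    single (x ∷ xs) (here ≡.refl) = subst (ℤ._≤ T x + Z.∑ xs T) (ℤP.+-identityʳ (T x)) (ℤP.+-monoʳ-≤ (T x) (0≤∑ xs))
    single (y ∷ xs) {x} (there i) = subst (ℤ._≤ T y + Z.∑ xs T) (ℤP.+-identityˡ (T x)) (ℤP.+-mono-≤ (nonneg y) (single xs i))

  ∣value∣≤∥∥ : ∀ a x → ℤ.∣ a ⟨ x ⟩ ∣ ≤ ∥ a ∥
  ∣value∣≤∥∥ a x = go elements (∈elements x)
    where
    go : ∀ xs → x ∈ xs → ℤ.∣ a ⟨ x ⟩ ∣ ≤ ℕ∑.∑ xs (λ z → ℤ.∣ a ⟨ z ⟩ ∣)
    go (x ∷ xs) (here ≡.refl) = m≤m+n _ _
    go (y ∷ xs) (there i) = ≤-trans (go xs i) (m≤n+m _ _)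

  private
    square-abs : ∀ (i : ℤ) → i * i ≡ + (ℤ.∣ i ∣ ℕ.* ℤ.∣ i ∣)
    square-abs (+ n) = ≡.sym (ℤP.pos-* n n)
    square-abs -[1+ n ] = ≡.refl

    ∣∣-mono : ∀ {m : ℕ} {j} → + m ℤ.≤ j → m ≤ ℤ.∣ j ∣
    ∣∣-mono (ℤ.+≤+ le) = le

  -- The power trick: ∣a(t)∣² is bounded by the growth rate of ∥a^N∥².
  squares : ∀ j a t → t ≢ 0F → (ℤ.∣ a ⟨ t ⟩ ∣ ℕ.* ℤ.∣ a ⟨ t ⟩ ∣) ℕ.^ (2 ℕ.^ j) ≤ ∥ a A.^ (2 ℕ.^ j) ∥ ℕ.* ∥ a A.^ (2 ℕ.^ j) ∥
  squares j a t nt = ≤-trans (^-monoˡ-≤ (2 ℕ.^ j) (at-one a t nt)) (≤-trans (go j a) (≤-trans (∣value∣≤∥∥ _ 1F)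
      (≤-trans (∥∥-* _ _) (≤-reflexive (cong (∥ a A.^ (2 ℕ.^ j) ∥ ℕ.*_) (∥star∥ _))))))
    where
    at-one : ∀ a t → t ≢ 0F → ℤ.∣ a ⟨ t ⟩ ∣ ℕ.* ℤ.∣ a ⟨ t ⟩ ∣ ≤ ℤ.∣ (a A.* star a) ⟨ 1F ⟩ ∣
    at-one a t nt = ∣∣-mono (subst (ℤ._≤ (a A.* star a) ⟨ 1F ⟩) (square-abs (a ⟨ t ⟩)) (square≤ a t nt))
    -- One doubling: for `b = a a*` one has `b(1)² ≤ (b b*)(1)`, and `b b* = a² (a²)*`.
    go : ∀ j a → ℤ.∣ (a A.* star a) ⟨ 1F ⟩ ∣ ℕ.^ (2 ℕ.^ j) ≤ ℤ.∣ (a A.^ (2 ℕ.^ j) A.* star (a A.^ (2 ℕ.^ j))) ⟨ 1F ⟩ ∣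
    go zero a = ≤-reflexive (≡.trans (ℕP.*-identityʳ _) (cong ℤ.∣_∣ (⟨⟩-cong (A.sym (A.*-cong (A.^-1 a) (star-cong (A.^-1 a)))) 1F)))
    go (suc j) a = ≤-trans (≤-reflexive (≡.trans (≡.sym (ℕP.^-*-assoc B 2 (2 ℕ.^ j))) (cong (ℕ._^ (2 ℕ.^ j)) (cong (B ℕ.*_) (ℕP.*-identityʳ B)))))
      (≤-trans (^-monoˡ-≤ (2 ℕ.^ j) (≤-trans (at-one b 1F F.1≢0) (≤-reflexive (cong ℤ.∣_∣ (⟨⟩-cong self-adjoint 1F)))))
        (≤-trans (go j (a A.* a)) (≤-reflexive (cong ℤ.∣_∣ (⟨⟩-cong (A.*-cong powers (star-cong powers)) 1F)))))
      where
      b : A.Carrier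
      b = a A.* star a
      B : ℕ
      B = ℤ.∣ b ⟨ 1F ⟩ ∣
      powers : (a A.* a) A.^ (2 ℕ.^ j) A.≈ a A.^ (2 ℕ.^ suc j)
      powers = A.trans (A.^-congˡ (2 ℕ.^ j) (A.*-congˡ (A.sym (A.^-1 a)))) (A.^-assocʳ a 2 (2 ℕ.^ j))
      self-adjoint : b A.* star b A.≈ (a A.* a) A.* star (a A.* a)
      self-adjoint = A.trans (A.*-congˡ (A.trans (star-* a (star a)) (A.*-congˡ (star-star a))))
        (A.trans (A.solve 2 (λ a s → (a A.:* s) A.:* (s A.:* a) A.:= (a A.:* a) A.:* (s A.:* s)) A.refl a (star a)) (A.*-congˡ (A.sym (star-* a a))))

-- Series that become polynomials after removing the trivial character

-- The quotient of R by the annihilator of κ.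
module Annihilator (R : CommutativeRing 0ℓ 0ℓ) (κ : CommutativeRing.Carrier R) where
  open RingKit R

  infix 4 _≈κ_
  record _≈κ_ (a b : Carrier) : Set where
    constructor κ≈
    field scaled : κ * a ≈ κ * b
  open _≈κ_ public

  ≈⇒≈κ : ∀ {a b} → a ≈ b → a ≈κ b
  ≈⇒≈κ e = κ≈ (*-congˡ e)

  reduced : CommutativeRing 0ℓ 0ℓ
  reduced = record
    { Carrier = Carrier ; _≈_ = _≈κ_ ; _+_ = _+_ ; _*_ = _*_ ; -_ = -_ ; 0# = 0# ; 1# = 1#
    ; isCommutativeRing = record
      { isRing = record
        { +-isAbelianGroup = record
          { isGroup = record
            { isMonoid = record
              { isSemigroup = record
                { isMagma = record
                  { isEquivalence = record { refl = κ≈ refl ; sym = λ (κ≈ p) → κ≈ (sym p) ; trans = λ (κ≈ p) (κ≈ r) → κ≈ (trans p r) }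
                  ; ∙-cong = λ (κ≈ p) (κ≈ r) → κ≈ (trans (distribˡ _ _ _) (trans (+-cong p r) (sym (distribˡ _ _ _)))) }
                ; assoc = λ a b c → ≈⇒≈κ (+-assoc a b c) }
              ; identity = (λ a → ≈⇒≈κ (+-identityˡ a)) , (λ a → ≈⇒≈κ (+-identityʳ a)) }
            ; inverse = (λ a → ≈⇒≈κ (-‿inverseˡ a)) , (λ a → ≈⇒≈κ (-‿inverseʳ a))
            ; ⁻¹-cong = λ (κ≈ p) → κ≈ (trans (sym (-‿distribʳ-* _ _)) (trans (-‿cong p) (-‿distribʳ-* _ _))) }
          ; comm = λ a b → ≈⇒≈κ (+-comm a b) }
        ; *-cong = λ {a} {b} {c} {d} (κ≈ p) (κ≈ r) → κ≈ (trans (sym (*-assoc κ a c)) (trans (*-congʳ p) (trans (solve 3 (λ k b c → (k :* b) :* c := b :* (k :* c)) refl κ b c)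
            (trans (*-congˡ r) (solve 3 (λ k b d → b :* (k :* d) := k :* (b :* d)) refl κ b d)))))
        ; *-assoc = λ a b c → ≈⇒≈κ (*-assoc a b c)
        ; *-identity = (λ a → ≈⇒≈κ (*-identityˡ a)) , (λ a → ≈⇒≈κ (*-identityʳ a))
        ; distrib = (λ a b c → ≈⇒≈κ (distribˡ a b c)) , (λ a b c → ≈⇒≈κ (distribʳ a b c)) }
      ; *-comm = λ a b → ≈⇒≈κ (*-comm a b) } }

  reduce : Hom R reduced
  reduce = record { fn = λ x → x ; resp = ≈⇒≈κ ; +-homo = λ _ _ → κ≈ refl ; *-homo = λ _ _ → κ≈ refl ; 0-homo = κ≈ refl ; 1-homo = κ≈ refl }

∑-homo : ∀ {X : Set} {R R′ : CommutativeRing 0ℓ 0ℓ} (φ : Hom R R′) (xs : List X) g →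
         CommutativeRing._≈_ R′ (Hom.fn φ (SemiringSum.∑ (CommutativeRing.commutativeSemiring R) xs g))
           (SemiringSum.∑ (CommutativeRing.commutativeSemiring R′) xs (λ x → Hom.fn φ (g x)))
∑-homo φ [] g = Hom.0-homo φ
∑-homo {R′ = R′} φ (x ∷ xs) g = CommutativeRing.trans R′ (Hom.+-homo φ _ _) (CommutativeRing.+-congˡ R′ (∑-homo φ xs g))

record ReducedSeries : Set₁ where
  field
    R : CommutativeRing 0ℓ 0ℓ
    norm : NormOn R
  open RingKit R
  open NormOn norm
  open SemiringSum commutativeSemiring using (∑)
  field
    n : ℕ
    1≤n : 1 ≤ n
    κ : Carrier
    κκ : κ * κ ≈ nat n * κ
    q : ℕ
    1≤q : 1 ≤ q
    c ν : ℕ → Carrier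
    c0 : c 0 ≈ 1#
    newton : ∀ m → nat m * c m ≈ ∑ (rng m) (λ j → ν j * c (m ∸ j))
    D : ℕ
    c-zero : ∀ m → D < m → κ * c m ≈ 0#
    K₀ : ℕ
    ν-bound : ∀ j → 1 ≤ j → ‖ κ * ν j ‖ ≤ K₀ ℕ.* q ℕ.^ ℕ.⌈ j /2⌉

-- The archimedean estimate for a series that becomes a polynomial after multiplication by the quasi-idempotent κ.
module ReducedBound (input : ReducedSeries) where
  open ReducedSeries input
  open NormOn norm
  open RingKit R
  open Annihilator R κ
  private
    module R′ = RingKit reduced
    module ∑′ = SemiringSum R′.commutativeSemiring

    size : Carrier → ℕ
    size a = ‖ κ * a ‖

    w : ℕ → ℕ
    w m = q ℕ.^ ℕ.⌈ m /2⌉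

    size-cong : ∀ {x y} → x ≈κ y → size x ≡ size y
    size-cong (κ≈ e) = ‖‖-cong e

    size-+ : ∀ x y → size (x + y) ≤ size x ℕ.+ size y
    size-+ x y = ≤-trans (≤-reflexive (‖‖-cong (distribˡ κ x y))) (‖‖-+ (κ * x) (κ * y))

    -- `n ‖κxy‖ = ‖κκxy‖ ≤ ‖κx‖ ‖κy‖`, and `n ≥ 1`.
    size-* : ∀ x y → size (x * y) ≤ size x ℕ.* size y
    size-* x y = ≤-trans (≤-trans (≤-reflexive (≡.sym (ℕP.*-identityˡ (size (x * y))))) (*-monoˡ-≤ (size (x * y)) 1≤n))
      (≤-trans (≤-reflexive (≡.trans (≡.sym (‖‖-nat n (κ * (x * y)))) (‖‖-cong (trans (sym (*-assoc (nat n) κ (x * y))) (trans (*-congʳ (sym κκ))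
        (solve 3 (λ k x y → (k :* k) :* (x :* y) := (k :* x) :* (k :* y)) refl κ x y)))))) (‖‖-* (κ * x) (κ * y)))

    size-neg : ∀ x → size (- x) ≡ size x
    size-neg x = ≡.trans (‖‖-cong (sym (-‿distribʳ-* κ x))) (‖‖-neg (κ * x))

    size-0 : size 0# ≡ 0
    size-0 = ≡.trans (‖‖-cong (zeroʳ κ)) ‖‖-0

    nat≈ : ∀ m → nat m ≈κ R′.nat m
    nat≈ m = HomP.nat-homo reduce m

    size-nat : ∀ m x → size (R′.nat m * x) ≡ m ℕ.* size x
    size-nat m x = ≡.trans (size-cong (R′.*-congʳ {x} (R′.sym (nat≈ m)))) (≡.trans (‖‖-cong (solve 3 (λ k m x → k :* (m :* x) := m :* (k :* x)) refl κ (nat m) x)) (‖‖-nat m (κ * x)))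

    newton′ : ∀ m → R′.nat m * c m ≈κ ∑′.∑ (rng m) (λ j → ν j * c (m ∸ j))
    newton′ m = R′.trans (R′.*-congʳ {c m} (R′.sym (nat≈ m))) (R′.trans (≈⇒≈κ (newton m)) (∑-homo reduce (rng m) _))

    w-mono : ∀ {i j} → i ≤ j → w i ≤ w j
    w-mono le = ^-monoʳ-≤ q {{ℕ.>-nonZero 1≤q}} (⌈n/2⌉-mono le)

    ⌈+⌉ : ∀ i j → ℕ.⌈ i /2⌉ ℕ.+ ℕ.⌈ j /2⌉ ≤ suc ℕ.⌈ i ℕ.+ j /2⌉
    ⌈+⌉ zero j = n≤1+n _
    ⌈+⌉ (suc zero) j = s≤s (⌈n/2⌉-mono (n≤1+n j))
    ⌈+⌉ (suc (suc i)) j = s≤s (⌈+⌉ i j)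

    w-* : ∀ i j → w i ℕ.* w j ≤ q ℕ.* w (i ℕ.+ j)
    w-* i j = ≤-trans (≤-reflexive (≡.sym (ℕP.^-distribˡ-+-* q ℕ.⌈ i /2⌉ ℕ.⌈ j /2⌉))) (^-monoʳ-≤ q {{ℕ.>-nonZero 1≤q}} (⌈+⌉ i j))

    series : PolynomialSeries
    series = record
      { R = reduced
      ; norm = record { ‖_‖ = size ; ‖‖-cong = size-cong ; ‖‖-+ = size-+ ; ‖‖-* = size-* ; ‖‖-neg = size-neg ; ‖‖-0 = size-0 ; ‖‖-nat = size-nat }
      ; w = w ; q = q ; 1≤q = 1≤q ; w0 = ≡.refl ; w-mono = w-mono ; w-* = w-* ; c = c ; ν = ν ; c0 = ≈⇒≈κ c0 ; newton = newton′
      ; D = D ; c-zero = λ m lt → κ≈ (trans (c-zero m lt) (sym (zeroʳ κ))) ; K₀ = K₀ ; ν-bound = ν-bound }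

    module B = Arch series

    ^-same : ∀ x N → x R′.^ N ≈κ x ^ N
    ^-same x N = R′.sym (HomP.^-homo reduce x N)

    open import Data.Nat.Solver using (module +-*-Solver)
    module N = +-*-Solver

    κ-power : ∀ N → (κ * c 1) ^ suc N ≈ nat (n ℕ.^ N) * (κ * c 1 ^ suc N)
    κ-power zero = trans (*-identityʳ _) (sym (trans (*-cong (+-identityʳ 1#) (*-congˡ (*-identityʳ (c 1)))) (*-identityˡ _)))
    κ-power (suc N) = trans (*-congˡ (κ-power N)) (trans (solve 4 (λ k c m d → (k :* c) :* (m :* (k :* d)) := m :* ((k :* k) :* (c :* d))) refl κ (c 1) (nat (n ℕ.^ N)) (c 1 ^ suc N))
      (trans (*-congˡ (*-congʳ κκ)) (trans (solve 4 (λ m n k x → m :* ((n :* k) :* x) := (n :* m) :* (k :* x)) refl (nat (n ℕ.^ N)) (nat n) κ (c 1 ^ suc (suc N))) (*-congʳ (sym (nat-* n (n ℕ.^ N)))))))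

    ⌈⌉-double : ∀ m → ℕ.⌈ m /2⌉ ℕ.+ ℕ.⌈ m /2⌉ ≤ suc m
    ⌈⌉-double zero = z≤n
    ⌈⌉-double (suc zero) = ≤-refl
    ⌈⌉-double (suc (suc m)) = s≤s (≤-trans (≤-reflexive (ℕP.+-suc _ _)) (s≤s (⌈⌉-double m)))

    ww : ∀ m → w m ℕ.* w m ≤ q ℕ.^ suc m
    ww m = ≤-trans (≤-reflexive (≡.sym (ℕP.^-distribˡ-+-* q ℕ.⌈ m /2⌉ ℕ.⌈ m /2⌉))) (^-monoʳ-≤ q {{ℕ.>-nonZero 1≤q}} (⌈⌉-double m))

  abstract
    -- The squared form avoids `√q`: the square of `q^⌈m/2⌉` is at most `q^(m+1)`. Everything
    -- polynomial in `N` goes into `K N^β`, and the powers of `n` come from `κ^N = n^(N-1) κ`.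
    square-power-bound : 1 ≤ D → Σ ℕ λ K → Σ ℕ λ β → ∀ N → 1 ≤ N →
      ‖ (κ * c 1) ^ N ‖ ℕ.* ‖ (κ * c 1) ^ N ‖ ≤ K ℕ.* N ℕ.^ β ℕ.* (n ℕ.* n ℕ.* (D ℕ.* D) ℕ.* q) ℕ.^ N
    square-power-bound 1≤D = K , β , bound
      where
      S₀ e L U : ℕ
      S₀ = proj₁ (B.power-bound 1≤D)
      e = B.e
      L = size 1#
      U = D ℕ.* L ℕ.* suc (suc S₀) ℕ.^ e ℕ.* q
      K β : ℕ
      K = (L ℕ.* U ℕ.^ D) ℕ.* (L ℕ.* U ℕ.^ D) ℕ.* q ℕ.^ suc S₀
      β = e ℕ.* D ℕ.+ e ℕ.* D
      bound : ∀ N → 1 ≤ N → ‖ (κ * c 1) ^ N ‖ ℕ.* ‖ (κ * c 1) ^ N ‖ ≤ K ℕ.* N ℕ.^ β ℕ.* (n ℕ.* n ℕ.* (D ℕ.* D) ℕ.* q) ℕ.^ N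
      bound N@(suc M) _ = ≤-trans (*-mono-≤ first first) (≤-trans (≤-reflexive (N.solve 4 (λ a b c w → (a N.:* (b N.:* c N.:* w)) N.:* (a N.:* (b N.:* c N.:* w)) N.:= (b N.:* b N.:* (c N.:* c)) N.:* ((a N.:* a) N.:* (w N.:* w))) ≡.refl
            (n ℕ.^ N ℕ.* D ℕ.^ N) (L ℕ.* U ℕ.^ D) (N ℕ.^ (e ℕ.* D)) (w (S₀ ℕ.+ N))))
          (≤-trans (*-monoʳ-≤ ((LU ℕ.* LU) ℕ.* (N ℕ.^ (e ℕ.* D) ℕ.* N ℕ.^ (e ℕ.* D))) (*-monoʳ-≤ (n ℕ.^ N ℕ.* D ℕ.^ N ℕ.* (n ℕ.^ N ℕ.* D ℕ.^ N)) (ww (S₀ ℕ.+ N))))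
            (≤-reflexive (≡.trans (cong₂ (λ x y → LU ℕ.* LU ℕ.* x ℕ.* (n ℕ.^ N ℕ.* D ℕ.^ N ℕ.* (n ℕ.^ N ℕ.* D ℕ.^ N) ℕ.* y)) (≡.sym (ℕP.^-distribˡ-+-* N (e ℕ.* D) (e ℕ.* D))) (ℕP.^-distribˡ-+-* q (suc S₀) N))
              (≡.trans (N.solve 6 (λ l x n d s q → l N.:* x N.:* (n N.:* d N.:* (n N.:* d) N.:* (s N.:* q)) N.:= (l N.:* s) N.:* x N.:* ((n N.:* n) N.:* (d N.:* d) N.:* q)) ≡.refl (LU ℕ.* LU) (N ℕ.^ β) (n ℕ.^ N) (D ℕ.^ N) (q ℕ.^ suc S₀) (q ℕ.^ N))
                (cong (K ℕ.* N ℕ.^ β ℕ.*_) (≡.sym (≡.trans (Growth.^-distribʳ-* (n ℕ.* n ℕ.* (D ℕ.* D)) q N) (cong (ℕ._* q ℕ.^ N) (≡.trans (Growth.^-distribʳ-* (n ℕ.* n) (D ℕ.* D) N) (cong₂ ℕ._*_ (Growth.^-distribʳ-* n n N) (Growth.^-distribʳ-* D D N)))))))))))) 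
        where
        LU : ℕ
        LU = L ℕ.* U ℕ.^ D
        linear : suc (S₀ ℕ.+ N) ≤ suc S₀ ℕ.* N ℕ.+ N
        linear = ≤-trans (+-monoˡ-≤ N {suc S₀} {suc S₀ ℕ.* N} (m≤m*n (suc S₀) N)) ≤-refl
        U-bound : (D ℕ.* L ℕ.* suc (S₀ ℕ.+ N) ℕ.^ e ℕ.* q) ℕ.^ D ≤ (D ℕ.* L ℕ.* suc (suc S₀) ℕ.^ e ℕ.* q) ℕ.^ D ℕ.* N ℕ.^ (e ℕ.* D)
        U-bound = ≤-trans (^-monoˡ-≤ D (≤-trans (*-monoˡ-≤ q (*-monoʳ-≤ (D ℕ.* L) (≤-trans (^-monoˡ-≤ e (≤-trans linear (≤-reflexive (N.solve 2 (λ s n → (N.con 1 N.:+ s) N.:* n N.:+ n N.:= (N.con 2 N.:+ s) N.:* n) ≡.refl S₀ N))))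
            (≤-reflexive (Growth.^-distribʳ-* (suc (suc S₀)) N e)))))
          (≤-reflexive (N.solve 4 (λ a b c q → a N.:* (b N.:* c) N.:* q N.:= a N.:* b N.:* q N.:* c) ≡.refl (D ℕ.* L) (suc (suc S₀) ℕ.^ e) (N ℕ.^ e) q))))
          (≤-reflexive (≡.trans (Growth.^-distribʳ-* (D ℕ.* L ℕ.* suc (suc S₀) ℕ.^ e ℕ.* q) (N ℕ.^ e) D) (cong ((D ℕ.* L ℕ.* suc (suc S₀) ℕ.^ e ℕ.* q) ℕ.^ D ℕ.*_) (ℕP.^-*-assoc N e D))))
        first : ‖ (κ * c 1) ^ N ‖ ≤ (n ℕ.^ N ℕ.* D ℕ.^ N) ℕ.* (LU ℕ.* N ℕ.^ (e ℕ.* D) ℕ.* w (S₀ ℕ.+ N))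
        first = ≤-trans (≤-reflexive (≡.trans (‖‖-cong (κ-power M)) (‖‖-nat (n ℕ.^ M) _)))
          (≤-trans (*-mono-≤ {n ℕ.^ M} {n ℕ.^ N} (^-monoʳ-≤ n {{ℕ.>-nonZero 1≤n}} (n≤1+n M)) (≤-trans (≤-reflexive (size-cong (R′.sym (^-same (c 1) N)))) (proj₂ (B.power-bound 1≤D) N)))
          (≤-trans (*-monoʳ-≤ (n ℕ.^ N) (*-monoʳ-≤ (D ℕ.^ N) (*-monoʳ-≤ L (*-monoˡ-≤ (w (S₀ ℕ.+ N)) U-bound))))
            (≤-reflexive (N.solve 6 (λ n d l u x w → n N.:* (d N.:* (l N.:* (u N.:* x N.:* w))) N.:= n N.:* d N.:* (l N.:* u N.:* x N.:* w)) ≡.refl (n ℕ.^ N) (D ℕ.^ N) L (U ℕ.^ D) (N ℕ.^ (e ℕ.* D)) (w (S₀ ℕ.+ N))))))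

if-true : ∀ {Q Y : Set} (c : Dec Q) {x y : Y} → Q → (if does c then x else y) ≡ x
if-true (yes _) _ = ≡.refl
if-true (no n) p = ⊥-elim (n p)

if-false : ∀ {Q Y : Set} (c : Dec Q) {x y : Y} → ¬ Q → (if does c then x else y) ≡ y
if-false (yes p) n = ⊥-elim (n p)
if-false (no _) _ = ≡.refl

-- Since `B` is the mean, the excesses and the deficits have the same sum; bounding the excesses
-- therefore bounds all absolute deviations.
deviation-sum : ∀ {Y : Set} (ys : List Y) (x : Y → ℕ) B U → SemiringSum.∑ ℕP.+-*-commutativeSemiring ys x ≡ length ys ℕ.* B → (∀ y → y ∈ ys → x y ≤ B ℕ.+ U) →
  SemiringSum.∑ ℕP.+-*-commutativeSemiring ys (λ y → ℤ.∣ + x y ℤ.- + B ∣) ≤ 2 ℕ.* (length ys ℕ.* U)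
deviation-sum {Y} ys x B U total le = ≤-trans (≤-reflexive (≡.trans (S.∑-cong ys λ y → ∣-∣ (x y) B) (S.∑-+ ys _ _)))
  (≤-trans (≤-reflexive (cong (S.∑ ys over ℕ.+_) (≡.sym balanced))) (≤-trans (+-mono-≤ over≤ over≤) (≤-reflexive (cong (length ys ℕ.* U ℕ.+_) (≡.sym (ℕP.+-identityʳ _))))))
  where
  module S = SemiringSum ℕP.+-*-commutativeSemiring
  over under : Y → ℕ
  over y = x y ∸ B
  under y = B ∸ x y
  const : ∀ (zs : List Y) c → S.∑ zs (λ _ → c) ≡ length zs ℕ.* c
  const [] c = ≡.refl
  const (z ∷ zs) c = cong (c ℕ.+_) (const zs c)
  ∣-∣ : ∀ a b → ℤ.∣ + a ℤ.- + b ∣ ≡ (a ∸ b) ℕ.+ (b ∸ a)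
  ∣-∣ a b = ≡.trans (cong ℤ.∣_∣ (ℤP.m-n≡m⊖n a b)) (case ≤-total b a of λ
    { (inj₁ b≤a) → ≡.trans (cong ℤ.∣_∣ (ℤP.⊖-≥ b≤a)) (≡.sym (≡.trans (cong (a ∸ b ℕ.+_) (m≤n⇒m∸n≡0 b≤a)) (ℕP.+-identityʳ _)))
    ; (inj₂ a≤b) → ≡.trans (ℤP.∣⊖∣-≤ a≤b) (cong (ℕ._+ (b ∸ a)) (≡.sym (m≤n⇒m∸n≡0 a≤b))) })
  swap-max : ∀ a b → a ℕ.+ (b ∸ a) ≡ b ℕ.+ (a ∸ b)
  swap-max a b = case ≤-total b a of λ
    { (inj₁ b≤a) → ≡.trans (≡.trans (cong (a ℕ.+_) (m≤n⇒m∸n≡0 b≤a)) (ℕP.+-identityʳ a)) (≡.sym (m+[n∸m]≡n b≤a))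
    ; (inj₂ a≤b) → ≡.trans (m+[n∸m]≡n a≤b) (≡.sym (≡.trans (cong (b ℕ.+_) (m≤n⇒m∸n≡0 a≤b)) (ℕP.+-identityʳ b))) }
  balanced : S.∑ ys over ≡ S.∑ ys under
  balanced = ≡.sym (ℕP.+-cancelˡ-≡ (S.∑ ys x) _ _ (≡.trans (≡.sym (S.∑-+ ys x under)) (≡.trans (S.∑-cong ys λ y → swap-max (x y) B)
    (≡.trans (S.∑-+ ys (λ _ → B) over) (cong (ℕ._+ S.∑ ys over) (≡.trans (const ys B) (≡.sym total)))))))
  over≤ : S.∑ ys over ≤ length ys ℕ.* U
  over≤ = ≤-trans (NatLemmas.∑≤ ys λ y i → m≤n+o⇒m∸n≤o (x y) B (le y i)) (≤-reflexive (const ys U))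

-- The resultant character and its reciprocity law

-- The residue character is `x ↦ x ^ e₁`, with values in the `n`-th roots of unity and `0`. The
-- factor `P₀` of multiplicity one excludes that `f` is degenerate, for instance an `n`-th power
-- with `n > 1`; the valuations in Stepanov's argument are taken at `P₀`.
record PowerResidueData : Set₁ where
  field base : PrimePowerField
  open PrimePowerField base public
  field
    lf : List (FiniteField.Carrier F)
    n e₁ : ℕ
    1≤n : 1 ≤ n
    ne₁ : suc (n ℕ.* e₁) ≡ p ℕ.^ k
    3≤q : 3 ≤ p ℕ.^ k
    P₀ : List (FiniteField.Carrier F)
    i₀ : FieldPoly.Irr F P₀
    f₁ : FieldPoly.P.Carrier F
    f≈ : FieldPoly.P._≈_ F (FieldPoly.⟦_⟧ F lf) (FieldPoly.P._*_ F (FieldPoly.⟦_⟧ F P₀) f₁)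
    P₀∤f₁ : ¬ (FieldPoly.P._∣_ F (FieldPoly.⟦_⟧ F P₀) f₁)

module Weil (input : PowerResidueData) where
  open PowerResidueData input
  open PrimePower base

  f : P.Carrier
  f = ⟦ lf ⟧

  abstract
    S : Splitting Fr f
    S = splitting (length lf) Fr f (mon-⟦⟧ lf)

  open Splitting S using (B; ι; roots)
  module B = RingKit B
  module ι = HomP ι
  module B∑ = SemiringSum B.commutativeSemiring

  evalι : B.Carrier → Hom Pol.poly B
  evalι θ = Pol.Eval.evalHom ι θ

  -- For g = ∏ (x - y_j) this is ∏ (y_j - θ).
  ev : List Carrier → B.Carrier → B.Carrier
  ev g θ = (B.- B.1#) B.^ length g B.* Hom.fn (evalι θ) ⟦ g ⟧

  -- The resultant of `f` and `g`, normalized to be `∏ f(y_j)` over the roots `y_j` of `g`, but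
  -- computed over the roots of `f`.
  ρB : List Carrier → B.Carrier
  ρB g = B∑.∏ roots (ev g)

  ρB-[] : ρB [] B.≈ B.1#
  ρB-[] = B.trans (B∑.∏-cong roots (λ θ → B.trans (B.*-identityˡ _) (Hom.1-homo (evalι θ)))) (B∑.∏-1 roots)

  ρB-⊛ : ∀ {a b c} → length c ≡ length a ℕ.+ length b → ⟦ c ⟧ P.≈ ⟦ a ⟧ P.* ⟦ b ⟧ → ρB c B.≈ ρB a B.* ρB b
  ρB-⊛ {a} {b} {c} len e = B.trans (B∑.∏-cong roots λ θ → B.trans
      (B.*-cong (B.trans (B.reflexive (cong ((B.- B.1#) B.^_) len)) (B.^-homo-* (B.- B.1#) (length a) (length b))) (B.trans (Hom.resp (evalι θ) e) (Hom.*-homo (evalι θ) ⟦ a ⟧ ⟦ b ⟧)))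
      (B.solve 4 (λ s t u v → (s B.:* t) B.:* (u B.:* v) B.:= (s B.:* u) B.:* (t B.:* v)) B.refl _ _ _ _))
    (B∑.∏-* roots (ev a) (ev b))

  linears-∏ : ∀ {R T} (φ : Hom R T) z zs → CommutativeRing._≈_ T (Hom.fn (PolyFacts.Eval.evalHom R φ z) (PolyFacts.linears R zs))
                (SemiringSum.∏ (CommutativeRing.commutativeSemiring T) zs (λ θ → CommutativeRing._-_ T z (Hom.fn φ θ)))
  linears-∏ {R} {T} φ z [] = Hom.1-homo (PolyFacts.Eval.evalHom R φ z)
  linears-∏ {R} {T} φ z (θ ∷ zs) = T.trans (E.*-homo _ _) (T.*-cong (T.trans (E.sub-homo A.X (A.C θ)) (T.+-cong (A.Eval.eval-X φ z) (T.-‿cong (A.Eval.eval-C φ z θ))))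
      (linears-∏ φ z zs))
    where
    module T = RingKit T
    module A = PolyFacts R
    module E = HomP (A.Eval.evalHom φ z)

  f-values : ∀ {T} (φ : Hom B T) z → CommutativeRing._≈_ T (Hom.fn (Pol.Eval.evalHom (φ ∘ₕ ι) z) f)
               (SemiringSum.∏ (CommutativeRing.commutativeSemiring T) roots (λ θ → CommutativeRing._-_ T z (Hom.fn φ θ)))
  f-values {T} φ z = T.trans (T.sym (PolyMap.eval-map ι φ z f)) (T.trans (Hom.resp (PolyFacts.Eval.evalHom B φ z) (Splitting.splits S)) (linears-∏ φ z roots))
    where module T = RingKit T

  eval-f-root : All (λ θ → Hom.fn (evalι θ) f B.≈ B.0#) roots
  eval-f-root = go roots (λ θ → B.trans (same θ) (f-values idHom θ))
    where
    same : ∀ θ → Hom.fn (evalι θ) f B.≈ Hom.fn (Pol.Eval.evalHom (idHom ∘ₕ ι) θ) f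
    same θ = Pol.hom-ext (evalι θ) (Pol.Eval.evalHom (idHom ∘ₕ ι) θ) (λ a → B.trans (Pol.Eval.eval-C ι θ a) (B.sym (Pol.Eval.eval-C (idHom ∘ₕ ι) θ a)))
      (B.trans (Pol.Eval.eval-X ι θ) (B.sym (Pol.Eval.eval-X (idHom ∘ₕ ι) θ))) f
    zero-factor : ∀ θ zs → θ ∈ zs → B∑.∏ zs (λ y → θ B.- y) B.≈ B.0#
    zero-factor θ (θ ∷ zs) (here ≡.refl) = B.trans (B.*-congʳ (B.-‿inverseʳ θ)) (B.zeroˡ _)
    zero-factor θ (y ∷ zs) (there i) = B.trans (B.*-congˡ (zero-factor θ zs i)) (B.zeroʳ _)
    go : ∀ zs → (∀ θ → Hom.fn (evalι θ) f B.≈ B∑.∏ zs (λ y → θ B.- y)) → All (λ θ → Hom.fn (evalι θ) f B.≈ B.0#) zs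
    go zs h = All.tabulate λ {θ} i → B.trans (h θ) (zero-factor θ zs i)

  -- At a root of `f` the value of a polynomial depends only on its class modulo `f`; lengths
  -- differing by the even number `2c` give the same sign.
  ρB-periodic : ∀ {a b} c → length a ≡ c ℕ.+ (c ℕ.+ length b) → f P.∣ (⟦ a ⟧ P.- ⟦ b ⟧) → ρB a B.≈ ρB b
  ρB-periodic {a} {b} c len (w P.by e) = B∑.∏-cong∈ roots λ θ i → B.*-cong
    (B.trans (B.reflexive (cong ((B.- B.1#) B.^_) len)) (even c (length b)))
    (B.x∙y⁻¹≈ε⇒x≈y _ _ (B.trans (B.sym (HomP.sub-homo (evalι θ) ⟦ a ⟧ ⟦ b ⟧)) (B.trans (Hom.resp (evalι θ) e)
      (B.trans (Hom.*-homo (evalι θ) f w) (B.trans (B.*-congʳ (All.lookup eval-f-root i)) (B.zeroˡ _))))))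
    where
    even : ∀ c n → (B.- B.1#) B.^ (c ℕ.+ (c ℕ.+ n)) B.≈ (B.- B.1#) B.^ n
    even zero n = B.refl
    even (suc c) n = B.trans (B.*-congˡ (B.reflexive (cong ((B.- B.1#) B.^_) (ℕP.+-suc c (c ℕ.+ n)))))
      (B.trans (B.solve 1 (λ x → (B.:- B.con (+ 1)) B.:* ((B.:- B.con (+ 1)) B.:* x) B.:= x) B.refl _) (even c n))

  ρB-linear : ∀ x → ρB (- x ∷ []) B.≈ ι.fn (Pol.eval x f)
  ρB-linear x = B.trans (B∑.∏-cong roots term) (B.trans (B.sym (f-values idHom (ι.fn x))) (B.sym back))
    where
    term : ∀ θ → ev (- x ∷ []) θ B.≈ ι.fn x B.- θ
    term θ = B.trans (B.*-congˡ (B.trans (E.+-homo _ _) (B.+-cong (B.trans (Pol.Eval.eval-C ι θ (- x)) (ι.neg-homo x))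
        (B.trans (E.*-homo _ _) (B.*-cong (Pol.Eval.eval-X ι θ) E.1-homo)))))
      (B.solve 2 (λ a t → ((B.:- B.con (+ 1)) B.:* B.con (+ 1)) B.:* ((B.:- a) B.:+ t B.:* B.con (+ 1)) B.:= a B.:- t) B.refl _ _)
      where module E = HomP (evalι θ)
    back : ι.fn (Pol.eval x f) B.≈ Hom.fn (Pol.Eval.evalHom (idHom ∘ₕ ι) (ι.fn x)) f
    back = Pol.hom-ext (ι ∘ₕ Pol.Eval.evalHom idHom x) (Pol.Eval.evalHom (idHom ∘ₕ ι) (ι.fn x))
      (λ a → B.trans (ι.resp (Pol.eval-C x a)) (B.sym (Pol.Eval.eval-C (idHom ∘ₕ ι) _ a)))
      (B.trans (ι.resp (Pol.eval-X x)) (B.sym (Pol.Eval.eval-X (idHom ∘ₕ ι) _))) f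

  -- geo j = 1 + q + … + q^(j-1)
  geo : ℕ → ℕ
  geo zero = 0
  geo (suc j) = suc (q ℕ.* geo j)

  geo-q^ : ∀ j → geo j ℕ.+ q ℕ.^ j ≡ suc (q ℕ.* geo j)
  geo-q^ zero = ≡.sym (cong suc (ℕP.*-zeroʳ q))
  geo-q^ (suc j) = cong suc (≡.trans (≡.sym (ℕP.*-distribˡ-+ q (geo j) (q ℕ.^ j))) (cong (q ℕ.*_) (geo-q^ j)))

  ∏-homo : ∀ {X : Set} {R R′ : CommutativeRing 0ℓ 0ℓ} (φ : Hom R R′) (xs : List X) g →
           CommutativeRing._≈_ R′ (Hom.fn φ (SemiringSum.∏ (CommutativeRing.commutativeSemiring R) xs g))
             (SemiringSum.∏ (CommutativeRing.commutativeSemiring R′) xs (λ x → Hom.fn φ (g x)))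
  ∏-homo φ [] g = Hom.1-homo φ
  ∏-homo {R′ = R′} φ (x ∷ xs) g = CommutativeRing.trans R′ (Hom.*-homo φ _ _) (CommutativeRing.*-congˡ R′ (∏-homo φ xs g))

  -- The computation takes place in a ring T containing the roots of f and of l.
  module Compositum {l : List Carrier} (il : Irr l) (T : CommutativeRing 0ℓ 0ℓ) (α : Hom B T) (β : Hom (Residue.κ il) T)
    (α-injective : ∀ {a b} → CommutativeRing._≈_ T (Hom.fn α a) (Hom.fn α b) → a B.≈ b)
    (square : ∀ c → CommutativeRing._≈_ T (Hom.fn α (ι.fn c)) (Hom.fn β (Hom.fn (Residue.emb il) c))) where
    open Residue il
    private
      module T = RingKit T
      module T∑ = SemiringSum T.commutativeSemiring
      module κ∑ = SemiringSum κ.commutativeSemiring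
      module α = HomP α
      module β = HomP β

    through-β : ∀ z (a : P.Carrier) → Hom.fn (Pol.Eval.evalHom (α ∘ₕ ι) z) a T.≈ Hom.fn (Pol.Eval.evalHom (β ∘ₕ emb) z) a
    through-β z = Pol.hom-ext (Pol.Eval.evalHom (α ∘ₕ ι) z) (Pol.Eval.evalHom (β ∘ₕ emb) z)
      (λ c → T.trans (Pol.Eval.eval-C (α ∘ₕ ι) z c) (T.trans (square c) (T.sym (Pol.Eval.eval-C (β ∘ₕ emb) z c))))
      (T.trans (Pol.Eval.eval-X (α ∘ₕ ι) z) (T.sym (Pol.Eval.eval-X (β ∘ₕ emb) z)))

    α-eval : ∀ θ (a : P.Carrier) → α.fn (Hom.fn (evalι θ) a) T.≈ Hom.fn (κT.Eval.evalHom β (α.fn θ)) (Hom.fn mapHom a)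
    α-eval θ a = T.trans (Pol.hom-ext (α ∘ₕ evalι θ) (Pol.Eval.evalHom (α ∘ₕ ι) (α.fn θ))
        (λ c → T.trans (α.resp (Pol.Eval.eval-C ι θ c)) (T.sym (Pol.Eval.eval-C (α ∘ₕ ι) (α.fn θ) c)))
        (T.trans (α.resp (Pol.Eval.eval-X ι θ)) (T.sym (Pol.Eval.eval-X (α ∘ₕ ι) (α.fn θ)))) a)
      (T.trans (through-β (α.fn θ) a) (T.sym (PolyMap.eval-map emb β (α.fn θ) a)))

    β-eval : ∀ z (a : P.Carrier) → Hom.fn (Pol.Eval.evalHom (α ∘ₕ ι) (β.fn z)) a T.≈ β.fn (Hom.fn (evalκ z) a)
    β-eval z a = T.trans (through-β (β.fn z) a) (T.sym (Pol.hom-ext (β ∘ₕ evalκ z) (Pol.Eval.evalHom (β ∘ₕ emb) (β.fn z))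
      (λ c → T.trans (β.resp (Pol.Eval.eval-C emb z c)) (T.sym (Pol.Eval.eval-C (β ∘ₕ emb) (β.fn z) c)))
      (T.trans (β.resp (Pol.Eval.eval-X emb z)) (T.sym (Pol.Eval.eval-X (β ∘ₕ emb) (β.fn z)))) a))

    signed : ∀ (zs : List κ.Carrier) θ → (T.- T.1#) T.^ length zs T.* T∑.∏ zs (λ z → θ T.- β.fn z) T.≈ T∑.∏ zs (λ z → β.fn z T.- θ)
    signed [] θ = T.*-identityˡ _
    signed (z ∷ zs) θ = T.trans (T.solve 4 (λ s t z P → ((T.:- T.con (+ 1)) T.:* s) T.:* ((t T.:- z) T.:* P) T.:= (z T.:- t) T.:* (s T.:* P)) T.refl _ θ (β.fn z) _)
      (T.*-congˡ (signed zs θ))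

    length-conjs′ : length conjs ≡ length l
    length-conjs′ = ≡.trans (ListP.length-map conj (upTo e)) (ListP.length-upTo e)

    α-ev : ∀ θ → α.fn (ev l θ) T.≈ T∑.∏ conjs (λ z → β.fn z T.- α.fn θ)
    α-ev θ = T.trans (α.*-homo _ _) (T.trans (T.*-cong
        (T.trans (α.^-homo (B.- B.1#) (length l)) (T.trans (T.^-congˡ (length l) (T.trans (α.neg-homo B.1#) (T.-‿cong α.1-homo)))
          (T.reflexive (cong ((T.- T.1#) T.^_) (≡.sym length-conjs′)))))
        (T.trans (α-eval θ ⟦ l ⟧) (T.trans (Hom.resp (κT.Eval.evalHom β (α.fn θ)) factorization) (linears-∏ β (α.fn θ) conjs))))
      (signed conjs (α.fn θ)))

    powers : ∀ n → κ∑.∏ (upTo n) (λ j → f κ.^ (q ℕ.^ j)) κ.≈ f κ.^ geo n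
    powers zero = κ.refl
    powers (suc n) = κ.trans (κ.reflexive (cong (λ ns → κ∑.∏ ns (λ j → f κ.^ (q ℕ.^ j))) (≡.sym (ListP.upTo-∷ʳ n))))
      (κ.trans (κ∑.∏-++ (upTo n) (n ∷ []) _) (κ.trans (κ.*-cong (powers n) (κ.*-identityʳ _))
        (κ.trans (κ.sym (κ.^-homo-* f (geo n) (q ℕ.^ n))) (κ.reflexive (cong (f κ.^_) (geo-q^ n))))))

    w : κ.Carrier
    w = f κ.^ geo e

    -- Reciprocity: exchanging the products over the roots of `f` and over the conjugates of `y`
    -- turns the resultant into `∏ f^(q^j)`, the norm of `f` modulo `l`.
    α-ρB : α.fn (ρB l) T.≈ β.fn w
    α-ρB = T.trans (∏-homo α roots (ev l)) (T.trans (T∑.∏-cong roots α-ev) (T.trans (T∑.∏-swap roots conjs _)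
      (T.trans (T.reflexive (T∑.∏-map conj (upTo e) _)) (T.trans (T∑.∏-cong (upTo e) term)
        (T.trans (T.sym (∏-homo β (upTo e) _)) (β.resp (powers e)))))))
      where
      term : ∀ j → T∑.∏ roots (λ θ → β.fn (conj j) T.- α.fn θ) T.≈ β.fn (f κ.^ (q ℕ.^ j))
      term j = T.trans (T.sym (f-values α (β.fn (conj j)))) (T.trans (β-eval (conj j) f) (β.resp (κ.sym (a^q^≈ j f))))

    -- `f w^q = f^(1 + q geo e) = f^(geo e + q^e) = w
    -- f` by Fermat, and `f` is cancelled unless it vanishes modulo `l`.
    w-fixed : w κ.^ q κ.≈ w
    w-fixed = case divides? l f of λ
      { (yes d) → let z = κ.trans (κ.^-congˡ (geo e) (∣⇒~0 d)) (geo0 e (positive il)) in κ.trans (κ.^-congˡ q z) (κ.trans (0^q) (κ.sym z))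
      ; (no nd) → κ.x∙y⁻¹≈ε⇒x≈y _ _ (case κ-domain f (w κ.^ q κ.- w) (κ.trans (κ.solve 3 (λ f a b → f κ.:* (a κ.:- b) κ.:= f κ.:* a κ.:- b κ.:* f) κ.refl f (w κ.^ q) w)
                   (κ.x≈y⇒x∙y⁻¹≈ε fw)) of λ { (inj₁ z) → ⊥-elim (nd (~0⇒∣ z)) ; (inj₂ z) → z }) }
      where
      geo0 : ∀ n → 1 ≤ n → κ.0# κ.^ geo n κ.≈ κ.0#
      geo0 (suc n) _ = κ.0^ (q ℕ.* geo n)
      0^q : κ.0# κ.^ q κ.≈ κ.0#
      0^q = κ.trans (κ.reflexive (cong (κ.0# κ.^_) (≡.sym (ℕP.*-identityʳ q)))) (^q-0 1)
      fw : f κ.* w κ.^ q κ.≈ w κ.* f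
      fw = κ.trans (κ.*-congˡ (κ.trans (κ.^-assocʳ f (geo e) q) (κ.reflexive (cong (f κ.^_) (ℕP.*-comm (geo e) q)))))
        (κ.trans (κ.reflexive (cong (f κ.^_) (≡.sym (geo-q^ e)))) (κ.trans (κ.^-homo-* f (geo e) (q ℕ.^ e)) (κ.*-congˡ (fermatκ f))))

    ρB-irr : Σ Carrier λ c → (ρB l B.≈ ι.fn c) × (f κ.^ geo e κ.≈ emb.fn c)
    ρB-irr = let (c , h) = fixed⇒scalar w w-fixed in c , α-injective (T.trans α-ρB (T.trans (β.resp h) (T.sym (square c)))) , h

  module Reciprocity {l : List Carrier} (il : Irr l) where
    open Residue il
    private
      module BP = PolyFacts B
      m : BP.P.Carrier
      m = Hom.fn (PolyMap.mapHom ι) ⟦ l ⟧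
      -- `B[X]/(l)` receives both `B` and the residue field of `l`, and `B` embeds in it because `l`
      -- is monic of positive degree.
      module Q = Quotient BP.poly m

      α : Hom B Q./ring
      α = Q.proj ∘ₕ BP.constHom

      α-injective : ∀ {a b} → Hom.fn α a Q.~ Hom.fn α b → a B.≈ b
      α-injective {a} {b} e = B.x∙y⁻¹≈ε⇒x≈y a b (B.trans (B.sym (BP.C‼0 _)) (B.trans (BP.‼-cong (BP.P.trans (HomP.sub-homo BP.constHom a b)
        (BP.monic∣⇒≈0 (PolyMap.map-mon ι (mon-⟦⟧ l)) (BP.bnd-mono (positive il) (BP.bnd-resp (HomP.sub-homo BP.constHom a b) (BP.bnd-C (a B.- b)))) (Q.divides e))) 0) (BP.‼-0 0)))

      β : Hom κ Q./ring
      β = lift (Q.proj ∘ₕ PolyMap.mapHom ι) (Q.∣⇒~0 BP.P.∣-refl)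

      square : ∀ c → Hom.fn α (ι.fn c) Q.~ Hom.fn β (emb.fn c)
      square c = Q.≈⇒~ (BP.P.sym (PolyMap.map-C ι c))

    abstract
      ρB-irr : Σ Carrier λ c → (ρB l B.≈ ι.fn c) × (f κ.^ geo e κ.≈ emb.fn c)
      ρB-irr = Compositum.ρB-irr il Q./ring α β α-injective square

  -- Multiplicativity reduces this to irreducible `g`, where the norm is fixed by `q`-th powering
  -- and hence lies in `F`.
  ρB-scalar : ∀ N g → length g ≤ N → Σ Carrier λ c → ρB g B.≈ ι.fn c
  ρB-scalar N g le = go N g le (splits g)
    where
    go : ∀ N g → length g ≤ N → Split g → Σ Carrier λ c → ρB g B.≈ ι.fn c
    go N g le (trivial ≡.refl) = 1# , B.trans ρB-[] (B.sym ι.1-homo)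
    go N g le (prime i) = let (c , h , _) = Reciprocity.ρB-irr i in c , h
    go zero g le (split a b la lb e len) = ⊥-elim (<⇒≱ (<-≤-trans la (≤-trans (m≤m+n _ _) (≤-reflexive (≡.sym len)))) le)
    go (suc N) g le (split a b la lb e len) =
      let (c , h) = go N a (≤-pred (≤-trans (subst (length a <_) (≡.sym len) (m<m+n (length a) lb)) le)) (splits a)
          (d , h′) = go N b (≤-pred (≤-trans (subst (length b <_) (≡.sym len) (m<n+m (length b) la)) le)) (splits b)
      in c * d , B.trans (ρB-⊛ {a} {b} {g} len e) (B.trans (B.*-cong h h′) (B.sym (ι.*-homo c d)))

  abstract
    ρ : List Carrier → Carrier
    ρ g = proj₁ (ρB-scalar (length g) g ≤-refl)

    ρ-spec : ∀ g → ρB g B.≈ ι.fn (ρ g)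
    ρ-spec g = proj₂ (ρB-scalar (length g) g ≤-refl)

  ρ-by : ∀ g c → ρB g B.≈ ι.fn c → ρ g ≡ c
  ρ-by g c h = Splitting.injective S (B.trans (B.sym (ρ-spec g)) h)

  ρ-[] : ρ [] ≡ 1#
  ρ-[] = ρ-by [] 1# (B.trans ρB-[] (B.sym ι.1-homo))

  ρ-⊛ : ∀ {a b c} → length c ≡ length a ℕ.+ length b → ⟦ c ⟧ P.≈ ⟦ a ⟧ P.* ⟦ b ⟧ → ρ c ≡ ρ a * ρ b
  ρ-⊛ {a} {b} {c} len e = ρ-by c (ρ a * ρ b) (B.trans (ρB-⊛ {a} {b} {c} len e) (B.trans (B.*-cong (ρ-spec a) (ρ-spec b)) (B.sym (ι.*-homo _ _))))

  ρ-periodic : ∀ {a b} c → length a ≡ c ℕ.+ (c ℕ.+ length b) → f P.∣ (⟦ a ⟧ P.- ⟦ b ⟧) → ρ a ≡ ρ b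
  ρ-periodic {a} {b} c len d = ρ-by a (ρ b) (B.trans (ρB-periodic {a} {b} c len d) (ρ-spec b))

  ρ-linear : ∀ x → ρ (- x ∷ []) ≡ Pol.eval x f
  ρ-linear x = ρ-by (- x ∷ []) _ (ρB-linear x)

  ρ-irr : ∀ {l} (il : Irr l) → ⟦ l ⟧ P.∣ (f P.^ geo (length l) P.- C (ρ l))
  ρ-irr {l} il = let (c , h , h′) = Reciprocity.ρB-irr il in
    divides (subst (λ c → (f P.^ geo (length l)) ~ C c) (≡.sym (ρ-by l c h)) (from^ h′))
    where
    open Residue il
    ^-same : ∀ n → f κ.^ n ≡ f P.^ n
    ^-same zero = ≡.refl
    ^-same (suc n) = cong (f P.*_) (^-same n)
    from^ : ∀ {c} → f κ.^ geo e κ.≈ emb.fn c → f P.^ geo e κ.≈ emb.fn c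
    from^ {c} = subst (λ z → z κ.≈ emb.fn c) (^-same (geo e))

  open import Data.Nat.Solver using (module +-*-Solver)
  private module N = +-*-Solver

  -- Stepanov's method

  -- E j = (q^j - 1) / n
  E : ℕ → ℕ
  E j = e₁ ℕ.* geo j

  nE : ∀ j → suc (n ℕ.* E j) ≡ q ℕ.^ j
  nE j = ℕP.+-cancelˡ-≡ (geo j) _ _ (≡.trans (N.solve 3 (λ g n e → g N.:+ (N.con 1 N.:+ n N.:* (e N.:* g)) N.:= N.con 1 N.:+ ((N.con 1 N.:+ n N.:* e) N.:* g)) ≡.refl (geo j) n e₁)
    (≡.trans (cong (λ z → suc (z ℕ.* geo j)) ne₁) (≡.sym (geo-q^ j))))

  E-+ : ∀ a b → E (a ℕ.+ b) ≡ E a ℕ.+ q ℕ.^ a ℕ.* E b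
  E-+ a b = ℕP.*-cancelˡ-≡ _ _ n {{ℕ.>-nonZero 1≤n}} (ℕP.suc-injective (≡.trans (nE (a ℕ.+ b)) (≡.trans (ℕP.^-distribˡ-+-* q a b)
    (≡.trans (cong (q ℕ.^ a ℕ.*_) (≡.sym (nE b))) (≡.trans (N.solve 3 (λ A n B → A N.:* (N.con 1 N.:+ n N.:* B) N.:= A N.:+ n N.:* (A N.:* B)) ≡.refl (q ℕ.^ a) n (E b))
      (≡.trans (cong (ℕ._+ n ℕ.* (q ℕ.^ a ℕ.* E b)) (≡.sym (nE a))) (cong suc (≡.sym (ℕP.*-distribˡ-+ n (E a) (q ℕ.^ a ℕ.* E b)))))))))) 

  1≤e₁ : 1 ≤ e₁
  1≤e₁ = go e₁ ne₁
    where
    go : ∀ e → suc (n ℕ.* e) ≡ q → 1 ≤ e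
    go zero h = ⊥-elim (<⇒≱ 1<q (≤-reflexive (≡.trans (≡.sym h) (cong suc (ℕP.*-zeroʳ n)))))
    go (suc e) h = s≤s z≤n

  1≤E : ∀ {j} → 1 ≤ j → 1 ≤ E j
  1≤E {suc j} _ = *-mono-≤ 1≤e₁ (s≤s (z≤n {q ℕ.* geo j}))

  -- The primes whose roots lie in the field with `q^m` elements and satisfy `f^(E m) = t` there.
  Good : ℕ → Carrier → List Carrier → Set
  Good m t l = Irr l × (Σ ℕ λ i → m ≡ i ℕ.* length l) × ⟦ l ⟧ P.∣ (f P.^ E m P.- C t)

  -- Distinct irreducible divisors can be split off one after another, each lowering the degree of
  -- the cofactor by its own.
  ∑-degrees : ∀ ls N D → ¬ (D P.≈ P.0#) → Bnd (suc N) D → Unique ls → All Irr ls → All (λ l → ⟦ l ⟧ P.∣ D) ls → ℕSum.∑ ls length ≤ N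
  ∑-degrees [] N D nz bd u il dl = z≤n
  ∑-degrees (l ∷ ls) N D nz bd (u ∷ us) (i ∷ is) ((w P.by ew) ∷ ds) =
    ≤-trans (+-monoʳ-≤ (length l) (∑-degrees ls (N ∸ length l) w nw bw us is (All.zipWith (λ (j , (u≢ , d)) → other j u≢ d) (is , All.zip (u , ds)))))
      (≤-reflexive (m+[n∸m]≡n l≤N))
    where
    nw : ¬ (w P.≈ P.0#)
    nw z = nz (P.trans ew (P.trans (P.*-congˡ z) (P.zeroʳ _)))
    other : ∀ {l′} → Irr l′ → l ≢ l′ → ⟦ l′ ⟧ P.∣ D → ⟦ l′ ⟧ P.∣ w
    other j ne d = case irr-prime j ⟦ l ⟧ w (P.∣-resp ew d) of λ { (inj₁ h) → ⊥-elim (ne (≡.sym (irr-∣-irr j i h))) ; (inj₂ h) → h }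
    top : ∀ L → Bnd (suc L) w → D ‼ (length l ℕ.+ L) ≡ w ‼ L
    top L b = trans (‼-cong ew _) (trans (proj₂ (Pol.*-bnd-top (length l) L ⟦ l ⟧ w (bnd (mon-⟦⟧ l)) b)) (trans (*-congʳ (lead (mon-⟦⟧ l))) (*-identityˡ _)))
    down : ∀ L → Bnd L w → Σ ℕ λ M → Bnd (suc M) w × w ‼ M ≢ 0#
    down zero b = ⊥-elim (nw (Pol.bnd0 b))
    down (suc L) b = case (w ‼ L) ≟ 0# of λ
      { (yes z) → down L (λ i le → case m≤n⇒m<n∨m≡n le of λ { (inj₁ lt) → b i lt ; (inj₂ ≡.refl) → z })
      ; (no nz) → L , b , nz }
    degree : Σ ℕ λ M → Bnd (suc M) w × w ‼ M ≢ 0#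
    degree = down (Pol.bound w) (Pol.bnd-bound w)
    M : ℕ
    M = proj₁ degree
    l+M≤N : length l ℕ.+ M ≤ N
    l+M≤N = ≮⇒≥ λ lt → proj₂ (proj₂ degree) (trans (sym (top M (proj₁ (proj₂ degree)))) (bd _ lt))
    l≤N : length l ≤ N
    l≤N = ≤-trans (m≤m+n _ M) l+M≤N
    bw : Bnd (suc (N ∸ length l)) w
    bw = Pol.bnd-mono (s≤s (subst (_≤ N ∸ length l) (m+n∸m≡n (length l) M) (∸-monoˡ-≤ (length l) l+M≤N))) (proj₁ (proj₂ degree))

  record Target : Set where
    field
      a a′ : ℕ
      t : Carrier
      t≢0 : t ≢ 0#

  -- A nonzero polynomial vanishing at all good points is built as a difference of two combinations
  -- `G`. Its `r`-th power, times a power of `f`, agrees at those points with a difference of two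
  -- `Z`, which have far fewer coefficients than there are unknowns. A coincidence among the `Z`
  -- then forces the vanishing.
  module Auxiliary (target : Target) where
    open Target target
    private instance
      n-nonZero : ℕ.NonZero n
      n-nonZero = ℕ.>-nonZero 1≤n

    d s r r′ m ℓ : ℕ
    d = length lf
    s = length P₀
    r = q ℕ.^ a
    r′ = q ℕ.^ a′
    m = a ℕ.+ a′
    ℓ = E a′

    -- With coefficient polynomials `c_i`, `V` is `∑ c_i X^(r′ i)` and `W` is `∑ c_i^r X^i`. At a
    -- point of the field with `q^m = r r′` elements `X^(r r′) = X`, so `W` takes the value of the
    -- `r`-th power of `V`.
    V W : List (List Carrier) → P.Carrier
    V [] = P.0#
    V (c ∷ α) = Pol.fromList c P.+ X P.^ r′ P.* V α
    W [] = P.0#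
    W (c ∷ α) = Pol.fromList c P.^ r P.+ X P.* W α

    -- At a good point `z τ` equals `(g τ)^r f^((n-1) E a)`: since `r ℓ + E a = E m`, powers of `f`
    -- are traded for powers of `t`, and the extra factor keeps the exponents nonnegative. Writing
    -- `τ` by quotient and remainder modulo `n` separates the `P₀`-adic valuations of the `g τ`.
    g z : ℕ → P.Carrier
    g τ = ⟦ P₀ ⟧ P.^ (r′ ℕ.* (τ ℕ./ n)) P.* f P.^ (ℓ ℕ.* (τ ℕ.% n))
    z τ = C (t ^ (τ ℕ.% n)) P.* (⟦ P₀ ⟧ P.^ (τ ℕ./ n) P.* f P.^ ((n ∸ suc (τ ℕ.% n)) ℕ.* E a))

    G Z : ℕ → List (List (List Carrier)) → P.Carrier
    G τ [] = P.0#
    G τ (α ∷ as) = V α P.* g τ P.+ G (suc τ) as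
    Z τ [] = P.0#
    Z τ (α ∷ as) = W α P.* z τ P.+ Z (suc τ) as

    cofactor-exponent : ℕ
    cofactor-exponent = (n ∸ 1) ℕ.* E a

    E-m : r ℕ.* ℓ ℕ.+ E a ≡ E m
    E-m = ≡.trans (ℕP.+-comm _ (E a)) (≡.sym (E-+ a a′))

    record Point : Set where
      constructor point
      field
        {l} : List Carrier
        il : Irr l
        i : ℕ
        mi : m ≡ i ℕ.* length l
        value : ⟦ l ⟧ P.∣ (f P.^ E m P.- C t)

    module AtPrime (x₀ : Point) where
      open Point x₀
      open Residue il
      private
        module π = HomP proj
        π-^ : ∀ (x : P.Carrier) n → x P.^ n κ.≈ x κ.^ n
        π-^ x n = π.^-homo x n

      ^Q≈ : ∀ (x : κ.Carrier) → x κ.^ (q ℕ.^ m) κ.≈ x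
      ^Q≈ x = κ.trans (κ.reflexive (cong (λ j → x κ.^ (q ℕ.^ j)) mi)) (fermatκ^ i x)

      ^r′^r : ∀ (x : κ.Carrier) → (x κ.^ r′) κ.^ r κ.≈ x
      ^r′^r x = κ.trans (^q^-+ x a′ a) (κ.trans (κ.reflexive (cong (λ j → x κ.^ (q ℕ.^ j)) (ℕP.+-comm a′ a))) (^Q≈ x))

      f^E : f κ.^ E m κ.≈ emb.fn t
      f^E = κ.trans (κ.sym (π-^ f (E m))) (~by value)

      V^r≈W : ∀ α → V α κ.^ r κ.≈ W α
      V^r≈W [] = ^q-0 a
      V^r≈W (c ∷ α) = κ.trans (^q-+ a (Pol.fromList c) (X P.^ r′ P.* V α))
        (κ.+-cong (κ.sym (π-^ (Pol.fromList c) r)) (κ.trans (κ.^-distrib-* (X P.^ r′) (V α) r)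
          (κ.*-cong (κ.trans (κ.^-congˡ r (π-^ X r′)) (^r′^r X)) (V^r≈W α))))

      g^r≈z : ∀ τ → g τ κ.^ r κ.* f κ.^ cofactor-exponent κ.≈ z τ
      g^r≈z τ = κ.trans (κ.*-congʳ (κ.^-distrib-* _ _ r)) (κ.trans (κ.*-assoc _ _ _) (κ.trans (κ.*-cong P-part f-part)
        (κ.trans (κ.solve 3 (λ x y w → x κ.:* (y κ.:* w) κ.:= y κ.:* (x κ.:* w)) κ.refl (⟦ P₀ ⟧ κ.^ c) (emb.fn (t ^ b)) (f κ.^ rest))
          (κ.*-congˡ (κ.*-cong (κ.sym (π-^ _ c)) (κ.sym (π-^ f rest)))))))
        where
        b = τ ℕ.% n
        c = τ ℕ./ n
        rest = (n ∸ suc b) ℕ.* E a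
        P-part : (⟦ P₀ ⟧ P.^ (r′ ℕ.* c)) κ.^ r κ.≈ ⟦ P₀ ⟧ κ.^ c
        P-part = κ.trans (κ.^-congˡ r (κ.trans (π-^ ⟦ P₀ ⟧ (r′ ℕ.* c)) (κ.trans (κ.reflexive (cong (⟦ P₀ ⟧ κ.^_) (ℕP.*-comm r′ c))) (κ.sym (κ.^-assocʳ ⟦ P₀ ⟧ c r′)))))
          (^r′^r (⟦ P₀ ⟧ κ.^ c))
        exponents : ℓ ℕ.* b ℕ.* r ℕ.+ cofactor-exponent ≡ E m ℕ.* b ℕ.+ rest
        exponents = ≡.trans (cong (λ z → ℓ ℕ.* b ℕ.* r ℕ.+ z ℕ.* E a) split-n)
          (≡.trans (N.solve 5 (λ l b r R E → l N.:* b N.:* r N.:+ (b N.:+ R) N.:* E N.:= (r N.:* l N.:+ E) N.:* b N.:+ R N.:* E) ≡.refl ℓ b r (n ∸ suc b) (E a))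
            (cong (λ z → z ℕ.* b ℕ.+ rest) E-m))
          where
          split-n : n ∸ 1 ≡ b ℕ.+ (n ∸ suc b)
          split-n = ≡.sym (cong (_∸ 1) (m+[n∸m]≡n {suc b} (ℕDM.m%n<n τ n)))
        f-part : (f P.^ (ℓ ℕ.* b)) κ.^ r κ.* f κ.^ cofactor-exponent κ.≈ emb.fn (t ^ b) κ.* f κ.^ rest
        f-part = κ.trans (κ.*-congʳ (κ.trans (κ.^-congˡ r (π-^ f (ℓ ℕ.* b))) (κ.^-assocʳ f (ℓ ℕ.* b) r)))
          (κ.trans (κ.sym (κ.^-homo-* f (ℓ ℕ.* b ℕ.* r) cofactor-exponent)) (κ.trans (κ.reflexive (cong (f κ.^_) exponents))
            (κ.trans (κ.^-homo-* f (E m ℕ.* b) rest) (κ.*-congʳ (κ.trans (κ.sym (κ.^-assocʳ f (E m) b)) (κ.trans (κ.^-congˡ b f^E) (κ.sym (emb.^-homo t b))))))))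

      G^r≈Z : ∀ τ as → G τ as κ.^ r κ.* f κ.^ cofactor-exponent κ.≈ Z τ as
      G^r≈Z τ [] = κ.trans (κ.*-congʳ (^q-0 a)) (κ.zeroˡ _)
      G^r≈Z τ (α ∷ as) = κ.trans (κ.*-congʳ (κ.trans (^q-+ a (V α P.* g τ) (G (suc τ) as)) (κ.+-congʳ (κ.^-distrib-* (V α) (g τ) r))))
        (κ.trans (κ.solve 4 (λ v g G f → (v κ.:* g κ.:+ G) κ.:* f κ.:= v κ.:* (g κ.:* f) κ.:+ G κ.:* f) κ.refl _ _ _ _)
          (κ.+-cong (κ.*-cong (V^r≈W α) (g^r≈z τ)) (G^r≈Z (suc τ) as)))

      -- At a good point `f` is invertible because a power of it is `t ≠ 0`; so the `r`-th power of
      -- the difference vanishes, and with it the difference.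
      vanishes : ∀ as bs → Z 0 as P.≈ Z 0 bs → 1 ≤ E m → ⟦ l ⟧ P.∣ (G 0 as P.- G 0 bs)
      vanishes as bs e 1≤Em = ~0⇒∣ (κ-^≈0 r (case κ-domain _ (f κ.^ cofactor-exponent) product of λ
          { (inj₁ h) → h ; (inj₂ h) → ⊥-elim (f≉0 (κ-^≈0 cofactor-exponent h)) }))
        where
        product : (G 0 as P.- G 0 bs) κ.^ r κ.* f κ.^ cofactor-exponent κ.≈ κ.0#
        product = κ.trans (κ.*-congʳ (^q-sub a (G 0 as) (G 0 bs))) (κ.trans (κ.solve 3 (λ x y f → (x κ.:- y) κ.:* f κ.:= x κ.:* f κ.:- y κ.:* f) κ.refl _ _ _)
          (κ.x≈y⇒x∙y⁻¹≈ε (κ.trans (G^r≈Z 0 as) (κ.trans (≈⇒~ e) (κ.sym (G^r≈Z 0 bs))))))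
        f≉0 : ¬ (f κ.≈ κ.0#)
        f≉0 h = t≢0 (emb-0 (κ.trans (κ.sym f^E) (κ.trans (κ.^-congˡ (E m) h) (zero-power (E m) 1≤Em))))
          where
          zero-power : ∀ N → 1 ≤ N → κ.0# κ.^ N κ.≈ κ.0#
          zero-power (suc N) _ = κ.0^ N
          emb-0 : emb.fn t κ.≈ κ.0# → t ≡ 0#
          emb-0 h = trans (sym (Pol.C‼0 t)) (trans (‼-cong (Pol.monic∣⇒≈0 (mon-⟦⟧ l) (Pol.bnd-mono (positive il) (Pol.bnd-C t)) (~0⇒∣ h)) 0) (Pol.‼-0 0))

    module Injectivity (ℓ≤r′ : ℓ ≤ r′) where
      open Residue i₀
      private
        module K = FrobeniusQ κT.poly (κT.constHom ∘ₕ emb)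
        module M = HomP mapHom

      x-θ : κT.P.Carrier
      x-θ = κT.X-C y

      V̄ : List (List Carrier) → κT.P.Carrier
      V̄ [] = κT.P.0#
      V̄ (c ∷ α) = M.fn (Pol.fromList c) κT.P.+ κT.C (y κ.^ r′) κT.P.* V̄ α

      x-θ∣P₀ : x-θ κT.P.∣ M.fn ⟦ P₀ ⟧
      x-θ∣P₀ = κT.factor y _ (κ.trans (eval-mapκ y ⟦ P₀ ⟧) (κ.trans (evalκ-y ⟦ P₀ ⟧) (∣⇒~0 P.∣-refl)))

      X^r′ : κT.P._∣_ (x-θ κT.P.^ r′) (M.fn (X P.^ r′) κT.P.- κT.C (y κ.^ r′))
      X^r′ = κT.P.∣-resp (κT.P.trans (K.^q-sub a′ κT.X (κT.C y)) (κT.P.+-cong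
          (κT.P.sym (κT.P.trans (M.^-homo X r′) (κT.P.^-congˡ r′ (PolyMap.map-X emb)))) (κT.P.-‿cong (κT.P.sym (HomP.^-homo κT.constHom y r′)))))
        κT.P.∣-refl

      V≡V̄ : ∀ α → x-θ κT.P.^ r′ κT.P.∣ (M.fn (V α) κT.P.- V̄ α)
      V≡V̄ [] = κT.P.∣-resp (κT.P.sym (κT.P.x≈y⇒x∙y⁻¹≈ε M.0-homo)) κT.P.∣0
      V≡V̄ (c ∷ α) = κT.P.∣-resp (κT.P.trans
          (κT.P.solve 5 (λ c x y u w → (x κT.P.:- y) κT.P.:* u κT.P.:+ y κT.P.:* (u κT.P.:- w) κT.P.:= (c κT.P.:+ x κT.P.:* u) κT.P.:- (c κT.P.:+ y κT.P.:* w)) κT.P.refl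
             (M.fn (Pol.fromList c)) (M.fn (X P.^ r′)) (κT.C (y κ.^ r′)) (M.fn (V α)) (V̄ α))
          (κT.P.+-congʳ (κT.P.sym (κT.P.trans (M.+-homo _ _) (κT.P.+-congˡ (M.*-homo _ _))))))
        (κT.P.∣-+ (κT.P.∣-* _ X^r′) (κT.P.∣-*ˡ _ (V≡V̄ α)))

      V̄-bnd : ∀ α → All (λ c → length c ≡ ℓ) α → κT.Bnd ℓ (V̄ α)
      V̄-bnd [] _ = κT.bnd-0
      V̄-bnd (c ∷ α) (e ∷ es) = κT.bnd-+ (PolyMap.map-bnd emb (subst (λ N → Bnd N (Pol.fromList c)) e (Pol.bnd-fromList c))) (κT.bnd-C* (y κ.^ r′) (V̄-bnd α es))

      row : ℕ → List (List Carrier) → List Carrier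
      row i = map (λ c → Pol.fromList c ‼ i)

      V̄-row : ∀ i α → V̄ α κT.‼ i κ.≈ Hom.fn (evalκ (y κ.^ r′)) (Pol.fromList (row i α))
      V̄-row i [] = κ.trans (κT.‼-0 i) (κ.sym (κ.trans (Hom.resp (evalκ (y κ.^ r′)) Pol.fromList-[]) (Hom.0-homo (evalκ (y κ.^ r′)))))
      V̄-row i (c ∷ α) = κ.trans (κT.‼-+ _ _ i) (κ.trans (κ.+-cong (PolyMap.map-‼ emb (Pol.fromList c) i)
          (κ.trans (κT.C*‼ (y κ.^ r′) (V̄ α) i) (κ.*-congˡ (V̄-row i α))))
        (κ.sym (κ.trans (Ev.resp (Pol.fromList-∷ _ (row i α))) (κ.trans (Ev.+-homo _ _) (κ.+-cong (Pol.Eval.eval-C emb (y κ.^ r′) _)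
          (κ.trans (Ev.*-homo _ _) (κ.*-congʳ (Pol.Eval.eval-X emb (y κ.^ r′)))))))))
        where module Ev = HomP (evalκ (y κ.^ r′))

      rows-determine : ∀ α β → length α ≡ length β → All (λ c → length c ≡ ℓ) α → All (λ c → length c ≡ ℓ) β → (∀ i → row i α ≡ row i β) → α ≡ β
      rows-determine [] [] _ _ _ _ = ≡.refl
      rows-determine (c ∷ α) (c′ ∷ β) len (e ∷ es) (e′ ∷ es′) h = cong₂ _∷_
        (fromList-injective (≡.trans e (≡.sym e′)) (λ i → ListP.∷-injectiveˡ (h i)))
        (rows-determine α β (ℕP.suc-injective len) es es′ (λ i → ListP.∷-injectiveʳ (h i)))

      -- Let `θ` be the root `y` of `P₀`. Modulo `(X - θ)^ℓ`, where `ℓ ≤ r′`, the power `X^r′` is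
      -- the constant `θ^r′`, so `V` reduces to `V̄` of degree less than `ℓ`. The coefficients of
      -- `V̄` are `r′`-th powers of residues of the rows, and a row of length `s = deg P₀` is
      -- determined by its residue.
      V-injective : ∀ α β → length α ≡ s → length β ≡ s → All (λ c → length c ≡ ℓ) α → All (λ c → length c ≡ ℓ) β →
                    ⟦ P₀ ⟧ P.^ ℓ P.∣ (V α P.- V β) → α ≡ β
      V-injective α β la lb ea eb dv = rows-determine α β (≡.trans la (≡.sym lb)) ea eb λ i →
          residue-injective (row i α) (row i β) (≡.trans (ListP.length-map _ α) la) (≡.trans (ListP.length-map _ β) lb)
            (^q-injective a′ (κ.trans (a^q^≈ a′ _) (κ.trans (κ.sym (V̄-row i α)) (κ.trans (κT.‼-cong V̄≈ i) (κ.trans (V̄-row i β) (κ.sym (a^q^≈ a′ _)))))))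
        where
        Mℓ∣ : x-θ κT.P.^ ℓ κT.P.∣ (V̄ α κT.P.- V̄ β)
        Mℓ∣ = κT.P.∣-resp (κT.P.trans (κT.P.+-congʳ (κT.P.+-congʳ (M.sub-homo (V α) (V β))))
            (κT.P.solve 4 (λ u v u′ v′ → ((u κT.P.:- v) κT.P.:- (u κT.P.:- u′)) κT.P.:+ (v κT.P.:- v′) κT.P.:= u′ κT.P.:- v′) κT.P.refl _ _ _ _))
          (κT.P.∣-+ (κT.P.∣-sub (κT.P.∣-trans (κT.P.^-∣ ℓ x-θ∣P₀) (κT.P.∣-respˡ (M.^-homo ⟦ P₀ ⟧ ℓ) (M.∣-homo dv)))
              (κT.P.∣-trans (κT.P.^-mono-∣ x-θ ℓ≤r′) (V≡V̄ α))) (κT.P.∣-trans (κT.P.^-mono-∣ x-θ ℓ≤r′) (V≡V̄ β)))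
        V̄≈ : V̄ α κT.P.≈ V̄ β
        V̄≈ = κT.P.x∙y⁻¹≈ε⇒x≈y _ _ (κT.monic∣⇒≈0 (subst (λ N → κT.Mon N (x-θ κT.P.^ ℓ)) (ℕP.*-identityʳ ℓ) (κT.mon-^ ℓ (κT.mon-X-C y)))
          (κT.bnd-sub (V̄-bnd α ea) (V̄-bnd β eb)) Mℓ∣)

      -- The `P₀`-adic valuation of `g τ`, which equals `r′ (τ / n) + ℓ (τ % n)` because
      -- `r′ = nℓ + 1`.
      v : ℕ → ℕ
      v τ = ℓ ℕ.* τ ℕ.+ τ ℕ./ n

      u : ℕ → P.Carrier
      u τ = f₁ P.^ (ℓ ℕ.* (τ ℕ.% n))

      g≈ : ∀ τ → g τ P.≈ ⟦ P₀ ⟧ P.^ v τ P.* u τ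
      g≈ τ = P.trans (P.*-congˡ (P.trans (P.^-congˡ (ℓ ℕ.* b) f≈) (P.^-distrib-* ⟦ P₀ ⟧ f₁ (ℓ ℕ.* b)))) (P.trans (P.sym (P.*-assoc _ _ _))
        (P.*-congʳ (P.trans (P.sym (P.^-homo-* ⟦ P₀ ⟧ (r′ ℕ.* c) (ℓ ℕ.* b))) (P.reflexive (cong (⟦ P₀ ⟧ P.^_) exponent)))))
        where
        b = τ ℕ.% n
        c = τ ℕ./ n
        exponent : r′ ℕ.* c ℕ.+ ℓ ℕ.* b ≡ v τ
        exponent = ≡.trans (cong (λ z → z ℕ.* c ℕ.+ ℓ ℕ.* b) (≡.sym (nE a′)))
          (≡.trans (N.solve 4 (λ n l c b → (N.con 1 N.:+ n N.:* l) N.:* c N.:+ l N.:* b N.:= l N.:* (b N.:+ c N.:* n) N.:+ c) ≡.refl n ℓ c b)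
            (cong (λ z → ℓ ℕ.* z ℕ.+ c) (≡.sym (ℕDM.m≡m%n+[m/n]*n τ n))))

      v-suc : ∀ τ → v τ ℕ.+ ℓ ≤ v (suc τ)
      v-suc τ = subst (_≤ v (suc τ)) (N.solve 3 (λ l t c → l N.:* (N.con 1 N.:+ t) N.:+ c N.:= (l N.:* t N.:+ c) N.:+ l) ≡.refl ℓ τ (τ ℕ./ n))
        (+-monoʳ-≤ (ℓ ℕ.* suc τ) (ℕDM./-monoˡ-≤ n (n≤1+n τ)))

      G-divisible : ∀ τ as → ⟦ P₀ ⟧ P.^ v τ P.∣ G τ as
      G-divisible τ [] = P.∣0
      G-divisible τ (α ∷ as) = P.∣-+ (P.∣-*ˡ _ (P.∣-resp (P.sym (g≈ τ)) (P.∣-* _ P.∣-refl)))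
        (P.∣-trans (P.^-mono-∣ ⟦ P₀ ⟧ (≤-trans (m≤m+n (v τ) ℓ) (v-suc τ))) (G-divisible (suc τ) as))

      Shape : List (List Carrier) → Set
      Shape α = length α ≡ s × All (λ c → length c ≡ ℓ) α

      -- The valuations `v τ` increase by at least `ℓ` at each step. All later terms being divisible
      -- by `P₀^(v τ + ℓ)`, the first difference of blocks is divisible by `P₀^ℓ`, and `V-injective`
      -- applies.
      G-injective : ∀ τ as bs → length as ≡ length bs → All Shape as → All Shape bs → G τ as P.≈ G τ bs → as ≡ bs
      G-injective τ [] [] _ _ _ _ = ≡.refl
      G-injective τ (α ∷ as) (β ∷ bs) len ((la , ea) ∷ sa) ((lb , eb) ∷ sb) h =
        combine (V-injective α β la lb ea eb (irr-^-coprime i₀ ℓ _ (irr-^-∤ i₀ (ℓ ℕ.* (τ ℕ.% n)) P₀∤f₁) cancelled))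
        where
        Δ : P.Carrier
        Δ = V α P.- V β
        tail-eq : Δ P.* g τ P.≈ G (suc τ) bs P.- G (suc τ) as
        tail-eq = P.trans (P.solve 5 (λ x y g u w → (x P.:- y) P.:* g P.:= ((x P.:* g P.:+ u) P.:- (y P.:* g P.:+ w)) P.:+ (w P.:- u)) P.refl (V α) (V β) (g τ) (G (suc τ) as) (G (suc τ) bs))
          (P.trans (P.+-congʳ (P.x≈y⇒x∙y⁻¹≈ε h)) (P.+-identityˡ _))
        divisible : ⟦ P₀ ⟧ P.^ (v τ ℕ.+ ℓ) P.∣ ⟦ P₀ ⟧ P.^ v τ P.* (u τ P.* Δ)
        divisible = P.∣-resp (P.trans (P.sym tail-eq) (P.trans (P.*-congˡ (g≈ τ)) (P.solve 3 (λ D p u → D P.:* (p P.:* u) P.:= p P.:* (u P.:* D)) P.refl Δ _ _)))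
          (P.∣-trans (P.^-mono-∣ ⟦ P₀ ⟧ (v-suc τ)) (P.∣-sub (G-divisible (suc τ) bs) (G-divisible (suc τ) as)))
        cancelled : ⟦ P₀ ⟧ P.^ ℓ P.∣ u τ P.* Δ
        cancelled = cancel divisible
          where
          cancel : ⟦ P₀ ⟧ P.^ (v τ ℕ.+ ℓ) P.∣ ⟦ P₀ ⟧ P.^ v τ P.* (u τ P.* Δ) → ⟦ P₀ ⟧ P.^ ℓ P.∣ u τ P.* Δ
          cancel (w P.by e) = w P.by Pol.monic-cancelˡ (Pol.mon-^ (v τ) (mon-⟦⟧ P₀))
            (P.trans e (P.trans (P.*-congʳ (P.^-homo-* ⟦ P₀ ⟧ (v τ) ℓ)) (P.*-assoc _ _ _)))
        combine : α ≡ β → α ∷ as ≡ β ∷ bs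
        combine ≡.refl = cong (α ∷_) (G-injective (suc τ) as bs (ℕP.suc-injective len) sa sb
          (P.+-cancelˡ (V α P.* g τ) _ _ h))

    module Degrees (J ℓ′ : ℕ) (ℓ≡ : ℓ ≡ suc ℓ′) where

      -- There are `T` blocks; `EZ` bounds the number of coefficients of `Z`, and `EG` that of `G`.
      J₁ T EZ EG : ℕ
      J₁ = suc J
      T = n ℕ.* J₁
      EZ = J ℕ.* s ℕ.+ r ℕ.* d ℕ.+ (r ℕ.* ℓ′ ℕ.+ s)
      EG = r′ ℕ.* J ℕ.* s ℕ.+ r′ ℕ.* d ℕ.+ (ℓ ℕ.+ r′ ℕ.* s)

      Row : List Carrier → Set
      Row c = length c ≡ ℓ

      row-bnd : ∀ {c} → Row c → Bnd (suc ℓ′) (Pol.fromList c)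
      row-bnd {c} e = subst (λ N → Bnd N (Pol.fromList c)) (≡.trans e ℓ≡) (Pol.bnd-fromList c)

      W-bnd : ∀ α → All Row α → Bnd (r ℕ.* ℓ′ ℕ.+ length α) (W α)
      W-bnd [] _ = Pol.bnd-0
      W-bnd (c ∷ α) (e ∷ es) = subst (λ N → Bnd N (W (c ∷ α))) (≡.sym (ℕP.+-suc (r ℕ.* ℓ′) (length α)))
        (Pol.bnd-+ (Pol.bnd-mono (s≤s (m≤m+n _ _)) (Pol.bnd-^ ℓ′ r (row-bnd e))) (Pol.bnd-X* (W-bnd α es)))

      V-bnd : ∀ α → All Row α → Bnd (ℓ ℕ.+ r′ ℕ.* length α) (V α)
      V-bnd [] _ = Pol.bnd-0
      V-bnd (c ∷ α) (e ∷ es) = Pol.bnd-+ (Pol.bnd-mono (m≤m+n ℓ _) (subst (λ N → Bnd N (Pol.fromList c)) e (Pol.bnd-fromList c)))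
        (subst (λ N → Bnd N (X P.^ r′ P.* V α)) (N.solve 3 (λ r l a → r N.:* N.con 1 N.:+ (l N.:+ r N.:* a) N.:= l N.:+ r N.:* (N.con 1 N.:+ a)) ≡.refl r′ ℓ (length α))
          (Pol.bnd-* (r′ ℕ.* 1) (Pol.bnd-^ 1 r′ (bnd Pol.mon-X)) (V-bnd α es)))

      private
        nE<q : ∀ b j → b ≤ n → b ℕ.* E j ≤ q ℕ.^ j
        nE<q b j le = ≤-trans (*-monoˡ-≤ (E j) le) (≤-trans (n≤1+n _) (≤-reflexive (nE j)))

        quotient≤J : ∀ {τ} → τ < T → τ ℕ./ n ≤ J
        quotient≤J {τ} lt = ≤-pred (ℕDM.m<n*o⇒m/o<n (subst (τ <_) (ℕP.*-comm n J₁) lt))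

      z-bnd : ∀ τ → τ < T → Bnd (suc (J ℕ.* s ℕ.+ r ℕ.* d)) (z τ)
      z-bnd τ lt = Pol.bnd-C* _ (Pol.bnd-mono (s≤s (+-mono-≤ (*-monoˡ-≤ s (quotient≤J lt)) (*-monoˡ-≤ d (nE<q (n ∸ suc (τ ℕ.% n)) a (m∸n≤m n (suc (τ ℕ.% n)))))))
        (proj₁ (Pol.*-bnd-top (τ ℕ./ n ℕ.* s) _ _ _ (Pol.bnd-^ s (τ ℕ./ n) (bnd (mon-⟦⟧ P₀))) (Pol.bnd-^ d ((n ∸ suc (τ ℕ.% n)) ℕ.* E a) (bnd (mon-⟦⟧ lf))))))

      g-bnd : ∀ τ → τ < T → Bnd (suc (r′ ℕ.* J ℕ.* s ℕ.+ r′ ℕ.* d)) (g τ)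
      g-bnd τ lt = Pol.bnd-mono (s≤s (+-mono-≤ (*-monoˡ-≤ s (*-monoʳ-≤ r′ (quotient≤J lt)))
          (*-monoˡ-≤ d (≤-trans (≤-reflexive (ℕP.*-comm ℓ (τ ℕ.% n))) (nE<q (τ ℕ.% n) a′ (<⇒≤ (ℕDM.m%n<n τ n)))))))
        (proj₁ (Pol.*-bnd-top (r′ ℕ.* (τ ℕ./ n) ℕ.* s) _ _ _ (Pol.bnd-^ s (r′ ℕ.* (τ ℕ./ n)) (bnd (mon-⟦⟧ P₀))) (Pol.bnd-^ d (ℓ ℕ.* (τ ℕ.% n)) (bnd (mon-⟦⟧ lf)))))

      Block : List (List Carrier) → Set
      Block α = length α ≡ s × All Row α

      Z-bnd : ∀ τ as → τ ℕ.+ length as ≤ T → All Block as → Bnd EZ (Z τ as)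
      Z-bnd τ [] _ _ = Pol.bnd-0
      Z-bnd τ (α ∷ as) le ((la , ea) ∷ bs) = Pol.bnd-+ (Pol.bnd-resp (P.*-comm _ _) (Pol.bnd-* (J ℕ.* s ℕ.+ r ℕ.* d)
          (z-bnd τ (<-≤-trans (m<m+n τ (s≤s z≤n)) le)) (subst (λ x → Bnd (r ℕ.* ℓ′ ℕ.+ x) (W α)) la (W-bnd α ea))))
        (Z-bnd (suc τ) as (subst (_≤ T) (ℕP.+-suc τ (length as)) le) bs)

      G-bnd : ∀ τ as → τ ℕ.+ length as ≤ T → All Block as → Bnd EG (G τ as)
      G-bnd τ [] _ _ = Pol.bnd-0
      G-bnd τ (α ∷ as) le ((la , ea) ∷ bs) = Pol.bnd-+ (Pol.bnd-resp (P.*-comm _ _) (Pol.bnd-* (r′ ℕ.* J ℕ.* s ℕ.+ r′ ℕ.* d)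
          (g-bnd τ (<-≤-trans (m<m+n τ (s≤s z≤n)) le)) (subst (λ x → Bnd (ℓ ℕ.+ r′ ℕ.* x) (V α)) la (V-bnd α ea))))
        (G-bnd (suc τ) as (subst (_≤ T) (ℕP.+-suc τ (length as)) le) bs)

      rows : List (List Carrier)
      rows = seqs elements ℓ
      blocks : List (List (List Carrier))
      blocks = seqs rows s
      unknowns : List (List (List (List Carrier)))
      unknowns = seqs blocks T

      length-unknowns : length unknowns ≡ q ℕ.^ (ℓ ℕ.* s ℕ.* T)
      length-unknowns = ≡.trans (length-seqs T) (≡.trans (cong (ℕ._^ T) (≡.trans (length-seqs s) (≡.trans (cong (ℕ._^ s) (≡.trans (length-seqs ℓ) (cong (ℕ._^ ℓ) length-elements)))
        (ℕP.^-*-assoc q ℓ s)))) (ℕP.^-*-assoc q (ℓ ℕ.* s) T))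

      unknowns-shape : ∀ {as} → as ∈ unknowns → length as ≡ T × All Block as
      unknowns-shape i = seqs-length T i , All.map (λ j → seqs-length s j , All.map (λ k → seqs-length ℓ k) (seqs-All s j)) (seqs-All T i)

      unknowns-unique : Unique unknowns
      unknowns-unique = seqs-unique (seqs-unique (seqs-unique elements-unique ℓ) s) T

      coefficients : P.Carrier → List Carrier
      coefficients p = map (p ‼_) (upTo EZ)

      map-injective : ∀ {X Y : Set} (h h′ : X → Y) xs → map h xs ≡ map h′ xs → ∀ {x} → x ∈ xs → h x ≡ h′ x
      map-injective h h′ (x ∷ xs) e (here ≡.refl) = ListP.∷-injectiveˡ e
      map-injective h h′ (x ∷ xs) e (there i) = map-injective h h′ xs (ListP.∷-injectiveʳ e) i

      abstract
        -- Pigeonhole: `q^(ℓ s T)` choices of unknowns against at most `q^EZ` values of `Z`.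
        auxiliary : EZ < ℓ ℕ.* s ℕ.* T → Σ (List (List (List Carrier))) λ as → Σ (List (List (List Carrier))) λ bs →
                    as ∈ unknowns × bs ∈ unknowns × as ≢ bs × Z 0 as P.≈ Z 0 bs
        auxiliary lt =
          let (as , bs , ia , ib , ne , e) = list-pigeonhole unknowns (seqs elements EZ) (λ as → coefficients (Z 0 as)) unknowns-unique
                (λ as _ → subst (λ N → coefficients (Z 0 as) ∈ seqs elements N) (≡.trans (ListP.length-map (Z 0 as ‼_) (upTo EZ)) (ListP.length-upTo EZ)) (seqs-∈ (All.tabulate (λ _ → ∈elements _))))
                (subst₂ _<_ (≡.sym (≡.trans (length-seqs EZ) (cong (ℕ._^ EZ) length-elements))) (≡.sym length-unknowns) (^-monoʳ-< q 1<q lt))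
          in as , bs , ia , ib , ne , Pol.≈-intro λ i → case i ℕP.<? EZ of λ
               { (yes lt) → map-injective (Z 0 as ‼_) (Z 0 bs ‼_) (upTo EZ) e (∈-upTo⁺ lt)
               ; (no ge) → trans (zbd as ia i (≮⇒≥ ge)) (sym (zbd bs ib i (≮⇒≥ ge))) }
          where
          zbd : ∀ as → as ∈ unknowns → Bnd EZ (Z 0 as)
          zbd as i = let (la , sh) = unknowns-shape i in Z-bnd 0 as (≤-reflexive la) sh

        degree-bound : 1 ≤ a′ → EZ < ℓ ℕ.* s ℕ.* T → ∀ ls → Unique ls → All (Good m t) ls → ℕSum.∑ ls length ≤ EG
        degree-bound 1≤a′ lt ls u good =
          let (as , bs , ia , ib , ne , e) = auxiliary lt
              (la , sa) = unknowns-shape ia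
              (lb , sb) = unknowns-shape ib
          in ∑-degrees ls EG (G 0 as P.- G 0 bs)
               (λ z → ne (Injectivity.G-injective ℓ≤r′ 0 as bs (≡.trans la (≡.sym lb)) sa sb (P.x∙y⁻¹≈ε⇒x≈y _ _ z)))
               (Pol.bnd-mono (n≤1+n _) (Pol.bnd-sub (G-bnd 0 as (≤-reflexive la) sa) (G-bnd 0 bs (≤-reflexive lb) sb)))
               u (All.map proj₁ good)
               (All.map (λ (il , (i , mi) , val) → AtPrime.vanishes (point il i mi val) as bs e (1≤E (≤-trans 1≤a′ (m≤n+m a′ a)))) good)
          where
          ℓ≤r′ : ℓ ≤ r′
          ℓ≤r′ = ≤-trans (≤-reflexive (≡.sym (ℕP.+-identityʳ ℓ))) (nE<q 1 a′ 1≤n)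

  module Bound where

    private
      d s C₁ : ℕ
      d = length lf
      s = length P₀
      C₁ = 3 ℕ.* suc (n ℕ.* d)

    C₂ : ℕ
    C₂ = C₁ ℕ.+ n ℕ.* (d ℕ.+ s ℕ.+ 1)

    private
      instance
        sn-nonZero : ℕ.NonZero (s ℕ.* n)
        sn-nonZero = ℕ.>-nonZero (*-mono-≤ (positive i₀) 1≤n)

      -- What remains of `EZ < ℓ s T` after multiplying by `n` and removing the common `Y`; here
      -- `N₁ = r′ - 2`, and `C₁` absorbs the term with `d` by means of `r ≤ r′ ≤ 3 N₁`.
      enough : ∀ r ℓ′ N₁ Y → n ℕ.* suc ℓ′ ≡ suc N₁ → 1 ≤ N₁ → r ≤ suc (suc N₁) → r ℕ.+ C₁ ≤ Y →
               n ℕ.* r ℕ.* d ℕ.+ r ℕ.* (n ℕ.* ℓ′) < N₁ ℕ.* Y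
      enough r ℓ′ N₁ Y eN 1≤N₁ r≤ Y≥ = begin-strict
        n ℕ.* r ℕ.* d ℕ.+ r ℕ.* (n ℕ.* ℓ′)    ≤⟨ +-mono-≤ (≤-reflexive (N.solve 3 (λ n r d → n N.:* r N.:* d N.:= r N.:* (n N.:* d)) ≡.refl n r d)) (*-monoʳ-≤ r nℓ′≤) ⟩
        r ℕ.* (n ℕ.* d) ℕ.+ r ℕ.* N₁          ≤⟨ +-monoˡ-≤ _ (*-monoˡ-≤ (n ℕ.* d) (≤-trans r≤ 2+N₁≤)) ⟩
        3 ℕ.* N₁ ℕ.* (n ℕ.* d) ℕ.+ r ℕ.* N₁   <⟨ +-monoˡ-< (r ℕ.* N₁) (m<m+n (3 ℕ.* N₁ ℕ.* (n ℕ.* d)) {N₁ ℕ.* 3} (*-mono-≤ 1≤N₁ (s≤s (z≤n {2})))) ⟩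
        3 ℕ.* N₁ ℕ.* (n ℕ.* d) ℕ.+ N₁ ℕ.* 3 ℕ.+ r ℕ.* N₁ ≡⟨ N.solve 3 (λ r N1 x → N.con 3 N.:* N1 N.:* x N.:+ N1 N.:* N.con 3 N.:+ r N.:* N1 N.:= N1 N.:* (r N.:+ N.con 3 N.:* (N.con 1 N.:+ x))) ≡.refl r N₁ (n ℕ.* d) ⟩
        N₁ ℕ.* (r ℕ.+ C₁)                     ≤⟨ *-monoʳ-≤ N₁ Y≥ ⟩
        N₁ ℕ.* Y ∎
        where
        open ℕP.≤-Reasoning
        nℓ′≤ : n ℕ.* ℓ′ ≤ N₁
        nℓ′≤ = ≤-pred (≤-trans (+-monoˡ-≤ (n ℕ.* ℓ′) 1≤n) (≤-reflexive (≡.trans (≡.sym (ℕP.*-suc n ℓ′)) eN)))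
        2+N₁≤ : suc (suc N₁) ≤ 3 ℕ.* N₁
        2+N₁≤ = ≤-trans (+-monoˡ-≤ N₁ (*-monoʳ-≤ 2 1≤N₁)) (≤-reflexive (N.solve 1 (λ x → N.con 2 N.:* x N.:+ x N.:= N.con 3 N.:* x) ≡.refl N₁))

    abstract
      -- The choice `J = ⌊(r + C₁) / (s n)⌋` makes the unknowns just outnumber the conditions, while
      -- `n · EG` stays at `r r′` up to a multiple of `r′`.
      stepanov : ∀ a a′ t → t ≢ 0# → a ≤ a′ → 1 ≤ a′ → ∀ ls → Unique ls → All (Good (a ℕ.+ a′) t) ls →
                 n ℕ.* ℕSum.∑ ls length ≤ q ℕ.^ (a ℕ.+ a′) ℕ.+ q ℕ.^ a′ ℕ.* C₂
      stepanov a a′ t t≢0 a≤a′ 1≤a′ ls u good = begin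
        n ℕ.* ℕSum.∑ ls length            ≤⟨ *-monoʳ-≤ n (D.degree-bound 1≤a′ EZ< ls u good) ⟩
        n ℕ.* D.EG                        ≤⟨ *-monoʳ-≤ n (+-monoʳ-≤ (r′ ℕ.* J ℕ.* s ℕ.+ r′ ℕ.* d) (+-monoˡ-≤ (r′ ℕ.* s) ℓ≤r′)) ⟩
        n ℕ.* (r′ ℕ.* J ℕ.* s ℕ.+ r′ ℕ.* d ℕ.+ (r′ ℕ.+ r′ ℕ.* s))
          ≡⟨ N.solve 5 (λ n r J s d → n N.:* (r N.:* J N.:* s N.:+ r N.:* d N.:+ (r N.:+ r N.:* s)) N.:= r N.:* (J N.:* (s N.:* n)) N.:+ r N.:* (n N.:* (d N.:+ s N.:+ N.con 1))) ≡.refl n r′ J s d ⟩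
        r′ ℕ.* (J ℕ.* (s ℕ.* n)) ℕ.+ r′ ℕ.* (n ℕ.* (d ℕ.+ s ℕ.+ 1)) ≤⟨ +-monoˡ-≤ _ (*-monoʳ-≤ r′ (ℕDM.m/n*n≤m (r ℕ.+ C₁) (s ℕ.* n))) ⟩
        r′ ℕ.* (r ℕ.+ C₁) ℕ.+ r′ ℕ.* (n ℕ.* (d ℕ.+ s ℕ.+ 1)) ≡⟨ N.solve 4 (λ R r c x → R N.:* (r N.:+ c) N.:+ R N.:* x N.:= r N.:* R N.:+ R N.:* (c N.:+ x)) ≡.refl r′ r C₁ _ ⟩
        r ℕ.* r′ ℕ.+ r′ ℕ.* C₂            ≡⟨ cong (ℕ._+ r′ ℕ.* C₂) (≡.sym (ℕP.^-distribˡ-+-* q a a′)) ⟩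
        q ℕ.^ (a ℕ.+ a′) ℕ.+ r′ ℕ.* C₂ ∎
        where
        open ℕP.≤-Reasoning
        target : Target
        target = record { a = a ; a′ = a′ ; t = t ; t≢0 = t≢0 }
        module A = Auxiliary target
        open A using (r; r′; ℓ)
        J : ℕ
        J = (r ℕ.+ C₁) ℕ./ (s ℕ.* n)
        predecessor : ∀ N → 1 ≤ N → Σ ℕ λ M → N ≡ suc M
        predecessor (suc M) _ = M , ≡.refl
        ℓ′ : ℕ
        ℓ′ = proj₁ (predecessor ℓ (1≤E 1≤a′))
        ℓ≡ : ℓ ≡ suc ℓ′
        ℓ≡ = proj₂ (predecessor ℓ (1≤E 1≤a′))
        module D = A.Degrees J ℓ′ ℓ≡
        ℓ≤r′ : ℓ ≤ r′
        ℓ≤r′ = ≤-trans (≤-trans (≤-reflexive (≡.sym (ℕP.*-identityˡ ℓ))) (*-monoˡ-≤ ℓ 1≤n)) (≤-trans (n≤1+n _) (≤-reflexive (nE a′)))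
        q≤r′ : q ≤ r′
        q≤r′ = ≤-trans (≤-reflexive (≡.sym (ℕP.*-identityʳ q))) (^-monoʳ-≤ q {{ℕ.>-nonZero (<-trans (s≤s z≤n) 1<q)}} 1≤a′)
        nℓ : Σ ℕ λ N₁ → n ℕ.* suc ℓ′ ≡ suc N₁
        nℓ = predecessor (n ℕ.* suc ℓ′) (*-mono-≤ 1≤n (s≤s (z≤n {ℓ′})))
        N₁ : ℕ
        N₁ = proj₁ nℓ
        r′≡ : suc (suc N₁) ≡ r′
        r′≡ = ≡.trans (cong suc (≡.trans (≡.sym (proj₂ nℓ)) (cong (n ℕ.*_) (≡.sym ℓ≡)))) (nE a′)
        1≤N₁ : 1 ≤ N₁
        1≤N₁ = ≤-pred (≤-pred (≤-trans 3≤q (≤-trans q≤r′ (≤-reflexive (≡.sym r′≡)))))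
        r≤ : r ≤ suc (suc N₁)
        r≤ = ≤-trans (^-monoʳ-≤ q {{ℕ.>-nonZero (<-trans (s≤s z≤n) 1<q)}} a≤a′) (≤-reflexive (≡.sym r′≡))
        Y : ℕ
        Y = s ℕ.* n ℕ.* suc J
        Y≥ : r ℕ.+ C₁ ≤ Y
        Y≥ = ≤-trans (≤-reflexive (ℕDM.m≡m%n+[m/n]*n (r ℕ.+ C₁) (s ℕ.* n))) (≤-trans (+-monoˡ-≤ _ (<⇒≤ (ℕDM.m%n<n (r ℕ.+ C₁) (s ℕ.* n))))
          (≤-reflexive (≡.trans (cong (s ℕ.* n ℕ.+_) (ℕP.*-comm J (s ℕ.* n))) (≡.sym (ℕP.*-suc (s ℕ.* n) J)))))
        EZ< : D.EZ < ℓ ℕ.* s ℕ.* D.T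
        EZ< = *-cancelˡ-< n _ _ (begin-strict
          n ℕ.* D.EZ ≡⟨ N.solve 6 (λ n J s r d l → n N.:* (J N.:* s N.:+ r N.:* d N.:+ (r N.:* l N.:+ s)) N.:= s N.:* n N.:* (N.con 1 N.:+ J) N.:+ (n N.:* r N.:* d N.:+ r N.:* (n N.:* l))) ≡.refl n J s r d ℓ′ ⟩
          Y ℕ.+ (n ℕ.* r ℕ.* d ℕ.+ r ℕ.* (n ℕ.* ℓ′)) <⟨ +-monoʳ-< Y (enough r ℓ′ N₁ Y (proj₂ nℓ) 1≤N₁ r≤ Y≥) ⟩
          suc N₁ ℕ.* Y ≡⟨ cong (ℕ._* Y) (≡.trans (≡.sym (proj₂ nℓ)) (cong (n ℕ.*_) (≡.sym ℓ≡))) ⟩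
          n ℕ.* ℓ ℕ.* Y ≡⟨ N.solve 4 (λ n l s J → n N.:* l N.:* (s N.:* n N.:* J) N.:= n N.:* (l N.:* s N.:* (n N.:* J))) ≡.refl n ℓ s (suc J) ⟩
          n ℕ.* (ℓ ℕ.* s ℕ.* D.T) ∎)

  -- The universal residue character and its L-series

  open GroupAlgebra F using (algebra; module A; _⟨_⟩; χ; χ-1; χ-*; ⟨χ⟩; ⟨*⟩; ⟨+⟩; ⟨neg⟩; ⟨0⟩; ⟨⟩-cong; ≈A-intro; ∥_∥; ∥∥-cong; ∥∥-+; ∥∥-*; ∥∥-neg; ∥∥-0; ∥∥-nat; ⟨nat*⟩; ∣value∣≤∥∥; squares)
  module A∑ = SemiringSum A.commutativeSemiring
  module Z∑ = SemiringSum (CommutativeRing.commutativeSemiring ℤP.+-*-commutativeRing)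
  module Zδ = Z∑.Delta _≟_
  module ℕδ = ℕSum.Delta _≟_

  d : ℕ
  d = length lf

  -- The `n`-th power residue symbol, with its values kept as elements of `F`.
  λ′ : List Carrier → Carrier
  λ′ g = ρ g ^ e₁

  λ-⊛ : ∀ a b → λ′ (a ⊛ b) ≡ λ′ a * λ′ b
  λ-⊛ a b = trans (^-congˡ e₁ (ρ-⊛ {a} {b} {a ⊛ b} (length-⊛ a b) (⟦⊛⟧ a b))) (^-distrib-* (ρ a) (ρ b) e₁)

  λ-[] : λ′ [] ≡ 1#
  λ-[] = trans (^-congˡ e₁ ρ-[]) (1^ e₁)

  length-nonzeros : length nonzeros ≡ n ℕ.* e₁
  length-nonzeros = ℕP.suc-injective (≡.trans suc-length-nonzeros (≡.sym ne₁))

  root-of-unity : ∀ {x} → x ≢ 0# → (x ^ e₁) ^ n ≡ 1#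
  root-of-unity {x} nx = trans (^-assocʳ x e₁ n) (trans (reflexive (cong (x ^_) (≡.trans (ℕP.*-comm e₁ n) (≡.sym length-nonzeros)))) (fermat-unit nx))

  μ : List Carrier
  μ = filter (λ x → (x ^ n) ≟ 1#) elements

  μ-unique : Unique μ
  μ-unique = Uniq.filter⁺ _ elements-unique

  ∈μ : ∀ {x} → x ^ n ≡ 1# → x ∈ μ
  ∈μ e = ∈-filter⁺ (λ x → (x ^ n) ≟ 1#) (∈elements _) e

  μ⇒ : ∀ {x} → x ∈ μ → x ^ n ≡ 1#
  μ⇒ i = proj₂ (∈-filter⁻ (λ x → (x ^ n) ≟ 1#) {xs = elements} i)

  ^n≡1⇒≢0 : ∀ {x} → x ^ n ≡ 1# → x ≢ 0#
  ^n≡1⇒≢0 {x} e ≡.refl = 1≢0 (trans (sym e) (zero-power n 1≤n))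
    where
    zero-power : ∀ N → 1 ≤ N → 0# ^ N ≡ 0#
    zero-power (suc N) _ = 0^ N

  μ⇒≢0 : ∀ {x} → x ∈ μ → x ≢ 0#
  μ⇒≢0 i = ^n≡1⇒≢0 (μ⇒ i)

  ∑-constℕ : ∀ {Y : Set} (ys : List Y) c → ℕSum.∑ ys (λ _ → c) ≡ length ys ℕ.* c
  ∑-constℕ [] c = ≡.refl
  ∑-constℕ (y ∷ ys) c = cong (c ℕ.+_) (∑-constℕ ys c)

  -- At most `n` by counting roots; at least `n` because `x ↦ x^e₁` maps the `n e₁` units into `μ`
  -- with at most `e₁` of them over each value.
  length-μ : length μ ≡ n
  length-μ = ≤-antisym (at-most n 1≤n μ μ-unique (All.tabulate μ⇒)) at-least
    where
    at-most : ∀ N → 1 ≤ N → ∀ zs → Unique zs → ∀ {c} → All (λ z → z ^ N ≡ c) zs → length zs ≤ N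
    at-most (suc N) _ zs u r = power-roots N _ zs u r
    fibre : ∀ t → ℕSum.∑ nonzeros (λ x → ℕδ.δ (x ^ e₁) t) ≤ e₁
    fibre t = ≤-trans (≤-reflexive (≡.trans (≡.sym (ℕSum.∑-filter (λ x → (x ^ e₁) ≟ t) nonzeros (λ _ → 1))) (≡.trans (∑-constℕ ts 1) (ℕP.*-identityʳ _))))
      (at-most e₁ 1≤e₁ ts (Uniq.filter⁺ _ nonzeros-unique) (all-filter (λ x → (x ^ e₁) ≟ t) nonzeros))
      where
      ts : List Carrier
      ts = filter (λ x → (x ^ e₁) ≟ t) nonzeros
    at-least : n ≤ length μ
    at-least = *-cancelʳ-≤ n (length μ) e₁ {{ℕ.>-nonZero 1≤e₁}} (≤-trans (≤-reflexive (≡.trans (≡.sym length-nonzeros)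
        (≡.trans (≡.sym (≡.trans (∑-constℕ nonzeros 1) (ℕP.*-identityʳ _))) (≡.trans (ℕSum.∑-cong∈ nonzeros λ x i →
          ≡.sym (≡.trans (ℕSum.∑-pick μ (x ^ e₁) _ μ-unique (∈μ (root-of-unity (nonzeros≢0 i))) (λ y _ ne → ℕδ.δ-≢ (λ e → ne (≡.sym e)))) (ℕδ.δ-refl (x ^ e₁))))
          (ℕSum.∑-swap nonzeros μ (λ x t → ℕδ.δ (x ^ e₁) t))))))
      (≤-trans (NatLemmas.∑≤ μ (λ t _ → fibre t)) (≤-reflexive (∑-constℕ μ e₁))))

  λ-value : ∀ x → x ^ e₁ ≢ 0# → x ^ e₁ ∈ μ
  λ-value x ne = ∈μ (root-of-unity λ z → ne (trans (^-congˡ e₁ z) (zero-power e₁ 1≤e₁)))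
    where
    zero-power : ∀ N → 1 ≤ N → 0# ^ N ≡ 0#
    zero-power (suc N) _ = 0^ N

  -- The universal character: applying a complex character of `μ`, extended by zero at `0`, would
  -- recover each ordinary residue character.
  φ : List Carrier → A.Carrier
  φ g = χ (λ′ g)

  character : Multiplicative
  character = record { F = F ; R = algebra ; φ = φ ; φ-[] = A.trans (A.reflexive (cong χ λ-[])) χ-1
    ; φ-⊛ = λ a b → A.trans (A.reflexive (cong χ (λ-⊛ a b))) (χ-* (λ′ a) (λ′ b)) }

  module M = Mangoldt character

  χ-^ : ∀ x i → χ (x ^ i) A.≈ χ x A.^ i
  χ-^ x zero = χ-1
  χ-^ x (suc i) = A.trans (χ-* x (x ^ i)) (A.*-congˡ (χ-^ x i))

  -- λ(P)^i is the common value of f^E(m) at the roots of P, where m = i deg P.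
  prime-power-value : ∀ {l} (il : Irr l) i → ⟦ l ⟧ P.∣ (f P.^ E (i ℕ.* length l) P.- C (λ′ l ^ i))
  prime-power-value {l} il i = go
    where
    open Residue il
    module π = HomP proj
    first-power : f κ.^ E e κ.≈ emb.fn (λ′ l)
    first-power = κ.trans (κ.reflexive (cong (f κ.^_) (ℕP.*-comm e₁ (geo e)))) (κ.trans (κ.sym (κ.^-assocʳ f (geo e) e₁))
      (κ.trans (κ.^-congˡ e₁ (κ.trans (κ.sym (π.^-homo f (geo e))) (~by (ρ-irr il)))) (κ.sym (emb.^-homo (ρ l) e₁))))
    power : ∀ i → f κ.^ E (i ℕ.* e) κ.≈ emb.fn (λ′ l ^ i)
    power zero = κ.trans (κ.reflexive (cong (f κ.^_) (ℕP.*-zeroʳ e₁))) (κ.sym emb.1-homo)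
    power (suc i) = κ.trans (κ.reflexive (cong (f κ.^_) (E-+ e (i ℕ.* e)))) (κ.trans (κ.^-homo-* f (E e) (q ℕ.^ e ℕ.* E (i ℕ.* e)))
      (κ.trans (κ.*-cong first-power (κ.trans (κ.sym (κ.^-assocʳ f (q ℕ.^ e) (E (i ℕ.* e)))) (κ.trans (κ.^-congˡ (E (i ℕ.* e)) (fermatκ f)) (power i))))
        (κ.sym (emb.*-homo _ _))))
    go : ⟦ l ⟧ P.∣ (f P.^ E (i ℕ.* length l) P.- C (λ′ l ^ i))
    go = divides (κ.trans (π.^-homo f (E (i ℕ.* e))) (power i))

  Hit : ℕ → Carrier → ℕ → List Carrier → Set
  Hit m t e l = Any.Any (λ i → e ℕ.* i ≡ m × λ′ l ^ i ≡ t) (rng m)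

  hit? : ∀ m t e l → Dec (Hit m t e l)
  hit? m t e l = Any.any? (λ i → ((e ℕ.* i) ℕP.≟ m) ×-dec ((λ′ l ^ i) ≟ t)) (rng m)

  hits-at : ℕ → Carrier → ℕ → List (List Carrier)
  hits-at m t e = filter (hit? m t e) (M.irrs e)

  hits : ℕ → Carrier → List (List Carrier)
  hits m t = concat (map (hits-at m t) (rng m))

  hits-at⇒ : ∀ {m t e l} → l ∈ hits-at m t e → (Irr l × length l ≡ e) × Hit m t e l
  hits-at⇒ {m} {t} {e} i = let (j , h) = ∈-filter⁻ (hit? m t e) {xs = M.irrs e} i in M.irrs⇒ {e} j , h

  hits-unique : ∀ m t → Unique (hits m t)
  hits-unique m t = Uniq.concat⁺ (AllP.map⁺ (All.tabulate λ {e} _ → Uniq.filter⁺ (hit? m t e) (M.irrs-unique e)))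
    (AllPairsP.map⁺ (AP.map (λ {e} {e′} ne {_} (i , j) → ne (≡.trans (≡.sym (proj₂ (proj₁ (hits-at⇒ {m} {t} {e} i)))) (proj₂ (proj₁ (hits-at⇒ {m} {t} {e′} j))))) (rng-unique m)))

  hits⇒ : ∀ m t {l} → l ∈ hits m t → Irr l × (Σ ℕ λ i → 1 ≤ i × m ≡ i ℕ.* length l × λ′ l ^ i ≡ t)
  hits⇒ m t {l} j = let (e , _ , k) = find (∈-concatMap⁻ (hits-at m t) {xs = rng m} j)
                        ((il , len) , h) = hits-at⇒ {m} {t} {e} k
                        (i , ir , (ei , v)) = find h
    in il , i , rng⇒1≤ ir , ≡.trans (≡.sym ei) (≡.trans (cong (ℕ._* i) (≡.sym len)) (ℕP.*-comm (length l) i)) , v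

  -- The number of points `x` of the field with `q^m` elements having `f(x)^(E m) = t`; a prime
  -- stands for as many conjugate points as its degree.
  count : ℕ → Carrier → ℕ
  count m t = ℕSum.∑ (hits m t) length

  pos-∑ : ∀ {Y : Set} (ys : List Y) f → Z∑.∑ ys (λ y → + f y) ≡ + ℕSum.∑ ys f
  pos-∑ [] f = ≡.refl
  pos-∑ (y ∷ ys) f = ≡.trans (cong (ℤ._+_ (+ f y)) (pos-∑ ys f)) (≡.sym (ℤP.pos-+ (f y) _))

  ⟨∑⟩ : ∀ {Y : Set} (ys : List Y) f x → A∑.∑ ys f ⟨ x ⟩ ≡ Z∑.∑ ys (λ y → f y ⟨ x ⟩)
  ⟨∑⟩ [] f x = ⟨0⟩ x
  ⟨∑⟩ (y ∷ ys) f x = ≡.trans (⟨+⟩ (f y) _ x) (cong (ℤ._+_ (f y ⟨ x ⟩)) (⟨∑⟩ ys f x))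

  ∑-concatℕ : ∀ {Y : Set} (es : List ℕ) (g : ℕ → List Y) (h : Y → ℕ) → ℕSum.∑ (concat (map g es)) h ≡ ℕSum.∑ es (λ e → ℕSum.∑ (g e) h)
  ∑-concatℕ [] g h = ≡.refl
  ∑-concatℕ (e ∷ es) g h = ≡.trans (ℕSum.∑-++ (g e) (concat (map g es)) h) (cong (ℕSum.∑ (g e) h ℕ.+_) (∑-concatℕ es g h))

  -- For a prime of degree `e` at most one exponent `i` satisfies `e i = m`, so each prime
  -- contributes its degree once or not at all.
  mangoldt-value : ∀ m t → M.mangoldt m ⟨ t ⟩ ≡ + count m t
  mangoldt-value m t = ≡.trans (⟨∑⟩ (rng m) _ t) (≡.trans (Z∑.∑-cong∈ (rng m) λ e ie → per-degree e (rng⇒1≤ ie))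
    (≡.trans (pos-∑ (rng m) _) (cong +_ (≡.sym (∑-concatℕ (rng m) (hits-at m t) length)))))
    where
    per-prime : ∀ e l → 1 ≤ e → (h : Dec (Hit m t e l)) → Z∑.∑ (rng m) (λ i → (A∑.[ (e ℕ.* i) ℕP.≟ m ]ᵢ A.* (A.nat e A.* φ l A.^ i)) ⟨ t ⟩) ≡ + (if does h then e else 0)
    per-prime e l 1≤e h = ≡.trans (Z∑.∑-cong (rng m) λ i → term i ((e ℕ.* i) ℕP.≟ m) ((λ′ l ^ i) ≟ t)) (go h)
      where
      both : ∀ i → Dec (e ℕ.* i ≡ m) → Dec (λ′ l ^ i ≡ t) → ℤ
      both i c v = if does (c ×-dec v) then + e else + 0
      term : ∀ i (c : Dec (e ℕ.* i ≡ m)) (v : Dec (λ′ l ^ i ≡ t)) → (A∑.[ c ]ᵢ A.* (A.nat e A.* φ l A.^ i)) ⟨ t ⟩ ≡ both i c v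
      term i (no _) v = ≡.trans (⟨⟩-cong (A.zeroˡ _) t) (⟨0⟩ t)
      term i (yes _) v = ≡.trans (⟨⟩-cong (A.trans (A.*-identityˡ _) (A.*-congˡ (A.sym (χ-^ (λ′ l) i)))) t) (≡.trans (⟨nat*⟩ e _ t)
        (≡.trans (cong (ℤ._*_ (+ e)) (⟨χ⟩ (λ′ l ^ i) t)) (value v)))
        where
        value : (v : Dec (λ′ l ^ i ≡ t)) → + e ℤ.* Zδ.δ (λ′ l ^ i) t ≡ (if does v then + e else + 0)
        value (yes eq) = ≡.trans (cong (ℤ._*_ (+ e)) (Z∑.ind-yes ((λ′ l ^ i) ≟ t) eq)) (ℤP.*-identityʳ (+ e))
        value (no ne) = ≡.trans (cong (ℤ._*_ (+ e)) (Z∑.ind-no ((λ′ l ^ i) ≟ t) ne)) (ℤP.*-zeroʳ (+ e))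
      go : (h : Dec (Hit m t e l)) → Z∑.∑ (rng m) (λ i → both i ((e ℕ.* i) ℕP.≟ m) ((λ′ l ^ i) ≟ t)) ≡ + (if does h then e else 0)
      go (yes h) = let (i , ir , (ei , v)) = find h in ≡.trans (Z∑.∑-pick (rng m) i _ (rng-unique m) ir (λ j _ ne → off j (λ (ej , _) → ne (ℕP.*-cancelˡ-≡ j i e {{ℕ.>-nonZero 1≤e}} (≡.trans ej (≡.sym ei))))))
          (on i (ei , v))
        where
        off : ∀ j → ¬ (e ℕ.* j ≡ m × λ′ l ^ j ≡ t) → both j ((e ℕ.* j) ℕP.≟ m) ((λ′ l ^ j) ≟ t) ≡ + 0
        off j ne = if-false (((e ℕ.* j) ℕP.≟ m) ×-dec ((λ′ l ^ j) ≟ t)) ne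
        on : ∀ j → e ℕ.* j ≡ m × λ′ l ^ j ≡ t → both j ((e ℕ.* j) ℕP.≟ m) ((λ′ l ^ j) ≟ t) ≡ + e
        on j y = if-true (((e ℕ.* j) ℕP.≟ m) ×-dec ((λ′ l ^ j) ≟ t)) y
      go (no nh) = Z∑.∑-zero (rng m) λ j jr → off j jr
        where
        off : ∀ j → j ∈ rng m → both j ((e ℕ.* j) ℕP.≟ m) ((λ′ l ^ j) ≟ t) ≡ + 0
        off j jr = if-false (((e ℕ.* j) ℕP.≟ m) ×-dec ((λ′ l ^ j) ≟ t)) λ y → nh (lose jr y)
    per-degree : ∀ e → 1 ≤ e → A∑.∑ (rng m) (λ i → A∑.[ (e ℕ.* i) ℕP.≟ m ]ᵢ A.* M.prim e i) ⟨ t ⟩ ≡ + ℕSum.∑ (hits-at m t e) length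
    per-degree e 1≤e = ≡.trans (⟨⟩-cong (A.trans (A∑.∑-cong (rng m) λ i → A.sym (A∑.∑-*ˡ (M.irrs e) _ _)) (A∑.∑-swap (rng m) (M.irrs e) _)) t)
      (≡.trans (⟨∑⟩ (M.irrs e) _ t) (≡.trans (Z∑.∑-cong∈ (M.irrs e) λ l il → ≡.trans (⟨∑⟩ (rng m) _ t) (≡.trans (per-prime e l 1≤e (hit? m t e l))
          (cong (λ e′ → + (if does (hit? m t e l) then e′ else 0)) (≡.sym (proj₂ (M.irrs⇒ {e} il))))))
        (≡.trans (pos-∑ (M.irrs e) _) (cong +_ (≡.sym (ℕSum.∑-filter (hit? m t e) (M.irrs e) length))))))

  open Bound using (C₂; stepanov)

  w : ℕ → ℕ
  w m = q ℕ.^ ℕ.⌈ m /2⌉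

  1≤q : 1 ≤ q
  1≤q = ≤-trans (s≤s z≤n) 3≤q

  1≤q^ : ∀ j → 1 ≤ q ℕ.^ j
  1≤q^ j = ≤-trans (≤-reflexive (≡.sym (ℕP.^-zeroˡ j))) (^-monoˡ-≤ j 1≤q)

  halves : ∀ m → ℕ.⌊ m /2⌋ ℕ.+ ℕ.⌈ m /2⌉ ≡ m
  halves = ⌊n/2⌋+⌈n/2⌉≡n

  count-bound : ∀ m t → 1 ≤ m → t ≢ 0# → n ℕ.* count m t ≤ q ℕ.^ m ℕ.+ w m ℕ.* C₂
  count-bound m t 1≤m t≢0 = subst (λ z → n ℕ.* count m t ≤ q ℕ.^ z ℕ.+ w m ℕ.* C₂) (halves m)
    (stepanov ℕ.⌊ m /2⌋ ℕ.⌈ m /2⌉ t t≢0 (⌊n/2⌋≤⌈n/2⌉ m) (⌈n/2⌉-mono 1≤m) (hits m t) (hits-unique m t) (All.tabulate good))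
    where
    good : ∀ {l} → l ∈ hits m t → Good (ℕ.⌊ m /2⌋ ℕ.+ ℕ.⌈ m /2⌉) t l
    good {l} j = let (il , i , _ , mi , v) = hits⇒ m t j in
      il , (i , ≡.trans (halves m) mi) , subst₂ (λ z c → ⟦ l ⟧ P.∣ (f P.^ E z P.- C c)) (≡.trans (≡.sym mi) (≡.sym (halves m))) v (prime-power-value il i)

  -- Used to bound the primes of value zero, which all divide `f`.
  f≉0 : ¬ (f P.≈ P.0#)
  f≉0 z = 1≢0 (trans (sym (lead (mon-⟦⟧ lf))) (trans (‼-cong z d) (Pol.‼-0 d)))

  λ≡0⇒∣ : ∀ {l} → Irr l → λ′ l ≡ 0# → ⟦ l ⟧ P.∣ f
  λ≡0⇒∣ {l} il e = irr-^ il f (geo (length l)) (P.∣-resp (P.trans (P.+-congˡ (P.-‿cong (P.trans (C-cong (^≡0 e₁ e)) C-0)))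
    (P.solve 1 (λ x → x P.:- P.con (+ 0) P.:= x) P.refl _)) (ρ-irr il))

  count-zero : ∀ m → count m 0# ≤ d
  count-zero m = ∑-degrees (hits m 0#) d f f≉0 (bnd (mon-⟦⟧ lf)) (hits-unique m 0#)
    (All.tabulate λ j → proj₁ (hits⇒ m 0# j)) (All.tabulate λ j → let (il , i , _ , _ , v) = hits⇒ m 0# j in λ≡0⇒∣ il (^≡0 i v))

  -- Counting all points, and the vanishing of high coefficients

  -- The trivial weight counts all points: ∑ deg P over deg P ∣ m is q^m.
  private
    ℤr : CommutativeRing 0ℓ 0ℓ
    ℤr = ℤP.+-*-commutativeRing
    module Zr = RingKit ℤr
    trivial-character : Multiplicative
    trivial-character = record { F = F ; R = ℤr ; φ = λ _ → + 1 ; φ-[] = ≡.refl ; φ-⊛ = λ _ _ → ≡.refl }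

    module M₁ = Mangoldt trivial-character

    natℤ : ∀ j → Zr.nat j ≡ + j
    natℤ zero = ≡.refl
    natℤ (suc j) = ≡.trans (cong (ℤ._+_ (+ 1)) (natℤ j)) ≡.refl

    coef₁ : ∀ m → M₁.coef m ≡ + (q ℕ.^ m)
    coef₁ m = ≡.trans (pos-∑ (M₁.mons m) (λ _ → 1)) (cong +_ (≡.trans (∑-constℕ (M₁.mons m) 1) (≡.trans (ℕP.*-identityʳ _) (≡.trans (length-seqs m) (cong (ℕ._^ m) length-elements)))))

    sum-powers : ∀ m → Z∑.∑ (rng m) (λ j → + (q ℕ.^ j) ℤ.* + (q ℕ.^ (m ∸ j))) ≡ + (m ℕ.* q ℕ.^ m)
    sum-powers m = ≡.trans (Z∑.∑-cong∈ (rng m) λ j ij → ≡.trans (≡.sym (ℤP.pos-* (q ℕ.^ j) _)) (cong +_ (≡.trans (≡.sym (ℕP.^-distribˡ-+-* q j (m ∸ j))) (cong (q ℕ.^_) (m+[n∸m]≡n (rng⇒≤ ij))))))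
      (≡.trans (pos-∑ (rng m) (λ _ → q ℕ.^ m)) (cong +_ (≡.trans (∑-constℕ (rng m) (q ℕ.^ m)) (cong (ℕ._* q ℕ.^ m) (≡.trans (ListP.length-map suc (upTo m)) (ListP.length-upTo m))))))

    total₁ : ∀ N m → 1 ≤ m → m ≤ N → M₁.mangoldt m ≡ + (q ℕ.^ m)
    total₁ (suc N) m@(suc m-1) _ (s≤s le) = ≡.trans (≡.sym (at-end (M₁.mangoldt m))) (≡.trans (Zr.+-cancelˡ L _ _ (≡.trans (≡.sym ih) (≡.trans (≡.sym lhs)
        (≡.trans (≡.sym (sum-powers m)) (∑-rng-last (CommutativeRing.commutativeSemiring ℤr) m-1 _))))) (at-end (+ (q ℕ.^ m))))
      where
      at-end : ∀ (z : ℤ) → z ℤ.* + (q ℕ.^ (m ∸ m)) ≡ z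
      at-end z = ≡.trans (cong (λ j → z ℤ.* + (q ℕ.^ j)) (n∸n≡0 m)) (ℤP.*-identityʳ z)
      L : ℤ
      L = Z∑.∑ (rng m-1) (λ j → + (q ℕ.^ j) ℤ.* + (q ℕ.^ (m ∸ j)))
      ih : Z∑.∑ (rng m) (λ j → M₁.mangoldt j ℤ.* + (q ℕ.^ (m ∸ j))) ≡ L ℤ.+ M₁.mangoldt m ℤ.* + (q ℕ.^ (m ∸ m))
      ih = ≡.trans (∑-rng-last (CommutativeRing.commutativeSemiring ℤr) m-1 _) (cong (ℤ._+ M₁.mangoldt m ℤ.* + (q ℕ.^ (m ∸ m)))
        (Z∑.∑-cong∈ (rng m-1) λ j ij → cong (ℤ._* + (q ℕ.^ (m ∸ j))) (total₁ N j (rng⇒1≤ ij) (≤-trans (rng⇒≤ ij) le))))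
      lhs : + (m ℕ.* q ℕ.^ m) ≡ Z∑.∑ (rng m) (λ j → M₁.mangoldt j ℤ.* + (q ℕ.^ (m ∸ j)))
      lhs = ≡.trans (ℤP.pos-* m (q ℕ.^ m)) (≡.trans (≡.sym (cong₂ ℤ._*_ (natℤ m) (coef₁ m))) (≡.trans (M₁.newton m)
        (Z∑.∑-cong (rng m) λ j → cong (M₁.mangoldt j ℤ.*_) (coef₁ (m ∸ j)))))

  λ-power∈ : ∀ l i → λ′ l ^ i ≢ 0# → λ′ l ^ i ∈ μ
  λ-power∈ l i ne = subst (_∈ μ) (trans (^-assocʳ (ρ l) i e₁) (trans (reflexive (cong (ρ l ^_) (ℕP.*-comm i e₁))) (sym (^-assocʳ (ρ l) e₁ i))))
    (λ-value (ρ l ^ i) λ z → ne (trans (^-assocʳ (ρ l) e₁ i) (trans (reflexive (cong (ρ l ^_) (ℕP.*-comm e₁ i))) (trans (sym (^-assocʳ (ρ l) i e₁)) z))))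

  values : List Carrier
  values = 0# ∷ μ

  values-unique : Unique values
  values-unique = All.tabulate (λ i e → μ⇒≢0 i (≡.sym e)) ∷ μ-unique

  -- Summing an element of the algebra over `0` and `μ` sends every `χ(λ^i)` to 1, which turns the
  -- von Mangoldt sum of the character into that of the trivial weight.
  total : ∀ m → 1 ≤ m → count m 0# ℕ.+ ℕSum.∑ μ (count m) ≡ q ℕ.^ m
  total m 1≤m = ℤP.+-injective (≡.trans (≡.sym (pos-∑ values (count m))) (≡.trans (Z∑.∑-cong values λ t → ≡.sym (mangoldt-value m t))
    (≡.trans augment (total₁ m m 1≤m ≤-refl))))
    where
    aug : A.Carrier → ℤ
    aug a = Z∑.∑ values (λ t → a ⟨ t ⟩)
    aug-∑ : ∀ {Y : Set} (ys : List Y) (g : Y → A.Carrier) → aug (A∑.∑ ys g) ≡ Z∑.∑ ys (λ y → aug (g y))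
    aug-∑ ys g = ≡.trans (Z∑.∑-cong values λ t → ⟨∑⟩ ys g t) (Z∑.∑-swap values ys _)
    aug-prim : ∀ e l i → aug (A.nat e A.* φ l A.^ i) ≡ + e
    aug-prim e l i = ≡.trans (Z∑.∑-cong values λ t → ≡.trans (⟨⟩-cong (A.*-congˡ (A.sym (χ-^ (λ′ l) i))) t) (≡.trans (⟨nat*⟩ e _ t) (cong (+ e ℤ.*_) (⟨χ⟩ (λ′ l ^ i) t))))
      (≡.trans (Z∑.∑-*ˡ values (+ e) (Zδ.δ (λ′ l ^ i))) (≡.trans (cong (+ e ℤ.*_) (≡.trans (Z∑.∑-pick values (λ′ l ^ i) _ values-unique ∈values (λ y _ ne → Zδ.δ-≢ (λ e → ne (≡.sym e)))) (Zδ.δ-refl (λ′ l ^ i))))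
        (ℤP.*-identityʳ (+ e))))
      where
      ∈values : λ′ l ^ i ∈ values
      ∈values = case (λ′ l ^ i) ≟ 0# of λ { (yes z) → here z ; (no ne) → there (λ-power∈ l i ne) }
    1^ℤ : ∀ i → (+ 1) Zr.^ i ≡ + 1
    1^ℤ zero = ≡.refl
    1^ℤ (suc i) = ≡.trans (cong (+ 1 ℤ.*_) (1^ℤ i)) ≡.refl
    aug-term : ∀ e i {Q : Set} (c : Dec Q) → aug (A∑.[ c ]ᵢ A.* M.prim e i) ≡ Z∑.[ c ]ᵢ ℤ.* M₁.prim e i
    aug-term e i (yes _) = ≡.trans (≡.trans (Z∑.∑-cong values λ t → ⟨⟩-cong (A.*-identityˡ _) t) (≡.trans (aug-∑ (M.irrs e) _)
      (Z∑.∑-cong (M.irrs e) λ l → ≡.trans (aug-prim e l i) (≡.sym (≡.trans (cong₂ ℤ._*_ (natℤ e) (1^ℤ i)) (ℤP.*-identityʳ (+ e))))))) (≡.sym (ℤP.*-identityˡ (M₁.prim e i)))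
    aug-term e i (no _) = ≡.trans (Z∑.∑-zero values (λ t _ → ≡.trans (⟨⟩-cong (A.zeroˡ _) t) (⟨0⟩ t))) (≡.sym (ℤP.*-zeroˡ (M₁.prim e i)))
    augment : Z∑.∑ values (λ t → M.mangoldt m ⟨ t ⟩) ≡ M₁.mangoldt m
    augment = ≡.trans (aug-∑ (rng m) _) (Z∑.∑-cong (rng m) λ e → ≡.trans (aug-∑ (rng m) _) (Z∑.∑-cong (rng m) λ i → aug-term e i ((e ℕ.* i) ℕP.≟ m)))

  -- By Stepanov's upper bounds every value in μ is taken.
  module Surjective (t : Carrier) (t∈ : t ∈ μ) where

    -- The degree `m = 2a` is even so that `ρ-periodic` applies to multiplication by `u`; `a` is
    -- large enough for `q^(2a)` to exceed the error terms.
    a m : ℕ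
    a = suc (n ℕ.* (d ℕ.+ C₂))
    m = a ℕ.+ a

    private
      half : ∀ a → ℕ.⌈ a ℕ.+ a /2⌉ ≡ a
      half zero = ≡.refl
      half (suc a) = ≡.trans (cong ℕ.⌈_/2⌉ (cong suc (ℕP.+-suc a a))) (cong suc (half a))

      W : ℕ
      W = q ℕ.^ a

      wm : w m ≡ W
      wm = cong (q ℕ.^_) (half a)

      qm : q ℕ.^ m ≡ W ℕ.* W
      qm = ℕP.^-distribˡ-+-* q a a

      n<q^n : ∀ j → j < q ℕ.^ j
      n<q^n j = <-≤-trans (Growth.n<2^n j) (^-monoˡ-≤ j (≤-trans (n≤1+n 2) 3≤q))

      remove : ∀ (g : Carrier → ℕ) B (xs : List Carrier) → t ∈ xs → (∀ x → x ∈ xs → g x ≤ B) → g t ≡ 0 → ℕSum.∑ xs g ℕ.+ B ≤ length xs ℕ.* B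
      remove g B (x ∷ xs) (here ≡.refl) h z = ≤-trans (≤-reflexive (≡.trans (cong (λ y → y ℕ.+ ℕSum.∑ xs g ℕ.+ B) z) (ℕP.+-comm _ B)))
        (+-monoʳ-≤ B (≤-trans (NatLemmas.∑≤ xs (λ y i → h y (there i))) (≤-reflexive (∑-constℕ xs B))))
      remove g B (x ∷ xs) (there i) h z = ≤-trans (≤-reflexive (ℕP.+-assoc (g x) (ℕSum.∑ xs g) B)) (+-mono-≤ (h x (here ≡.refl)) (remove g B xs i (λ y j → h y (there j)) z))

      -- If `t` were missed, the remaining `n - 1` values could account only for the fraction
      -- `(n-1)/n` of the `q^m` points, up to lower-order terms.
      positive-count : 1 ≤ count m t
      positive-count = ℕP.n≢0⇒n>0 λ z → <⇒≱ big (bound z)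
        where
        U : ℕ
        U = n ℕ.* ℕSum.∑ μ (count m)
        bound : count m t ≡ 0 → W ℕ.* W ≤ n ℕ.* d ℕ.+ n ℕ.* (W ℕ.* C₂)
        bound z = +-cancelʳ-≤ (n ℕ.* (W ℕ.* W)) _ _ (≤-trans (+-monoʳ-≤ (W ℕ.* W) (≤-trans (≤-reflexive (cong (n ℕ.*_) (≡.trans (≡.sym qm) (≡.sym (total m (s≤s z≤n))))))
            (≤-trans (≤-reflexive (ℕP.*-distribˡ-+ n (count m 0#) _)) (+-monoˡ-≤ U (*-monoʳ-≤ n (count-zero m))))))
          (≤-trans (≤-reflexive (N.solve 3 (λ x y z → x N.:+ (y N.:+ z) N.:= y N.:+ (z N.:+ x)) ≡.refl (W ℕ.* W) (n ℕ.* d) U))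
            (≤-trans (+-monoʳ-≤ (n ℕ.* d) (≤-trans (+-monoʳ-≤ U (m≤m+n (W ℕ.* W) (W ℕ.* C₂))) (≤-trans (+-monoˡ-≤ _ (≤-reflexive (≡.sym (ℕSum.∑-*ˡ μ n (count m)))))
                (remove (λ x → n ℕ.* count m x) (W ℕ.* W ℕ.+ W ℕ.* C₂) μ t∈ (λ x i → ≤-trans (count-bound m x (s≤s z≤n) (μ⇒≢0 i)) (≤-reflexive (cong₂ (λ y v → y ℕ.+ v ℕ.* C₂) qm wm)))
                  (≡.trans (cong (n ℕ.*_) z) (ℕP.*-zeroʳ n))))))
              (≤-reflexive (≡.trans (cong (λ L → n ℕ.* d ℕ.+ L ℕ.* (W ℕ.* W ℕ.+ W ℕ.* C₂)) length-μ) (N.solve 4 (λ n d x y → n N.:* d N.:+ n N.:* (x N.:+ y) N.:= n N.:* d N.:+ n N.:* y N.:+ n N.:* x) ≡.refl n d (W ℕ.* W) (W ℕ.* C₂)))))))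
        big : n ℕ.* d ℕ.+ n ℕ.* (W ℕ.* C₂) < W ℕ.* W
        big = ≤-<-trans (+-monoˡ-≤ _ (*-monoʳ-≤ n (≤-trans (≤-reflexive (≡.sym (ℕP.*-identityˡ d))) (*-monoˡ-≤ d (1≤q^ a)))))
          (<-≤-trans (≤-<-trans (≤-reflexive (N.solve 4 (λ n W d c → n N.:* (W N.:* d) N.:+ n N.:* (W N.:* c) N.:= n N.:* (d N.:+ c) N.:* W) ≡.refl n W d C₂))
            (*-monoˡ-< W {{ℕ.>-nonZero (1≤q^ a)}} (n<1+n (n ℕ.* (d ℕ.+ C₂))))) (*-monoˡ-≤ W (<⇒≤ (n<q^n a))))

      nonempty : ∀ (ls : List (List Carrier)) → 1 ≤ ℕSum.∑ ls length → Σ (List Carrier) λ l → l ∈ ls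
      nonempty (l ∷ ls) _ = l , here ≡.refl

    abstract
      witness : Σ (List Carrier) λ l → Σ ℕ λ i → Irr l × (m ≡ i ℕ.* length l) × (λ′ l ^ i ≡ t)
      witness = let (l , j) = nonempty (hits m t) positive-count ; (il , i , _ , mi , v) = hits⇒ m t j in l , i , il , mi , v

    l : List Carrier
    l = proj₁ witness
    i : ℕ
    i = proj₁ (proj₂ witness)
    il : Irr l
    il = proj₁ (proj₂ (proj₂ witness))
    u : List Carrier
    u = M.powM l i

    λ-powM : ∀ i → λ′ (M.powM l i) ≡ λ′ l ^ i
    λ-powM zero = λ-[]
    λ-powM (suc i) = trans (λ-⊛ l (M.powM l i)) (*-congˡ (λ-powM i))

    λu : λ′ u ≡ t
    λu = trans (λ-powM i) (proj₂ (proj₂ (proj₂ (proj₂ witness))))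

    length-u : length u ≡ a ℕ.+ a
    length-u = ≡.trans (M.length-powM l i) (≡.trans (ℕP.*-comm (length l) i) (≡.sym (proj₁ (proj₂ (proj₂ (proj₂ witness))))))

    private
      l∤f : ¬ (⟦ l ⟧ P.∣ f)
      l∤f dv = μ⇒≢0 t∈ (trans (sym (proj₂ (proj₂ (proj₂ (proj₂ witness))))) (trans (^-congˡ i λl≡0) (zero-power i i≢0)))
        where
        zero-power : ∀ N → N ≢ 0 → 0# ^ N ≡ 0#
        zero-power zero ne = ⊥-elim (ne ≡.refl)
        zero-power (suc N) _ = 0^ N
        i≢0 : i ≢ 0
        i≢0 z = case ≡.trans (proj₁ (proj₂ (proj₂ (proj₂ witness)))) (cong (ℕ._* length l) z) of λ ()
        ∣f^ : ∀ N → 1 ≤ N → ⟦ l ⟧ P.∣ f P.^ N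
        ∣f^ (suc N) _ = P.∣-* _ dv
        1≤geo : ∀ j → 1 ≤ j → 1 ≤ geo j
        1≤geo (suc j) _ = s≤s z≤n
        Cρ≈0 : C (ρ l) P.≈ P.0#
        Cρ≈0 = Pol.monic∣⇒≈0 (mon-⟦⟧ l) (Pol.bnd-mono (positive il) (Pol.bnd-C (ρ l))) (P.∣-resp (P.solve 2 (λ x y → x P.:- (x P.:- y) P.:= y) P.refl (f P.^ geo (length l)) (C (ρ l)))
          (P.∣-sub (∣f^ _ (1≤geo _ (positive il))) (ρ-irr il)))
        λl≡0 : λ′ l ≡ 0#
        λl≡0 = trans (^-congˡ e₁ (trans (sym (Pol.C‼0 _)) (trans (‼-cong Cρ≈0 0) (Pol.‼-0 0)))) (zero-power e₁ (m<n⇒n≢0 1≤e₁))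

      inverse-of : (Σ P.Carrier λ v → ⟦ l ⟧ P.∣ (v P.* f P.- P.1#)) → Σ P.Carrier λ v → f P.∣ (v P.* ⟦ l ⟧ P.- P.1#)
      inverse-of (v , (w P.by e)) = P.- w , (P.- v P.by P.trans (P.solve 3 (λ w l v → (P.:- w) P.:* l P.:- P.con (+ 1) P.:= P.:- (l P.:* w) P.:- P.con (+ 1)) P.refl w ⟦ l ⟧ v)
        (P.trans (P.+-congʳ (P.-‿cong (P.sym e))) (P.solve 2 (λ v f → (P.:- (v P.:* f P.:- P.con (+ 1))) P.:- P.con (+ 1) P.:= f P.:* (P.:- v)) P.refl v f)))

      l⁻¹ : Σ P.Carrier λ v → f P.∣ (v P.* ⟦ l ⟧ P.- P.1#)
      l⁻¹ = inverse-of (irr-bezout il f l∤f)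

    u⁻¹ : Σ P.Carrier λ v → f P.∣ (v P.* ⟦ u ⟧ P.- P.1#)
    u⁻¹ = power i
      where
      power : ∀ i → Σ P.Carrier λ v → f P.∣ (v P.* ⟦ M.powM l i ⟧ P.- P.1#)
      power zero = P.1# , P.∣-resp (P.sym (P.x≈y⇒x∙y⁻¹≈ε (P.*-identityˡ P.1#))) P.∣0
      power (suc i) = let (v , dv) = l⁻¹ ; (v′ , dv′) = power i in v P.* v′ , P.∣-resp
        (P.trans (P.solve 4 (λ v l v′ m → (v P.:* l P.:- P.con (+ 1)) P.:* (v′ P.:* m) P.:+ (v′ P.:* m P.:- P.con (+ 1)) P.:= (v P.:* v′) P.:* (l P.:* m) P.:- P.con (+ 1)) P.refl v ⟦ l ⟧ v′ ⟦ M.powM l i ⟧)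
          (P.+-congʳ (P.*-congˡ (P.sym (⟦⊛⟧ l (M.powM l i))))))
        (P.∣-+ (P.∣-* _ dv) dv′)


  -- The monic polynomial of the same degree as g that is congruent to v g modulo f.
  record Twist (v : P.Carrier) (g : List Carrier) : Set where
    constructor twisted
    field
      result : List Carrier
      same-length : length result ≡ length g
      near : Bnd d (⟦ result ⟧ P.- ⟦ g ⟧)
      congruent : f P.∣ (⟦ result ⟧ P.- v P.* ⟦ g ⟧)
  open Twist

  abstract
    twist : ∀ v g → d ≤ length g → Twist v g
    twist v g d≤ = go (Pol.divide (mon-⟦⟧ lf) (v P.* ⟦ g ⟧ P.- ⟦ g ⟧))
      where
      go : Pol.Division d f (v P.* ⟦ g ⟧ P.- ⟦ g ⟧) → Twist v g
      go (Pol.division y r e small) = build (toMonic (length g) (⟦ g ⟧ P.+ r) (mon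
          (Pol.bnd-+ (bnd (mon-⟦⟧ g)) (Pol.bnd-mono (m≤n⇒m≤1+n d≤) small))
          (trans (Pol.‼-+ ⟦ g ⟧ r (length g)) (trans (+-cong (lead (mon-⟦⟧ g)) (small (length g) d≤)) (+-identityʳ 1#)))))
        where
        build : (Σ (List Carrier) λ l → length l ≡ length g × (⟦ g ⟧ P.+ r) P.≈ ⟦ l ⟧) → Twist v g
        build (l , len , el) = twisted l len
          (Pol.bnd-resp (P.trans (P.solve 2 (λ g r → r P.:= (g P.:+ r) P.:- g) P.refl ⟦ g ⟧ r) (P.+-congʳ el)) small)
          (P.- y P.by P.trans (P.+-congʳ (P.sym el)) (P.trans (P.solve 3 (λ g r x → (g P.:+ r) P.:- x P.:= r P.:- (x P.:- g)) P.refl ⟦ g ⟧ r (v P.* ⟦ g ⟧))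
            (P.trans (P.+-congˡ (P.-‿cong e)) (P.solve 3 (λ f y r → r P.:- (f P.:* y P.:+ r) P.:= f P.:* (P.:- y)) P.refl f y r))))

  near-unique : ∀ {a b} → Bnd d (⟦ a ⟧ P.- ⟦ b ⟧) → f P.∣ (⟦ a ⟧ P.- ⟦ b ⟧) → a ≡ b
  near-unique bd dv = ⟦⟧-injective (P.x∙y⁻¹≈ε⇒x≈y _ _ (Pol.monic∣⇒≈0 (mon-⟦⟧ lf) bd dv))

  twist-inverse : ∀ {v v′ g} → f P.∣ (v′ P.* v P.- P.1#) → (t : Twist v g) (t′ : Twist v′ (result t)) → result t′ ≡ g
  twist-inverse {v} {v′} {g} inv t t′ = near-unique
    (Pol.bnd-resp (P.solve 3 (λ a b c → (a P.:- b) P.:+ (b P.:- c) P.:= a P.:- c) P.refl ⟦ result t′ ⟧ ⟦ result t ⟧ ⟦ g ⟧) (Pol.bnd-+ (near t′) (near t)))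
    (P.∣-resp (P.solve 5 (λ a b c v v′ → ((a P.:- v′ P.:* b) P.:+ v′ P.:* (b P.:- v P.:* c)) P.:+ c P.:* (v′ P.:* v P.:- P.con (+ 1)) P.:= a P.:- c) P.refl ⟦ result t′ ⟧ ⟦ result t ⟧ ⟦ g ⟧ v v′)
      (P.∣-+ (P.∣-+ (congruent t′) (P.∣-*ˡ v′ (congruent t))) (P.∣-*ˡ ⟦ g ⟧ inv)))

  module _ (t : Carrier) (t∈ : t ∈ μ) (m : ℕ) (d≤m : d ≤ m) where
    private
      module S = Surjective t t∈

      twistIf : P.Carrier → (g : List Carrier) → Dec (d ≤ length g) → List Carrier
      twistIf v g (yes le) = result (twist v g le)
      twistIf v g (no _) = g

      shift : P.Carrier → List Carrier → List Carrier
      shift v g = twistIf v g (d ℕP.≤? length g)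

      shift-of : ∀ v g → g ∈ M.mons m → Σ (Twist v g) λ t → shift v g ≡ result t
      shift-of v g i = go (d ℕP.≤? length g)
        where
        go : (c : Dec (d ≤ length g)) → Σ (Twist v g) λ t → twistIf v g c ≡ result t
        go (yes le) = twist v g le , ≡.refl
        go (no n) = ⊥-elim (n (subst (d ≤_) (≡.sym (seqs-length m i)) d≤m))

      shift∈ : ∀ v g → g ∈ M.mons m → shift v g ∈ M.mons m
      shift∈ v g i = let (t , e) = shift-of v g i in subst₂ (λ a j → a ∈ M.mons j) (≡.sym e) (≡.trans (same-length t) (seqs-length m i)) (M.∈mons (result t))

      cancel : ∀ v v′ g → f P.∣ (v′ P.* v P.- P.1#) → g ∈ M.mons m → shift v′ (shift v g) ≡ g
      cancel v v′ g inv i = let (t , e) = shift-of v g i ; (t′ , e′) = shift-of v′ (shift v g) (shift∈ v g i) in ≡.trans e′ (go t (shift v g) e t′)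
        where
        go : (t : Twist v g) → ∀ h → h ≡ result t → (t′ : Twist v′ h) → result t′ ≡ g
        go t h ≡.refl t′ = twist-inverse inv t t′

      v : P.Carrier
      v = proj₁ S.u⁻¹

      vu : f P.∣ (v P.* ⟦ S.u ⟧ P.- P.1#)
      vu = proj₂ S.u⁻¹

      uv : f P.∣ (⟦ S.u ⟧ P.* v P.- P.1#)
      uv = P.∣-resp (P.+-congʳ (P.*-comm v ⟦ S.u ⟧)) vu

      λ-shift : ∀ g → g ∈ M.mons m → λ′ (shift ⟦ S.u ⟧ g) ≡ t * λ′ g
      λ-shift g i = let (tw , e) = shift-of ⟦ S.u ⟧ g i in trans (reflexive (cong λ′ e)) (trans
        (^-congˡ e₁ (sym (ρ-periodic {S.u ⊛ g} {result tw} S.a (≡.trans (length-⊛ S.u g) (≡.trans (cong (ℕ._+ length g) S.length-u) (≡.trans (ℕP.+-assoc S.a S.a _) (cong (λ z → S.a ℕ.+ (S.a ℕ.+ z)) (≡.sym (same-length tw))))))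
          (P.∣-resp (P.trans (P.solve 2 (λ a b → P.:- (a P.:- b) P.:= b P.:- a) P.refl ⟦ result tw ⟧ (⟦ S.u ⟧ P.* ⟦ g ⟧)) (P.+-congʳ (P.sym (⟦⊛⟧ S.u g)))) (P.∣-neg (congruent tw))))))
        (trans (λ-⊛ S.u g) (*-congʳ S.λu)))

    -- Multiplication by `u` modulo `f` permutes the monic polynomials of degree `m ≥ d` and
    -- multiplies their residue symbol by `t`.
    χ-coef : χ t A.* M.coef m A.≈ M.coef m
    χ-coef = A.trans (A.sym (A∑.∑-*ˡ (M.mons m) (χ t) φ)) (A.trans (A∑.∑-cong∈ (M.mons m) λ g i → A.trans (A.sym (χ-* t (λ′ g))) (A.reflexive (cong χ (≡.sym (λ-shift g i)))))
      (A∑.∑-bij (shift ⟦ S.u ⟧) (shift v) φ (seqs-unique elements-unique m) (seqs-unique elements-unique m)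
        (λ g i → shift∈ ⟦ S.u ⟧ g i , cancel ⟦ S.u ⟧ v g vu i) (λ g i → shift∈ v g i , cancel v ⟦ S.u ⟧ g uv i)))

  -- Projection away from the trivial character, and Weil's bound

  -- On elements supported in `μ`, `s / n` is the idempotent of the trivial character; `κ` is `n`
  -- times the complementary idempotent and stays integral.
  s κ : A.Carrier
  s = A∑.∑ μ χ
  κ = A.nat n A.- s

  ∑-const-μ : ∀ a → A∑.∑ μ (λ _ → a) A.≈ A.nat n A.* a
  ∑-const-μ a = A.trans (A∑.∑-const μ a) (A.trans (A.·-nat (length μ) a) (A.reflexive (cong (λ j → A.nat j A.* a) length-μ)))

  s-fixes : ∀ a → (∀ t → t ∈ μ → χ t A.* a A.≈ a) → s A.* a A.≈ A.nat n A.* a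
  s-fixes a fix = A.trans (A.sym (A∑.∑-*ʳ μ a χ)) (A.trans (A∑.∑-cong∈ μ fix) (∑-const-μ a))

  kills : ∀ a → (∀ t → t ∈ μ → χ t A.* a A.≈ a) → κ A.* a A.≈ A.0#
  kills a fix = A.trans (A.distribʳ a _ _) (A.trans (A.+-congˡ (A.trans (A.sym (A.-‿distribˡ-* s a)) (A.-‿cong (s-fixes a fix)))) (A.-‿inverseʳ _))

  χ-s : ∀ t → t ∈ μ → χ t A.* s A.≈ s
  χ-s t i = A.trans (A.sym (A∑.∑-*ˡ μ (χ t) χ)) (A.trans (A∑.∑-cong μ λ x → A.sym (χ-* t x))
    (A∑.∑-bij (t *_) (t ⁻¹ *_) χ μ-unique μ-unique (λ x j → closed i j , a⁻¹[ax] x (μ⇒≢0 i)) (λ x j → closed inverse∈ j , a[a⁻¹x] x (μ⇒≢0 i))))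
    where
    closed : ∀ {x y} → x ∈ μ → y ∈ μ → x * y ∈ μ
    closed {x} {y} i j = ∈μ (trans (^-distrib-* x y n) (trans (*-cong (μ⇒ i) (μ⇒ j)) (*-identityˡ 1#)))
    inverse∈ : t ⁻¹ ∈ μ
    inverse∈ = ∈μ (trans (sym (*-identityˡ _)) (trans (*-congʳ (sym (μ⇒ i))) (trans (sym (^-distrib-* t (t ⁻¹) n)) (trans (^-congˡ n (*-inverseʳ (μ⇒≢0 i))) (1^ n)))))

  κκ : κ A.* κ A.≈ A.nat n A.* κ
  κκ = A.trans (A.solve 2 (λ n s → (n A.:- s) A.:* (n A.:- s) A.:= n A.:* (n A.:- s) A.:- (n A.:- s) A.:* s) A.refl (A.nat n) s)
    (A.trans (A.+-congˡ (A.trans (A.-‿cong (kills s χ-s)) A.-0#≈0#)) (A.+-identityʳ _))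

  -- The element ∑ b(t) χ(t), supported on μ ∪ {0}.
  module Measure (a : A.Carrier) (b : Carrier → ℕ) (value : ∀ t → a ⟨ t ⟩ ≡ + b t) (support : ∀ t → b t ≢ 0 → t ∈ values) where

    mass : ℕ
    mass = ℕSum.∑ μ b

    private
      expand : a A.≈ A∑.∑ values (λ t → A.nat (b t) A.* χ t)
      expand = ≈A-intro λ x → ≡.trans (value x) (≡.sym (≡.trans (⟨∑⟩ values _ x) (≡.trans (Z∑.∑-cong values λ t → ≡.trans (⟨nat*⟩ (b t) (χ t) x) (cong (+ b t ℤ.*_) (⟨χ⟩ t x))) (at x (b x ℕP.≟ 0)))))
        where
        at : ∀ x → Dec (b x ≡ 0) → Z∑.∑ values (λ t → + b t ℤ.* Zδ.δ t x) ≡ + b x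
        at x (yes z) = ≡.trans (Z∑.∑-zero values λ t _ → here-or t (t ≟ x)) (cong +_ (≡.sym z))
          where
          here-or : ∀ t → Dec (t ≡ x) → + b t ℤ.* Zδ.δ t x ≡ + 0
          here-or t (yes ≡.refl) = ≡.trans (cong (λ y → + y ℤ.* Zδ.δ t x) z) (ℤP.*-zeroˡ (Zδ.δ t x))
          here-or t (no ne) = ≡.trans (cong (+ b t ℤ.*_) (Zδ.δ-≢ ne)) (ℤP.*-zeroʳ (+ b t))
        at x (no nz) = ≡.trans (Z∑.∑-pick values x _ values-unique (support x nz) (λ t _ ne → ≡.trans (cong (+ b t ℤ.*_) (Zδ.δ-≢ ne)) (ℤP.*-zeroʳ (+ b t))))
          (≡.trans (cong (+ b x ℤ.*_) (Zδ.δ-refl x)) (ℤP.*-identityʳ (+ b x)))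

      κχ : ∀ t → t ∈ μ → κ A.* χ t A.≈ A.nat n A.* χ t A.- s
      κχ t i = A.trans (A.distribʳ (χ t) _ _) (A.+-congˡ (A.trans (A.sym (A.-‿distribˡ-* s (χ t))) (A.-‿cong (A.trans (A.*-comm s (χ t)) (χ-s t i)))))

      κχ0 : κ A.* χ 0# A.≈ A.0#
      κχ0 = kills (χ 0#) λ t _ → A.trans (A.sym (χ-* t 0#)) (A.reflexive (cong χ (zeroʳ t)))

      κa : κ A.* a A.≈ A∑.∑ μ (λ t → A.nat (b t) A.* (A.nat n A.* χ t A.- s))
      κa = A.trans (A.*-congˡ expand) (A.trans (A.sym (A∑.∑-*ˡ values κ _)) (A.trans (A.+-cong
          (A.trans (A.solve 3 (λ k m x → k A.:* (m A.:* x) A.:= m A.:* (k A.:* x)) A.refl κ (A.nat (b 0#)) (χ 0#)) (A.trans (A.*-congˡ κχ0) (A.zeroʳ _)))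
          (A∑.∑-cong∈ μ λ t i → A.trans (A.solve 3 (λ k m x → k A.:* (m A.:* x) A.:= m A.:* (k A.:* x)) A.refl κ (A.nat (b t)) (χ t)) (A.*-congˡ (κχ t i))))
        (A.+-identityˡ _)))

      s-value : ∀ x → s ⟨ x ⟩ ≡ Z∑.∑ μ (λ t → Zδ.δ t x)
      s-value x = ≡.trans (⟨∑⟩ μ χ x) (Z∑.∑-cong μ λ t → ⟨χ⟩ t x)

      κa-value : ∀ x → (κ A.* a) ⟨ x ⟩ ≡ Z∑.∑ μ (λ t → + b t ℤ.* (+ n ℤ.* Zδ.δ t x ℤ.- s ⟨ x ⟩))
      κa-value x = ≡.trans (⟨⟩-cong κa x) (≡.trans (⟨∑⟩ μ _ x) (Z∑.∑-cong μ λ t → ≡.trans (⟨nat*⟩ (b t) _ x) (cong (+ b t ℤ.*_)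
        (≡.trans (⟨+⟩ (A.nat n A.* χ t) (A.- s) x) (cong₂ ℤ._+_ (≡.trans (⟨nat*⟩ n (χ t) x) (cong (+ n ℤ.*_) (⟨χ⟩ t x))) (⟨neg⟩ s x))))))

    at-outside : ∀ x → ¬ (x ∈ μ) → (κ A.* a) ⟨ x ⟩ ≡ + 0
    at-outside x x∉ = ≡.trans (κa-value x) (Z∑.∑-zero μ λ t i → ≡.trans (cong₂ (λ y z → + b t ℤ.* (+ n ℤ.* y ℤ.- z)) (δ0 t i) (≡.trans (s-value x) (Z∑.∑-zero μ δ0)))
      (≡.trans (cong (+ b t ℤ.*_) (cong (ℤ._- + 0) (ℤP.*-zeroʳ (+ n)))) (ℤP.*-zeroʳ (+ b t))))
      where
      δ0 : ∀ t → t ∈ μ → Zδ.δ t x ≡ + 0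
      δ0 t i = Zδ.δ-≢ λ { ≡.refl → x∉ i }

    at-unit : ∀ x → x ∈ μ → (κ A.* a) ⟨ x ⟩ ≡ + (n ℕ.* b x) ℤ.- + mass
    at-unit x x∈ = ≡.trans (κa-value x) (≡.trans (Z∑.∑-cong μ λ t → ≡.trans (cong (λ z → + b t ℤ.* (+ n ℤ.* Zδ.δ t x ℤ.- z)) s≡1) (spread (+ b t) (+ n) (Zδ.δ t x)))
      (≡.trans (Z∑.∑-+ μ _ _) (cong₂ ℤ._+_ first second)))
      where
      spread : ∀ b n δ → b ℤ.* (n ℤ.* δ ℤ.- + 1) ≡ (n ℤ.* b) ℤ.* δ ℤ.+ ℤ.- b
      spread b n δ = Zr.solve 3 (λ b n δ → b Zr.:* (n Zr.:* δ Zr.:- Zr.con (+ 1)) Zr.:= (n Zr.:* b) Zr.:* δ Zr.:+ Zr.:- b) ≡.refl b n δ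
      s≡1 : s ⟨ x ⟩ ≡ + 1
      s≡1 = ≡.trans (s-value x) (≡.trans (Z∑.∑-pick μ x _ μ-unique x∈ (λ t _ ne → Zδ.δ-≢ ne)) (Zδ.δ-refl x))
      first : Z∑.∑ μ (λ t → (+ n ℤ.* + b t) ℤ.* Zδ.δ t x) ≡ + (n ℕ.* b x)
      first = ≡.trans (Z∑.∑-pick μ x _ μ-unique x∈ (λ t _ ne → ≡.trans (cong ((+ n ℤ.* + b t) ℤ.*_) (Zδ.δ-≢ ne)) (ℤP.*-zeroʳ (+ n ℤ.* + b t))))
        (≡.trans (cong ((+ n ℤ.* + b x) ℤ.*_) (Zδ.δ-refl x)) (≡.trans (ℤP.*-identityʳ (+ n ℤ.* + b x)) (≡.sym (ℤP.pos-* n (b x)))))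
      neg-∑ : ∀ (ts : List Carrier) → Z∑.∑ ts (λ t → ℤ.- (+ b t)) ≡ ℤ.- (+ ℕSum.∑ ts b)
      neg-∑ [] = ≡.refl
      neg-∑ (t ∷ ts) = ≡.trans (cong (ℤ._+_ (ℤ.- (+ b t))) (neg-∑ ts)) (≡.trans (≡.sym (ℤP.neg-distrib-+ (+ b t) (+ ℕSum.∑ ts b))) (cong ℤ.-_ (≡.sym (ℤP.pos-+ (b t) (ℕSum.∑ ts b)))))
      second : Z∑.∑ μ (λ t → ℤ.- (+ b t)) ≡ ℤ.- (+ mass)
      second = neg-∑ μ

    -- `κ a` is `n b(x) - mass` on `μ` and zero elsewhere, so its norm is a sum of deviations from
    -- the mean.
    ∥κa∥≤ : ∀ U → (∀ t → t ∈ μ → n ℕ.* b t ≤ mass ℕ.+ U) → ∥ κ A.* a ∥ ≤ 2 ℕ.* (n ℕ.* U)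
    ∥κa∥≤ U le = ≤-trans (≤-reflexive (≡.trans (ℕSum.∑-cong elements λ x → on x ((x ^ n) ≟ 1#)) (≡.trans (≡.sym (ℕSum.∑-filter (λ x → (x ^ n) ≟ 1#) elements _)) ≡.refl)))
      (subst (λ N → ℕSum.∑ μ (λ y → ℤ.∣ + (n ℕ.* b y) ℤ.- + mass ∣) ≤ 2 ℕ.* (N ℕ.* U)) length-μ
        (deviation-sum μ (λ t → n ℕ.* b t) mass U (≡.trans (ℕSum.∑-*ˡ μ n b) (cong (ℕ._* mass) (≡.sym length-μ))) le))
      where
      on : ∀ x (c : Dec (x ^ n ≡ 1#)) → ℤ.∣ (κ A.* a) ⟨ x ⟩ ∣ ≡ (if does c then ℤ.∣ + (n ℕ.* b x) ℤ.- + mass ∣ else 0)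
      on x (yes e) = cong ℤ.∣_∣ (at-unit x (∈μ e))
      on x (no ne) = cong ℤ.∣_∣ (at-outside x λ i → ne (μ⇒ i))

  K₀ : ℕ
  K₀ = 2 ℕ.* (n ℕ.* (d ℕ.+ C₂))

  -- Stepanov's bound compares with `q^m`, which differs from the mass on `μ` only by the count at
  -- zero, at most `d`.
  κν-bound : ∀ m → 1 ≤ m → ∥ κ A.* M.mangoldt m ∥ ≤ K₀ ℕ.* w m
  κν-bound m 1≤m = ≤-trans (Me.∥κa∥≤ ((d ℕ.+ C₂) ℕ.* w m) bound) (≤-reflexive (N.solve 3 (λ n u w → N.con 2 N.:* (n N.:* (u N.:* w)) N.:= N.con 2 N.:* (n N.:* u) N.:* w) ≡.refl n (d ℕ.+ C₂) (w m)))
    where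
    support : ∀ t → count m t ≢ 0 → t ∈ values
    support t ne = go (hits m t) (λ l j → let (_ , i , _ , _ , v) = hits⇒ m t j in l , i , v) ne
      where
      go : ∀ ls → (∀ l → l ∈ ls → Σ (List Carrier) λ l → Σ ℕ λ i → λ′ l ^ i ≡ t) → ℕSum.∑ ls length ≢ 0 → t ∈ values
      go [] _ ne = ⊥-elim (ne ≡.refl)
      go (l ∷ ls) h _ = let (l′ , i , v) = h l (here ≡.refl) in case t ≟ 0# of λ
        { (yes z) → here z ; (no nz) → there (subst (_∈ μ) v (λ-power∈ l′ i λ z → nz (trans (sym v) z))) }
    module Me = Measure (M.mangoldt m) (count m) (mangoldt-value m) support
    bound : ∀ t → t ∈ μ → n ℕ.* count m t ≤ Me.mass ℕ.+ (d ℕ.+ C₂) ℕ.* w m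
    bound t i = ≤-trans (count-bound m t 1≤m (μ⇒≢0 i)) (≤-trans (+-monoˡ-≤ (w m ℕ.* C₂) (≤-trans (≤-reflexive (≡.trans (≡.sym (total m 1≤m)) (ℕP.+-comm (count m 0#) Me.mass)))
        (+-monoʳ-≤ Me.mass (≤-trans (count-zero m) (≤-trans (≤-reflexive (≡.sym (ℕP.*-identityʳ d))) (*-monoʳ-≤ d (1≤q^ ℕ.⌈ m /2⌉)))))))
      (≤-reflexive (N.solve 4 (λ b d w c → b N.:+ d N.:* w N.:+ w N.:* c N.:= b N.:+ (d N.:+ c) N.:* w) ≡.refl Me.mass d (w m) C₂)))

  frequency : Carrier → ℕ
  frequency t = ℕSum.∑ elements (λ x → ℕδ.δ (Pol.eval x f ^ e₁) t)

  -- The resultant of `f` with `X - x` is `f(x)`; the substitution `x ↦ -x` converts constant terms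
  -- into roots.
  coef-1 : M.coef 1 A.≈ A∑.∑ elements (λ x → χ (Pol.eval x f ^ e₁))
  coef-1 = A.trans (A∑.∑-product _∷_ elements ([] ∷ []) φ) (A.trans (A∑.∑-cong elements λ x → A.+-identityʳ _)
    (A.trans (A.sym (A∑.∑-bij (-_) (-_) (λ x → φ (x ∷ [])) elements-unique elements-unique (λ x _ → ∈elements _ , -‿involutive x) (λ x _ → ∈elements _ , -‿involutive x)))
      (A∑.∑-cong elements λ x → A.reflexive (cong χ (^-congˡ e₁ (ρ-linear x))))))

  frequency-value : ∀ t → M.coef 1 ⟨ t ⟩ ≡ + frequency t
  frequency-value t = ≡.trans (⟨⟩-cong coef-1 t) (≡.trans (⟨∑⟩ elements _ t) (≡.trans (Z∑.∑-cong elements λ x → ≡.trans (⟨χ⟩ (Pol.eval x f ^ e₁) t) (cast ((Pol.eval x f ^ e₁) ≟ t))) (pos-∑ elements _)))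
    where
    cast : ∀ {Q : Set} (c : Dec Q) → Z∑.[ c ]ᵢ ≡ + ℕSum.[ c ]ᵢ
    cast (yes _) = ≡.refl
    cast (no _) = ≡.refl

  value∈ : ∀ x → Pol.eval x f ^ e₁ ∈ values
  value∈ x = case (Pol.eval x f ^ e₁) ≟ 0# of λ { (yes z) → here z ; (no nz) → there (λ-value (Pol.eval x f) nz) }

  frequency-support : ∀ t → frequency t ≢ 0 → t ∈ values
  frequency-support t ne = case Any.any? (λ x → (Pol.eval x f ^ e₁) ≟ t) elements of λ
    { (yes a) → let (x , _ , e) = find a in subst (_∈ values) e (value∈ x)
    ; (no n) → ⊥-elim (ne (ℕSum.∑-zero elements λ x i → ℕδ.δ-≢ λ e → n (lose i e))) }

  frequency-total : frequency 0# ℕ.+ ℕSum.∑ μ frequency ≡ q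
  frequency-total = ≡.trans (ℕSum.∑-swap values elements (λ t x → ℕδ.δ (Pol.eval x f ^ e₁) t)) (≡.trans (ℕSum.∑-cong elements {g = λ _ → 1} λ x →
      ≡.trans (ℕSum.∑-pick values (Pol.eval x f ^ e₁) _ values-unique (value∈ x) (λ t _ ne → ℕδ.δ-≢ λ e → ne (≡.sym e))) (ℕδ.δ-refl _))
    (≡.trans (∑-constℕ elements 1) (≡.trans (ℕP.*-identityʳ _) length-elements)))

  frequency-zero : frequency 0# ≤ d
  frequency-zero = ≤-trans (≤-reflexive (≡.trans (≡.sym (ℕSum.∑-filter root? elements (λ _ → 1))) (≡.trans (∑-constℕ (filter root? elements) 1) (ℕP.*-identityʳ _))))
    (≤-pred (few-roots f (bnd (mon-⟦⟧ lf)) f≉0 (filter root? elements) (Uniq.filter⁺ root? elements-unique)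
      (All.map (λ {x} e → ^≡0 e₁ e) (all-filter root? elements))))
    where
    root? : ∀ x → Dec (Pol.eval x f ^ e₁ ≡ 0#)
    root? x = (Pol.eval x f ^ e₁) ≟ 0#

  D : ℕ
  D = d ∸ 1

  private
    c0 : M.coef 0 A.≈ A.1#
    c0 = A.trans (A.+-identityʳ _) (A.trans (A.reflexive (cong χ λ-[])) χ-1)

    κcoef : ∀ m → D < m → κ A.* M.coef m A.≈ A.0#
    κcoef m lt = kills (M.coef m) λ t i → χ-coef t i m (≤-trans (m≤n+m∸n d 1) lt)

    series : ReducedSeries
    series = record
      { R = algebra
      ; norm = record { ‖_‖ = ∥_∥ ; ‖‖-cong = ∥∥-cong ; ‖‖-+ = ∥∥-+ ; ‖‖-* = ∥∥-* ; ‖‖-neg = ∥∥-neg ; ‖‖-0 = ∥∥-0 ; ‖‖-nat = ∥∥-nat }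
      ; n = n ; 1≤n = 1≤n ; κ = κ ; κκ = κκ ; q = q ; 1≤q = 1≤q ; c = M.coef ; ν = M.mangoldt ; c0 = c0 ; newton = M.newton
      ; D = D ; c-zero = κcoef ; K₀ = K₀ ; ν-bound = κν-bound }

    module RB = ReducedBound series
    module F₁ = Measure (M.coef 1) frequency frequency-value frequency-support

    abstract
      -- For `N = 2^j`, `squares` bounds the `N`-th power of the left side by the squared norm of
      -- `(κ c₁)^N`, which is `O(N^β (n² D² q)^N)`; `growth` discards the polynomial factor.
      square-bound : ∀ t → t ≢ 0# → ℤ.∣ (κ A.* M.coef 1) ⟨ t ⟩ ∣ ℕ.* ℤ.∣ (κ A.* M.coef 1) ⟨ t ⟩ ∣ ≤ n ℕ.* n ℕ.* (D ℕ.* D) ℕ.* q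
      square-bound t t≢0 = go (1 ℕP.≤? D)
        where
        go : Dec (1 ≤ D) → ℤ.∣ (κ A.* M.coef 1) ⟨ t ⟩ ∣ ℕ.* ℤ.∣ (κ A.* M.coef 1) ⟨ t ⟩ ∣ ≤ n ℕ.* n ℕ.* (D ℕ.* D) ℕ.* q
        -- For `D = 0` the linear coefficient is already killed by `κ`.
        go (no D≱1) = ≤-trans (≤-reflexive (cong (λ z → ℤ.∣ z ∣ ℕ.* ℤ.∣ z ∣) (≡.trans (⟨⟩-cong (κcoef 1 (≰⇒> D≱1)) t) (⟨0⟩ t)))) z≤n
        go (yes 1≤D) = let (K , β , h) = RB.square-power-bound 1≤D in Growth.growth _ (n ℕ.* n ℕ.* (D ℕ.* D) ℕ.* q) K β λ j _ →
          ≤-trans (squares j (κ A.* M.coef 1) t t≢0) (h (2 ℕ.^ j) (≤-trans (s≤s z≤n) (Growth.n<2^n j)))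

  abstract
    weil : ∀ t → t ^ n ≡ 1# → let Δ = ℤ.∣ + (n ℕ.* frequency t) ℤ.- + ℕSum.∑ μ frequency ∣ in Δ ℕ.* Δ ≤ n ℕ.* n ℕ.* (D ℕ.* D) ℕ.* q
    weil t e = subst (λ z → ℤ.∣ z ∣ ℕ.* ℤ.∣ z ∣ ≤ n ℕ.* n ℕ.* (D ℕ.* D) ℕ.* q) (F₁.at-unit t (∈μ e)) (square-bound t (^n≡1⇒≢0 e))

-- Derivatives and the Picard-Fuchs equation of the Hasse invariant

module Derivative (R : CommutativeRing 0ℓ 0ℓ) where
  open PolyFacts R
  private
    module P² = PolyFacts poly

    τ : Hom poly P².poly
    τ = Eval.evalHom (P².constHom ∘ₕ constHom) (P².C X P².P.+ P².X)

    module τ = HomP τ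

    τ-step : ∀ a p → τ.fn (C a P.+ X P.* p) P².P.≈ P².C (C a) P².P.+ (P².C X P².P.+ P².X) P².P.* τ.fn p
    τ-step a p = P².P.trans (τ.+-homo _ _) (P².P.+-cong (Eval.eval-C (P².constHom ∘ₕ constHom) _ a)
      (P².P.trans (τ.*-homo X p) (P².P.*-congʳ (Eval.eval-X (P².constHom ∘ₕ constHom) (P².C X P².P.+ P².X)))))

    shape : ∀ a x y t → (a P².P.+ (x P².P.+ y) P².P.* t) P².P.≈ (a P².P.+ x P².P.* t) P².P.+ y P².P.* t
    shape a x y t = P².P.solve 4 (λ a x y t → a P².P.:+ (x P².P.:+ y) P².P.:* t P².P.:= (a P².P.:+ x P².P.:* t) P².P.:+ y P².P.:* t) P².P.refl a x y t

  -- The derivative is the linear coefficient of p(X + Y) in Y.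
  ∂ : P.Carrier → P.Carrier
  ∂ p = τ.fn p P².‼ 1

  ∂-cong : ∀ {p q} → p P.≈ q → ∂ p P.≈ ∂ q
  ∂-cong e = P².‼-cong (τ.resp e) 1

  ∂-+ : ∀ p q → ∂ (p P.+ q) P.≈ ∂ p P.+ ∂ q
  ∂-+ p q = P.trans (P².‼-cong (τ.+-homo p q) 1) (P².‼-+ _ _ 1)

  ∂-0 : ∂ P.0# P.≈ P.0#
  ∂-0 = P.trans (P².‼-cong τ.0-homo 1) (P².‼-0 1)

  private
    τ‼0 : ∀ p → τ.fn p P².‼ 0 P.≈ p
    τ‼0 = poly-ind (λ p → τ.fn p P².‼ 0 P.≈ p) (λ e h → P.trans (P².‼-cong (τ.resp (P.sym e)) 0) (P.trans h e)) (P.trans (P².‼-cong τ.0-homo 0) (P².‼-0 0))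
      λ a p h → P.trans (P².‼-cong (P².P.trans (τ-step a p) (shape _ _ _ _)) 0) (P.trans (P².‼-+ _ _ 0) (P.trans (P.+-cong
        (P.trans (P².‼-+ _ _ 0) (P.+-cong (P².C‼0 _) (P.trans (P².C*‼ X _ 0) (P.*-congˡ h)))) (P².X*‼0 _)) (P.+-identityʳ _)))

  ∂-step : ∀ a p → ∂ (C a P.+ X P.* p) P.≈ p P.+ X P.* ∂ p
  ∂-step a p = P.trans (P².‼-cong (P².P.trans (τ-step a p) (shape _ _ _ _)) 1) (P.trans (P².‼-+ _ _ 1) (P.trans (P.+-cong
    (P.trans (P².‼-+ _ _ 1) (P.trans (P.+-cong (P².C‼suc _ 0) (P².C*‼ X _ 1)) (P.+-identityˡ _))) (P.trans (P².X*‼suc _ 0) (τ‼0 p))) (P.+-comm _ _)))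

  ∂-* : ∀ p q → ∂ (p P.* q) P.≈ ∂ p P.* q P.+ p P.* ∂ q
  ∂-* p q = P.trans (P².‼-cong (τ.*-homo p q) 1) (P.trans (product (τ.fn p) (τ.fn q)) (P.+-cong (P.*-congˡ (τ‼0 q)) (P.*-congʳ (τ‼0 p))))
    where
    product : ∀ u v → (u P².P.* v) P².‼ 1 P.≈ u P².‼ 1 P.* v P².‼ 0 P.+ u P².‼ 0 P.* v P².‼ 1
    product u v = let (t , e) = P².decompose u ; (s , e′) = P².decompose t in
      P.trans (P².‼-cong (P².P.*-congʳ e) 1) (P.trans (P².step*‼suc _ t v 0) (P.trans (P.+-comm _ _) (P.+-congʳ
        (P.trans (P².‼-cong (P².P.*-congʳ e′) 0) (P.trans (P².step*‼0 _ s v) (P.*-congʳ (P.sym (P.trans (P².‼-cong e 1) (P².step‼suc _ t 0)))))))))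

  ∂-C : ∀ a → ∂ (C a) P.≈ P.0#
  ∂-C a = P.trans (∂-cong (P.sym (P.trans (P.+-congˡ (P.zeroʳ X)) (P.+-identityʳ _)))) (P.trans (∂-step a P.0#) (P.trans (P.+-identityˡ _) (P.trans (P.*-congˡ ∂-0) (P.zeroʳ X))))

  ∂-1 : ∂ P.1# P.≈ P.0#
  ∂-1 = P.trans (∂-cong (P.sym C-1)) (∂-C R.1#)

  ∂-X : ∂ X P.≈ P.1#
  ∂-X = P.trans (∂-cong (P.sym (P.trans (P.+-cong C-0 (P.*-identityʳ X)) (P.+-identityˡ X)))) (P.trans (∂-step R.0# P.1#) (P.trans (P.+-congˡ (P.trans (P.*-congˡ ∂-1) (P.zeroʳ X))) (P.+-identityʳ _)))

  ∂-scale : ∀ {c} u → ∂ c P.≈ P.0# → ∂ (c P.* u) P.≈ c P.* ∂ u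
  ∂-scale {c} u z = P.trans (∂-* c u) (P.trans (P.+-congʳ (P.trans (P.*-congʳ z) (P.zeroˡ u))) (P.+-identityˡ _))

  ∂-nat : ∀ n → ∂ (P.nat n) P.≈ P.0#
  ∂-nat zero = ∂-0
  ∂-nat (suc n) = P.trans (∂-+ P.1# (P.nat n)) (P.trans (P.+-cong ∂-1 (∂-nat n)) (P.+-identityʳ _))

  ∂-nat* : ∀ n u → ∂ (P.nat n P.* u) P.≈ P.nat n P.* ∂ u
  ∂-nat* n u = ∂-scale u (∂-nat n)

  ∂-^ : ∀ g m → ∂ (g P.^ suc m) P.≈ P.nat (suc m) P.* (g P.^ m P.* ∂ g)
  ∂-^ g zero = P.trans (∂-* g P.1#) (P.trans (P.+-congˡ (P.trans (P.*-congˡ ∂-1) (P.zeroʳ g)))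
    (P.solve 1 (λ d → d P.:* P.con (+ 1) P.:+ P.con (+ 0) P.:= (P.con (+ 1) P.:+ P.con (+ 0)) P.:* (P.con (+ 1) P.:* d)) P.refl (∂ g)))
  ∂-^ g (suc m) = P.trans (∂-* g (g P.^ suc m)) (P.trans (P.+-congˡ (P.*-congˡ (∂-^ g m)))
    (P.solve 4 (λ d g y n → d P.:* (g P.:* y) P.:+ g P.:* (n P.:* (y P.:* d)) P.:= (P.con (+ 1) P.:+ n) P.:* ((g P.:* y) P.:* d)) P.refl (∂ g) g (g P.^ m) (P.nat (suc m))))

  ∂‼ : ∀ p i → ∂ p ‼ i R.≈ R.nat (suc i) R.* p ‼ suc i
  ∂‼ = poly-ind (λ p → ∀ i → ∂ p ‼ i R.≈ R.nat (suc i) R.* p ‼ suc i)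
    (λ e h i → R.trans (‼-cong (∂-cong (P.sym e)) i) (R.trans (h i) (R.*-congˡ (‼-cong e (suc i)))))
    (λ i → R.trans (‼-cong ∂-0 i) (R.trans (‼-0 i) (R.sym (R.trans (R.*-congˡ (‼-0 (suc i))) (R.zeroʳ _)))))
    λ a p h i → R.trans (‼-cong (∂-step a p) i) (R.trans (‼-+ p _ i) (R.trans (R.+-congˡ (tail p h i)) (R.trans
      (R.solve 2 (λ n x → x R.:+ n R.:* x R.:= (R.con (+ 1) R.:+ n) R.:* x) R.refl (R.nat i) (p ‼ i)) (R.*-congˡ (R.sym (step‼suc a p i))))))
    where
    tail : ∀ p → (∀ i → ∂ p ‼ i R.≈ R.nat (suc i) R.* p ‼ suc i) → ∀ i → (X P.* ∂ p) ‼ i R.≈ R.nat i R.* p ‼ i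
    tail p h zero = R.trans (X*‼0 _) (R.sym (R.zeroˡ _))
    tail p h (suc i) = R.trans (X*‼suc _ i) (h i)

module Cubic (R : CommutativeRing 0ℓ 0ℓ) (a b : CommutativeRing.Carrier R) where
  open PolyFacts R

  g : P.Carrier
  g = C b P.+ X P.* (C a P.+ X P.* (C R.0# P.+ X P.* C R.1#))

  g*-expand : ∀ u → g P.* u P.≈ C b P.* u P.+ (C a P.* (X P.* u) P.+ X P.* (X P.* (X P.* u)))
  g*-expand u = P.trans (P.*-congʳ (P.+-congˡ (P.*-congˡ (P.+-congˡ (P.*-congˡ (P.+-cong C-0 (P.*-congˡ C-1)))))))
    (P.solve 4 (λ b a x u → (b P.:+ x P.:* (a P.:+ x P.:* (P.con (+ 0) P.:+ x P.:* P.con (+ 1)))) P.:* u P.:= b P.:* u P.:+ (a P.:* (x P.:* u) P.:+ x P.:* (x P.:* (x P.:* u)))) P.refl (C b) (C a) X u)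

  mon-g : Mon 3 g
  mon-g = mon (bnd-step b (bnd-step a (bnd-step R.0# (bnd-C R.1#))))
    (R.trans (step‼suc b _ 2) (R.trans (step‼suc a _ 1) (R.trans (step‼suc R.0# _ 0) (C‼0 R.1#))))

  g*‼3 : ∀ u i → (g P.* u) ‼ (3 ℕ.+ i) R.≈ b R.* u ‼ (3 ℕ.+ i) R.+ (a R.* u ‼ (2 ℕ.+ i) R.+ u ‼ i)
  g*‼3 u i = R.trans (‼-cong (g*-expand u) (3 ℕ.+ i)) (R.trans (‼-+ _ _ (3 ℕ.+ i)) (R.+-cong (C*‼ b u _) (R.trans (‼-+ _ _ (3 ℕ.+ i))
    (R.+-cong (R.trans (C*‼ a _ _) (R.*-congˡ (X*‼suc u _))) (R.trans (X*‼suc _ _) (R.trans (X*‼suc _ _) (X*‼suc u i)))))))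

  private
    coefficients : ∀ m i → 2 ℕ.+ i ≡ m ℕ.* 3 → ((g P.^ m) ‼ suc i R.≈ R.0#) × ((g P.^ m) ‼ i R.≈ R.nat m R.* a)
    coefficients (suc zero) (suc zero) ≡.refl =
        R.trans (‼-cong (P.*-identityʳ g) 2) (R.trans (step‼suc b _ 1) (R.trans (step‼suc a _ 0) (step‼0 R.0# _)))
      , R.trans (‼-cong (P.*-identityʳ g) 1) (R.trans (step‼suc b _ 0) (R.trans (step‼0 a _) (R.solve 1 (λ a → a R.:= (R.con (+ 1) R.:+ R.con (+ 0)) R.:* a) R.refl a)))
    coefficients (suc (suc m)) (suc zero) ()
    coefficients (suc (suc m)) (suc (suc zero)) ()
    coefficients (suc m@(suc _)) (suc (suc (suc i))) e = let (next , second) = coefficients m i e′ in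
        R.trans (g*‼3 _ (suc i)) (R.trans (R.+-cong (zero-times b (top (4 ℕ.+ i) (s≤s (≤-trans (≤-reflexive (≡.sym e′)) (n≤1+n _))))) (R.+-cong (zero-times a (top (3 ℕ.+ i) (s≤s (≤-reflexive (≡.sym e′))))) next))
          (R.solve 0 (R.con (+ 0) R.:+ (R.con (+ 0) R.:+ R.con (+ 0)) R.:= R.con (+ 0)) R.refl))
      , R.trans (g*‼3 _ i) (R.trans (R.+-cong (zero-times b (top (3 ℕ.+ i) (s≤s (≤-reflexive (≡.sym e′))))) (R.+-cong (R.*-congˡ (R.trans (R.reflexive (cong ((g P.^ m) ‼_) e′)) (lead (mon-^ m mon-g)))) second))
          (R.solve 2 (λ a n → R.con (+ 0) R.:+ (a R.:* R.con (+ 1) R.:+ n R.:* a) R.:= (R.con (+ 1) R.:+ n) R.:* a) R.refl a (R.nat m)))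
      where
      e′ : 2 ℕ.+ i ≡ m ℕ.* 3
      e′ = ℕP.suc-injective (ℕP.suc-injective (ℕP.suc-injective e))
      zero-times : ∀ c {x} → x R.≈ R.0# → c R.* x R.≈ R.0#
      zero-times c z = R.trans (R.*-congˡ z) (R.zeroʳ c)
      top : ∀ j → m ℕ.* 3 < j → (g P.^ m) ‼ j R.≈ R.0#
      top j lt = bnd (mon-^ m mon-g) j lt
    coefficients (suc m@(suc _)) zero ()

  second-coefficient : ∀ m i → 2 ℕ.+ i ≡ m ℕ.* 3 → (g P.^ m) ‼ i R.≈ R.nat m R.* a
  second-coefficient m i e = proj₂ (coefficients m i e)

record CubicFamily : Set₁ where
  field
    R : CommutativeRing 0ℓ 0ℓ
    α : CommutativeRing.Carrier R
    m : ℕ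
    char : CommutativeRing._≈_ R (RingKit.nat R (suc (suc (suc m) ℕ.+ suc (suc m)))) (CommutativeRing.0# R)

-- For g = x³ + αx + B, the coefficients K_i ∈ R[B] of x^(p-1) in g^i.  Here p = 2(m + 2) + 1 vanishes in R.
module PicardFuchs (family : CubicFamily) where
  open CubicFamily family
  open PolyFacts R
  open Derivative R
  private
    module T = PolyFacts poly
    module ∂x = Derivative poly
    module TP = T.P

  open Cubic poly (C α) X

  nn : ℕ
  nn = suc (suc m)

  K : ℕ → P.Carrier
  K i = (g TP.^ i) T.‼ (nn ℕ.+ nn)

  Δ : P.Carrier
  Δ = P.nat 4 P.* (C α P.* (C α P.* C α)) P.+ P.nat 27 P.* (X P.* X)

  private
    T-nat : ∀ n → TP.nat n TP.≈ T.C (P.nat n)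
    T-nat n = TP.sym (HomP.nat-homo T.constHom n)

    nat*‼ : ∀ n u i → (TP.nat n TP.* u) T.‼ i P.≈ P.nat n P.* u T.‼ i
    nat*‼ n u i = P.trans (T.‼-cong (TP.*-congʳ (T-nat n)) i) (T.C*‼ (P.nat n) u i)

    charP : P.nat (suc (nn ℕ.+ nn)) P.≈ P.0#
    charP = P.trans (P.sym (HomP.nat-homo constHom (suc (nn ℕ.+ nn)))) (P.trans (C-cong char) C-0)

    charT : TP.nat (suc (nn ℕ.+ nn)) TP.≈ TP.0#
    charT = TP.trans (T-nat (suc (nn ℕ.+ nn))) (TP.trans (T.C-cong charP) T.C-0)

    a b x Q Q′ g′ Δ′ : TP.Carrier
    a = T.C (C α)
    b = T.C X
    x = T.X
    Q = TP.nat 15 TP.* x TP.^ 4 TP.+ (TP.nat 21 TP.* (a TP.* x TP.^ 2) TP.+ (TP.nat 6 TP.* (b TP.* x) TP.+ TP.nat 4 TP.* (a TP.* a)))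
    Q′ = TP.nat 60 TP.* x TP.^ 3 TP.+ (TP.nat 42 TP.* (a TP.* x) TP.+ TP.nat 6 TP.* b)
    g′ = TP.nat 3 TP.* (x TP.* x) TP.+ a
    Δ′ = TP.nat 4 TP.* (a TP.* (a TP.* a)) TP.+ TP.nat 27 TP.* (b TP.* b)

    num : ∀ {n} → ℕ → _
    num {n} zero = TP.con {n} (+ 0)
    num {n} (suc k) = TP._:+_ {n} (TP.con {n} (+ 1)) (num {n} k)

    g≈ : g TP.≈ b TP.+ x TP.* (a TP.+ x TP.* x)
    g≈ = TP.+-congˡ (TP.*-congˡ (TP.+-congˡ (TP.*-congˡ (TP.trans (TP.+-cong T.C-0 (TP.trans (TP.*-congˡ T.C-1) (TP.*-identityʳ x))) (TP.+-identityˡ x)))))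

    ∂g : ∂x.∂ g TP.≈ g′
    ∂g = TP.trans (∂x.∂-step X _) (TP.trans (TP.+-cong (TP.+-congˡ (TP.*-congˡ u₂)) (TP.*-congˡ (TP.trans (∂x.∂-step (C α) _) (TP.+-cong u₂ (TP.*-congˡ
        (TP.trans (∂x.∂-step P.0# (T.C P.1#)) (TP.+-cong T.C-1 (TP.trans (TP.*-congˡ (∂x.∂-C P.1#)) (TP.zeroʳ x)))))))))
      (TP.solve 2 (λ a x → (a TP.:+ x TP.:* x) TP.:+ x TP.:* (x TP.:+ x TP.:* (TP.con (+ 1) TP.:+ TP.con (+ 0))) TP.:= num 3 TP.:* (x TP.:* x) TP.:+ a) TP.refl a x))
      where
      u₂ : T.C P.0# TP.+ x TP.* T.C P.1# TP.≈ x
      u₂ = TP.trans (TP.+-cong T.C-0 (TP.trans (TP.*-congˡ T.C-1) (TP.*-identityʳ x))) (TP.+-identityˡ x)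

    ∂Q : ∂x.∂ Q TP.≈ Q′
    ∂Q = TP.trans (∂x.∂-+ _ _) (TP.trans (TP.+-cong (power 15 3) (TP.trans (∂x.∂-+ _ _) (TP.+-cong
          (TP.trans (∂x.∂-nat* 21 _) (TP.*-congˡ (TP.trans (∂x.∂-scale _ (∂x.∂-C (C α))) (TP.*-congˡ (TP.trans (∂x.∂-^ x 1) (TP.*-congˡ (TP.*-congˡ ∂x.∂-X)))))))
          (TP.trans (∂x.∂-+ _ _) (TP.+-cong (TP.trans (∂x.∂-nat* 6 _) (TP.*-congˡ (TP.trans (∂x.∂-scale _ (∂x.∂-C X)) (TP.*-congˡ ∂x.∂-X))))
            (TP.trans (∂x.∂-nat* 4 _) (TP.*-congˡ (TP.trans (∂x.∂-scale _ (∂x.∂-C (C α))) (TP.trans (TP.*-congˡ (∂x.∂-C (C α))) (TP.zeroʳ a))))))))))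
      (TP.solve 3 (λ a b x → let x³ = x TP.:* (x TP.:* (x TP.:* TP.con (+ 1))) in
          num 15 TP.:* (num 4 TP.:* (x³ TP.:* TP.con (+ 1))) TP.:+ (num 21 TP.:* (a TP.:* (num 2 TP.:* ((x TP.:* TP.con (+ 1)) TP.:* TP.con (+ 1)))) TP.:+ (num 6 TP.:* (b TP.:* TP.con (+ 1)) TP.:+ num 4 TP.:* TP.con (+ 0)))
          TP.:= num 60 TP.:* x³ TP.:+ (num 42 TP.:* (a TP.:* x) TP.:+ num 6 TP.:* b)) TP.refl a b x))
      where
      power : ∀ n e → ∂x.∂ (TP.nat n TP.* x TP.^ suc e) TP.≈ TP.nat n TP.* (TP.nat (suc e) TP.* (x TP.^ e TP.* TP.1#))
      power n e = TP.trans (∂x.∂-nat* n _) (TP.*-congˡ (TP.trans (∂x.∂-^ x e) (TP.*-congˡ (TP.*-congˡ ∂x.∂-X))))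

    -- 3Qg′ - 2Q′g = 3Δ - 108Bg + 15g² determines the quartic Q; modulo p the left side times g^m is the derivative of -2Qg^(m+1).
    griffiths : TP.nat 2 TP.* (Q′ TP.* g) TP.+ (TP.nat 3 TP.* Δ′ TP.+ TP.nat 15 TP.* (g TP.* g)) TP.≈ TP.nat 3 TP.* (Q TP.* g′) TP.+ TP.nat 4 TP.* (TP.nat 27 TP.* (b TP.* g))
    griffiths = TP.trans (TP.+-cong (TP.*-congˡ (TP.*-congˡ g≈)) (TP.+-congˡ (TP.*-congˡ (TP.*-cong g≈ g≈)))) (TP.trans
      (TP.solve 3 (λ a b x →
          let g = b TP.:+ x TP.:* (a TP.:+ x TP.:* x)
              x² = x TP.:* (x TP.:* TP.con (+ 1))
              x³ = x TP.:* x²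
              Q = num 15 TP.:* (x TP.:* x³) TP.:+ (num 21 TP.:* (a TP.:* x²) TP.:+ (num 6 TP.:* (b TP.:* x) TP.:+ num 4 TP.:* (a TP.:* a)))
              Q′ = num 60 TP.:* x³ TP.:+ (num 42 TP.:* (a TP.:* x) TP.:+ num 6 TP.:* b)
              g′ = num 3 TP.:* (x TP.:* x) TP.:+ a
              Δ′ = num 4 TP.:* (a TP.:* (a TP.:* a)) TP.:+ num 27 TP.:* (b TP.:* b)
          in num 2 TP.:* (Q′ TP.:* g) TP.:+ (num 3 TP.:* Δ′ TP.:+ num 15 TP.:* (g TP.:* g)) TP.:= num 3 TP.:* (Q TP.:* g′) TP.:+ num 4 TP.:* (num 27 TP.:* (b TP.:* g)))
        TP.refl a b x)
      (TP.+-congˡ (TP.*-congˡ (TP.*-congˡ (TP.*-congˡ (TP.sym g≈))))))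

    -- `p = 2m + 5`, hence `2(m + 1) = p - 3`.
    minus-3 : TP.nat 2 TP.* TP.nat (suc m) TP.≈ TP.- TP.nat 3
    minus-3 = TP.trans (TP.solve 1 (λ m → num 2 TP.:* (TP.con (+ 1) TP.:+ m) TP.:= (TP.con (+ 1) TP.:+ ((num 1 TP.:+ (TP.con (+ 1) TP.:+ m)) TP.:+ (num 1 TP.:+ (TP.con (+ 1) TP.:+ m)))) TP.:- num 3) TP.refl (TP.nat m))
      (TP.trans (TP.+-congʳ (TP.trans (TP.+-congˡ (TP.trans (TP.+-cong one one) (TP.sym (TP.nat-+ nn nn)))) charT)) (TP.+-identityˡ _))
      where
      one : (TP.1# TP.+ TP.0#) TP.+ TP.nat (suc m) TP.≈ TP.nat nn
      one = TP.+-congʳ (TP.+-identityʳ TP.1#)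

    exact : TP.nat 2 TP.* ∂x.∂ (Q TP.* g TP.^ suc m) TP.+ (TP.nat 3 TP.* (Δ′ TP.* g TP.^ m) TP.+ TP.nat 15 TP.* g TP.^ suc (suc m)) TP.≈ TP.nat 4 TP.* (TP.nat 27 TP.* (b TP.* g TP.^ suc m))
    exact = TP.trans (TP.+-congʳ (TP.*-congˡ (TP.trans (∂x.∂-* Q (g TP.^ suc m)) (TP.+-cong (TP.*-congʳ ∂Q) (TP.*-congˡ (TP.trans (∂x.∂-^ g m) (TP.*-congˡ (TP.*-congˡ ∂g))))))))
      (TP.trans (TP.solve 10 (λ n₂ n₁ n₃ n₁₅ q q′ g g′ δ y →
          n₂ TP.:* (q′ TP.:* (g TP.:* y) TP.:+ q TP.:* (n₁ TP.:* (y TP.:* g′))) TP.:+ (n₃ TP.:* (δ TP.:* y) TP.:+ n₁₅ TP.:* (g TP.:* (g TP.:* y)))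
          TP.:= y TP.:* (n₂ TP.:* (q′ TP.:* g) TP.:+ (n₃ TP.:* δ TP.:+ n₁₅ TP.:* (g TP.:* g)) TP.:+ (n₂ TP.:* n₁) TP.:* (q TP.:* g′)))
          TP.refl (TP.nat 2) (TP.nat (suc m)) (TP.nat 3) (TP.nat 15) Q Q′ g g′ Δ′ (g TP.^ m))
        (TP.trans (TP.*-congˡ (TP.+-cong griffiths (TP.*-congʳ minus-3)))
          (TP.solve 7 (λ n₃ n₄ n₂₇ z b g y → y TP.:* ((n₃ TP.:* z TP.:+ n₄ TP.:* (n₂₇ TP.:* (b TP.:* g))) TP.:+ (TP.:- n₃) TP.:* z) TP.:= n₄ TP.:* (n₂₇ TP.:* (b TP.:* (g TP.:* y))))
            TP.refl (TP.nat 3) (TP.nat 4) (TP.nat 27) (Q TP.* g′) b g (g TP.^ m))))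

    Δ′≈ : Δ′ TP.≈ T.C Δ
    Δ′≈ = TP.sym (TP.trans (T.C-+ _ _) (TP.+-cong
      (TP.trans (T.C-* _ _) (TP.*-cong (TP.sym (T-nat 4)) (TP.trans (T.C-* _ _) (TP.*-congˡ (T.C-* _ _)))))
      (TP.trans (T.C-* _ _) (TP.*-cong (TP.sym (T-nat 27)) (T.C-* _ _)))))

  -- The coefficient of `x^(p-1)` in `exact`: a derivative has there a multiple of `p`, which
  -- vanishes.
  relation : P.nat 3 P.* (Δ P.* K m) P.+ P.nat 15 P.* K (suc (suc m)) P.≈ P.nat 4 P.* (P.nat 27 P.* (X P.* K (suc m)))
  relation = P.trans (P.sym (P.trans (P.+-congʳ killed) (P.trans (P.+-identityˡ _) (P.+-cong (P.trans (nat*‼ 3 _ _) (P.*-congˡ (P.trans (T.‼-cong (TP.*-congʳ Δ′≈) (nn ℕ.+ nn)) (T.C*‼ Δ _ _)))) (nat*‼ 15 _ _)))))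
    (P.trans (P.+-congˡ (P.sym (T.‼-+ _ _ (nn ℕ.+ nn)))) (P.trans (P.sym (T.‼-+ _ _ (nn ℕ.+ nn))) (P.trans (T.‼-cong exact (nn ℕ.+ nn))
      (P.trans (nat*‼ 4 _ _) (P.*-congˡ (P.trans (nat*‼ 27 _ _) (P.*-congˡ (T.C*‼ X _ _))))))))
    where
    killed : (TP.nat 2 TP.* ∂x.∂ (Q TP.* g TP.^ suc m)) T.‼ (nn ℕ.+ nn) P.≈ P.0#
    killed = P.trans (nat*‼ 2 _ _) (P.trans (P.*-congˡ (P.trans (∂x.∂‼ _ (nn ℕ.+ nn)) (P.trans (P.*-congʳ charP) (P.zeroˡ _)))) (P.zeroʳ _))

  private
    -- v is the coefficientwise derivative of u with respect to B.
    record _′≈_ (u v : TP.Carrier) : Set where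
      constructor deriv
      field at : ∀ i → ∂ (u T.‼ i) P.≈ v T.‼ i

    ′-X : ∀ {u v} → u ′≈ v → (T.X TP.* u) ′≈ (T.X TP.* v)
    ′-X (deriv h) = deriv λ { zero → P.trans (∂-cong (T.X*‼0 _)) (P.trans ∂-0 (P.sym (T.X*‼0 _)))
                            ; (suc i) → P.trans (∂-cong (T.X*‼suc _ i)) (P.trans (h i) (P.sym (T.X*‼suc _ i))) }

    ′-+ : ∀ {u v u′ v′} → u ′≈ v → u′ ′≈ v′ → (u TP.+ u′) ′≈ (v TP.+ v′)
    ′-+ (deriv h) (deriv h′) = deriv λ i → P.trans (∂-cong (T.‼-+ _ _ i)) (P.trans (∂-+ _ _) (P.trans (P.+-cong (h i) (h′ i)) (P.sym (T.‼-+ _ _ i))))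

    ′-C : ∀ c {u v} → u ′≈ v → (T.C c TP.* u) ′≈ (T.C (∂ c) TP.* u TP.+ T.C c TP.* v)
    ′-C c (deriv h) = deriv λ i → P.trans (∂-cong (T.C*‼ c _ i)) (P.trans (∂-* c _) (P.trans (P.+-congˡ (P.*-congˡ (h i)))
      (P.sym (P.trans (T.‼-+ _ _ i) (P.+-cong (T.C*‼ _ _ i) (T.C*‼ c _ i))))))

    ′-resp : ∀ {u u′ v v′} → u TP.≈ u′ → v TP.≈ v′ → u ′≈ v → u′ ′≈ v′
    ′-resp e e′ (deriv h) = deriv λ i → P.trans (∂-cong (T.‼-cong (TP.sym e) i)) (P.trans (h i) (T.‼-cong e′ i))

    ′-g : ∀ {u v} → u ′≈ v → (g TP.* u) ′≈ (u TP.+ g TP.* v)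
    ′-g {u} {v} h = ′-resp (TP.sym (g*-expand u)) (TP.trans (TP.+-cong (TP.+-congʳ (TP.trans (TP.*-congʳ (TP.trans (T.C-cong ∂-X) T.C-1)) (TP.*-identityˡ u)))
        (TP.+-congʳ (TP.trans (TP.+-congʳ (TP.trans (TP.*-congʳ (TP.trans (T.C-cong (∂-C α)) T.C-0)) (TP.zeroˡ _))) (TP.+-identityˡ _))))
      (TP.trans (TP.+-assoc _ _ _) (TP.+-congˡ (TP.sym (g*-expand v)))))
      (′-+ (′-C X h) (′-+ (′-C (C α) (′-X h)) (′-X (′-X (′-X h)))))

    slope : ℕ → TP.Carrier
    slope zero = TP.0#
    slope (suc i) = TP.nat (suc i) TP.* g TP.^ i

    ′-g^ : ∀ i → (g TP.^ i) ′≈ slope i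
    ′-g^ zero = deriv λ { zero → P.trans (∂-cong (P.trans (T.‼-cong (TP.sym T.C-1) 0) (T.C‼0 P.1#))) (P.trans ∂-1 (P.sym (T.‼-0 0)))
                        ; (suc j) → P.trans (∂-cong (P.trans (T.‼-cong (TP.sym T.C-1) (suc j)) (T.C‼suc P.1# j))) (P.trans ∂-0 (P.sym (T.‼-0 (suc j)))) }
    ′-g^ (suc i) = ′-resp TP.refl (combine i) (′-g (′-g^ i))
      where
      combine : ∀ i → g TP.^ i TP.+ g TP.* slope i TP.≈ slope (suc i)
      combine zero = TP.solve 1 (λ g → TP.con (+ 1) TP.:+ g TP.:* TP.con (+ 0) TP.:= (TP.con (+ 1) TP.:+ TP.con (+ 0)) TP.:* TP.con (+ 1)) TP.refl g
      combine (suc i) = TP.solve 3 (λ g y n → g TP.:* y TP.:+ g TP.:* (n TP.:* y) TP.:= (TP.con (+ 1) TP.:+ n) TP.:* (g TP.:* y)) TP.refl g (g TP.^ i) (TP.nat (suc i))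

  -- The derivative of `g` with respect to `B` is 1.
  ∂K : ∀ i → ∂ (K (suc i)) P.≈ P.nat (suc i) P.* K i
  ∂K i = P.trans (_′≈_.at (′-g^ (suc i)) (nn ℕ.+ nn)) (nat*‼ (suc i) _ _)

  f : ℕ → P.Carrier
  f zero = K nn
  f (suc j) = ∂ (f j)

  private
    num′ : ∀ {n} → ℕ → _
    num′ {n} zero = P.con {n} (+ 0)
    num′ {n} (suc k) = P._:+_ {n} (P.con {n} (+ 1)) (num′ {n} k)

    ∂Δ : ∂ Δ P.≈ P.nat 54 P.* X
    ∂Δ = P.trans (∂-+ _ _) (P.trans (P.+-cong
        (P.trans (∂-nat* 4 _) (P.*-congˡ (P.trans (∂-scale _ (∂-C α)) (P.*-congˡ (P.trans (∂-scale _ (∂-C α)) (P.*-congˡ (∂-C α)))))))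
        (P.trans (∂-nat* 27 _) (P.*-congˡ (P.trans (∂-* X X) (P.+-cong (P.*-congʳ ∂-X) (P.*-congˡ ∂-X))))))
      (P.solve 2 (λ a x → num′ 4 P.:* (a P.:* (a P.:* P.con (+ 0))) P.:+ num′ 27 P.:* (P.con (+ 1) P.:* x P.:+ x P.:* P.con (+ 1)) P.:= num′ 54 P.:* x) P.refl (C α) X))

  -- `432 n(n + 1) + 60`, where the first term accumulates from the derivatives of `Δ` and of the
  -- coefficient `B` by Leibniz' rule.
  lower : ℕ → P.Carrier
  lower n = P.nat 8 P.* (P.nat 54 P.* (P.nat n P.* P.nat (suc n))) P.+ P.nat 60

  -- The Picard–Fuchs equation 4Δf″ + 216Bf′ + 15f = 0 (scaled by 4), differentiated n times.
  ode : ∀ n → P.nat 16 P.* (Δ P.* f (suc (suc n))) P.+ (P.nat 16 P.* (P.nat 54 P.* (P.nat (suc n) P.* (X P.* f (suc n)))) P.+ lower n P.* f n) P.≈ P.0#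
  ode zero = P.trans (P.+-cong (P.*-congˡ (P.*-congˡ second)) (P.+-congʳ (P.*-congˡ (P.*-congˡ (P.*-congˡ (P.*-congˡ (∂K (suc m))))))))
    (P.trans (P.solve 6 (λ δ x k₀ k₁ k₂ n → let n₁ = P.con (+ 1) P.:+ n ; n₂ = P.con (+ 1) P.:+ n₁ in
        num′ 16 P.:* (δ P.:* (n₂ P.:* (n₁ P.:* k₀))) P.:+ (num′ 16 P.:* (num′ 54 P.:* ((P.con (+ 1) P.:+ P.con (+ 0)) P.:* (x P.:* (n₂ P.:* k₁))))
          P.:+ (num′ 8 P.:* (num′ 54 P.:* (P.con (+ 0) P.:* (P.con (+ 1) P.:+ P.con (+ 0)))) P.:+ num′ 60) P.:* k₂)
        P.:= num′ 4 P.:* ((num′ 3 P.:* (δ P.:* k₀) P.:+ num′ 15 P.:* k₂) P.:- num′ 4 P.:* (num′ 27 P.:* (x P.:* k₁)))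
          P.:+ (P.con (+ 1) P.:+ (n₂ P.:+ n₂)) P.:* (δ P.:* k₀ P.:* (num′ 8 P.:* n₂ P.:- num′ 12) P.:+ num′ 8 P.:* (num′ 54 P.:* (x P.:* k₁))))
      P.refl Δ X (K m) (K (suc m)) (K nn) (P.nat m))
    (P.trans (P.+-cong (P.trans (P.*-congˡ (P.x≈y⇒x∙y⁻¹≈ε relation)) (P.zeroʳ _)) (P.trans (P.*-congʳ (P.trans (P.+-congˡ (P.sym (P.nat-+ nn nn))) charP)) (P.zeroˡ _))) (P.+-identityʳ _)))
    where
    second : ∂ (∂ (K nn)) P.≈ P.nat nn P.* (P.nat (suc m) P.* K m)
    second = P.trans (∂-cong (∂K (suc m))) (P.trans (∂-nat* nn _) (P.*-congˡ (∂K m)))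
  ode (suc n) = P.trans (P.sym (P.trans (∂-+ _ _) (P.trans (P.+-cong
      (P.trans (∂-nat* 16 _) (P.*-congˡ (P.trans (∂-* Δ _) (P.+-congʳ (P.*-congʳ ∂Δ)))))
      (P.trans (∂-+ _ _) (P.+-cong
        (P.trans (∂-nat* 16 _) (P.*-congˡ (P.trans (∂-nat* 54 _) (P.*-congˡ (P.trans (∂-nat* (suc n) _) (P.*-congˡ (P.trans (∂-* X _) (P.+-congʳ (P.*-congʳ ∂-X)))))))))
        (∂-scale _ lower-const))))
    (P.solve 6 (λ δ x f₃ f₂ f₁ n → let n₁ = P.con (+ 1) P.:+ n ; n₂ = P.con (+ 1) P.:+ n₁ in
        num′ 16 P.:* ((num′ 54 P.:* x) P.:* f₂ P.:+ δ P.:* f₃) P.:+ (num′ 16 P.:* (num′ 54 P.:* (n₁ P.:* (P.con (+ 1) P.:* f₁ P.:+ x P.:* f₂)))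
          P.:+ (num′ 8 P.:* (num′ 54 P.:* (n P.:* n₁)) P.:+ num′ 60) P.:* f₁)
        P.:= num′ 16 P.:* (δ P.:* f₃) P.:+ (num′ 16 P.:* (num′ 54 P.:* (n₂ P.:* (x P.:* f₂))) P.:+ (num′ 8 P.:* (num′ 54 P.:* (n₁ P.:* n₂)) P.:+ num′ 60) P.:* f₁))
      P.refl Δ X (f (suc (suc (suc n)))) (f (suc (suc n))) (f (suc n)) (P.nat n)))))
    (P.trans (∂-cong (ode n)) ∂-0)
    where
    lower-const : ∂ (lower n) P.≈ P.0#
    lower-const = P.trans (∂-+ _ _) (P.trans (P.+-cong (P.trans (∂-nat* 8 _) (P.*-congˡ (P.trans (∂-nat* 54 _) (P.*-congˡ (P.trans (∂-nat* n _) (P.*-congˡ (∂-nat (suc n)))))))) (∂-nat 60))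
      (P.solve 1 (λ n → num′ 8 P.:* (num′ 54 P.:* (n P.:* P.con (+ 0))) P.:+ P.con (+ 0) P.:= P.con (+ 0)) P.refl (P.nat n)))

  -- `g` is linear in `B`, so `g^i` has degree at most `i` in `B`.
  bnd-K : ∀ i j → Bnd (suc i) ((g TP.^ i) T.‼ j)
  bnd-K zero zero = bnd-resp (P.sym (P.trans (T.‼-cong (TP.sym T.C-1) 0) (T.C‼0 P.1#))) (bnd-resp C-1 (bnd-C R.1#))
  bnd-K zero (suc j) = bnd-resp (P.sym (P.trans (T.‼-cong (TP.sym T.C-1) (suc j)) (T.C‼suc P.1# j))) bnd-0
  bnd-K (suc i) j = bnd-resp (P.sym (P.trans (T.‼-cong (g*-expand (g TP.^ i)) j) (P.trans (T.‼-+ _ _ j) (P.+-cong (T.C*‼ X _ j) (P.trans (T.‼-+ _ _ j) (P.+-congʳ (T.C*‼ (C α) _ j)))))))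
    (bnd-+ (bnd-X* (bnd-K i j)) (bnd-mono (n≤1+n (suc i)) (bnd-+ (bnd-C* α (shift (bnd-K i) j)) (shift (shift (shift (bnd-K i))) j))))
    where
    shift : ∀ {N u} → (∀ j → Bnd N (u T.‼ j)) → ∀ j → Bnd N ((T.X TP.* u) T.‼ j)
    shift h zero = bnd-resp (P.sym (T.X*‼0 _)) bnd-0
    shift h (suc j) = bnd-resp (P.sym (T.X*‼suc _ j)) (h j)

-- Elementary integer estimates

square-root : ∀ N → Σ ℕ λ r → r ℕ.* r ≤ N × N < suc r ℕ.* suc r
square-root zero = 0 , z≤n , s≤s z≤n
square-root (suc N) = let (r , lo , hi) = square-root N in case (suc r ℕ.* suc r) ℕP.≤? suc N of λ
  { (yes le) → suc r , le , ≤-<-trans hi (*-mono-< {suc r} {suc (suc r)} ≤-refl ≤-refl)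
  ; (no gt) → r , m≤n⇒m≤1+n lo , ≰⇒> gt }

square-≤ : ∀ {x r N} → x ℕ.* x ≤ N → N < suc r ℕ.* suc r → x ≤ r
square-≤ {x} {r} le lt = ≮⇒≥ λ gt → <⇒≱ lt (≤-trans (*-mono-≤ gt gt) le)

∣-∣-bounds : ∀ a b {N} → ℤ.∣ + a ℤ.- + b ∣ ≤ N → a ≤ b ℕ.+ N × b ≤ a ℕ.+ N
∣-∣-bounds a b {N} le = case ≤-total a b of λ
  { (inj₁ a≤b) → ≤-trans a≤b (m≤m+n b N) , ≤-trans (m≤n+m∸n b a) (+-monoʳ-≤ a (≤-trans (≤-reflexive (≡.sym (≡.trans (cong ℤ.∣_∣ (ℤP.m-n≡m⊖n a b)) (ℤP.∣⊖∣-≤ a≤b)))) le))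
  ; (inj₂ b≤a) → ≤-trans (m≤n+m∸n a b) (+-monoʳ-≤ b (≤-trans (≤-reflexive (≡.sym (cong ℤ.∣_∣ (≡.trans (ℤP.m-n≡m⊖n a b) (ℤP.⊖-≥ b≤a))))) le)) , ≤-trans b≤a (m≤m+n a N) }

bounds-∣-∣ : ∀ a b {N} → a ≤ b ℕ.+ N → b ≤ a ℕ.+ N → ℤ.∣ + a ℤ.- + b ∣ ≤ N
bounds-∣-∣ a b {N} le le′ = case ≤-total a b of λ
  { (inj₁ a≤b) → ≤-trans (≤-reflexive (≡.trans (cong ℤ.∣_∣ (ℤP.m-n≡m⊖n a b)) (ℤP.∣⊖∣-≤ a≤b))) (m≤n+o⇒m∸n≤o b a le′)
  ; (inj₂ b≤a) → ≤-trans (≤-reflexive (cong ℤ.∣_∣ (≡.trans (ℤP.m-n≡m⊖n a b) (ℤP.⊖-≥ b≤a)))) (m≤n+o⇒m∸n≤o a b le) }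

∣∣-square : ∀ z → z ℤ.* z ≡ + (ℤ.∣ z ∣ ℕ.* ℤ.∣ z ∣)
∣∣-square (+ a) = ≡.sym (ℤP.pos-* a a)
∣∣-square -[1+ a ] = ≡.refl

-- Point counts modulo p and the Hasse invariant

record Setting : Set₁ where
  field base : PrimePowerField
  open PrimePowerField base public
  field
    nn : ℕ
    odd : p ≡ suc (nn ℕ.+ nn)
    1≤nn : 1 ≤ nn
    1≤k : 1 ≤ k
    5≤p : 5 ≤ p
    t₀ : ℕ
    1≤t₀ : 1 ≤ t₀
    t₀<p : t₀ < p

module Count (input : Setting) where
  open Setting input
  open PrimePower base
  open import Data.Nat.Solver using (module +-*-Solver)
  private module N = +-*-Solver
  open ≡.≡-Reasoning

  -- `E j = (p^j - 1)/(p - 1)`. Thus `e₁` is the exponent of the norm to the prime field, and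
  -- `h = (q - 1)/2`.
  E : ℕ → ℕ
  E zero = 0
  E (suc j) = suc (p ℕ.* E j)

  E-spec : ∀ j → suc ((nn ℕ.+ nn) ℕ.* E j) ≡ p ℕ.^ j
  E-spec zero = cong suc (ℕP.*-zeroʳ (nn ℕ.+ nn))
  E-spec (suc j) = ≡.trans (N.solve 3 (λ n p e → N.con 1 N.:+ n N.:* (N.con 1 N.:+ p N.:* e) N.:= N.con 1 N.:+ n N.:+ p N.:* (n N.:* e)) ≡.refl (nn ℕ.+ nn) p (E j))
    (≡.trans (cong (ℕ._+ p ℕ.* ((nn ℕ.+ nn) ℕ.* E j)) (≡.sym odd)) (≡.trans (≡.sym (ℕP.*-suc p _)) (cong (p ℕ.*_) (E-spec j))))

  e₁ h 2h : ℕ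
  e₁ = E k
  h = nn ℕ.* e₁
  2h = h ℕ.+ h

  private
    1≤E : ∀ j → 1 ≤ j → 1 ≤ E j
    1≤E (suc j) _ = s≤s z≤n

    1≤h : 1 ≤ h
    1≤h = *-mono-≤ 1≤nn (1≤E k 1≤k)

    q≡ : q ≡ suc 2h
    q≡ = ≡.trans (≡.sym (E-spec k)) (cong suc (ℕP.*-distribʳ-+ e₁ nn nn))

    nonzeros-2h : length nonzeros ≡ 2h
    nonzeros-2h = ℕP.suc-injective (≡.trans suc-length-nonzeros q≡)

    0^1≤ : ∀ {j} → 1 ≤ j → 0# ^ j ≡ 0#
    0^1≤ {suc j} _ = 0^ j

    S : ℕ → Carrier
    S j = ∑ elements (_^ j)

    ∑1 : ∑ elements (λ _ → 1#) ≡ 0#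
    ∑1 = trans (∑-const elements 1#) (trans (reflexive (cong nat length-elements)) nat-q)

    -- For `0 < j < q - 1` some unit `a` has `a^j ≠ 1`, and scaling by `a` gives
    -- `(a^j - 1) S j = 0`.
    S-small : ∀ j → j < 2h → S j ≡ 0#
    S-small zero _ = ∑1
    S-small j@(suc j-1) lt = go (Any.any? (λ a → ¬? ((a ^ j) ≟ 1#)) nonzeros)
      where
      go : Dec (Any.Any (λ a → ¬ (a ^ j ≡ 1#)) nonzeros) → S j ≡ 0#
      go (no none) = ⊥-elim (<⇒≱ lt (≤-trans (≤-reflexive (≡.sym nonzeros-2h)) (power-roots j-1 1# nonzeros nonzeros-unique
        (All.tabulate λ {a} i → decidable-stable ((a ^ j) ≟ 1#) λ ne → none (lose i ne)))))
      go (yes some) = let (a , i , ne) = find some in scale a (nonzeros≢0 i) ne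
        where
        scale : ∀ a → a ≢ 0# → a ^ j ≢ 1# → S j ≡ 0#
        scale a a≢0 ne = case domain (a ^ j - 1#) (S j) (trans (solve 2 (λ a s → (a :- con (+ 1)) :* s := a :* s :- s) refl (a ^ j) (S j)) (trans (+-congʳ aS) (-‿inverseʳ (S j)))) of λ
          { (inj₁ z) → ⊥-elim (ne (x∙y⁻¹≈ε⇒x≈y (a ^ j) 1# z)) ; (inj₂ z) → z }
          where
          aS : a ^ j * S j ≡ S j
          aS = trans (sym (∑-*ˡ elements (a ^ j) (_^ j))) (trans (∑-cong elements λ x → sym (^-distrib-* a x j))
            (∑-bij (a *_) (a ⁻¹ *_) (_^ j) elements-unique elements-unique (λ x _ → ∈elements _ , a⁻¹[ax] x a≢0) (λ x _ → ∈elements _ , a[a⁻¹x] x a≢0)))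

    S-top : S 2h ≡ - 1#
    S-top = trans (∑-cong elements λ x → at x (x ≟ 0#)) (trans (∑-+ elements (λ _ → 1#) _) (trans (+-cong ∑1 (trans (∑-*ˡ elements (- 1#) (λ x → δ x 0#))
        (*-congˡ (trans (∑-pick elements 0# _ elements-unique (∈elements 0#) (λ x _ ne → δ-≢ ne)) (δ-refl 0#))))) (trans (+-identityˡ _) (*-identityʳ _))))
      where
      at : ∀ x → Dec (x ≡ 0#) → x ^ 2h ≡ 1# + (- 1#) * δ x 0#
      at x (yes ≡.refl) = trans (0^1≤ (≤-trans 1≤h (m≤m+n h h))) (sym (trans (+-congˡ (trans (*-congˡ (δ-refl 0#)) (*-identityʳ _))) (-‿inverseʳ 1#)))
      at x (no ne) = trans (trans (reflexive (cong (x ^_) (≡.sym nonzeros-2h))) (fermat-unit ne)) (sym (trans (+-congˡ (trans (*-congˡ (δ-≢ ne)) (zeroʳ _))) (+-identityʳ 1#)))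

    S-period : ∀ j → 1 ≤ j → S (j ℕ.+ 2h) ≡ S j
    S-period (suc j) _ = ∑-cong elements λ x → trans (reflexive (cong (x ^_) (≡.trans (≡.sym (ℕP.+-suc j 2h)) (cong (j ℕ.+_) (≡.sym q≡)))))
      (trans (^-homo-* x j q) (trans (*-congˡ (fermat x)) (*-comm _ x)))

    S-middle : ∀ j → 2h < j → j < 2h ℕ.+ 2h → S j ≡ 0#
    S-middle j lt lt′ = trans (reflexive (cong S (≡.sym (m∸n+n≡m (<⇒≤ lt))))) (trans (S-period (j ∸ 2h) (m<n⇒0<n∸m lt))
      (S-small (j ∸ 2h) (+-cancelʳ-< 2h _ _ (≤-<-trans (≤-reflexive (m∸n+n≡m (<⇒≤ lt))) lt′))))

    -- ∑_{i<N} a^i v^(N-1-i); for N = q it equals (a - v)^(q-1).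
    G : ℕ → Carrier → Carrier → Carrier
    G zero a v = 0#
    G (suc N) a v = a ^ N + v * G N a v

    G-difference : ∀ N a v → (a - v) * G N a v ≡ a ^ N - v ^ N
    G-difference zero a v = solve 1 (λ x → x :* con (+ 0) := con (+ 1) :- con (+ 1)) refl (a - v)
    G-difference (suc N) a v = trans (solve 4 (λ a v x g → (a :- v) :* (x :+ v :* g) := a :* x :- v :* x :+ v :* ((a :- v) :* g)) refl a v (a ^ N) (G N a v))
      (trans (+-congˡ (*-congˡ (G-difference N a v))) (solve 4 (λ a v x y → a :* x :- v :* x :+ v :* (x :- y) := a :* x :- v :* y) refl a v (a ^ N) (v ^ N)))

    G-diagonal : ∀ N a → G (suc N) a a ≡ nat (suc N) * a ^ N
    G-diagonal zero a = solve 1 (λ a → con (+ 1) :+ a :* con (+ 0) := (con (+ 1) :+ con (+ 0)) :* con (+ 1)) refl a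
    G-diagonal (suc N) a = trans (+-congˡ (*-congˡ (G-diagonal N a))) (solve 3 (λ a n x → a :* x :+ a :* (n :* x) := (con (+ 1) :+ n) :* (a :* x)) refl a (nat (suc N)) (a ^ N))

    indicator : ∀ a v → [ a ≟ v ]ᵢ ≡ 1# - G q a v
    indicator a v = go (a ≟ v)
      where
      go : (c : Dec (a ≡ v)) → [ c ]ᵢ ≡ 1# - G q a v
      go (yes ≡.refl) = sym (trans (+-congˡ (-‿cong (trans (reflexive (cong (λ N → G N a a) q≡)) (trans (G-diagonal 2h a) (trans (*-congʳ (trans (reflexive (cong nat (≡.sym q≡))) nat-q)) (zeroˡ _))))))
        (solve 0 (con (+ 1) :- con (+ 0) := con (+ 1)) refl))
      go (no ne) = sym (trans (+-congˡ (-‿cong one)) (-‿inverseʳ 1#))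
        where
        one : G q a v ≡ 1#
        one = *-cancelˡ (a - v) (λ z → ne (x∙y⁻¹≈ε⇒x≈y a v z)) (trans (G-difference q a v) (trans (+-cong (fermat a) (-‿cong (fermat v))) (sym (*-identityʳ _))))

    T : ℕ → Carrier → Carrier
    T N v = ∑ elements (λ y → G N (y * y) v)

    T-suc : ∀ N v → T (suc N) v ≡ S (N ℕ.+ N) + v * T N v
    T-suc N v = trans (∑-+ elements _ _) (+-cong (∑-cong elements λ y → trans (^-distrib-* y y N) (sym (^-homo-* y N N))) (∑-*ˡ elements v _))

    T-zero : ∀ N v → N ≤ h → T N v ≡ 0#
    T-zero zero v _ = ∑-0 elements
    T-zero (suc N) v le = trans (T-suc N v) (trans (+-cong (S-small (N ℕ.+ N) (+-mono-< le le)) (trans (*-congˡ (T-zero N v (<⇒≤ le))) (zeroʳ v))) (+-identityʳ 0#))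

    -- In the recursion `T (N + 1) = S (2N) + v T N`, for `N < q`, the power sum is nonzero only at
    -- `N = h` and `N = 2h`. The first starts the powers `-v^j`; the second adds the `-1` in `T-q`.
    T-high : ∀ j v → suc j ≤ h → T (suc (j ℕ.+ h)) v ≡ - (v ^ j)
    T-high zero v _ = trans (T-suc h v) (trans (+-cong S-top (trans (*-congˡ (T-zero h v ≤-refl)) (zeroʳ v))) (+-identityʳ _))
    T-high (suc j) v lt = trans (T-suc (suc (j ℕ.+ h)) v) (trans (+-cong (S-middle _ (+-mono-< lo lo) (≤-trans (+-mono-< hi hi) ≤-refl)) (*-congˡ (T-high j v (<⇒≤ lt))))
      (solve 2 (λ v x → con (+ 0) :+ v :* (:- x) := :- (v :* x)) refl v (v ^ j)))
      where
      lo : h < suc (j ℕ.+ h)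
      lo = s≤s (m≤n+m h j)
      hi : suc (j ℕ.+ h) < 2h
      hi = +-monoˡ-< h lt

    T-q : ∀ v → T q v ≡ - 1# - v ^ h
    T-q v = go h ≡.refl 1≤h
      where
      go : ∀ H → H ≡ h → 1 ≤ H → T q v ≡ - 1# - v ^ H
      go (suc H) e _ = trans (reflexive (cong (λ N → T N v) (≡.trans q≡ (cong (λ z → suc (z ℕ.+ h)) (≡.sym e))))) (trans (T-suc (suc (H ℕ.+ h)) v)
        (trans (+-cong (trans (reflexive (cong (λ z → S ((z ℕ.+ h) ℕ.+ (z ℕ.+ h))) e)) (trans (S-period 2h (≤-trans 1≤h (m≤m+n h h))) S-top)) (*-congˡ (T-high H v (≤-reflexive e))))
          (solve 3 (λ o v x → o :+ v :* (:- x) := o :- v :* x) refl (- 1#) v (v ^ H))))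

  -- Euler's criterion read in `F`: sum the indicator `1 - (y² - v)^(q-1)` over `y`.
  square-count : ∀ v → ∑ elements (λ y → [ (y * y) ≟ v ]ᵢ) ≡ 1# + v ^ h
  square-count v = trans (∑-cong elements λ y → trans (indicator (y * y) v) (sym (+-congˡ (-1*x≈-x (G q (y * y) v))))) (trans (∑-+ elements (λ _ → 1#) _)
    (trans (+-cong ∑1 (trans (∑-*ˡ elements (- 1#) _) (*-congˡ (T-q v)))) (solve 1 (λ x → con (+ 0) :+ (:- con (+ 1)) :* ((:- con (+ 1)) :- x) := con (+ 1) :+ x) refl (v ^ h))))

  private
    moment : ℕ → P.Carrier → Carrier
    moment j u = ∑ elements (λ x → x ^ j * Pol.eval x u)

    moment-zero : ∀ j {u} → Bnd 0 u → moment j u ≡ 0#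
    moment-zero j b = ∑-zero elements λ x _ → trans (*-congˡ (trans (Pol.EvalP.resp x (Pol.bnd0 b)) (Pol.EvalP.0-homo x))) (zeroʳ _)

    moment-step : ∀ j {u a t} → u P.≈ C a P.+ X P.* t → moment j u ≡ a * S j + moment (suc j) t
    moment-step j {u} {a} {t} e = trans (∑-cong elements λ x → trans (*-congˡ (trans (Pol.EvalP.resp x e) (trans (Pol.EvalP.+-homo x _ _) (+-cong (Pol.eval-C x a) (trans (Pol.EvalP.*-homo x _ _) (*-congʳ (Pol.eval-X x)))))))
        (solve 4 (λ y a x v → y :* (a :+ x :* v) := a :* y :+ (x :* y) :* v) refl (x ^ j) a x (Pol.eval x t)))
      (trans (∑-+ elements _ _) (+-congʳ (∑-*ˡ elements a _)))

    moment-high : ∀ N j u → 2h < j → j ℕ.+ N ≤ 2h ℕ.+ 2h → Bnd N u → moment j u ≡ 0#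
    moment-high zero j u _ _ b = moment-zero j b
    moment-high (suc N) j u lt le b = let (t , e) = Pol.decompose u ; le′ = ≤-trans (≤-reflexive (≡.sym (ℕP.+-suc j N))) le in
      trans (moment-step j e) (trans (+-cong (trans (*-congˡ (S-middle j lt (≤-trans (s≤s (m≤m+n j N)) le′))) (zeroʳ _)) (moment-high N (suc j) t (m<n⇒m<1+n lt) le′ (Pol.bnd-tail e b))) (+-identityʳ 0#))

    moment-low : ∀ N i j u → i ℕ.+ j ≡ 2h → j ℕ.+ N ≤ 2h ℕ.+ 2h → Bnd N u → moment j u ≡ - (u ‼ i)
    moment-low zero i j u _ _ b = trans (moment-zero j b) (sym (trans (-‿cong (b i z≤n)) -0#≈0#))
    moment-low (suc N) zero j u ≡.refl le b = let (t , e) = Pol.decompose u ; le′ = ≤-trans (≤-reflexive (≡.sym (ℕP.+-suc j N))) le in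
      trans (moment-step j e) (trans (+-cong (*-congˡ S-top) (moment-high N (suc j) t ≤-refl le′ (Pol.bnd-tail e b))) (solve 1 (λ a → a :* (:- con (+ 1)) :+ con (+ 0) := :- a) refl (u ‼ 0)))
    moment-low (suc N) (suc i) j u ij le b = let (t , e) = Pol.decompose u ; le′ = ≤-trans (≤-reflexive (≡.sym (ℕP.+-suc j N))) le in
      trans (moment-step j e) (trans (+-cong (trans (*-congˡ (S-small j (≤-trans (s≤s (m≤n+m j i)) (≤-reflexive ij)))) (zeroʳ _)) (moment-low N i (suc j) t (≡.trans (ℕP.+-suc i j) ij) le′ (Pol.bnd-tail e b)))
        (trans (+-identityˡ _) (-‿cong (sym (trans (‼-cong e (suc i)) (Pol.step‼suc _ t i))))))

  -- Among exponents up to `3(q-1)/2` only `q - 1` has a nonvanishing power sum, equal to `-1`.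
  ∑-eval : ∀ u → Bnd (suc (h ℕ.* 3)) u → ∑ elements (λ x → Pol.eval x u) ≡ - (u ‼ 2h)
  ∑-eval u b = trans (∑-cong elements λ x → sym (*-identityˡ _)) (moment-low (suc (h ℕ.* 3)) 2h 0 u (ℕP.+-identityʳ 2h)
    (≤-trans (+-monoˡ-≤ (h ℕ.* 3) 1≤h) (≤-reflexive (N.solve 1 (λ h → h N.:+ h N.:* N.con 3 N.:= (h N.:+ h) N.:+ (h N.:+ h)) ≡.refl h))) b)

  X^*‼ : ∀ j u i → (X P.^ j P.* u) ‼ (j ℕ.+ i) ≡ u ‼ i
  X^*‼ zero u i = ‼-cong (P.*-identityˡ u) i
  X^*‼ (suc j) u i = trans (‼-cong (P.*-assoc X (X P.^ j) u) (suc (j ℕ.+ i))) (trans (Pol.X*‼suc _ (j ℕ.+ i)) (X^*‼ j u i))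

  X^*‼< : ∀ j u i → i < j → (X P.^ j P.* u) ‼ i ≡ 0#
  X^*‼< (suc j) u zero _ = trans (‼-cong (P.*-assoc X (X P.^ j) u) 0) (Pol.X*‼0 _)
  X^*‼< (suc j) u (suc i) (s≤s lt) = trans (‼-cong (P.*-assoc X (X P.^ j) u) (suc i)) (trans (Pol.X*‼suc _ i) (X^*‼< j u i lt))

  private
    module Frob = Frobenius Pol.poly p pr (P.trans (P.sym (HomP.nat-homo Pol.constHom p)) (P.trans (C-cong charp) C-0))

  -- `b^p` only involves exponents `p i`. To reach `p - 1 + m p`, the factor `a` must supply
  -- `p - 1 + (m - i) p`; this is negative for `i > m` and beyond its degree bound for `i < m`.
  frobenius-coefficient : ∀ m a b → Bnd (p ℕ.+ (nn ℕ.+ nn)) a → (a P.* b P.^ p) ‼ (nn ℕ.+ nn ℕ.+ m ℕ.* p) ≡ a ‼ (nn ℕ.+ nn) * (b ‼ m) ^ p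
  frobenius-coefficient m a b bd = go m (Pol.decompose b)
    where
    n : ℕ
    n = nn ℕ.+ nn
    n<p : n < p
    n<p = ≤-reflexive (≡.sym odd)
    go : ∀ m → (Σ P.Carrier λ t → b P.≈ C (b ‼ 0) P.+ X P.* t) → (a P.* b P.^ p) ‼ (n ℕ.+ m ℕ.* p) ≡ a ‼ n * (b ‼ m) ^ p
    go m (t , e) = trans (‼-cong expand _) (trans (Pol.‼-+ _ _ _) (trans (+-congʳ (C*‼ β a _)) (at m)))
      where
      β : Carrier
      β = (b ‼ 0) ^ p
      expand : a P.* b P.^ p P.≈ C β P.* a P.+ X P.^ p P.* (a P.* t P.^ p)
      expand = P.trans (P.*-congˡ (P.trans (P.^-congˡ p e) (P.trans (Frob.frob-+ _ _) (P.+-cong (P.sym (HomP.^-homo Pol.constHom (b ‼ 0) p)) (P.^-distrib-* X t p)))))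
        (P.solve 4 (λ a c x t → a P.:* (c P.:+ x P.:* t) P.:= c P.:* a P.:+ x P.:* (a P.:* t)) P.refl a (C β) (X P.^ p) (t P.^ p))
      at : ∀ m → β * a ‼ (n ℕ.+ m ℕ.* p) + (X P.^ p P.* (a P.* t P.^ p)) ‼ (n ℕ.+ m ℕ.* p) ≡ a ‼ n * (b ‼ m) ^ p
      at zero = trans (+-cong (*-congˡ (reflexive (cong (a ‼_) (ℕP.+-identityʳ n)))) (trans (reflexive (cong ((X P.^ p P.* (a P.* t P.^ p)) ‼_) (ℕP.+-identityʳ n))) (X^*‼< p (a P.* t P.^ p) n n<p)))
        (trans (+-identityʳ _) (*-comm β _))
      at (suc m) = trans (+-cong (trans (*-congˡ (bd _ (≤-trans (≤-reflexive (ℕP.+-comm p n)) (+-monoʳ-≤ n (m≤m+n p (m ℕ.* p)))))) (zeroʳ β))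
          (trans (reflexive (cong ((X P.^ p P.* (a P.* t P.^ p)) ‼_) (N.solve 3 (λ n p m → n N.:+ (p N.:+ m) N.:= p N.:+ (n N.:+ m)) ≡.refl n p (m ℕ.* p)))) (trans (X^*‼ p (a P.* t P.^ p) (n ℕ.+ m ℕ.* p)) (frobenius-coefficient m a t bd))))
        (trans (+-identityˡ _) (*-congˡ (^-congˡ p (sym (trans (‼-cong e (suc m)) (Pol.step‼suc _ t m))))))

  -- From `g^(nn E(j+1)) = g^nn (g^(nn E j))^p` the coefficient acquires one more Frobenius factor
  -- at each step, so for `j = k` it is raised to the norm exponent `e₁`.
  hasse-power : ∀ g → Bnd 4 g → ∀ j → (g P.^ (nn ℕ.* E j)) ‼ ((nn ℕ.+ nn) ℕ.* E j) ≡ ((g P.^ nn) ‼ (nn ℕ.+ nn)) ^ E j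
  hasse-power g bd zero = trans (reflexive (cong₂ (λ i j → (g P.^ i) ‼ j) (ℕP.*-zeroʳ nn) (ℕP.*-zeroʳ (nn ℕ.+ nn)))) (trans (‼-cong (P.sym C-1) 0) (Pol.C‼0 1#))
  hasse-power g bd (suc j) = trans (‼-cong peel _) (trans (reflexive (cong ((g P.^ nn P.* (g P.^ (nn ℕ.* E j)) P.^ p) ‼_) index))
      (trans (frobenius-coefficient ((nn ℕ.+ nn) ℕ.* E j) (g P.^ nn) (g P.^ (nn ℕ.* E j)) (Pol.bnd-mono small (Pol.bnd-^ 3 nn bd)))
        (*-congˡ (trans (^-congˡ p (hasse-power g bd j)) (trans (^-assocʳ _ (E j) p) (reflexive (cong (((g P.^ nn) ‼ (nn ℕ.+ nn)) ^_) (ℕP.*-comm (E j) p))))))))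
    where
    peel : g P.^ (nn ℕ.* E (suc j)) P.≈ g P.^ nn P.* (g P.^ (nn ℕ.* E j)) P.^ p
    peel = P.trans (P.reflexive (cong (g P.^_) (N.solve 3 (λ n p e → n N.:* (N.con 1 N.:+ p N.:* e) N.:= n N.:+ n N.:* e N.:* p) ≡.refl nn p (E j))))
      (P.trans (P.^-homo-* g nn _) (P.*-congˡ (P.sym (P.^-assocʳ g (nn ℕ.* E j) p))))
    index : (nn ℕ.+ nn) ℕ.* E (suc j) ≡ nn ℕ.+ nn ℕ.+ (nn ℕ.+ nn) ℕ.* E j ℕ.* p
    index = N.solve 3 (λ n p e → n N.:* (N.con 1 N.:+ p N.:* e) N.:= n N.:+ n N.:* e N.:* p) ≡.refl (nn ℕ.+ nn) p (E j)
    small : suc (nn ℕ.* 3) ≤ p ℕ.+ (nn ℕ.+ nn)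
    small = ≤-trans (m≤m+n _ nn) (≤-reflexive (≡.trans (N.solve 1 (λ n → N.con 1 N.:+ n N.:* N.con 3 N.:+ n N.:= N.con 1 N.:+ (n N.:+ n) N.:+ (n N.:+ n)) ≡.refl nn) (cong (ℕ._+ (nn ℕ.+ nn)) (≡.sym odd))))

  cubic : Carrier → Carrier → P.Carrier
  cubic A B = C B P.+ X P.* (C A P.+ X P.* (C 0# P.+ X P.* C 1#))

  bnd-cubic : ∀ A B → Bnd 4 (cubic A B)
  bnd-cubic A B = Pol.bnd-step B (Pol.bnd-step A (Pol.bnd-step 0# (Pol.bnd-C 1#)))

  eval-cubic : ∀ A B x → Pol.eval x (cubic A B) ≡ x * x * x + A * x + B
  eval-cubic A B x = trans (step B _) (trans (+-congˡ (*-congˡ (trans (step A _) (+-congˡ (*-congˡ (trans (step 0# _) (+-congˡ (*-congˡ (Pol.eval-C x 1#)))))))))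
    (solve 3 (λ a b x → b :+ x :* (a :+ x :* (con (+ 0) :+ x :* con (+ 1))) := x :* x :* x :+ a :* x :+ b) refl A B x))
    where
    step : ∀ a u → Pol.eval x (C a P.+ X P.* u) ≡ a + x * Pol.eval x u
    step a u = trans (Pol.EvalP.+-homo x _ _) (+-cong (Pol.eval-C x a) (trans (Pol.EvalP.*-homo x _ _) (*-congʳ (Pol.eval-X x))))

  hasse : Carrier → Carrier → Carrier
  hasse A B = (cubic A B P.^ nn) ‼ (nn ℕ.+ nn)

  affine : Carrier → Carrier → ℕ
  affine A B = FiniteField.#² F (λ x y → does ((y * y) ≟ (x * x * x + A * x + B)))

  sum-∑ : ∀ {Y : Set} (ys : List Y) (f : Y → ℕ) → ListAction.sum (map f ys) ≡ ℕSum.∑ ys f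
  sum-∑ [] f = ≡.refl
  sum-∑ (y ∷ ys) f = cong (f y ℕ.+_) (sum-∑ ys f)

  nat-∑ : ∀ {Y : Set} (ys : List Y) (f : Y → ℕ) → nat (ℕSum.∑ ys f) ≡ ∑ ys (λ y → nat (f y))
  nat-∑ [] f = refl
  nat-∑ (y ∷ ys) f = trans (nat-+ (f y) _) (+-congˡ (nat-∑ ys f))

  -- Summing Euler's criterion over `x` leaves `∑ (x³ + Ax + B)^h`, which `∑-eval` reduces to one
  -- coefficient.
  nat-affine : ∀ A B → nat (affine A B) ≡ - (hasse A B ^ e₁)
  nat-affine A B = begin
    nat (affine A B)                                           ≡⟨ cong nat (sum-∑ elements _) ⟩
    nat (ℕSum.∑ elements _)                                    ≡⟨ nat-∑ elements _ ⟩
    ∑ elements _                                               ≡⟨ ∑-cong elements column ⟩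
    ∑ elements (λ x → 1# + Pol.eval x (cubic A B P.^ h))       ≡⟨ ∑-+ elements (λ _ → 1#) _ ⟩
    ∑ elements (λ _ → 1#) + ∑ elements (λ x → Pol.eval x (cubic A B P.^ h)) ≡⟨ trans (+-congʳ ∑1) (+-identityˡ _) ⟩
    ∑ elements (λ x → Pol.eval x (cubic A B P.^ h))            ≡⟨ ∑-eval _ (Pol.bnd-^ 3 h (bnd-cubic A B)) ⟩
    - ((cubic A B P.^ h) ‼ 2h)                                 ≡⟨ cong (λ i → - ((cubic A B P.^ h) ‼ i)) (≡.sym (ℕP.*-distribʳ-+ e₁ nn nn)) ⟩
    - ((cubic A B P.^ h) ‼ ((nn ℕ.+ nn) ℕ.* e₁))               ≡⟨ -‿cong (hasse-power (cubic A B) (bnd-cubic A B) k) ⟩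
    - (hasse A B ^ e₁) ∎
    where
    nat-ind : ∀ {Q : Set} (c : Dec Q) → nat (if does c then 1 else 0) ≡ [ c ]ᵢ
    nat-ind (yes _) = +-identityʳ 1#
    nat-ind (no _) = refl
    column : ∀ x → nat (FiniteField.#_ F (λ y → does ((y * y) ≟ (x * x * x + A * x + B)))) ≡ 1# + Pol.eval x (cubic A B P.^ h)
    column x = trans (reflexive (cong nat (sum-∑ elements _))) (trans (nat-∑ elements _) (trans (∑-cong elements λ y → nat-ind ((y * y) ≟ (x * x * x + A * x + B)))
      (trans (square-count _) (+-congˡ (trans (^-congˡ h (sym (eval-cubic A B x))) (sym (Pol.EvalP.^-homo x (cubic A B) h)))))))

  private
    trace-t : ∀ A B t → FiniteField.trace F A B ℤ.- + t ≡ + q ℤ.- + (affine A B ℕ.+ t)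
    trace-t A B t = ≡.trans (shape (+ q) (+ affine A B) (+ t)) (cong (ℤ._-_ (+ q)) (≡.sym (ℤP.pos-+ (affine A B) t)))
      where
      module Zr = RingKit ℤP.+-*-commutativeRing
      shape : ∀ q N t → (q ℤ.+ + 1) ℤ.- (+ 1 ℤ.+ N) ℤ.- t ≡ q ℤ.- (N ℤ.+ t)
      shape q N t = Zr.solve 3 (λ q N t → (q Zr.:+ Zr.con (+ 1)) Zr.:- (Zr.con (+ 1) Zr.:+ N) Zr.:- t Zr.:= q Zr.:- (N Zr.:+ t)) ≡.refl q N t

    p∣q : p ℕD.∣ q
    p∣q = go k 1≤k
      where
      go : ∀ k → 1 ≤ k → p ℕD.∣ p ℕ.^ k
      go (suc k) _ = ℕD.m∣m*n (p ℕ.^ k)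

    -∣ : ∀ a b → p ℕD.∣ a → (p ℕD.∣ ℤ.∣ + a ℤ.- + b ∣ → p ℕD.∣ b) × (p ℕD.∣ b → p ℕD.∣ ℤ.∣ + a ℤ.- + b ∣)
    -∣ a b pa = (λ d → subst (p ℕD.∣_) (ℤP.∣-i∣≡∣i∣ (+ b)) (Signed.∣⇒∣ᵤ {+ p} {ℤ.- (+ b)} (Signed.∣m+n∣m⇒∣n (Signed.∣ᵤ⇒∣ {+ p} {+ a ℤ.- + b} d) (Signed.∣ᵤ⇒∣ {+ p} {+ a} pa))))
              , (λ d → Signed.∣⇒∣ᵤ {+ p} {+ a ℤ.- + b} (Signed.∣m∣n⇒∣m+n (Signed.∣ᵤ⇒∣ {+ p} {+ a} pa) (Signed.∣ᵤ⇒∣ {+ p} {ℤ.- (+ b)} (subst (p ℕD.∣_) (≡.sym (ℤP.∣-i∣≡∣i∣ (+ b))) d))))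

  -- The trace is `q` minus the number of affine points, hence congruent to the negative of that
  -- number; a congruence modulo `p` is an equality in `F`.
  trace⇒hasse : ∀ A B t → p ℕD.∣ ℤ.∣ FiniteField.trace F A B ℤ.- + t ∣ → hasse A B ^ e₁ ≡ nat t
  trace⇒hasse A B t d = sym (x∙y⁻¹≈ε⇒x≈y _ _ (trans (+-comm (nat t) _) (trans (+-congʳ (sym (nat-affine A B))) (trans (sym (nat-+ (affine A B) t))
    (∣⇒nat≡0 (proj₁ (-∣ q (affine A B ℕ.+ t) p∣q) (subst (λ z → p ℕD.∣ ℤ.∣ z ∣) (trace-t A B t) d)))))))

  hasse⇒trace : ∀ A B t → hasse A B ^ e₁ ≡ nat t → p ℕD.∣ ℤ.∣ FiniteField.trace F A B ℤ.- + t ∣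
  hasse⇒trace A B t e = subst (λ z → p ℕD.∣ ℤ.∣ z ∣) (≡.sym (trace-t A B t)) (proj₂ (-∣ q (affine A B ℕ.+ t) p∣q)
    (nat≡0⇒∣ _ (trans (nat-+ (affine A B) t) (trans (+-congʳ (nat-affine A B)) (trans (+-congˡ (sym e)) (-‿inverseˡ _))))))

  -- Lines in the parameter plane and simple roots of the Hasse invariant

  -- On a slice the Hasse invariant is a scalar times a monic polynomial with a simple irreducible factor.
  record Slice (h : Carrier → Carrier) : Set where
    field
      c : Carrier
      lf P₀ : List Carrier
      f₁ : P.Carrier
      c≢0 : c ≢ 0#
      i₀ : Irr P₀
      f≈ : ⟦ lf ⟧ P.≈ ⟦ P₀ ⟧ P.* f₁
      P₀∤f₁ : ¬ (⟦ P₀ ⟧ P.∣ f₁)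
      degree≤ : length lf ≤ nn
      value : ∀ x → h x ≡ c * Pol.eval x ⟦ lf ⟧

  p∤small : ∀ i → 1 ≤ i → i < p → ¬ (p ℕD.∣ i)
  p∤small i@(suc _) _ lt d = <⇒≱ lt (ℕD.∣⇒≤ d)

  p∤* : ∀ {i j} → ¬ (p ℕD.∣ i) → ¬ (p ℕD.∣ j) → ¬ (p ℕD.∣ i ℕ.* j)
  p∤* {i} {j} ni nj d = case Primality.euclidsLemma i j pr d of λ { (inj₁ y) → ni y ; (inj₂ y) → nj y }

  nat≢0 : ∀ {i} → ¬ (p ℕD.∣ i) → nat i ≢ 0#
  nat≢0 {i} np e = np (nat≡0⇒∣ i e)

  private
    4≥ : ∀ i → 1 ≤ i → i ≤ 4 → ¬ (p ℕD.∣ i)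
    4≥ i 1≤i i≤4 = p∤small i 1≤i (≤-trans (s≤s i≤4) 5≤p)

    p∤2 : ¬ (p ℕD.∣ 2)
    p∤2 = 4≥ 2 (s≤s z≤n) (s≤s (s≤s z≤n))

    p∤3 : ¬ (p ℕD.∣ 3)
    p∤3 = 4≥ 3 (s≤s z≤n) (s≤s (s≤s (s≤s z≤n)))

    p∤4 : ¬ (p ℕD.∣ 4)
    p∤4 = 4≥ 4 (s≤s z≤n) ≤-refl

    p∤54 : ¬ (p ℕD.∣ 54)
    p∤54 = p∤* {6} {9} (p∤* {2} {3} p∤2 p∤3) (p∤* {3} {3} p∤3 p∤3)

    suc-nn<p : suc nn < p
    suc-nn<p = ≤-trans (s≤s (+-monoˡ-≤ nn 1≤nn)) (≤-reflexive (≡.sym odd))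

  irr∤C : ∀ {l} → Irr l → ∀ {c} → c ≢ 0# → ¬ (⟦ l ⟧ P.∣ C c)
  irr∤C il {c} c≢0 d = irr∤1 il (P.∣-resp (P.trans (P.sym (C-* c (c ⁻¹))) (P.trans (C-cong (*-inverseʳ c≢0)) C-1)) (P.∣-* (C (c ⁻¹)) d))

  P-nat : ∀ i → P.nat i P.≈ C (nat i)
  P-nat i = P.sym (HomP.nat-homo Pol.constHom i)

  irr∤nat : ∀ {l} → Irr l → ∀ {i} → ¬ (p ℕD.∣ i) → ¬ (⟦ l ⟧ P.∣ P.nat i)
  irr∤nat il {i} np d = irr∤C il (nat≢0 np) (P.∣-resp (P-nat i) d)

  irr-drop : ∀ {l} (il : Irr l) {a b} → ¬ (⟦ l ⟧ P.∣ a) → ⟦ l ⟧ P.∣ a P.* b → ⟦ l ⟧ P.∣ b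
  irr-drop il {a} {b} na d = case irr-prime il a b d of λ { (inj₁ y) → ⊥-elim (na y) ; (inj₂ y) → y }

  summand : ∀ {l a b} → a P.+ b P.≈ P.0# → ⟦ l ⟧ P.∣ b → ⟦ l ⟧ P.∣ a
  summand {l} {a} {b} e d = P.∣-resp (P.solve 2 (λ a b → (a P.:+ b) P.:- b P.:= a) P.refl a b) (P.∣-sub (P.∣-resp (P.sym e) P.∣0) d)

  mod3 : ∀ i → (Σ ℕ λ v → i ≡ v ℕ.* 3) ⊎ (Σ ℕ λ v → i ≡ 1 ℕ.+ v ℕ.* 3) ⊎ (Σ ℕ λ v → i ≡ 2 ℕ.+ v ℕ.* 3)
  mod3 zero = inj₁ (0 , ≡.refl)
  mod3 (suc zero) = inj₂ (inj₁ (0 , ≡.refl))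
  mod3 (suc (suc zero)) = inj₂ (inj₂ (0 , ≡.refl))
  mod3 (suc (suc (suc i))) = case mod3 i of λ
    { (inj₁ (v , e)) → inj₁ (suc v , cong (3 ℕ.+_) e)
    ; (inj₂ (inj₁ (v , e))) → inj₂ (inj₁ (suc v , cong (3 ℕ.+_) e))
    ; (inj₂ (inj₂ (v , e))) → inj₂ (inj₂ (suc v , cong (3 ℕ.+_) e)) }

  record Line : Set where
    constructor line
    field
      m : ℕ
      nn≡ : nn ≡ suc (suc m)
      1≤m : 1 ≤ m
      a : Carrier
      a≢0 : a ≢ 0#

  module Vertical (ℓ₀ : Line) where
    open Line ℓ₀
    private
      module D = Derivative Fr
      module Cub = Cubic Pol.poly (C a) X
      module T = PolyFacts Pol.poly

      p≡ : p ≡ suc (suc (suc m) ℕ.+ suc (suc m))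
      p≡ = ≡.trans odd (cong (λ i → suc (i ℕ.+ i)) nn≡)

    family : CubicFamily
    family = record { R = Fr ; α = a ; m = m ; char = trans (reflexive (cong nat (≡.sym p≡))) charp }

    module PF = PicardFuchs family
    open PF using (K; f; Δ; ode)

    value-at : ∀ b → Pol.eval b (f 0) ≡ hasse a b
    value-at b = trans (sym (Map.map-‼ (Cub.g T.P.^ suc (suc m)) (suc (suc m) ℕ.+ suc (suc m)))) (trans (‼-cong (P.trans (M.^-homo Cub.g (suc (suc m))) (P.^-congˡ (suc (suc m)) map-g)) _)
      (reflexive (cong (λ i → (cubic a b P.^ i) ‼ (i ℕ.+ i)) (≡.sym nn≡))))
      where
      ev : Hom Pol.poly Fr
      ev = Pol.Eval.evalHom idHom b
      module Map = PolyMap {Pol.poly} {Fr} ev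
      module M = HomP Map.mapHom
      step : ∀ c {c′} u {u′} → Pol.eval b c ≡ c′ → M.fn u P.≈ u′ → M.fn (T.C c T.P.+ T.X T.P.* u) P.≈ C c′ P.+ X P.* u′
      step c u e h = P.trans (M.+-homo _ _) (P.+-cong (P.trans (Map.map-C c) (C-cong e)) (P.trans (M.*-homo T.X u) (P.*-cong Map.map-X h)))
      map-g : M.fn Cub.g P.≈ cubic a b
      map-g = step X _ (Pol.eval-X b) (step (C a) _ (Pol.eval-C b a) (step P.0# _ (Pol.EvalP.0-homo b) (P.trans (Map.map-C P.1#) (C-cong (Pol.EvalP.1-homo b)))))

    -- Iterating `∂K` produces the factors `nn, nn - 1, …, i + 1`, all nonzero modulo `p`.
    falling : ∀ j i → i ℕ.+ j ≡ nn → Σ Carrier λ c → c ≢ 0# × f j P.≈ C c P.* K i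
    falling zero i e = 1# , 1≢0 , P.trans (P.reflexive (cong K (≡.sym (≡.trans (≡.sym (ℕP.+-identityʳ i)) (≡.trans e nn≡))))) (P.sym (P.trans (P.*-congʳ C-1) (P.*-identityˡ _)))
    falling (suc j) i e = let (c , c≢0 , h) = falling j (suc i) (≡.trans (≡.sym (ℕP.+-suc i j)) e) in
      c * nat (suc i) , *-≢0 c≢0 (nat≢0 (p∤small (suc i) (s≤s z≤n) (≤-<-trans (≤-trans (≤-trans (m≤m+n (suc i) j) (≤-reflexive (≡.trans (≡.sym (ℕP.+-suc i j)) e))) (n≤1+n nn)) suc-nn<p)))
      , P.trans (D.∂-cong h) (P.trans (D.∂-scale _ (D.∂-C c)) (P.trans (P.*-congˡ (P.trans (PF.∂K i) (P.*-congʳ (P-nat (suc i))))) (P.trans (P.sym (P.*-assoc _ _ _)) (P.*-congʳ (P.sym (C-* c (nat (suc i))))))))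

    -- The coefficient of x^(p-1) in g^i is the leading one for 3i = p - 1 and the second one for 3i = p + 1.
    constant-K : Σ ℕ λ i → Σ ℕ λ j → i ℕ.+ j ≡ nn × (Σ Carrier λ e → e ≢ 0# × K i P.≈ C e)
    constant-K = go (mod3 nn)
      where
      go : (Σ ℕ λ v → nn ≡ v ℕ.* 3) ⊎ (Σ ℕ λ v → nn ≡ 1 ℕ.+ v ℕ.* 3) ⊎ (Σ ℕ λ v → nn ≡ 2 ℕ.+ v ℕ.* 3) → _
      go (inj₁ (v , e)) = v ℕ.+ v , v , ≡.trans (N.solve 1 (λ v → v N.:+ v N.:+ v N.:= v N.:* N.con 3) ≡.refl v) (≡.sym e) , 1# , 1≢0 ,
        P.trans (P.reflexive (cong ((Cub.g T.P.^ (v ℕ.+ v)) T.‼_) (≡.trans (cong (λ i → i ℕ.+ i) (≡.trans (≡.sym nn≡) e)) (N.solve 1 (λ v → v N.:* N.con 3 N.:+ v N.:* N.con 3 N.:= (v N.:+ v) N.:* N.con 3) ≡.refl v))))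
          (P.trans (T.lead (T.mon-^ (v ℕ.+ v) Cub.mon-g)) (P.sym C-1))
      -- In this case `p = 3(1 + 2v)`, impossible for a prime that is at least 5.
      go (inj₂ (inj₁ (v , e))) = ⊥-elim (p∤* {3} {1 ℕ.+ (v ℕ.+ v)} p∤3 (p∤small _ (s≤s z≤n) (<-≤-trans (m<m+n (1 ℕ.+ (v ℕ.+ v)) (s≤s z≤n)) (≤-reflexive (≡.trans (N.solve 1 (λ v → N.con 1 N.:+ (v N.:+ v) N.:+ (N.con 1 N.:+ (N.con 1 N.:+ v N.:* N.con 4)) N.:= N.con 3 N.:* (N.con 1 N.:+ (v N.:+ v))) ≡.refl v) (≡.sym 3∣)))))
          (ℕD.∣-reflexive 3∣))
        where
        3∣ : p ≡ 3 ℕ.* (1 ℕ.+ (v ℕ.+ v))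
        3∣ = ≡.trans odd (≡.trans (cong (λ i → suc (i ℕ.+ i)) e) (N.solve 1 (λ v → N.con 1 N.:+ ((N.con 1 N.:+ v N.:* N.con 3) N.:+ (N.con 1 N.:+ v N.:* N.con 3)) N.:= N.con 3 N.:* (N.con 1 N.:+ (v N.:+ v))) ≡.refl v))
      go (inj₂ (inj₂ (v , e))) = i , v , sum≡ , nat i * a , *-≢0 (nat≢0 (p∤small i (s≤s z≤n) (≤-<-trans (≤-trans (m≤m+n i v) (≤-trans (≤-reflexive sum≡) (n≤1+n nn))) suc-nn<p))) a≢0 ,
        P.trans (Cub.second-coefficient i (suc (suc m) ℕ.+ suc (suc m)) (≡.trans (cong (λ i → 2 ℕ.+ (i ℕ.+ i)) (≡.trans (≡.sym nn≡) e)) (N.solve 1 (λ v → N.con 2 N.:+ ((N.con 2 N.:+ v N.:* N.con 3) N.:+ (N.con 2 N.:+ v N.:* N.con 3)) N.:= (N.con 2 N.:+ (v N.:+ v)) N.:* N.con 3) ≡.refl v)))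
          (P.trans (P.*-congʳ (P-nat i)) (P.sym (C-* (nat i) a)))
        where
        i : ℕ
        i = 2 ℕ.+ (v ℕ.+ v)
        sum≡ : i ℕ.+ v ≡ nn
        sum≡ = ≡.trans (N.solve 1 (λ v → N.con 2 N.:+ (v N.:+ v) N.:+ v N.:= N.con 2 N.:+ v N.:* N.con 3) ≡.refl v) (≡.sym e)

    constant-derivative : Σ ℕ λ j → suc j < p × (Σ Carrier λ e → e ≢ 0# × f j P.≈ C e)
    constant-derivative = let (i , j , ij , (e , e≢0 , h)) = constant-K ; (c , c≢0 , h′) = falling j i ij in
      j , ≤-<-trans (s≤s (≤-trans (m≤n+m j i) (≤-reflexive ij))) suc-nn<p , c * e , *-≢0 c≢0 e≢0 , P.trans h′ (P.trans (P.*-congˡ h) (P.sym (C-* c e)))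

    module _ {l : List Carrier} (il : Irr l) where
      private
        16∤ : ¬ (⟦ l ⟧ P.∣ P.nat 16)
        16∤ = irr∤nat il (p∤* {4} {4} p∤4 p∤4)

        X∤ : ⟦ l ⟧ P.∣ Δ → ¬ (⟦ l ⟧ P.∣ X)
        X∤ dΔ dX = irr∤C il (*-≢0 (nat≢0 p∤4) (*-≢0 a≢0 (*-≢0 a≢0 a≢0))) (P.∣-resp
          (P.trans (P.solve 2 (λ u v → (u P.:+ v) P.:- v P.:= u) P.refl (P.nat 4 P.* (C a P.* (C a P.* C a))) (P.nat 27 P.* (X P.* X)))
            (P.sym (P.trans (C-* _ _) (P.*-cong (P.sym (P-nat 4)) (P.trans (C-* _ _) (P.*-congˡ (C-* _ _)))))))
          (P.∣-sub dΔ (P.∣-*ˡ (P.nat 27) (P.∣-* X dX))))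

      -- If `l` does not divide `Δ`, the equation differentiated `n` times can be solved for the
      -- next derivative. If `l` divides `Δ`, the top term drops out after one more differentiation,
      -- and the coefficient of the middle term is invertible: `l` dividing both `X` and `Δ` would
      -- divide `4a³`.
      next-derivative : ∀ n → suc (suc n) < p → ⟦ l ⟧ P.∣ f n → ⟦ l ⟧ P.∣ f (suc n) → ⟦ l ⟧ P.∣ f (suc (suc n))
      next-derivative n lt d d′ = case divides? l Δ of λ
        { (no nΔ) → irr-drop il nΔ (irr-drop il 16∤ (summand {l} (ode n) (P.∣-+ (P.∣-*ˡ (P.nat 16) (P.∣-*ˡ (P.nat 54) (P.∣-*ˡ (P.nat (suc n)) (P.∣-*ˡ X d′)))) (P.∣-*ˡ (PF.lower n) d))))
        ; (yes dΔ) → irr-drop il (X∤ dΔ) (irr-drop il (irr∤nat il (p∤small (suc (suc n)) (s≤s z≤n) lt)) (irr-drop il (irr∤nat il p∤54) (irr-drop il 16∤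
            (summand {l} (P.trans (P.solve 3 (λ u v w → v P.:+ (w P.:+ u) P.:= u P.:+ (v P.:+ w)) P.refl _ _ _) (ode (suc n)))
              (P.∣-+ (P.∣-*ˡ (PF.lower (suc n)) d′) (P.∣-*ˡ (P.nat 16) (P.∣-* (f (suc (suc (suc n)))) dΔ))))))) }

      all-derivatives : ⟦ l ⟧ P.∣ f 0 → ⟦ l ⟧ P.∣ f 1 → ∀ n → suc n < p → ⟦ l ⟧ P.∣ f n × ⟦ l ⟧ P.∣ f (suc n)
      all-derivatives d d′ zero _ = d , d′
      all-derivatives d d′ (suc n) lt = let (e , e′) = all-derivatives d d′ n (<-trans (n<1+n _) lt) in e′ , next-derivative n lt e e′

      -- A common factor with the first derivative would divide all derivatives below order `p`,
      -- among them a nonzero constant.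
      simple : ⟦ l ⟧ P.∣ f 0 → ¬ (⟦ l ⟧ P.∣ f 1)
      simple d d′ = let (j , lt , (e , e≢0 , h)) = constant-derivative in irr∤C il e≢0 (P.∣-resp h (proj₁ (all-derivatives d d′ j lt)))

    nonzero : ¬ (f 0 P.≈ P.0#)
    nonzero z = let (j , _ , (e , e≢0 , h)) = constant-derivative in e≢0 (trans (sym (Pol.C‼0 e)) (trans (‼-cong (P.trans (P.sym h) (vanish j)) 0) (Pol.‼-0 0)))
      where
      vanish : ∀ j → f j P.≈ P.0#
      vanish zero = z
      vanish (suc j) = P.trans (D.∂-cong (vanish j)) D.∂-0

    -- For constant `f 0` the differential equation reduces to `60 f = 0`, while `p > 5` because
    -- `m ≥ 1`.
    nonconstant : ∀ c → c ≢ 0# → ¬ (f 0 P.≈ C c)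
    nonconstant c c≢0 e = *-≢0 (nat≢0 (p∤* {4} {15} p∤4 (p∤* {3} {5} p∤3 (p∤small 5 (s≤s z≤n) 5<p)))) c≢0
      (trans (sym (Pol.C‼0 _)) (trans (‼-cong (P.trans (C-* (nat 60) c) (P.trans (P.*-cong (P.sym (P-nat 60)) (P.sym e)) 60f≈0)) 0) (Pol.‼-0 0)))
      where
      5<p : 5 < p
      5<p = ≤-trans (s≤s (+-mono-≤ (s≤s (s≤s 1≤m)) (≤-trans (s≤s (s≤s z≤n)) (≤-refl {suc (suc m)})))) (≤-reflexive (≡.sym p≡))
      f1 : f 1 P.≈ P.0#
      f1 = P.trans (D.∂-cong e) (D.∂-C c)
      f2 : f 2 P.≈ P.0#
      f2 = P.trans (D.∂-cong f1) D.∂-0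
      60f≈0 : P.nat 60 P.* f 0 P.≈ P.0#
      60f≈0 = P.trans (P.sym (P.trans (P.+-cong (P.trans (P.*-congˡ (P.trans (P.*-congˡ f2) (P.zeroʳ _))) (P.zeroʳ _)) (P.+-cong
          (P.trans (P.*-congˡ (P.trans (P.*-congˡ (P.trans (P.*-congˡ (P.trans (P.*-congˡ f1) (P.zeroʳ _))) (P.zeroʳ _))) (P.zeroʳ _))) (P.zeroʳ _))
          (P.*-congʳ (P.trans (P.+-congʳ (P.trans (P.*-congˡ (P.trans (P.*-congˡ (P.zeroˡ _)) (P.zeroʳ _))) (P.zeroʳ _))) (P.+-identityˡ _)))))
        (P.trans (P.+-identityˡ _) (P.+-identityˡ _)))) (ode 0)

    slice : Slice (hasse a)
    slice = go (normalForm (f 0))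
      where
      go : NormalForm (f 0) → Slice (hasse a)
      go (isZero z) = ⊥-elim (nonzero z)
      go (scaled c [] c≢0 e) = ⊥-elim (nonconstant c c≢0 (P.trans e (P.*-identityʳ _)))
      go (scaled c lf@(_ ∷ _) c≢0 e) = build (irreducible-factor (length lf) lf ≤-refl (s≤s z≤n))
        where
        build : (Σ (List Carrier) λ P₀ → Irr P₀ × ⟦ P₀ ⟧ P.∣ ⟦ lf ⟧) → Slice (hasse a)
        build (P₀ , i₀ , (f₁ P.by ef)) = record
          { c = c ; lf = lf ; P₀ = P₀ ; f₁ = f₁ ; c≢0 = c≢0 ; i₀ = i₀ ; f≈ = ef ; P₀∤f₁ = not-square
          ; degree≤ = ≤-pred (≤-trans (≰⇒> λ le → c≢0 (trans (sym lead-c) (PF.bnd-K (suc (suc m)) _ (length lf) le))) (≤-reflexive (cong suc (≡.sym nn≡))))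
          ; value = λ x → trans (sym (value-at x)) (trans (Pol.EvalP.resp x e) (trans (Pol.EvalP.*-homo x _ _) (*-congʳ (Pol.eval-C x c)))) }
          where
          lead-c : f 0 ‼ length lf ≡ c
          lead-c = trans (‼-cong e _) (trans (C*‼ c _ _) (trans (*-congˡ (lead (mon-⟦⟧ lf))) (*-identityʳ c)))
          not-square : ¬ (⟦ P₀ ⟧ P.∣ f₁)
          -- A repeated factor divides the derivative by the product rule.
          not-square (v P.by ev) = simple i₀ (_ P.by f0≈) (P.∣-resp (P.sym (P.trans (D.∂-cong f0≈) (D.∂-* _ _))) (P.∣-+ (P.∣-*ˡ _ (P.∣-* _ P.∣-refl)) (P.∣-* _ P.∣-refl)))
            where
            f0≈ : f 0 P.≈ ⟦ P₀ ⟧ P.* (⟦ P₀ ⟧ P.* (C c P.* v))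
            f0≈ = P.trans e (P.trans (P.*-congˡ (P.trans ef (P.*-congˡ ev))) (P.solve 3 (λ c l v → c P.:* (l P.:* (l P.:* v)) P.:= l P.:* (l P.:* (c P.:* v))) P.refl (C c) ⟦ P₀ ⟧ v))

  -- For p = 5 the Hasse invariant is 2A.
  horizontal : nn ≡ 2 → ∀ b → Slice (λ a → hasse a b)
  horizontal nn≡2 b = record
    { c = nat 2 ; lf = 0# ∷ [] ; P₀ = 0# ∷ [] ; f₁ = P.1# ; c≢0 = nat≢0 p∤2 ; i₀ = linear ; f≈ = P.sym (P.*-identityʳ _) ; P₀∤f₁ = irr∤1 linear ; degree≤ = 1≤nn
    ; value = λ x → trans (reflexive (cong (λ i → (cubic x b P.^ i) ‼ (i ℕ.+ i)) nn≡2)) (trans (Cubic.second-coefficient Fr x b 2 4 ≡.refl) (*-congˡ (sym (identity x)))) }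
    where
    linear : Irr (0# ∷ [])
    linear = irr (s≤s z≤n) λ u v e → go u v (mon-degree (mon-⟦⟧ (0# ∷ [])) (Pol.mon-resp (P.sym e) (Pol.mon-* (mon-⟦⟧ u) (mon-⟦⟧ v))))
      where
      go : ∀ (u v : List Carrier) → 1 ≡ length u ℕ.+ length v → u ≡ [] ⊎ v ≡ []
      go [] v _ = inj₁ ≡.refl
      go (_ ∷ u) v e = inj₂ (length≡0 (ℕP.m+n≡0⇒n≡0 (length u) (≡.sym (ℕP.suc-injective e))))
    identity : ∀ x → Pol.eval x ⟦ 0# ∷ [] ⟧ ≡ x
    identity x = trans (Pol.EvalP.resp x (P.trans (P.+-congʳ C-0) (P.trans (P.+-identityˡ _) (P.*-identityʳ X)))) (Pol.eval-X x)

  -- Summation over the lines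

  private
    module ℕδ = ℕSum.Delta _≟_

  n : ℕ
  n = nn ℕ.+ nn

  private
    1≤n : 1 ≤ n
    1≤n = ≤-trans 1≤nn (m≤m+n nn nn)

    3≤q : 3 ≤ q
    3≤q = go k 1≤k
      where
      go : ∀ k → 1 ≤ k → 3 ≤ p ℕ.^ k
      go (suc k) _ = ≤-trans (≤-trans (s≤s (s≤s (s≤s z≤n))) 5≤p) (m≤m*n p (p ℕ.^ k) {{ℕP.m^n≢0 p k {{ℕ.>-nonZero (≤-trans (s≤s z≤n) 5≤p)}}}})

    length-nonzeros : length nonzeros ≡ e₁ ℕ.* n
    length-nonzeros = ℕP.suc-injective (≡.trans suc-length-nonzeros (≡.trans (≡.sym (E-spec k)) (cong suc (ℕP.*-comm n e₁))))

    frobenius-nat : ∀ i → nat i ^ p ≡ nat i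
    frobenius-nat zero = trans (reflexive (cong (0# ^_) odd)) (0^ n)
    frobenius-nat (suc i) = trans (Frobenius.frob-+ Fr p pr charp 1# (nat i)) (+-cong (1^ p) (frobenius-nat i))

    t : Carrier
    t = nat t₀

    t^n : t ^ n ≡ 1#
    t^n = *-cancelˡ t (nat≢0 (p∤small t₀ 1≤t₀ t₀<p)) (trans (reflexive (cong (t ^_) (≡.sym odd))) (trans (frobenius-nat t₀) (sym (*-identityʳ t))))

    roots : Σ ℕ λ r → r ℕ.* r ≤ n ℕ.* n ℕ.* (nn ℕ.* nn) ℕ.* q × n ℕ.* n ℕ.* (nn ℕ.* nn) ℕ.* q < suc r ℕ.* suc r
    roots = square-root (n ℕ.* n ℕ.* (nn ℕ.* nn) ℕ.* q)

  -- The integer part of `n · nn · √q`, Weil's error for `n` times the number of hits on a line.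
  M : ℕ
  M = proj₁ roots

  hits : (Carrier → Carrier) → ℕ
  hits h = ℕSum.∑ elements (λ x → ℕδ.δ (h x ^ e₁) t)

  hits≤q : ∀ h → hits h ≤ q
  hits≤q h = ≤-trans (NatLemmas.∑≤ elements {g = λ _ → 1} λ x _ → le ((h x ^ e₁) ≟ t)) (≤-reflexive (≡.trans (const elements) length-elements))
    where
    le : ∀ {Q : Set} (c : Dec Q) → ℕSum.[ c ]ᵢ ≤ 1
    le (yes _) = ≤-refl
    le (no _) = z≤n
    const : ∀ (xs : List Carrier) → ℕSum.∑ xs (λ _ → 1) ≡ length xs
    const [] = ≡.refl
    const (x ∷ xs) = cong suc (const xs)

  abstract
    -- Dividing by the scalar `c` changes the target value to another `n`-th root of unity `t′`.
    -- Weil's bound compares with the number of points where `f` does not vanish, which falls short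
    -- of `q` by at most `nn`.
    slice-bounds : ∀ {h} → Slice h → n ℕ.* hits h ≤ q ℕ.+ (M ℕ.+ nn) × q ≤ n ℕ.* hits h ℕ.+ (M ℕ.+ nn)
    slice-bounds {h} s = subst (λ w → n ℕ.* w ≤ q ℕ.+ (M ℕ.+ nn) × q ≤ n ℕ.* w ℕ.+ (M ℕ.+ nn)) (≡.sym same)
        ( ≤-trans (proj₁ near) (≤-trans (+-monoˡ-≤ M (≤-trans (m≤n+m B z) (≤-reflexive total))) (+-monoʳ-≤ q (m≤m+n M nn)))
        , ≤-trans (≤-reflexive (≡.trans (≡.sym total) (ℕP.+-comm z B))) (≤-trans (+-mono-≤ (proj₂ near) (≤-trans (Weil.frequency-zero residues) degree≤)) (≤-reflexive (ℕP.+-assoc (n ℕ.* freq t′) M nn))))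
      where
      open Slice s
      residues : PowerResidueData
      residues = record { base = base ; lf = lf ; n = n ; e₁ = e₁ ; 1≤n = 1≤n ; ne₁ = E-spec k ; 3≤q = 3≤q ; P₀ = P₀ ; i₀ = i₀ ; f₁ = f₁ ; f≈ = f≈ ; P₀∤f₁ = P₀∤f₁ }
      freq : Carrier → ℕ
      freq = Weil.frequency residues
      t′ : Carrier
      t′ = (c ⁻¹) ^ e₁ * t
      t′^n : t′ ^ n ≡ 1#
      t′^n = trans (^-distrib-* ((c ⁻¹) ^ e₁) t n) (trans (*-cong (trans (^-assocʳ (c ⁻¹) e₁ n) (trans (reflexive (cong ((c ⁻¹) ^_) (≡.sym length-nonzeros))) (fermat-unit (⁻¹-≢0 c≢0)))) t^n) (*-identityˡ 1#))
      z B : ℕ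
      z = freq 0#
      B = ℕSum.∑ (Weil.μ residues) freq
      total : z ℕ.+ B ≡ q
      total = Weil.frequency-total residues
      scale : ∀ y → c ^ e₁ * ((c ⁻¹) ^ e₁ * y) ≡ y
      scale y = trans (sym (*-assoc _ _ y)) (trans (*-congʳ (trans (sym (^-distrib-* c (c ⁻¹) e₁)) (trans (^-congˡ e₁ (*-inverseʳ c≢0)) (1^ e₁)))) (*-identityˡ y))
      unscale : ∀ y → (c ⁻¹) ^ e₁ * (c ^ e₁ * y) ≡ y
      unscale y = trans (solve 3 (λ a b y → a :* (b :* y) := b :* (a :* y)) refl ((c ⁻¹) ^ e₁) (c ^ e₁) y) (scale y)
      power : ∀ x → h x ^ e₁ ≡ c ^ e₁ * Pol.eval x ⟦ lf ⟧ ^ e₁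
      power x = trans (^-congˡ e₁ (value x)) (^-distrib-* c _ e₁)
      same : hits h ≡ freq t′
      same = ℕSum.∑-cong elements λ x → ℕSum.ind-⇔ ((h x ^ e₁) ≟ t) ((Pol.eval x ⟦ lf ⟧ ^ e₁) ≟ t′)
        (λ e → trans (sym (unscale _)) (*-congˡ (trans (sym (power x)) e)))
        (λ e → trans (power x) (trans (*-congˡ e) (scale t)))
      near : n ℕ.* freq t′ ≤ B ℕ.+ M × B ≤ n ℕ.* freq t′ ℕ.+ M
      near = ∣-∣-bounds (n ℕ.* freq t′) B (square-≤ (≤-trans (Weil.weil residues t′ t′^n) (*-monoˡ-≤ q (*-monoʳ-≤ (n ℕ.* n) (*-mono-≤ D≤ D≤)))) (proj₂ (proj₂ roots)))
        where
        D≤ : length lf ∸ 1 ≤ nn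
        D≤ = ≤-trans (m∸n≤m (length lf) 1) degree≤

  L : ℕ
  L = q ℕ.* (M ℕ.+ nn)

  total-hits : (Carrier → Carrier → Carrier) → ℕ
  total-hits H = ℕSum.∑ elements (λ s → hits (H s))

  private
    -- The cost of the line `s = 0`, which carries no slice and is bounded trivially.
    exceptional : ℕ
    exceptional = n ℕ.* q

    ∑-constq : ∀ c → ℕSum.∑ elements (λ _ → c) ≡ q ℕ.* c
    ∑-constq c = ≡.trans (go elements) (cong (ℕ._* c) length-elements)
      where
      go : ∀ (xs : List Carrier) → ℕSum.∑ xs (λ _ → c) ≡ length xs ℕ.* c
      go [] = ≡.refl
      go (x ∷ xs) = cong (c ℕ.+_) (go xs)

    ∑-zero-slice : ∀ c → ℕSum.∑ elements (λ s → ℕδ.δ s 0# ℕ.* c) ≡ c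
    ∑-zero-slice c = ≡.trans (ℕSum.∑-pick elements 0# _ elements-unique (∈elements 0#) (λ s _ ne → cong (ℕ._* c) (ℕδ.δ-≢ ne))) (≡.trans (cong (ℕ._* c) (ℕδ.δ-refl 0#)) (ℕP.*-identityˡ c))

    ∑-bound : ∀ c → ℕSum.∑ elements (λ s → c ℕ.+ (M ℕ.+ nn) ℕ.+ ℕδ.δ s 0# ℕ.* exceptional) ≡ q ℕ.* c ℕ.+ L ℕ.+ exceptional
    ∑-bound c = ≡.trans (ℕSum.∑-+ elements _ _) (cong₂ ℕ._+_ (≡.trans (∑-constq (c ℕ.+ (M ℕ.+ nn))) (ℕP.*-distribˡ-+ q c (M ℕ.+ nn))) (∑-zero-slice exceptional))

    q≤nq : q ≤ exceptional
    q≤nq = ≤-trans (≤-reflexive (≡.sym (ℕP.*-identityˡ q))) (*-monoˡ-≤ q 1≤n)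

  module _ (H : Carrier → Carrier → Carrier) (slices : ∀ s → s ≢ 0# → Slice (H s)) where

    private
      upper lower : ∀ s (c : Dec (s ≡ 0#)) → ℕ
      upper s c = q ℕ.+ (M ℕ.+ nn) ℕ.+ ℕSum.[ c ]ᵢ ℕ.* exceptional
      lower s c = n ℕ.* hits (H s) ℕ.+ (M ℕ.+ nn) ℕ.+ ℕSum.[ c ]ᵢ ℕ.* exceptional

      below : ∀ s c → n ℕ.* hits (H s) ≤ upper s c
      below s (yes _) = ≤-trans (*-monoʳ-≤ n (hits≤q (H s))) (≤-trans (≤-reflexive (≡.sym (ℕP.*-identityˡ exceptional))) (m≤n+m _ (q ℕ.+ (M ℕ.+ nn))))
      below s (no ne) = ≤-trans (proj₁ (slice-bounds (slices s ne))) (m≤m+n _ _)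

      above : ∀ s c → q ≤ lower s c
      above s (yes _) = ≤-trans q≤nq (≤-trans (≤-reflexive (≡.sym (ℕP.*-identityˡ exceptional))) (m≤n+m _ (n ℕ.* hits (H s) ℕ.+ (M ℕ.+ nn))))
      above s (no ne) = ≤-trans (proj₂ (slice-bounds (slices s ne))) (m≤m+n _ _)

    total-below : n ℕ.* total-hits H ≤ q ℕ.* q ℕ.+ L ℕ.+ n ℕ.* q
    total-below = ≤-trans (≤-reflexive (≡.sym (ℕSum.∑-*ˡ elements n _))) (≤-trans (NatLemmas.∑≤ elements λ s _ → below s (s ≟ 0#)) (≤-reflexive (∑-bound q)))

    total-above : q ℕ.* q ≤ n ℕ.* total-hits H ℕ.+ L ℕ.+ n ℕ.* q
    total-above = ≤-trans (≤-reflexive (≡.sym (∑-constq q))) (≤-trans (NatLemmas.∑≤ elements λ s _ → above s (s ≟ 0#))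
      (≤-reflexive (≡.trans (ℕSum.∑-+ elements _ _) (cong₂ ℕ._+_ (≡.trans (ℕSum.∑-+ elements _ _) (cong₂ ℕ._+_ (ℕSum.∑-*ˡ elements n _) (∑-constq (M ℕ.+ nn)))) (∑-zero-slice exceptional)))))

  W : ℕ
  W = total-hits hasse

  -- For `nn ≥ 3` the lines have `A` fixed; for `nn = 2`, that is `p = 5`, they have `B` fixed, and
  -- the order of summation is exchanged.
  W-bounds : n ℕ.* W ≤ q ℕ.* q ℕ.+ L ℕ.+ n ℕ.* q × q ℕ.* q ≤ n ℕ.* W ℕ.+ L ℕ.+ n ℕ.* q
  W-bounds = go nn ≡.refl
    where
    go : ∀ i → nn ≡ i → n ℕ.* W ≤ q ℕ.* q ℕ.+ L ℕ.+ n ℕ.* q × q ℕ.* q ≤ n ℕ.* W ℕ.+ L ℕ.+ n ℕ.* q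
    go zero e = ⊥-elim (<⇒≱ (s≤s z≤n) (subst (1 ≤_) e 1≤nn))
    go (suc zero) e = ⊥-elim (<⇒≱ 5≤p (≤-trans (≤-reflexive (≡.trans odd (cong (λ i → suc (i ℕ.+ i)) e))) (n≤1+n 3)))
    go (suc (suc zero)) e = subst (λ w → n ℕ.* w ≤ q ℕ.* q ℕ.+ L ℕ.+ n ℕ.* q × q ℕ.* q ≤ n ℕ.* w ℕ.+ L ℕ.+ n ℕ.* q) (ℕSum.∑-swap elements elements (λ b a → ℕδ.δ (hasse a b ^ e₁) t))
      (total-below (λ b a → hasse a b) (λ b _ → horizontal e b) , total-above (λ b a → hasse a b) (λ b _ → horizontal e b))
    go (suc (suc (suc m))) e = total-below hasse (λ a ne → Vertical.slice (line (suc m) e (s≤s z≤n) a ne)) , total-above hasse (λ a ne → Vertical.slice (line (suc m) e (s≤s z≤n) a ne))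

  -- Singular pairs

  disc : Carrier → Carrier → Carrier
  disc A B = nat 4 * (A * A * A) + nat 27 * (B * B)

  singular : ℕ
  singular = ℕSum.∑ elements (λ A → ℕSum.∑ elements (λ B → ℕδ.δ (disc A B) 0#))

  -- The singular pairs are (-3y², 2y³).
  singular≡q : singular ≡ q
  singular≡q = ≡.trans (≡.sym (ℕSum.∑-product _,_ elements elements (λ (A , B) → ℕδ.δ (disc A B) 0#)))
    (≡.trans (≡.sym (ℕSum.∑-filter sing? pairs (λ _ → 1))) (≡.trans (≡.sym (ℕSum.∑-bij point node (λ _ → 1) elements-unique (Uniq.filter⁺ sing? pairs-unique) to from))
      (≡.trans (∑-constq 1) (ℕP.*-identityʳ q))))
    where
    pairs : List (Carrier × Carrier)
    pairs = cartesianProductWith _,_ elements elements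
    pairs-unique : Unique pairs
    pairs-unique = Uniq.cartesianProductWith⁺ _,_ (λ { ≡.refl → ≡.refl , ≡.refl }) elements-unique elements-unique
    sing? : (x : Carrier × Carrier) → Dec (disc (proj₁ x) (proj₂ x) ≡ 0#)
    sing? x = disc (proj₁ x) (proj₂ x) ≟ 0#
    num : ∀ {n} → ℕ → _
    num {n} zero = con {n} (+ 0)
    num {n} (suc k) = _:+_ {n} (con {n} (+ 1)) (num {n} k)
    two three : Carrier
    two = nat 2
    three = nat 3
    2≢0 : two ≢ 0#
    2≢0 = nat≢0 (p∤small 2 (s≤s z≤n) (≤-trans (s≤s (s≤s (s≤s z≤n))) 5≤p))
    3≢0 : three ≢ 0#
    3≢0 = nat≢0 (p∤small 3 (s≤s z≤n) (≤-trans (s≤s (s≤s (s≤s (s≤s z≤n)))) 5≤p))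
    point : Carrier → Carrier × Carrier
    point y = - (three * (y * y)) , two * (y * (y * y))
    -- The double root `-3B/(2A)` of the cubic `(x - y)²(x + 2y)`.
    slope : Carrier → Carrier → Carrier
    slope A B = (two * A) ⁻¹ * - (three * B)
    nodeIf : ∀ A B → Dec (A ≡ 0#) → Carrier
    nodeIf A B (yes _) = 0#
    nodeIf A B (no _) = slope A B
    node : Carrier × Carrier → Carrier
    node (A , B) = nodeIf A B (A ≟ 0#)
    on-curve : ∀ y → disc (- (three * (y * y))) (two * (y * (y * y))) ≡ 0#
    on-curve y = solve 1 (λ y → let A = :- (num 3 :* (y :* y)) ; B = num 2 :* (y :* (y :* y)) in num 4 :* (A :* A :* A) :+ num 27 :* (B :* B) := con (+ 0)) refl y
    square≡0 : ∀ {y} → y * y ≡ 0# → y ≡ 0#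
    square≡0 {y} e = case domain y y e of λ { (inj₁ z) → z ; (inj₂ z) → z }
    node-point : ∀ y (c : Dec (- (three * (y * y)) ≡ 0#)) → nodeIf (- (three * (y * y))) (two * (y * (y * y))) c ≡ y
    node-point y (yes e) = sym (square≡0 (*-cancelˡ three 3≢0 (trans (trans (sym (-‿involutive _)) (trans (-‿cong e) -0#≈0#)) (sym (zeroʳ three)))))
    node-point y (no A≢0) = *-cancelˡ (two * - (three * (y * y))) (*-≢0 2≢0 A≢0) (trans (a[a⁻¹x] _ (*-≢0 2≢0 A≢0))
      (solve 1 (λ y → :- (num 3 :* (num 2 :* (y :* (y :* y)))) := num 2 :* :- (num 3 :* (y :* y)) :* y) refl y))
    point-node : ∀ A B → disc A B ≡ 0# → (c : Dec (A ≡ 0#)) → point (nodeIf A B c) ≡ (A , B)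
    point-node A B e (yes ≡.refl) = cong₂ _,_ (solve 0 (:- (num 3 :* (con (+ 0) :* con (+ 0))) := con (+ 0)) refl)
      (trans (solve 0 (num 2 :* (con (+ 0) :* (con (+ 0) :* con (+ 0))) := con (+ 0)) refl) (sym (square≡0 (*-cancelˡ (three * (three * three)) (*-≢0 3≢0 (*-≢0 3≢0 3≢0))
        (trans (solve 1 (λ b → num 3 :* (num 3 :* num 3) :* (b :* b) := num 4 :* (con (+ 0) :* con (+ 0) :* con (+ 0)) :+ num 27 :* (b :* b)) refl B) (trans e (sym (zeroʳ _))))))))
    point-node A B e (no A≢0) = cong₂ _,_ first second
      where
      u : Carrier
      u = slope A B
      2Au : two * A * u ≡ - (three * B)
      2Au = a[a⁻¹x] _ (*-≢0 2≢0 A≢0)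
      first : - (three * (u * u)) ≡ A
      first = *-cancelˡ ((two * A) * (two * A)) (*-≢0 (*-≢0 2≢0 A≢0) (*-≢0 2≢0 A≢0)) (trans (solve 2 (λ v u → (v :* v) :* :- (num 3 :* (u :* u)) := :- (num 3 :* ((v :* u) :* (v :* u)))) refl (two * A) u)
        (trans (-‿cong (*-congˡ (*-cong 2Au 2Au))) (trans (solve 2 (λ a b → :- (num 3 :* (:- (num 3 :* b) :* :- (num 3 :* b))) := num 2 :* a :* (num 2 :* a) :* a :- (num 4 :* (a :* a :* a) :+ num 27 :* (b :* b))) refl A B)
          (trans (+-congˡ (trans (-‿cong e) -0#≈0#)) (+-identityʳ _)))))
      second : two * (u * (u * u)) ≡ B
      second = *-cancelˡ three 3≢0 (trans (solve 1 (λ u → num 3 :* (num 2 :* (u :* (u :* u))) := :- (num 2 :* :- (num 3 :* (u :* u)) :* u)) refl u)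
        (trans (-‿cong (*-congʳ (*-congˡ first))) (trans (-‿cong 2Au) (-‿involutive _))))
    to : ∀ y → y ∈ elements → point y ∈ filter sing? pairs × node (point y) ≡ y
    to y _ = ∈-filter⁺ sing? (∈-cartesianProductWith⁺ _,_ (∈elements _) (∈elements _)) (on-curve y) , node-point y ((- (three * (y * y))) ≟ 0#)
    from : ∀ x → x ∈ filter sing? pairs → node x ∈ elements × point (node x) ≡ x
    from x@(A , B) i = ∈elements _ , point-node A B (proj₂ (∈-filter⁻ sing? {xs = pairs} i)) (A ≟ 0#)

  -- The final estimate

  #S #Sₜ : ℕ
  #S = FiniteField.#S F
  #Sₜ = FiniteField.#S[_,_] F p t₀

  private
    #²-∑ : ∀ (P : Carrier → Carrier → Bool) → FiniteField.#² F P ≡ ℕSum.∑ elements (λ A → ℕSum.∑ elements (λ B → if P A B then 1 else 0))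
    #²-∑ P = ≡.trans (sum-∑ elements _) (ℕSum.∑-cong elements λ A → sum-∑ elements _)

    ∑²≤ : ∀ {u v : Carrier → Carrier → ℕ} → (∀ A B → u A B ≤ v A B) → ℕSum.∑ elements (λ A → ℕSum.∑ elements (u A)) ≤ ℕSum.∑ elements (λ A → ℕSum.∑ elements (v A))
    ∑²≤ h = NatLemmas.∑≤ elements λ A _ → NatLemmas.∑≤ elements λ B _ → h A B

    ∑²-+ : ∀ (u v : Carrier → Carrier → ℕ) → ℕSum.∑ elements (λ A → ℕSum.∑ elements (λ B → u A B ℕ.+ v A B)) ≡ ℕSum.∑ elements (λ A → ℕSum.∑ elements (u A)) ℕ.+ ℕSum.∑ elements (λ A → ℕSum.∑ elements (v A))
    ∑²-+ u v = ≡.trans (ℕSum.∑-cong elements λ A → ℕSum.∑-+ elements (u A) (v A)) (ℕSum.∑-+ elements _ _)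

  #S+q : #S ℕ.+ q ≡ q ℕ.* q
  #S+q = ≡.trans (cong₂ ℕ._+_ (#²-∑ (FiniteField.nonsingular F)) (≡.sym singular≡q)) (≡.trans (≡.sym (∑²-+ _ _)) (≡.trans (ℕSum.∑-cong elements λ A → ≡.trans (ℕSum.∑-cong elements {g = λ _ → 1} λ B → one (disc A B ≟ 0#)) (≡.trans (∑-constq 1) (ℕP.*-identityʳ q))) (∑-constq q)))
    where
    one : ∀ {Q : Set} (c : Dec Q) → (if not (does c) then 1 else 0) ℕ.+ ℕSum.[ c ]ᵢ ≡ 1
    one (yes _) = ≡.refl
    one (no _) = ≡.refl

  private
    hit? : ∀ A B → Dec (hasse A B ^ e₁ ≡ t)
    hit? A B = (hasse A B ^ e₁) ≟ t

    trace? : ∀ A B → Dec (p ℕD.∣ ℤ.∣ FiniteField.trace F A B ℤ.- + t₀ ∣)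
    trace? A B = p ℕD.∣? ℤ.∣ FiniteField.trace F A B ℤ.- + t₀ ∣

  #Sₜ≤W : #Sₜ ≤ W
  #Sₜ≤W = ≤-trans (≤-reflexive (#²-∑ _)) (∑²≤ λ A B → le (disc A B ≟ 0#) (trace? A B) (hit? A B) (trace⇒hasse A B t₀))
    where
    le : ∀ {P Q R : Set} (c : Dec P) (d : Dec Q) (e : Dec R) → (Q → R) → (if not (does c) ∧ does d then 1 else 0) ≤ ℕSum.[ e ]ᵢ
    le (yes _) d e h = z≤n
    le (no _) (no _) e h = z≤n
    le (no _) (yes y) (yes _) h = ≤-refl
    le (no _) (yes y) (no n) h = ⊥-elim (n (h y))

  -- A pair counted by `W` but not by `#Sₜ` is singular.
  W≤#Sₜ+q : W ≤ #Sₜ ℕ.+ q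
  W≤#Sₜ+q = ≤-trans (∑²≤ λ A B → le (disc A B ≟ 0#) (trace? A B) (hit? A B) (hasse⇒trace A B t₀)) (≤-reflexive (≡.trans (∑²-+ _ _) (cong₂ ℕ._+_ (≡.sym (#²-∑ _)) singular≡q)))
    where
    le : ∀ {P Q R : Set} (c : Dec P) (d : Dec Q) (e : Dec R) → (R → Q) → ℕSum.[ e ]ᵢ ≤ (if not (does c) ∧ does d then 1 else 0) ℕ.+ ℕSum.[ c ]ᵢ
    le c d (no _) h = z≤n
    le (yes _) d (yes _) h = ≤-refl
    le (no _) (yes _) (yes _) h = ≤-refl
    le (no _) (no n) (yes y) h = ⊥-elim (n (h y))

  -- On either side the error is `q(M + nn)` from the lines and `n q` from the excluded line, plus
  -- at most `n q` from singular pairs; with `n = 2 nn` this is the stated bound.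
  deviation : ℤ.∣ + (n ℕ.* #Sₜ) ℤ.- + #S ∣ ≤ q ℕ.* (M ℕ.+ 5 ℕ.* nn)
  deviation = bounds-∣-∣ (n ℕ.* #Sₜ) #S
    (≤-trans (*-monoʳ-≤ n #Sₜ≤W) (≤-trans (proj₁ W-bounds) (≤-trans (+-monoˡ-≤ (n ℕ.* q) (+-monoˡ-≤ L (≤-trans (≤-reflexive (≡.sym #S+q)) (+-monoʳ-≤ #S q≤nq)))) (≤-reflexive
      (N.solve 4 (λ s q m n → s N.:+ (n N.:+ n) N.:* q N.:+ q N.:* (m N.:+ n) N.:+ (n N.:+ n) N.:* q N.:= s N.:+ q N.:* (m N.:+ N.con 5 N.:* n)) ≡.refl #S q M nn)))))
    (≤-trans (m≤m+n #S q) (≤-trans (≤-reflexive #S+q) (≤-trans (proj₂ W-bounds) (≤-trans (+-monoˡ-≤ (n ℕ.* q) (+-monoˡ-≤ L (*-monoʳ-≤ n W≤#Sₜ+q))) (≤-reflexive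
      (N.solve 4 (λ s q m n → (n N.:+ n) N.:* (s N.:+ q) N.:+ q N.:* (m N.:+ n) N.:+ (n N.:+ n) N.:* q N.:= (n N.:+ n) N.:* s N.:+ q N.:* (m N.:+ N.con 5 N.:* n)) ≡.refl #Sₜ q M nn))))))

  -- By `(x + y)² ≤ 2x² + 2y²` it suffices that `M² ≤ n² nn² q` with `nn ≤ p`, and that `25 ≤ p²`.
  numeric : (M ℕ.+ 5 ℕ.* nn) ℕ.* (M ℕ.+ 5 ℕ.* nn) ≤ 9 ℕ.* (n ℕ.* n) ℕ.* (p ℕ.* p ℕ.* q)
  numeric = ≤-trans (amgm M (5 ℕ.* nn)) (≤-trans (+-mono-≤ (*-monoʳ-≤ 2 (≤-trans (proj₁ (proj₂ roots)) (*-monoˡ-≤ q (*-monoʳ-≤ (n ℕ.* n) (*-mono-≤ nn≤p nn≤p)))))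
      (≤-trans (≤-reflexive (N.solve 1 (λ n → N.con 2 N.:* (N.con 5 N.:* n N.:* (N.con 5 N.:* n)) N.:= N.con 2 N.:* (n N.:* n) N.:* (N.con 5 N.:* N.con 5) N.:* N.con 1) ≡.refl nn))
        (*-mono-≤ (*-mono-≤ (*-monoʳ-≤ 2 (*-mono-≤ (m≤m+n nn nn) (m≤m+n nn nn))) (*-mono-≤ 5≤p 5≤p)) (≤-trans (s≤s z≤n) 3≤q))))
    (≤-trans (m≤m+n _ (5 ℕ.* (n ℕ.* n) ℕ.* (p ℕ.* p ℕ.* q))) (≤-reflexive
      (N.solve 3 (λ n p q → N.con 2 N.:* (n N.:* (p N.:* p) N.:* q) N.:+ N.con 2 N.:* n N.:* (p N.:* p) N.:* q N.:+ N.con 5 N.:* n N.:* (p N.:* p N.:* q) N.:= N.con 9 N.:* n N.:* (p N.:* p N.:* q)) ≡.refl (n ℕ.* n) p q))))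
    where
    nn≤p : nn ≤ p
    nn≤p = ≤-trans (≤-trans (m≤m+n nn nn) (n≤1+n _)) (≤-reflexive (≡.sym odd))
    amgm : ∀ a b → (a ℕ.+ b) ℕ.* (a ℕ.+ b) ≤ 2 ℕ.* (a ℕ.* a) ℕ.+ 2 ℕ.* (b ℕ.* b)
    amgm a b = case ≤-total a b of λ
      { (inj₁ le) → subst (λ b → (a ℕ.+ b) ℕ.* (a ℕ.+ b) ≤ 2 ℕ.* (a ℕ.* a) ℕ.+ 2 ℕ.* (b ℕ.* b)) (m+[n∸m]≡n le) (ordered a (b ∸ a))
      ; (inj₂ le) → subst₂ _≤_ (cong (λ x → x ℕ.* x) (ℕP.+-comm b a)) (ℕP.+-comm (2 ℕ.* (b ℕ.* b)) _)
          (subst (λ a → (b ℕ.+ a) ℕ.* (b ℕ.+ a) ≤ 2 ℕ.* (b ℕ.* b) ℕ.+ 2 ℕ.* (a ℕ.* a)) (m+[n∸m]≡n le) (ordered b (a ∸ b))) }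
      where
      ordered : ∀ a d → (a ℕ.+ (a ℕ.+ d)) ℕ.* (a ℕ.+ (a ℕ.+ d)) ≤ 2 ℕ.* (a ℕ.* a) ℕ.+ 2 ℕ.* ((a ℕ.+ d) ℕ.* (a ℕ.+ d))
      ordered a d = ≤-trans (m≤m+n _ (d ℕ.* d)) (≤-reflexive (N.solve 2 (λ a d → (a N.:+ (a N.:+ d)) N.:* (a N.:+ (a N.:+ d)) N.:+ d N.:* d N.:= N.con 2 N.:* (a N.:* a) N.:+ N.con 2 N.:* ((a N.:+ d) N.:* (a N.:+ d))) ≡.refl a d))

  p∸1≡n : p ∸ 1 ≡ n
  p∸1≡n = cong (_∸ 1) odd

  size : #S ≡ p ℕ.^ (2 ℕ.* k) ∸ q
  size = ≡.trans (≡.sym (m+n∸n≡m #S q)) (cong (_∸ q) (≡.trans #S+q (≡.trans (≡.sym (ℕP.^-distribˡ-+-* p k k)) (cong (λ i → p ℕ.^ (k ℕ.+ i)) (≡.sym (ℕP.+-identityʳ k))))))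

  -- The estimate is multiplied by `p - 1` and squared, which clears the denominator and turns the
  -- exponent `3k/2 + 1` into `3k + 2`.
  conclusion : let D = (+ (p ∸ 1)) ℤ.* (+ #Sₜ) ℤ.- (+ #S) in D ℤ.* D ℤ.≤ + (9 ℕ.* ((p ∸ 1) ℕ.^ 2) ℕ.* (p ℕ.^ (3 ℕ.* k ℕ.+ 2)))
  conclusion = subst (ℤ._≤ + (9 ℕ.* ((p ∸ 1) ℕ.^ 2) ℕ.* (p ℕ.^ (3 ℕ.* k ℕ.+ 2)))) (≡.sym (≡.trans (cong (λ z → z ℤ.* z) D≡) (∣∣-square (+ (n ℕ.* #Sₜ) ℤ.- + #S))))
    (ℤ.+≤+ (≤-trans (*-mono-≤ deviation deviation) (≤-trans (≤-reflexive (N.solve 2 (λ q m → q N.:* m N.:* (q N.:* m) N.:= q N.:* q N.:* (m N.:* m)) ≡.refl q (M ℕ.+ 5 ℕ.* nn)))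
      (≤-trans (*-monoʳ-≤ (q ℕ.* q) numeric) (≤-reflexive (≡.trans (N.solve 3 (λ n p q → q N.:* q N.:* (N.con 9 N.:* (n N.:* n) N.:* (p N.:* p N.:* q)) N.:= N.con 9 N.:* (n N.:* (n N.:* N.con 1)) N.:* (q N.:* (q N.:* q) N.:* (p N.:* (p N.:* N.con 1)))) ≡.refl n p q)
        (cong₂ (λ a b → 9 ℕ.* (a ℕ.^ 2) ℕ.* b) (≡.sym p∸1≡n) (≡.sym powers))))))))
    where
    D≡ : (+ (p ∸ 1)) ℤ.* (+ #Sₜ) ℤ.- (+ #S) ≡ + (n ℕ.* #Sₜ) ℤ.- + #S
    D≡ = cong (ℤ._- (+ #S)) (≡.trans (cong (λ i → + i ℤ.* + #Sₜ) p∸1≡n) (≡.sym (ℤP.pos-* n #Sₜ)))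
    powers : p ℕ.^ (3 ℕ.* k ℕ.+ 2) ≡ q ℕ.* (q ℕ.* q) ℕ.* p ℕ.^ 2
    powers = ≡.trans (ℕP.^-distribˡ-+-* p (3 ℕ.* k) 2) (cong (ℕ._* p ℕ.^ 2) (≡.trans (cong (λ i → p ℕ.^ (k ℕ.+ (k ℕ.+ i))) (ℕP.+-identityʳ k)) (≡.trans (ℕP.^-distribˡ-+-* p k (k ℕ.+ k)) (cong (q ℕ.*_) (ℕP.^-distribˡ-+-* p k k)))))

-- Parity of the prime and the theorem

parity : ∀ i → (Σ ℕ λ v → i ≡ v ℕ.+ v) ⊎ (Σ ℕ λ v → i ≡ suc (v ℕ.+ v))
parity zero = inj₁ (0 , ≡.refl)
parity (suc i) = case parity i of λ
  { (inj₁ (v , e)) → inj₂ (v , cong suc e)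
  ; (inj₂ (v , e)) → inj₁ (suc v , ≡.trans (cong suc e) (cong suc (≡.sym (ℕP.+-suc v v)))) }

odd-prime : ∀ {p} → Prime p → 5 ≤ p → Σ ℕ λ v → 1 ≤ v × p ≡ suc (v ℕ.+ v)
odd-prime {p} pr 5≤p = case parity p of λ
  { (inj₁ (v , e)) → ⊥-elim (even v e)
  ; (inj₂ (zero , e)) → ⊥-elim (<⇒≱ 5≤p (subst (_≤ 4) (≡.sym e) (s≤s z≤n)))
  ; (inj₂ (suc v , e)) → suc v , s≤s z≤n , e }
  where
  large : ∀ i → 1 ≤ i → i < p → ¬ (p ℕD.∣ i)
  large i@(suc _) _ lt d = <⇒≱ lt (ℕD.∣⇒≤ d)
  even : ∀ v → p ≢ v ℕ.+ v
  even zero e = <⇒≱ 5≤p (subst (_≤ 4) (≡.sym e) z≤n)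
  even v@(suc w) e = case Primality.euclidsLemma 2 v pr (ℕD.∣-reflexive (≡.trans e (cong (v ℕ.+_) (≡.sym (ℕP.+-identityʳ v))))) of λ
    { (inj₁ d) → large 2 (s≤s z≤n) (≤-trans (s≤s (s≤s (s≤s z≤n))) 5≤p) d
    ; (inj₂ d) → large v (s≤s z≤n) (≤-trans (s≤s (m≤m+n v w)) (≤-reflexive (≡.trans (≡.sym (ℕP.+-suc v w)) (≡.sym e)))) d }

open import Defs
open import Data.Nat using (_≤_; _<_; _^_; _∸_; _*_; _+_)

theorem10p2 : (p k t : ℕ) → Prime p → 5 ≤ p → 1 ≤ k → 1 ≤ t → t < p →
  (F : FiniteField (p ^ k)) →
    (FiniteField.#S F ≡ p ^ (2 * k) ∸ p ^ k)
    × (let D = (+ (p ∸ 1)) ℤ.* (+ FiniteField.#S[_,_] F p t) ℤ.- (+ FiniteField.#S F)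
       in D ℤ.* D ℤ.≤ + (9 * ((p ∸ 1) ^ 2) * (p ^ (3 * k + 2))))
theorem10p2 p k t pr 5≤p 1≤k 1≤t t<p F = Count.size setting , Count.conclusion setting
  where
  setting : Setting
  setting = let (nn , 1≤nn , odd) = odd-prime pr 5≤p in
    record { base = record { p = p ; k = k ; pr = pr ; F = F } ; nn = nn ; odd = odd ; 1≤nn = 1≤nn ; 1≤k = 1≤k ; 5≤p = 5≤p ; t₀ = t ; 1≤t₀ = 1≤t ; t₀<p = t<p }
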